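{- Let $N\ge1$ be an integer and let $\mathcal{X}_N$ be the algebraic variety defined in the context. Then every coordinate $X^{\pm}_\gamma(u)$ of every point of $\mathcal{X}_N(\overline{\mathbb{Q}})$ is a $2$-adic unit (that is, has valuation $0$ under every valuation of $\overline{\mathbb{Q}}$ extending the $2$-adic valuation of $\mathbb{Q}$), and $\mathcal{X}_N$ is zero-dimensional (it has only finitely many complex points).
   Context: Notation: $\mathbf{e}_M(x)=\exp(2\pi i x/M)$; elements of $\mathbb{Z}^2,\mathbb{Q}^2$ are row vectors; $\omega(v,w)=v_1w_2-v_2w_1$. Let $\Gamma_N$ be the set of $\gamma=\begin{pmatrix}a&b\\c&d\end{pmatrix}\in\mathrm{SL}_2(\mathbb{Z})$ with $c>0$ and trace $N+2$. For $\gamma\in\Gamma_N$: $\Lambda_\gamma=\{u\in\mathbb{Z}^2:u\gamma\equiv u\pmod N\}=\mathbb{Z}^2(\gamma-I)$, $G_\gamma=\mathbb{Z}^2/\Lambda_\gamma$ (order $N$), $$\langle u\rangle_\gamma=(-1)^{u_1+u_2+u_1u_2}\mathbf{e}_{2N}(\omega(u\gamma,u)),\qquad\langle u;v\rangle_\gamma=\mathbf{e}_N(\omega(u\gamma-u,v)),$$ which are well defined on $G_\gamma$, and $\mu_\gamma=\dfrac{\eta(\gamma z)}{\eta(z)\sqrt{cz+d}}$ ($z$ in the upper half-plane, $\eta$ the Dedekind eta function, principal square root; independent of $z$, a root of unity). $\mathcal{X}_N$ has coordinates $X^+_\gamma(u),X^-_\gamma(u)$ for $\gamma\in\Gamma_N$,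 $u\in G_\gamma$, where $X^+_\gamma(u)=X^-_\gamma(u)$ for $u\ne0$, and where coordinates belonging to conjugate matrices are identified: $X^\pm_{\delta\gamma\delta^{ -1}}(u\delta^{ -1})=X^\pm_\gamma(u)$ whenever $\delta\in\mathrm{SL}_2(\mathbb{Z})$ and $\gamma,\delta\gamma\delta^{ -1}\in\Gamma_N$ (so, there being finitely many conjugacy classes of trace $N+2$, there are finitely many distinct coordinates). Its defining equations are the following. (1) For every $\gamma\in\Gamma_N$: $$X_\gamma^{\pm}(0)=\sqrt{\tfrac{N+2\pm\sqrt{N^2+4N}}{2}},\qquad X^+_\gamma(u)X^-_\gamma(-u)=\langle u\rangle_\gamma^{ -1}\ (u\in G_\gamma),$$ $$\frac1{\sqrt N}\sum_{x\in G_\gamma}\langle x;u\rangle_\gamma X^+_\gamma(x)=\mu_\gamma\frac1{X^-_\gamma(u)}\ (u\in G_\gamma),$$ $$\frac1{\sqrt N}\sum_{x\in G_\gamma}\langle x;u\rangle_\gamma\frac{X^+_\gamma(x)}{X^-_\gamma(x+v)}=\frac{X^+_\gamma(u+v)}{X^-_\gamma(u)X^-_\gamma(v)}\ (u,v\in G_\gamma,\ (u,v)\ne(0,0)).$$ (2) (Distribution relations.) For every $\gamma\in\Gamma_N$, every $g=(m,k)\in\mathbb{Z}^2$, whose order in $G_\gamma$ is denoted $\mathrm{ord}(g)$, every $(\ell,j)\in\mathbb{Z}^2$ and each sign: $$\mu_\gamma^{ -\mathrm{ord}(g)}\prod_{n=1}^{\mathrm{ord}(g)}X^{\pm}_\gamma(\ell+nm,j+nk)=\mu_{\gamma'}^{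 -1}X^{\pm}_{\gamma'}(h\ell,\,yj-f\ell),$$ where, writing $(m,k)(I-\gamma)^{ -1}=(r_1,r_2)\in\mathbb{Q}^2$: $h\ge1$ is the smallest integer with $hr_1\in\mathbb{Z}$; $hr_2\equiv x/y\pmod{\mathbb{Z}}$ with $y\ge1$, $\gcd(x,y)=1$; $w$ is an integer with $wr_1\equiv 1/h\pmod{\mathbb{Z}}$ and $f$ is an integer with $wyr_2\equiv f/h\pmod{\mathbb{Z}}$; and $$\gamma'=VU^{ -1}\gamma UV^{ -1},\qquad U=\begin{pmatrix}1&0\\0&y\end{pmatrix},\quad V=\begin{pmatrix}1&f\\0&h\end{pmatrix},$$ which again lies in $\Gamma_N$. -}

module Defs where

open import Algebra.Bundles using (CommutativeRing; RawRing; Semiring)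

open import Axiom.ExcludedMiddle using (ExcludedMiddle)
open import Data.Fin.Base using (Fin; toℕ)
open import Data.Integer.Base as ℤ using (ℤ; +_)
import Data.Integer.Divisibility as ℤ
open import Data.List.Base using (List; []; _∷_; foldr; map; upTo; cartesianProduct; deduplicate)
open import Data.List.Relation.Unary.Any using (Any)
open import Data.Maybe.Base using (zipWith)
open import Data.Nat.Base as ℕ using (ℕ; suc; _⊔_; _!)
open import Data.Nat.Coprimality using (Coprime)
import Data.Nat.Divisibility as ℕ
import Data.Nat.Properties as ℕ
open import Data.Product.Base using (Σ; ∃; ∃-syntax; _×_; _,_; proj₁; proj₂)
open import Data.Rational.Base as ℚ using (ℚ; 0ℚ; 1ℚ; ½)
import Data.Rational.Properties as ℚ
import Data.Rational.Solver as ℚ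
open import Data.Sign.Base using (Sign)
open import Data.Sum.Base using (_⊎_)
open import Function.Bundles using (_⇔_)
open import Level using (0ℓ)
open import Relation.Binary.PropositionalEquality using (_≡_; _≢_; refl; sym; trans; cong; subst; _≗_)
open import Relation.Nullary using (¬_; Dec; yes; no)
open import Relation.Nullary.Decidable using (_×-dec_)
open import Relation.Nullary.Construct.Add.Supremum using (_⁺; [_]; ⊤⁺)
import Relation.Binary.Construct.Add.Supremum.Equality as SupEquality
import Relation.Binary.Construct.Add.Supremum.NonStrict as SupOrder

infix 4 _∼_

-- On Cauchy sequences this says that the difference tends to 0; using
-- independent indices makes the Cauchy condition the case s ∼ s.
_∼_ : (ℕ → ℚ) → (ℕ → ℚ) → Set
s ∼ t = ∀ ε → 0ℚ ℚ.< ε → ∃[ k ] ∀ m n → k ℕ.≤ m → k ℕ.≤ n → ℚ.∣ s m ℚ.- t n ∣ ℚ.< ε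

record ℝ : Set where
  no-eta-equality
  field
    seq    : ℕ → ℚ
    cauchy : seq ∼ seq

open ℝ public

-- A record rather than an abbreviation, so that x and y can be inferred from x ≈ℝ y.
infix 4 _≈ℝ_

record _≈ℝ_ (x y : ℝ) : Set where
  constructor mk≈
  field
    close : seq x ∼ seq y

open _≈ℝ_ public

open ℚ.+-*-Solver using (solve; con; _:=_; _:+_; _:*_; _:-_; :-_)

abstract
  0<½* : ∀ ε → 0ℚ ℚ.< ε → 0ℚ ℚ.< ½ ℚ.* ε
  0<½* ε 0<ε = subst (ℚ._< ½ ℚ.* ε) (ℚ.*-zeroʳ ½) (ℚ.*-monoʳ-<-pos ½ 0<ε)

  halves : ∀ p q ε → p ℚ.< ½ ℚ.* ε → q ℚ.< ½ ℚ.* ε → p ℚ.+ q ℚ.< ε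
  halves p q ε p< q< = subst (p ℚ.+ q ℚ.<_)
    (trans (sym (ℚ.*-distribʳ-+ ε ½ ½)) (ℚ.*-identityˡ ε))
    (ℚ.+-mono-< p< q<)

  divide : ∀ B ε → 0ℚ ℚ.< B → 0ℚ ℚ.< ε → ∃[ δ ] (0ℚ ℚ.< δ × B ℚ.* δ ≡ ε)
  divide B ε 0<B 0<ε = B⁻¹ ℚ.* ε
    , subst (ℚ._< B⁻¹ ℚ.* ε) (ℚ.*-zeroʳ B⁻¹)
        (ℚ.*-monoʳ-<-pos B⁻¹ {{ℚ.1/pos⇒pos B {{ℚ.positive 0<B}}}} 0<ε)
    , trans (sym (ℚ.*-assoc B B⁻¹ ε))
        (trans (cong (ℚ._* ε) (ℚ.*-inverseʳ B {{B≢0}})) (ℚ.*-identityˡ ε))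
    where
    B≢0 : ℚ.NonZero B
    B≢0 = ℚ.pos⇒nonZero B {{ℚ.positive 0<B}}
    B⁻¹ : ℚ
    B⁻¹ = (ℚ.1/ B) {{B≢0}}

  triangle : ∀ p q r → p ℚ.+ q ≡ r → ℚ.∣ r ∣ ℚ.≤ ℚ.∣ p ∣ ℚ.+ ℚ.∣ q ∣
  triangle p q r refl = ℚ.∣p+q∣≤∣p∣+∣q∣ p q

  triangle-½ : ∀ p q r ε → p ℚ.+ q ≡ r →
               ℚ.∣ p ∣ ℚ.< ½ ℚ.* ε → ℚ.∣ q ∣ ℚ.< ½ ℚ.* ε → ℚ.∣ r ∣ ℚ.< ε
  triangle-½ p q r ε eq p< q< =
    ℚ.≤-<-trans (triangle p q r eq) (halves ℚ.∣ p ∣ ℚ.∣ q ∣ ε p< q<)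

  ∣-∣-< : ∀ p q ε → ℚ.- p ≡ q → ℚ.∣ p ∣ ℚ.< ε → ℚ.∣ q ∣ ℚ.< ε
  ∣-∣-< p _ ε refl = subst (ℚ._< ε) (sym (ℚ.∣-p∣≡∣p∣ p))

  ∣*∣-< : ∀ a b B δ → 0ℚ ℚ.< B → ℚ.∣ a ∣ ℚ.≤ B → ℚ.∣ b ∣ ℚ.< δ → ℚ.∣ a ℚ.* b ∣ ℚ.< B ℚ.* δ
  ∣*∣-< a b B δ 0<B a≤B b<δ = subst (ℚ._< B ℚ.* δ) (sym (ℚ.∣p*q∣≡∣p∣*∣q∣ a b))
    (ℚ.≤-<-trans
      (ℚ.*-monoʳ-≤-nonNeg ℚ.∣ b ∣ {{ℚ.nonNegative (ℚ.0≤∣p∣ b)}} a≤B)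
      (ℚ.*-monoʳ-<-pos B {{ℚ.positive 0<B}} b<δ))

  sub-swap : ∀ a b → ℚ.- (a ℚ.- b) ≡ b ℚ.- a
  sub-swap = solve 2 (λ a b → :- (a :- b) := b :- a) refl

  sub-neg : ∀ a b → ℚ.- (a ℚ.- b) ≡ ℚ.- a ℚ.- ℚ.- b
  sub-neg = solve 2 (λ a b → :- (a :- b) := :- a :- :- b) refl

  sub-sub : ∀ a b c → (a ℚ.- b) ℚ.+ (b ℚ.- c) ≡ a ℚ.- c
  sub-sub = solve 3 (λ a b c → (a :- b) :+ (b :- c) := a :- c) refl

  sub-cancel : ∀ a b → (a ℚ.- b) ℚ.+ b ≡ a
  sub-cancel = solve 2 (λ a b → (a :- b) :+ b := a) refl

  sub-+ : ∀ a b c d → (a ℚ.- b) ℚ.+ (c ℚ.- d) ≡ (a ℚ.+ c) ℚ.- (b ℚ.+ d)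
  sub-+ = solve 4 (λ a b c d → (a :- b) :+ (c :- d) := (a :+ c) :- (b :+ d)) refl

  sub-* : ∀ a b c d → a ℚ.* (c ℚ.- d) ℚ.+ d ℚ.* (a ℚ.- b) ≡ a ℚ.* c ℚ.- b ℚ.* d
  sub-* = solve 4 (λ a b c d → a :* (c :- d) :+ d :* (a :- b) := a :* c :- b :* d) refl

  ∼-sym : ∀ {s t} → s ∼ t → t ∼ s
  ∼-sym {s} {t} s∼t ε 0<ε = let k , p = s∼t ε 0<ε in
    k , λ m n k≤m k≤n →
      ∣-∣-< (s n ℚ.- t m) (t m ℚ.- s n) ε (sub-swap (s n) (t m)) (p n m k≤n k≤m)

  ∼-trans : ∀ {s t u} → s ∼ t → t ∼ u → s ∼ u
  ∼-trans {s} {t} {u} s∼t t∼u ε 0<ε =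
    let k , p = s∼t (½ ℚ.* ε) (0<½* ε 0<ε)
        l , q = t∼u (½ ℚ.* ε) (0<½* ε 0<ε)
        i = k ⊔ l
    in i , λ m n i≤m i≤n →
      triangle-½ (s m ℚ.- t i) (t i ℚ.- u n) (s m ℚ.- u n) ε (sub-sub (s m) (t i) (u n))
        (p m i (ℕ.m⊔n≤o⇒m≤o k l i≤m) (ℕ.m≤m⊔n k l))
        (q i n (ℕ.m≤n⊔m k l) (ℕ.m⊔n≤o⇒n≤o k l i≤n))

  ∼-≗ : ∀ {s t} → s ∼ s → s ≗ t → s ∼ t
  ∼-≗ {s} {t} s∼s s≗t ε 0<ε = let k , p = s∼s ε 0<ε in
    k , λ m n k≤m k≤n → subst (λ z → ℚ.∣ s m ℚ.- z ∣ ℚ.< ε) (s≗t n) (p m n k≤m k≤n)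

  const-∼ : ∀ q → (λ _ → q) ∼ (λ _ → q)
  const-∼ q ε 0<ε = 0 , λ _ _ _ _ → subst (ℚ._< ε) (cong ℚ.∣_∣ (sym (ℚ.+-inverseʳ q))) 0<ε

  +-∼ : ∀ {s s′ t t′} → s ∼ s′ → t ∼ t′ →
        (λ n → s n ℚ.+ t n) ∼ (λ n → s′ n ℚ.+ t′ n)
  +-∼ {s} {s′} {t} {t′} s∼s′ t∼t′ ε 0<ε =
    let k , p = s∼s′ (½ ℚ.* ε) (0<½* ε 0<ε)
        l , q = t∼t′ (½ ℚ.* ε) (0<½* ε 0<ε)
    in k ⊔ l , λ m n i≤m i≤n →
      triangle-½ (s m ℚ.- s′ n) (t m ℚ.- t′ n) ((s m ℚ.+ t m) ℚ.- (s′ n ℚ.+ t′ n)) ε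
        (sub-+ (s m) (s′ n) (t m) (t′ n))
        (p m n (ℕ.m⊔n≤o⇒m≤o k l i≤m) (ℕ.m⊔n≤o⇒m≤o k l i≤n))
        (q m n (ℕ.m⊔n≤o⇒n≤o k l i≤m) (ℕ.m⊔n≤o⇒n≤o k l i≤n))

  neg-∼ : ∀ {s t} → s ∼ t → (λ n → ℚ.- s n) ∼ (λ n → ℚ.- t n)
  neg-∼ {s} {t} s∼t ε 0<ε = let k , p = s∼t ε 0<ε in
    k , λ m n k≤m k≤n →
      ∣-∣-< (s m ℚ.- t n) (ℚ.- s m ℚ.- ℚ.- t n) ε (sub-neg (s m) (t n)) (p m n k≤m k≤n)

  bounded : ∀ s → s ∼ s → ∃[ B ] (0ℚ ℚ.< B × ∃[ k ] ∀ n → k ℕ.≤ n → ℚ.∣ s n ∣ ℚ.≤ B)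
  bounded s s∼s = let k , p = s∼s 1ℚ (ℚ.positive⁻¹ 1ℚ) in
      1ℚ ℚ.+ ℚ.∣ s k ∣
    , ℚ.+-mono-<-≤ (ℚ.positive⁻¹ 1ℚ) (ℚ.0≤∣p∣ (s k))
    , k , λ n k≤n → ℚ.≤-trans
        (triangle (s n ℚ.- s k) (s k) (s n) (sub-cancel (s n) (s k)))
        (ℚ.+-monoˡ-≤ ℚ.∣ s k ∣ (ℚ.<⇒≤ (p n k k≤n ℕ.≤-refl)))

  *-∼ : ∀ {s s′ t t′} → s ∼ s′ → t ∼ t′ →
        (λ n → s n ℚ.* t n) ∼ (λ n → s′ n ℚ.* t′ n)
  *-∼ {s} {s′} {t} {t′} s∼s′ t∼t′ ε 0<ε =
    let B , 0<B , i , s≤B  = bounded s  (∼-trans {s} {s′} {s} s∼s′ (∼-sym {s} {s′} s∼s′))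
        C , 0<C , j , t′≤C = bounded t′ (∼-trans {t′} {t} {t′} (∼-sym {t} {t′} t∼t′) t∼t′)
        δ , 0<δ , Bδ≡ = divide B (½ ℚ.* ε) 0<B (0<½* ε 0<ε)
        η , 0<η , Cη≡ = divide C (½ ℚ.* ε) 0<C (0<½* ε 0<ε)
        k , p = t∼t′ δ 0<δ
        l , q = s∼s′ η 0<η
    in (i ⊔ j) ⊔ (k ⊔ l) , λ m n ≤m ≤n →
      triangle-½ (s m ℚ.* (t m ℚ.- t′ n)) (t′ n ℚ.* (s m ℚ.- s′ n))
        (s m ℚ.* t m ℚ.- s′ n ℚ.* t′ n) ε (sub-* (s m) (s′ n) (t m) (t′ n))
        (subst (ℚ.∣ s m ℚ.* (t m ℚ.- t′ n) ∣ ℚ.<_) Bδ≡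
          (∣*∣-< (s m) (t m ℚ.- t′ n) B δ 0<B
            (s≤B m (ℕ.m⊔n≤o⇒m≤o i j (ℕ.m⊔n≤o⇒m≤o (i ⊔ j) (k ⊔ l) ≤m)))
            (p m n (ℕ.m⊔n≤o⇒m≤o k l (ℕ.m⊔n≤o⇒n≤o (i ⊔ j) (k ⊔ l) ≤m))
                   (ℕ.m⊔n≤o⇒m≤o k l (ℕ.m⊔n≤o⇒n≤o (i ⊔ j) (k ⊔ l) ≤n)))))
        (subst (ℚ.∣ t′ n ℚ.* (s m ℚ.- s′ n) ∣ ℚ.<_) Cη≡
          (∣*∣-< (t′ n) (s m ℚ.- s′ n) C η 0<C
            (t′≤C n (ℕ.m⊔n≤o⇒n≤o i j (ℕ.m⊔n≤o⇒m≤o (i ⊔ j) (k ⊔ l) ≤n)))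
            (q m n (ℕ.m⊔n≤o⇒n≤o k l (ℕ.m⊔n≤o⇒n≤o (i ⊔ j) (k ⊔ l) ≤m))
                   (ℕ.m⊔n≤o⇒n≤o k l (ℕ.m⊔n≤o⇒n≤o (i ⊔ j) (k ⊔ l) ≤n)))))

infixl 6 _+ℝ_
infixl 7 _*ℝ_
infix 8 -ℝ_

ℚ→ℝ : ℚ → ℝ
seq    (ℚ→ℝ q) _ = q
cauchy (ℚ→ℝ q)   = const-∼ q

_+ℝ_ _*ℝ_ : ℝ → ℝ → ℝ
seq    (x +ℝ y) n = seq x n ℚ.+ seq y n
cauchy (x +ℝ y)   = +-∼ {seq x} {seq x} {seq y} {seq y} (cauchy x) (cauchy y)
seq    (x *ℝ y) n = seq x n ℚ.* seq y n
cauchy (x *ℝ y)   = *-∼ {seq x} {seq x} {seq y} {seq y} (cauchy x) (cauchy y)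

-ℝ_ : ℝ → ℝ
seq    (-ℝ x) n = ℚ.- seq x n
cauchy (-ℝ x)   = neg-∼ {seq x} {seq x} (cauchy x)

pointwise : ∀ x y → (∀ n → seq x n ≡ seq y n) → x ≈ℝ y
pointwise x _ p = mk≈ (∼-≗ {seq x} (cauchy x) p)

ℝ-commutativeRing : CommutativeRing 0ℓ 0ℓ
ℝ-commutativeRing = record
  { Carrier = ℝ
  ; _≈_     = _≈ℝ_
  ; _+_     = _+ℝ_
  ; _*_     = _*ℝ_
  ; -_      = -ℝ_
  ; 0#      = ℚ→ℝ 0ℚ
  ; 1#      = ℚ→ℝ 1ℚ
  ; isCommutativeRing = record
    { isRing = record
      { +-isAbelianGroup = record
        { isGroup = record
          { isMonoid = record
            { isSemigroup = record
              { isMagma = record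
                { isEquivalence = record
                  { refl  = λ {x} → mk≈ (cauchy x)
                  ; sym   = λ {x} {y} p → mk≈ (∼-sym {seq x} {seq y} (close p))
                  ; trans = λ {x} {y} {z} p q →
                      mk≈ (∼-trans {seq x} {seq y} {seq z} (close p) (close q))
                  }
                ; ∙-cong = λ {x} {x′} {y} {y′} p q →
                    mk≈ (+-∼ {seq x} {seq x′} {seq y} {seq y′} (close p) (close q))
                }
              ; assoc = λ x y z → pointwise ((x +ℝ y) +ℝ z) (x +ℝ (y +ℝ z))
                  (λ n → ℚ.+-assoc (seq x n) (seq y n) (seq z n))
              }
            ; identity =
                (λ x → pointwise (ℚ→ℝ 0ℚ +ℝ x) x (λ n → ℚ.+-identityˡ (seq x n)))
              , (λ x → pointwise (x +ℝ ℚ→ℝ 0ℚ) x (λ n → ℚ.+-identityʳ (seq x n)))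
            }
          ; inverse =
              (λ x → pointwise (-ℝ x +ℝ x) (ℚ→ℝ 0ℚ) (λ n → ℚ.+-inverseˡ (seq x n)))
            , (λ x → pointwise (x +ℝ -ℝ x) (ℚ→ℝ 0ℚ) (λ n → ℚ.+-inverseʳ (seq x n)))
          ; ⁻¹-cong = λ {x} {y} p → mk≈ (neg-∼ {seq x} {seq y} (close p))
          }
        ; comm = λ x y → pointwise (x +ℝ y) (y +ℝ x) (λ n → ℚ.+-comm (seq x n) (seq y n))
        }
      ; *-cong = λ {x} {x′} {y} {y′} p q →
          mk≈ (*-∼ {seq x} {seq x′} {seq y} {seq y′} (close p) (close q))
      ; *-assoc = λ x y z → pointwise ((x *ℝ y) *ℝ z) (x *ℝ (y *ℝ z))
          (λ n → ℚ.*-assoc (seq x n) (seq y n) (seq z n))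
      ; *-identity =
          (λ x → pointwise (ℚ→ℝ 1ℚ *ℝ x) x (λ n → ℚ.*-identityˡ (seq x n)))
        , (λ x → pointwise (x *ℝ ℚ→ℝ 1ℚ) x (λ n → ℚ.*-identityʳ (seq x n)))
      ; distrib =
          (λ x y z → pointwise (x *ℝ (y +ℝ z)) (x *ℝ y +ℝ x *ℝ z)
            (λ n → ℚ.*-distribˡ-+ (seq x n) (seq y n) (seq z n)))
        , (λ x y z → pointwise ((y +ℝ z) *ℝ x) (y *ℝ x +ℝ z *ℝ x)
            (λ n → ℚ.*-distribʳ-+ (seq x n) (seq y n) (seq z n)))
      }
    ; *-comm = λ x y → pointwise (x *ℝ y) (y *ℝ x) (λ n → ℚ.*-comm (seq x n) (seq y n))
    }
  }

module ℝ-Ring = CommutativeRing ℝ-commutativeRing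

infix 4 _<ℝ_ _≤ℝ_

_<ℝ_ _≤ℝ_ : ℝ → ℝ → Set
x <ℝ y = ∃[ ε ] (0ℚ ℚ.< ε × ∃[ k ] ∀ n → k ℕ.≤ n → seq x n ℚ.+ ε ℚ.≤ seq y n)
x ≤ℝ y = ¬ (y <ℝ x)

infix 4 _+i_

record ℂ : Set where
  constructor _+i_
  field
    Re Im : ℝ

open ℂ public

infix 4 _≈ℂ_

record _≈ℂ_ (z w : ℂ) : Set where
  constructor _,_
  field
    Re≈ : Re z ≈ℝ Re w
    Im≈ : Im z ≈ℝ Im w

infixl 6 _+ℂ_
infixl 7 _*ℂ_
infix 8 -ℂ_

_+ℂ_ _*ℂ_ : ℂ → ℂ → ℂ
z +ℂ w = (Re z +ℝ Re w) +i (Im z +ℝ Im w)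
z *ℂ w = (Re z *ℝ Re w +ℝ -ℝ (Im z *ℝ Im w)) +i (Re z *ℝ Im w +ℝ Im z *ℝ Re w)

-ℂ_ : ℂ → ℂ
-ℂ z = (-ℝ Re z) +i (-ℝ Im z)

1ℂ : ℂ
1ℂ = ℚ→ℝ 1ℚ +i ℚ→ℝ 0ℚ

private
  module ℂ-Laws where
    open ℝ-Ring using (+-cong; *-cong; -‿cong)

    abstract
      assocRe : ∀ a b c d e f →
        (a ℚ.* c ℚ.- b ℚ.* d) ℚ.* e ℚ.- (a ℚ.* d ℚ.+ b ℚ.* c) ℚ.* f ≡
        a ℚ.* (c ℚ.* e ℚ.- d ℚ.* f) ℚ.- b ℚ.* (c ℚ.* f ℚ.+ d ℚ.* e)
      assocRe = solve 6 (λ a b c d e f →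
        (a :* c :- b :* d) :* e :- (a :* d :+ b :* c) :* f
          := a :* (c :* e :- d :* f) :- b :* (c :* f :+ d :* e)) refl

      assocIm : ∀ a b c d e f →
        (a ℚ.* c ℚ.- b ℚ.* d) ℚ.* f ℚ.+ (a ℚ.* d ℚ.+ b ℚ.* c) ℚ.* e ≡
        a ℚ.* (c ℚ.* f ℚ.+ d ℚ.* e) ℚ.+ b ℚ.* (c ℚ.* e ℚ.- d ℚ.* f)
      assocIm = solve 6 (λ a b c d e f →
        (a :* c :- b :* d) :* f :+ (a :* d :+ b :* c) :* e
          := a :* (c :* f :+ d :* e) :+ b :* (c :* e :- d :* f)) refl

      distribRe : ∀ a b c d e f →
        a ℚ.* (c ℚ.+ e) ℚ.- b ℚ.* (d ℚ.+ f) ≡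
        (a ℚ.* c ℚ.- b ℚ.* d) ℚ.+ (a ℚ.* e ℚ.- b ℚ.* f)
      distribRe = solve 6 (λ a b c d e f →
        a :* (c :+ e) :- b :* (d :+ f) := (a :* c :- b :* d) :+ (a :* e :- b :* f)) refl

      distribIm : ∀ a b c d e f →
        a ℚ.* (d ℚ.+ f) ℚ.+ b ℚ.* (c ℚ.+ e) ≡
        (a ℚ.* d ℚ.+ b ℚ.* c) ℚ.+ (a ℚ.* f ℚ.+ b ℚ.* e)
      distribIm = solve 6 (λ a b c d e f →
        a :* (d :+ f) :+ b :* (c :+ e) := (a :* d :+ b :* c) :+ (a :* f :+ b :* e)) refl

      commRe : ∀ a b c d → a ℚ.* c ℚ.- b ℚ.* d ≡ c ℚ.* a ℚ.- d ℚ.* b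
      commRe = solve 4 (λ a b c d → a :* c :- b :* d := c :* a :- d :* b) refl

      commIm : ∀ a b c d → a ℚ.* d ℚ.+ b ℚ.* c ≡ c ℚ.* b ℚ.+ d ℚ.* a
      commIm = solve 4 (λ a b c d → a :* d :+ b :* c := c :* b :+ d :* a) refl

      identityRe : ∀ a b → 1ℚ ℚ.* a ℚ.- 0ℚ ℚ.* b ≡ a
      identityRe = solve 2 (λ a b → con 1ℚ :* a :- con 0ℚ :* b := a) refl

      identityIm : ∀ a b → 1ℚ ℚ.* b ℚ.+ 0ℚ ℚ.* a ≡ b
      identityIm = solve 2 (λ a b → con 1ℚ :* b :+ con 0ℚ :* a := b) refl

    abstract
      *ℂ-assoc : ∀ z w v → (z *ℂ w) *ℂ v ≈ℂ z *ℂ (w *ℂ v)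
      *ℂ-assoc z@(a +i b) w@(c +i d) v@(e +i f) =
          pointwise (Re ((z *ℂ w) *ℂ v)) (Re (z *ℂ (w *ℂ v)))
            (λ n → assocRe (seq a n) (seq b n) (seq c n) (seq d n) (seq e n) (seq f n))
        , pointwise (Im ((z *ℂ w) *ℂ v)) (Im (z *ℂ (w *ℂ v)))
            (λ n → assocIm (seq a n) (seq b n) (seq c n) (seq d n) (seq e n) (seq f n))

      *ℂ-comm : ∀ z w → z *ℂ w ≈ℂ w *ℂ z
      *ℂ-comm z@(a +i b) w@(c +i d) =
          pointwise (Re (z *ℂ w)) (Re (w *ℂ z))
            (λ n → commRe (seq a n) (seq b n) (seq c n) (seq d n))
        , pointwise (Im (z *ℂ w)) (Im (w *ℂ z))
            (λ n → commIm (seq a n) (seq b n) (seq c n) (seq d n))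

      *ℂ-distribˡ : ∀ z w v → z *ℂ (w +ℂ v) ≈ℂ (z *ℂ w) +ℂ (z *ℂ v)
      *ℂ-distribˡ z@(a +i b) w@(c +i d) v@(e +i f) =
          pointwise (Re (z *ℂ (w +ℂ v))) (Re ((z *ℂ w) +ℂ (z *ℂ v)))
            (λ n → distribRe (seq a n) (seq b n) (seq c n) (seq d n) (seq e n) (seq f n))
        , pointwise (Im (z *ℂ (w +ℂ v))) (Im ((z *ℂ w) +ℂ (z *ℂ v)))
            (λ n → distribIm (seq a n) (seq b n) (seq c n) (seq d n) (seq e n) (seq f n))

      *ℂ-identityˡ : ∀ z → 1ℂ *ℂ z ≈ℂ z
      *ℂ-identityˡ z@(a +i b) =
          pointwise (Re (1ℂ *ℂ z)) a (λ n → identityRe (seq a n) (seq b n))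
        , pointwise (Im (1ℂ *ℂ z)) b (λ n → identityIm (seq a n) (seq b n))

    ≈ℂ-trans : ∀ {z w v} → z ≈ℂ w → w ≈ℂ v → z ≈ℂ v
    ≈ℂ-trans (p , q) (p′ , q′) = ℝ-Ring.trans p p′ , ℝ-Ring.trans q q′

    +ℂ-cong : ∀ {z z′ w w′} → z ≈ℂ z′ → w ≈ℂ w′ → z +ℂ w ≈ℂ z′ +ℂ w′
    +ℂ-cong (p , q) (p′ , q′) = +-cong p p′ , +-cong q q′

    abstract
      *ℂ-cong : ∀ {z z′ w w′} → z ≈ℂ z′ → w ≈ℂ w′ → z *ℂ w ≈ℂ z′ *ℂ w′
      *ℂ-cong (p , q) (p′ , q′) =
          +-cong (*-cong p p′) (-‿cong (*-cong q q′))
        , +-cong (*-cong p q′) (*-cong q p′)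

      *ℂ-identityʳ : ∀ z → z *ℂ 1ℂ ≈ℂ z
      *ℂ-identityʳ z = ≈ℂ-trans (*ℂ-comm z 1ℂ) (*ℂ-identityˡ z)

      *ℂ-distribʳ : ∀ z w v → (w +ℂ v) *ℂ z ≈ℂ (w *ℂ z) +ℂ (v *ℂ z)
      *ℂ-distribʳ z w v = ≈ℂ-trans (*ℂ-comm (w +ℂ v) z)
        (≈ℂ-trans (*ℂ-distribˡ z w v) (+ℂ-cong (*ℂ-comm z w) (*ℂ-comm z v)))

ℂ-commutativeRing : CommutativeRing 0ℓ 0ℓ
ℂ-commutativeRing = record
  { Carrier = ℂ
  ; _≈_     = _≈ℂ_
  ; _+_     = _+ℂ_
  ; _*_     = _*ℂ_
  ; -_      = -ℂ_
  ; 0#      = ℚ→ℝ 0ℚ +i ℚ→ℝ 0ℚ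
  ; 1#      = 1ℂ
  ; isCommutativeRing = record
    { isRing = record
      { +-isAbelianGroup = record
        { isGroup = record
          { isMonoid = record
            { isSemigroup = record
              { isMagma = record
                { isEquivalence = record
                  { refl  = ℝ-Ring.refl , ℝ-Ring.refl
                  ; sym   = λ (p , q) → ℝ-Ring.sym p , ℝ-Ring.sym q
                  ; trans = ≈ℂ-trans
                  }
                ; ∙-cong = +ℂ-cong
                }
              ; assoc = λ z w v → +-assoc (Re z) (Re w) (Re v) , +-assoc (Im z) (Im w) (Im v)
              }
            ; identity = (λ z → +-identityˡ (Re z) , +-identityˡ (Im z))
                       , (λ z → +-identityʳ (Re z) , +-identityʳ (Im z))
            }
          ; inverse = (λ z → -‿inverseˡ (Re z) , -‿inverseˡ (Im z))
                    , (λ z → -‿inverseʳ (Re z) , -‿inverseʳ (Im z))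
          ; ⁻¹-cong = λ (p , q) → -‿cong p , -‿cong q
          }
        ; comm = λ z w → +-comm (Re z) (Re w) , +-comm (Im z) (Im w)
        }
      ; *-cong     = *ℂ-cong
      ; *-assoc    = *ℂ-assoc
      ; *-identity = *ℂ-identityˡ , *ℂ-identityʳ
      ; distrib    = *ℂ-distribˡ , *ℂ-distribʳ
      }
    ; *-comm = *ℂ-comm
    }
  }
  where
  open ℂ-Laws
  open ℝ-Ring using (+-assoc; +-comm; +-identityˡ; +-identityʳ; -‿inverseˡ; -‿inverseʳ; -‿cong)

module ℂ-Ring = CommutativeRing ℂ-commutativeRing

infix 8 ∣_∣²

∣_∣² : ℂ → ℝ
∣ z ∣² = Re z *ℝ Re z +ℝ Im z *ℝ Im z

infix 4 _⟶_

_⟶_ : (ℕ → ℂ) → ℂ → Set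
s ⟶ w = ∀ ε → 0ℚ ℚ.< ε → ∃[ k ] ∀ n → k ℕ.≤ n → ∣ s n +ℂ -ℂ w ∣² <ℝ ℚ→ℝ ε

ℝ→ℂ : ℝ → ℂ
ℝ→ℂ x = x +i ℚ→ℝ 0ℚ

ℚ→ℂ : ℚ → ℂ
ℚ→ℂ q = ℝ→ℂ (ℚ→ℝ q)

ℤ→ℚ : ℤ → ℚ
ℤ→ℚ k = k ℚ./ 1

ℤ→ℂ : ℤ → ℂ
ℤ→ℂ k = ℚ→ℂ (ℤ→ℚ k)

ℕ→ℂ : ℕ → ℂ
ℕ→ℂ n = ℤ→ℂ (+ n)

evaluate : List ℚ → ℂ → ℂ
evaluate cs z = foldr (λ c acc → ℚ→ℂ c +ℂ z *ℂ acc) (ℚ→ℂ 0ℚ) cs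

IsAlgebraic : ℂ → Set
IsAlgebraic z = ∃[ cs ] (Any (_≢ 0ℚ) cs × evaluate cs z ≈ℂ ℚ→ℂ 0ℚ)

record ℚ̄ : Set where
  constructor mkℚ̄
  field
    value     : ℂ
    algebraic : IsAlgebraic value

open ℚ̄ public

-- q = 2^(i-j) a/b with a and b odd
HasValuation₂ : ℚ → ℤ → Set
HasValuation₂ q k = ∃[ i ] ∃[ j ] ∃[ a ] ∃[ b ]
  ( ¬ (+ 2 ℤ.∣ a) × ¬ (+ 2 ℤ.∣ b)
  × ℚ.↥ q ℤ.* (+ (2 ℕ.^ j) ℤ.* b) ≡ + (2 ℕ.^ i) ℤ.* a ℤ.* ℚ.↧ q
  × k ≡ i ℤ.⊖ j )

open SupEquality _≈ℝ_ using (_≈⁺_)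
open SupOrder _≤ℝ_ using (_≤⁺_)

_+⁺_ : ℝ ⁺ → ℝ ⁺ → ℝ ⁺
_+⁺_ = zipWith _+ℝ_

-- The field operations of ℚ̄ are expressed through the underlying complex
-- numbers: z ranges over the elements of ℚ̄ equal to the product or sum.
record Valuation : Set where
  field
    v      : ℚ̄ → ℝ ⁺
    v-cong : ∀ x y → value x ≈ℂ value y → v x ≈⁺ v y
    v-∞    : ∀ x → v x ≡ ⊤⁺ ⇔ value x ≈ℂ ℚ→ℂ 0ℚ
    v-*    : ∀ x y z → value z ≈ℂ value x *ℂ value y → v z ≈⁺ (v x +⁺ v y)
    v-+    : ∀ x y z → value z ≈ℂ value x +ℂ value y → v x ≤⁺ v z ⊎ v y ≤⁺ v z

Extends₂ : Valuation → Set
Extends₂ val = ∀ x q k → value x ≈ℂ ℚ→ℂ q → HasValuation₂ q k → v x ≈⁺ [ ℚ→ℝ (ℤ→ℚ k) ]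
  where open Valuation val

Is2AdicUnit : ℚ̄ → Set
Is2AdicUnit x = ∀ val → Extends₂ val → Valuation.v val x ≈⁺ [ ℚ→ℝ 0ℚ ]

record Mat (A : Set) : Set where
  constructor mat
  field
    a b c d : A

module Matrices (R : RawRing 0ℓ 0ℓ) where
  open RawRing R renaming (Carrier to A)

  infixl 7 _·_ _▹_
  infixl 6 _⊟_

  _·_ : Mat A → Mat A → Mat A
  mat a b c d · mat a′ b′ c′ d′ =
    mat (a * a′ + b * c′) (a * b′ + b * d′) (c * a′ + d * c′) (c * b′ + d * d′)

  _⊟_ : Mat A → Mat A → Mat A
  mat a b c d ⊟ mat a′ b′ c′ d′ = mat (a + - a′) (b + - b′) (c + - c′) (d + - d′)

  𝟙 : Mat A
  𝟙 = mat 1# 0# 0# 1#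

  det tr : Mat A → A
  det (mat a b c d) = a * d + - (b * c)
  tr  (mat a b c d) = a + d

  adj : Mat A → Mat A
  adj (mat a b c d) = mat d (- b) (- c) a

  scale : A → Mat A → Mat A
  scale t (mat a b c d) = mat (t * a) (t * b) (t * c) (t * d)

  _▹_ : A × A → Mat A → A × A
  (x , y) ▹ mat a b c d = x * a + y * c , x * b + y * d

module ℤᴹ = Matrices ℤ.+-*-rawRing
module ℚᴹ = Matrices ℚ.+-*-rawRing

infix 8 _⁻¹ℚ _⁻¹ᴹ

-- Only values at nonzero arguments matter below.
_⁻¹ℚ : ℚ → ℚ
q ⁻¹ℚ with q ℚ.≟ 0ℚ
... | yes _   = 0ℚ
... | no  q≢0 = (ℚ.1/ q) {{ℚ.≢-nonZero q≢0}}

_⁻¹ᴹ : Mat ℚ → Mat ℚ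
A ⁻¹ᴹ = ℚᴹ.scale (ℚᴹ.det A ⁻¹ℚ) (ℚᴹ.adj A)

Matℤ→ℚ : Mat ℤ → Mat ℚ
Matℤ→ℚ (mat a b c d) = mat (ℤ→ℚ a) (ℤ→ℚ b) (ℤ→ℚ c) (ℤ→ℚ d)

record SL₂ℤ : Set where
  field
    matrix : Mat ℤ
    det≡1  : ℤᴹ.det matrix ≡ + 1

record Γ (N : ℕ) : Set where
  field
    matrix : Mat ℤ
    det≡1  : ℤᴹ.det matrix ≡ + 1
    c>0    : + 0 ℤ.< Mat.c matrix
    trace  : ℤᴹ.tr matrix ≡ + (N ℕ.+ 2)

ℤ² : Set
ℤ² = ℤ × ℤ

infixl 6 _⊕_ _⊖_
infixl 7 _⊛_

_⊕_ _⊖_ : ℤ² → ℤ² → ℤ²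
(x , y) ⊕ (x′ , y′) = x ℤ.+ x′ , y ℤ.+ y′
(x , y) ⊖ (x′ , y′) = x ℤ.- x′ , y ℤ.- y′

⊝_ : ℤ² → ℤ²
⊝ (x , y) = ℤ.- x , ℤ.- y

_⊛_ : ℕ → ℤ² → ℤ²
n ⊛ (x , y) = + n ℤ.* x , + n ℤ.* y

𝟎 : ℤ²
𝟎 = + 0 , + 0

ω : ℤ² → ℤ² → ℤ
ω (v₁ , v₂) (w₁ , w₂) = v₁ ℤ.* w₂ ℤ.- v₂ ℤ.* w₁

module _ {N : ℕ} (γ : Γ N) where
  open Γ γ
  open ℤᴹ using (_▹_)

  InΛ : ℤ² → Set
  InΛ u = + N ℤ.∣ proj₁ (u ▹ matrix ⊖ u) × + N ℤ.∣ proj₂ (u ▹ matrix ⊖ u)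

  InΛ? : ∀ u → Dec (InΛ u)
  InΛ? u = (N ℕ.∣? ℤ.∣ proj₁ (u ▹ matrix ⊖ u) ∣) ×-dec (N ℕ.∣? ℤ.∣ proj₂ (u ▹ matrix ⊖ u) ∣)

  -- One representative of each class of ℤ²/Λ: since N ℤ² ⊆ Λ, every class meets {0,…,N-1}².
  representatives : List ℤ²
  representatives = deduplicate (λ u u′ → InΛ? (u ⊖ u′))
    (cartesianProduct (map +_ (upTo N)) (map +_ (upTo N)))

IsLeast : (ℕ → Set) → ℕ → Set
IsLeast P n = P n × (∀ m → P m → n ℕ.≤ m)

IsOrder : ∀ {N} → Γ N → ℤ² → ℕ → Set
IsOrder γ g = IsLeast (λ n → 1 ℕ.≤ n × InΛ γ (n ⊛ g))

IsInteger : ℚ → Set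
IsInteger q = ∃[ k ] q ≡ ℤ→ℚ k

rowTimesInverse : ∀ {N} → Γ N → ℤ² → ℚ × ℚ
rowTimesInverse γ (m , k) = (ℤ→ℚ m , ℤ→ℚ k) ℚᴹ.▹ (ℚᴹ.𝟙 ℚᴹ.⊟ Matℤ→ℚ (Γ.matrix γ)) ⁻¹ᴹ

U : ℕ → Mat ℚ
U y = mat 1ℚ 0ℚ 0ℚ (ℤ→ℚ (+ y))

V : ℤ → ℕ → Mat ℚ
V f h = mat 1ℚ (ℤ→ℚ f) 0ℚ (ℤ→ℚ (+ h))

-- x is determined only modulo y, and w and f only modulo h; the distribution
-- relation is imposed for every admissible choice.
record DistributionData {N : ℕ} (γ : Γ N) (g : ℤ²) : Set where
  r₁ : ℚ
  r₁ = proj₁ (rowTimesInverse γ g)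

  r₂ : ℚ
  r₂ = proj₂ (rowTimesInverse γ g)

  field
    h y : ℕ
    x w f : ℤ
    γ′ : Γ N
    h-least    : IsLeast (λ n → 1 ℕ.≤ n × IsInteger (ℤ→ℚ (+ n) ℚ.* r₁)) h
    y≥1        : 1 ℕ.≤ y
    xy-coprime : Coprime ℤ.∣ x ∣ y
    hr₂≡x/y    : IsInteger (ℤ→ℚ (+ h) ℚ.* r₂ ℚ.- ℤ→ℚ x ℚ.* ℤ→ℚ (+ y) ⁻¹ℚ)
    wr₁≡1/h    : IsInteger (ℤ→ℚ w ℚ.* r₁ ℚ.- ℤ→ℚ (+ h) ⁻¹ℚ)
    wyr₂≡f/h   : IsInteger (ℤ→ℚ w ℚ.* ℤ→ℚ (+ y) ℚ.* r₂ ℚ.- ℤ→ℚ f ℚ.* ℤ→ℚ (+ h) ⁻¹ℚ)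
    γ′-def     : Matℤ→ℚ (Γ.matrix γ′) ≡
                 V f h ℚᴹ.· U y ⁻¹ᴹ ℚᴹ.· Matℤ→ℚ (Γ.matrix γ) ℚᴹ.· U y ℚᴹ.· V f h ⁻¹ᴹ

  image : ℤ² → ℤ²
  image (ℓ , j) = + h ℤ.* ℓ , + y ℤ.* j ℤ.- f ℤ.* ℓ

-- Excluded middle makes inverses, limits and square roots total functions.
module Classical (em : ExcludedMiddle 0ℓ) where
  open ℂ-Ring using (_≈_; _+_; _*_; _-_; -_; 0#; 1#; semiring)
  open import Algebra.Definitions.RawSemiring (Semiring.rawSemiring semiring) using (_^_; sum; product)

  -- Some element satisfying P, and a default value if there is none. Below, P
  -- determines its element up to equality, and the default is never used for
  -- the arguments at which the functions so defined are meaningful.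
  choose : {A : Set} → A → (A → Set) → A
  choose default P with em {∃ P}
  ... | yes (x , _) = x
  ... | no  _       = default

  lim : (ℕ → ℂ) → ℂ
  lim s = choose 0# (s ⟶_)

  infix  8 _⁻¹
  infixl 7 _÷_

  _⁻¹ : ℂ → ℂ
  z ⁻¹ = choose 0# (λ w → z * w ≈ 1#)

  _÷_ : ℂ → ℂ → ℂ
  z ÷ w = z * w ⁻¹

  √_ : ℂ → ℂ
  √ z = choose 0# (λ w → w * w ≈ z ×
    (ℚ→ℝ 0ℚ <ℝ Re w ⊎ (Re w ≈ℝ ℚ→ℝ 0ℚ × ℚ→ℝ 0ℚ ≤ℝ Im w)))

  exp : ℂ → ℂ
  exp z = lim (λ n → sum {n} (λ k → z ^ toℕ k ÷ ℕ→ℂ (toℕ k !)))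

  i : ℂ
  i = ℚ→ℝ 0ℚ +i ℚ→ℝ 1ℚ

  -- π is the least positive real t with exp (i t) = -1.
  π : ℝ
  π = choose (ℚ→ℝ 0ℚ) (λ t →
      ℚ→ℝ 0ℚ <ℝ t
    × exp (i * ℝ→ℂ t) ≈ - 1#
    × (∀ t′ → ℚ→ℝ 0ℚ <ℝ t′ → t′ <ℝ t → ¬ exp (i * ℝ→ℂ t′) ≈ - 1#))

  exp2πi : ℂ → ℂ
  exp2πi z = exp (ℕ→ℂ 2 * ℝ→ℂ π * i * z)

  e : ℕ → ℤ → ℂ
  e M x = exp2πi (ℤ→ℂ x ÷ ℕ→ℂ M)

  η : ℂ → ℂ
  η z = exp2πi (z ÷ ℕ→ℂ 24) * lim (λ n → product {n} (λ k → 1# - exp2πi (ℕ→ℂ (suc (toℕ k)) * z)))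

  module _ {N : ℕ} (γ : Γ N) where
    open Γ γ using (matrix)
    open Mat matrix
    open ℤᴹ using (_▹_)

    μ : ℂ
    μ = choose 0# (λ m → ∀ z → ℚ→ℝ 0ℚ <ℝ Im z →
      m ≈ η ((ℤ→ℂ a * z + ℤ→ℂ b) ÷ (ℤ→ℂ c * z + ℤ→ℂ d))
          ÷ (η z * √ (ℤ→ℂ c * z + ℤ→ℂ d)))

    -- quad u is ⟨u⟩_γ, and pair u u′ below is ⟨u;u′⟩_γ. The absolute value in the
    -- exponent is harmless, as (-1)ᵏ = (-1)^∣k∣ for every integer k.
    quad : ℤ² → ℂ
    quad u@(u₁ , u₂) = (- 1#) ^ ℤ.∣ u₁ ℤ.+ u₂ ℤ.+ u₁ ℤ.* u₂ ∣ * e (2 ℕ.* N) (ω (u ▹ matrix) u)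

    pair : ℤ² → ℤ² → ℂ
    pair u u′ = e N (ω (u ▹ matrix ⊖ u) u′)

    ΣG : (ℤ² → ℂ) → ℂ
    ΣG F = foldr (λ x acc → F x + acc) 0# (representatives γ)

  infix 7 _·ˢ_

  _·ˢ_ : Sign → ℂ → ℂ
  Sign.+ ·ˢ z = z
  Sign.- ·ˢ z = - z

  -- A coordinate indexed by u ∈ G_γ is a function of u ∈ ℤ² invariant under Λ_γ.
  Coordinates : ℕ → Set
  Coordinates N = Sign → Γ N → ℤ² → ℂ

  module Equations {N : ℕ} (X : Coordinates N) where
    X⁺ X⁻ : Γ N → ℤ² → ℂ
    X⁺ = X Sign.+
    X⁻ = X Sign.-

    Periodic : Set
    Periodic = ∀ s γ u u′ → InΛ γ (u ⊖ u′) → X s γ u ≈ X s γ u′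

    SignIndependent : Set
    SignIndependent = ∀ γ u → ¬ InΛ γ u → X⁺ γ u ≈ X⁻ γ u

    ConjugationInvariant : Set
    ConjugationInvariant = ∀ s (δ : SL₂ℤ) (γ γ′ : Γ N) u →
      let D = SL₂ℤ.matrix δ; D⁻¹ = ℤᴹ.adj D in
      Γ.matrix γ′ ≡ D ℤᴹ.· Γ.matrix γ ℤᴹ.· D⁻¹ →
      X s γ′ (u ℤᴹ.▹ D⁻¹) ≈ X s γ u

    ValueAtZero : Set
    ValueAtZero = ∀ s γ →
      X s γ 𝟎 ≈ √ ((ℕ→ℂ (N ℕ.+ 2) + s ·ˢ √ ℕ→ℂ (N ℕ.^ 2 ℕ.+ 4 ℕ.* N)) ÷ ℕ→ℂ 2)

    Inversion : Set
    Inversion = ∀ γ u → X⁺ γ u * X⁻ γ (⊝ u) ≈ quad γ u ⁻¹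

    Fourier : Set
    Fourier = ∀ γ u →
      (√ ℕ→ℂ N) ⁻¹ * ΣG γ (λ x → pair γ x u * X⁺ γ x) ≈ μ γ * X⁻ γ u ⁻¹

    Convolution : Set
    Convolution = ∀ γ u v → ¬ (InΛ γ u × InΛ γ v) →
      (√ ℕ→ℂ N) ⁻¹ * ΣG γ (λ x → pair γ x u * (X⁺ γ x ÷ X⁻ γ (x ⊕ v)))
        ≈ X⁺ γ (u ⊕ v) ÷ (X⁻ γ u * X⁻ γ v)

    Distribution : Set
    Distribution = ∀ s γ g ord → IsOrder γ g ord → (D : DistributionData γ g) →
      let open DistributionData D in ∀ p →
      (μ γ ^ ord) ⁻¹ * product {ord} (λ n → X s γ (p ⊕ suc (toℕ n) ⊛ g))
        ≈ μ γ′ ⁻¹ * X s γ′ (image p)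

    IsPoint : Set
    IsPoint = Periodic × SignIndependent × ConjugationInvariant
            × ValueAtZero × Inversion × Fourier × Convolution × Distribution

  open Equations public using (IsPoint)

  Point : ℕ → Set
  Point N = Σ (Coordinates N) IsPoint

  FinitelyManyPoints : ℕ → Set
  FinitelyManyPoints N = Σ (List (Point N)) λ Qs → ∀ (P : Point N) →
    Any (λ Q → ∀ s γ u → proj₁ P s γ u ≈ proj₁ Q s γ u) Qs

module Submission where

-- At a point of X_N write z(u) = X⁺(u). The convolution equation at (a,-2a), multiplied by
-- z(a)², has terms exchanged by the involution x ↔ 2a - x, so that only its fixed points
-- survive modulo 2; by the distribution relations for elements of order 2, the fixed points
-- other than a contribute terms of degree 2. Hence, if 2a ≠ 0, z(a)⁴ is the sum of twice a form
-- of degree at most 4 and one of degree at most 3 in the coordinates, with coefficients generated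
-- by roots of unity and √N; if 2a = 0, the inversion and value equations say as much. By
-- Nakayama's lemma at 2 the coordinates generate a ring that is finite over ℤ₍₂₎. They are
-- therefore integral at 2, and so are their inverses by the inversion equation. The same argument
-- in the ring of functions on the set of points gives, for each coordinate, one integer polynomial
-- that it satisfies at all points; and there are finitely many coordinates, because there are
-- finitely many conjugacy classes of trace N + 2.

open import Defs
open import Algebra.Bundles using (CommutativeRing; Semiring)
import Algebra.Construct.Pointwise as Pointwise
import Algebra.Properties.Ring as RingProperties
import Algebra.Properties.Semiring.Exp as Exp
import Algebra.Properties.Semiring.Mult.TCOptimised as Mult
import Algebra.Properties.Semiring.Sum as Sum
import Algebra.Solver.Ring as RingSolver
import Algebra.Solver.Ring.AlmostCommutativeRing as ACR
open import Axiom.ExcludedMiddle using (ExcludedMiddle)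
open import Data.Empty using (⊥; ⊥-elim)
open import Data.Fin.Base as Fin using (Fin; toℕ; punchIn)
import Data.Fin.Properties as Fin
open import Data.Integer.Base as ℤ using (ℤ; +_; -[1+_])
open import Data.Nat.Coprimality as Coprimality using (Coprime)
import Data.Integer.DivMod as ℤ
import Data.Integer.Divisibility as ℤ
import Data.Integer.Divisibility.Signed as Signed
import Data.Integer.Properties as ℤ
import Data.Integer.Solver as ℤSolver
open import Data.List.Base as List using (List; []; _∷_; _++_; map; foldr; length; cartesianProduct; cartesianProductWith; concatMap; upTo; lookup)
import Data.List.Properties as List
open import Data.List.Membership.Propositional using (_∈_; lose; find)
open import Data.List.Membership.Propositional.Properties using (∈-map⁺; ∈-map⁻; ∈-upTo⁺; ∈-cartesianProduct⁺; ∈-++⁺ˡ; ∈-++⁺ʳ; ∈-++⁻; ∈-∃++; ∈-concatMap⁺; ∈-concatMap⁻; ∈-cartesianProductWith⁺; ∈-cartesianProductWith⁻)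
open import Data.List.Relation.Unary.All as All using (All; []; _∷_)
import Data.List.Relation.Unary.All.Properties as All
open import Data.List.Relation.Unary.AllPairs as AllPairs using (AllPairs; []; _∷_)
import Data.List.Relation.Unary.AllPairs.Properties as AllPairsP
open import Data.List.Relation.Unary.Any as Any using (Any; here; there)
import Data.List.Relation.Unary.Any.Properties as Any
open import Data.List.Relation.Unary.Unique.DecSetoid.Properties using (deduplicate-!)
open import Data.List.Relation.Binary.Permutation.Propositional using (_↭_; ↭-sym)
import Data.List.Relation.Binary.Permutation.Propositional.Properties as Perm
open import Data.Maybe.Base using (Maybe; just; nothing)
open import Data.Nat.Base as ℕ using (ℕ; zero; suc; _≤_; z≤n; s≤s; _⊔_; _!)
import Data.Nat.Divisibility as ℕ
import Data.Nat.DivMod as ℕ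
import Data.Nat.Induction as ℕ
import Data.Nat.Properties as ℕ
import Data.Nat.Solver as ℕSolver
open import Data.Product.Base using (Σ; ∃; ∃-syntax; _×_; _,_; proj₁; proj₂)
open import Data.Rational.Base as ℚ using (ℚ; 0ℚ; 1ℚ; ½)
import Data.Rational.Properties as ℚ
import Data.Rational.Solver as ℚSolver
import Data.Rational.Unnormalised.Base as ℚᵘ
import Data.Rational.Unnormalised.Properties as ℚᵘ
open import Data.Sign.Base as Sign using (Sign)
open import Data.Sum.Base as Sum⊎ using (_⊎_; inj₁; inj₂; [_,_]′)
import Data.Vec.Functional as VecF
import Data.Vec.Functional.Properties as VecF
open import Function.Base using (_∘_; _$_; id; case_of_)
open import Function.Bundles using (_⇔_; Equivalence)
open import Induction.WellFounded using (Acc; acc)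
open import Level using (0ℓ)
open import Relation.Binary.Bundles using (DecSetoid)
import Relation.Binary.Reasoning.Setoid as SetoidReasoning
open import Relation.Binary.PropositionalEquality as ≡ using (_≡_; _≢_; refl; sym; trans; cong; cong₂; subst)
open import Relation.Nullary using (¬_; Dec; yes; no; contradiction)
open import Relation.Nullary.Decidable using (¬?)
open import Relation.Nullary.Construct.Add.Supremum using (_⁺; [_]; ⊤⁺)
import Relation.Binary.Construct.Add.Supremum.Equality as SupEquality
import Relation.Binary.Construct.Add.Supremum.NonStrict as SupOrder

-- Modules over ℤ₍₂₎ in a commutative ring

module IntegerScalars (R : CommutativeRing 0ℓ 0ℓ) where
  open CommutativeRing R renaming (Carrier to A; refl to ≈-refl; sym to ≈-sym; trans to ≈-trans)
  open RingProperties ring public using (-‿distribˡ-*; -‿distribʳ-*)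
  open RingProperties ring using (-0#≈0#; -‿+-comm; -‿involutive)
  open Mult semiring using (×-homo-+; ×1-homo-*; 1+×) renaming (_×_ to infixl 8 _⊠_)
  open SetoidReasoning setoid

  fromℤ : ℤ → A
  fromℤ (+ n)    = n ⊠ 1#
  fromℤ -[1+ n ] = - (suc n ⊠ 1#)

  fromℤ-⊖ : ∀ m n → fromℤ (m ℤ.⊖ n) ≈ m ⊠ 1# - n ⊠ 1#
  fromℤ-⊖ m       zero    = ≈-sym (≈-trans (+-congˡ -0#≈0#) (+-identityʳ _))
  fromℤ-⊖ zero    (suc n) = ≈-sym (+-identityˡ _)
  fromℤ-⊖ (suc m) (suc n) = begin
    fromℤ (suc m ℤ.⊖ suc n)             ≡⟨ cong fromℤ (ℤ.[1+m]⊖[1+n]≡m⊖n m n) ⟩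
    fromℤ (m ℤ.⊖ n)                     ≈⟨ fromℤ-⊖ m n ⟩
    m ⊠ 1# - n ⊠ 1#                     ≈⟨ +-congʳ (+-identityˡ _) ⟨
    (0# + m ⊠ 1#) - n ⊠ 1#              ≈⟨ +-congʳ (+-congʳ (-‿inverseˡ 1#)) ⟨
    ((- 1# + 1#) + m ⊠ 1#) - n ⊠ 1#     ≈⟨ +-congʳ (+-assoc _ _ _) ⟩
    (- 1# + (1# + m ⊠ 1#)) - n ⊠ 1#     ≈⟨ +-congʳ (+-comm _ _) ⟩
    ((1# + m ⊠ 1#) - 1#) - n ⊠ 1#       ≈⟨ +-assoc _ _ _ ⟩
    (1# + m ⊠ 1#) + (- 1# - n ⊠ 1#)     ≈⟨ +-congˡ (-‿+-comm _ _) ⟩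
    (1# + m ⊠ 1#) - (1# + n ⊠ 1#)       ≈⟨ +-cong (1+× m 1#) (-‿cong (1+× n 1#)) ⟨
    suc m ⊠ 1# - suc n ⊠ 1#             ∎

  fromℤ-+ : ∀ a b → fromℤ (a ℤ.+ b) ≈ fromℤ a + fromℤ b
  fromℤ-+ (+ m)    (+ n)    = ×-homo-+ 1# m n
  fromℤ-+ (+ m)    -[1+ n ] = fromℤ-⊖ m (suc n)
  fromℤ-+ -[1+ m ] (+ n)    = ≈-trans (fromℤ-⊖ n (suc m)) (+-comm _ _)
  fromℤ-+ -[1+ m ] -[1+ n ] = begin
    - (suc (suc (m ℕ.+ n)) ⊠ 1#)      ≡⟨ cong (λ k → - (suc k ⊠ 1#)) (ℕ.+-suc m n) ⟨
    - ((suc m ℕ.+ suc n) ⊠ 1#)        ≈⟨ -‿cong (×-homo-+ 1# (suc m) (suc n)) ⟩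
    - (suc m ⊠ 1# + suc n ⊠ 1#)       ≈⟨ -‿+-comm _ _ ⟨
    - (suc m ⊠ 1#) - (suc n ⊠ 1#)     ∎

  fromℤ-neg : ∀ a → fromℤ (ℤ.- a) ≈ - fromℤ a
  fromℤ-neg (+ zero)  = ≈-sym -0#≈0#
  fromℤ-neg (+ suc n) = ≈-refl
  fromℤ-neg -[1+ n ]  = ≈-sym (-‿involutive _)

  private
    fromℤ-*⁺ : ∀ m n → fromℤ (+ m ℤ.* + n) ≈ fromℤ (+ m) * fromℤ (+ n)
    fromℤ-*⁺ m n = ≈-trans (reflexive (cong fromℤ (sym (ℤ.pos-* m n)))) (×1-homo-* m n)

    fromℤ-*ʳ : ∀ m b → fromℤ (+ m ℤ.* b) ≈ fromℤ (+ m) * fromℤ b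
    fromℤ-*ʳ m (+ n)    = fromℤ-*⁺ m n
    fromℤ-*ʳ m -[1+ n ] = begin
      fromℤ (+ m ℤ.* -[1+ n ])        ≡⟨ cong fromℤ (ℤ.neg-distribʳ-* (+ m) (+ suc n)) ⟨
      fromℤ (ℤ.- (+ m ℤ.* + suc n))   ≈⟨ fromℤ-neg (+ m ℤ.* + suc n) ⟩
      - fromℤ (+ m ℤ.* + suc n)       ≈⟨ -‿cong (fromℤ-*⁺ m (suc n)) ⟩
      - (fromℤ (+ m) * (suc n ⊠ 1#))  ≈⟨ -‿distribʳ-* _ _ ⟩
      fromℤ (+ m) * fromℤ -[1+ n ]    ∎

  fromℤ-* : ∀ a b → fromℤ (a ℤ.* b) ≈ fromℤ a * fromℤ b
  fromℤ-* (+ m)    b = fromℤ-*ʳ m b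
  fromℤ-* -[1+ m ] b = begin
    fromℤ (-[1+ m ] ℤ.* b)          ≡⟨ cong fromℤ (ℤ.neg-distribˡ-* (+ suc m) b) ⟨
    fromℤ (ℤ.- (+ suc m ℤ.* b))     ≈⟨ fromℤ-neg (+ suc m ℤ.* b) ⟩
    - fromℤ (+ suc m ℤ.* b)         ≈⟨ -‿cong (fromℤ-*ʳ (suc m) b) ⟩
    - ((suc m ⊠ 1#) * fromℤ b)      ≈⟨ -‿distribˡ-* _ _ ⟩
    fromℤ -[1+ m ] * fromℤ b        ∎

  fromℤ-morphism : ℤ.+-*-rawRing ACR.-Raw-AlmostCommutative⟶ ACR.fromCommutativeRing R
  fromℤ-morphism = record
    { ⟦_⟧    = fromℤ
    ; +-homo = fromℤ-+
    ; *-homo = fromℤ-*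
    ; -‿homo = fromℤ-neg
    ; 0-homo = ≈-refl
    ; 1-homo = ≈-refl
    }

  private
    _≟ℤ_ : ∀ a b → Maybe (fromℤ a ≈ fromℤ b)
    a ≟ℤ b with a ℤ.≟ b
    ... | yes refl = just ≈-refl
    ... | no _     = nothing

  module Solver = RingSolver ℤ.+-*-rawRing (ACR.fromCommutativeRing R) fromℤ-morphism _≟ℤ_

private
  module ℤSum = Sum ℤ.+-*-semiring

odd : ℤ → ℤ
odd k = + 1 ℤ.+ + 2 ℤ.* k

odd-* : ∀ k l → ∃[ m ] odd k ℤ.* odd l ≡ odd m
odd-* k l = k ℤ.+ l ℤ.+ + 2 ℤ.* k ℤ.* l
  , ℤS.solve 2 (λ k l → (ℤS.con (+ 1) ℤS.:+ ℤS.con (+ 2) ℤS.:* k) ℤS.:* (ℤS.con (+ 1) ℤS.:+ ℤS.con (+ 2) ℤS.:* l)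
      ℤS.:= ℤS.con (+ 1) ℤS.:+ ℤS.con (+ 2) ℤS.:* (k ℤS.:+ l ℤS.:+ ℤS.con (+ 2) ℤS.:* k ℤS.:* l)) refl k l
  where module ℤS = ℤSolver.+-*-Solver

odd≢0 : ∀ k → odd k ≢ + 0
odd≢0 k eq = 1≢2* ℤ.∣ k ∣ (trans (cong ℤ.∣_∣ 1≡-2k) (trans (ℤ.∣-i∣≡∣i∣ (+ 2 ℤ.* k)) (ℤ.abs-* (+ 2) k)))
  where
  open ≡.≡-Reasoning

  1≡-2k : + 1 ≡ ℤ.- (+ 2 ℤ.* k)
  1≡-2k = begin
    + 1                                      ≡⟨ ℤ.+-identityʳ (+ 1) ⟨
    + 1 ℤ.+ + 0                              ≡⟨ cong (ℤ._+_ (+ 1)) (ℤ.+-inverseʳ (+ 2 ℤ.* k)) ⟨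
    + 1 ℤ.+ (+ 2 ℤ.* k ℤ.- + 2 ℤ.* k)        ≡⟨ ℤ.+-assoc (+ 1) (+ 2 ℤ.* k) (ℤ.- (+ 2 ℤ.* k)) ⟨
    odd k ℤ.- + 2 ℤ.* k                      ≡⟨ cong (ℤ._- (+ 2 ℤ.* k)) eq ⟩
    + 0 ℤ.- + 2 ℤ.* k                        ≡⟨ ℤ.+-identityˡ (ℤ.- (+ 2 ℤ.* k)) ⟩
    ℤ.- (+ 2 ℤ.* k)                          ∎

  1≢2* : ∀ n → 1 ≢ 2 ℕ.* n
  1≢2* (suc n) eq = ℕ.1+n≢0 (sym (ℕ.suc-injective (trans eq (cong suc (ℕ.+-suc n (n ℕ.+ 0))))))

module Spans (R : CommutativeRing 0ℓ 0ℓ) where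
  open CommutativeRing R renaming (Carrier to A; refl to ≈-refl; sym to ≈-sym; trans to ≈-trans)
  open IntegerScalars R public
  open Sum semiring using (sum; sum-cong-≋; sum-remove; *-distribˡ-sum; ∑-distrib-+)
  open Exp semiring using (_^_)
  open SetoidReasoning setoid
  open Solver using (solve; con; _:=_; _:+_; _:*_; _:-_; :-_)

  record IsSubmodule (S : A → Set) : Set where
    field
      resp  : ∀ {r s} → r ≈ s → S r → S s
      zero# : S 0#
      add   : ∀ {r s} → S r → S s → S (r + s)
      scale : ∀ n {r} → S r → S (fromℤ n * r)

    neg : ∀ {r} → S r → S (- r)
    neg {r} Sr = resp (solve 1 (λ r → con (ℤ.- + 1) :* r := :- r) ≈-refl r) (scale (ℤ.- + 1) Sr)

    sub : ∀ {r s} → S r → S s → S (r - s)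
    sub Sr Ss = add Sr (neg Ss)

  open IsSubmodule public

  infix 4 _mod_∋_

  -- S mod Y ∋ r says that r lies in S up to an integer combination of Y.
  _mod_∋_ : (A → Set) → List A → A → Set
  S mod []      ∋ r = S r
  S mod (y ∷ Y) ∋ r = ∃[ a ] S mod Y ∋ (r - fromℤ a * y)

  Span : List A → A → Set
  Span E r = (_≈ 0#) mod E ∋ r

  0-isSubmodule : IsSubmodule (_≈ 0#)
  0-isSubmodule = record
    { resp  = λ r≈s r≈0 → ≈-trans (≈-sym r≈s) r≈0
    ; zero# = ≈-refl
    ; add   = λ p q → ≈-trans (+-cong p q) (+-identityˡ 0#)
    ; scale = λ n p → ≈-trans (*-congˡ p) (zeroʳ (fromℤ n))
    }

  mod-isSubmodule : ∀ {S} → IsSubmodule S → ∀ Y → IsSubmodule (S mod Y ∋_)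
  mod-isSubmodule isS []      = isS
  mod-isSubmodule isS (y ∷ Y) = record
    { resp  = λ r≈s (a , p) → a , resp rec (+-congʳ r≈s) p
    ; zero# = + 0 , resp rec (solve 1 (λ y → con (+ 0) := con (+ 0) :- con (+ 0) :* y) ≈-refl y) (zero# rec)
    ; add   = λ {r} {s} (a , p) (b , q) → a ℤ.+ b , resp rec
        (≈-trans
          (solve 5 (λ r s a b y → (r :- a :* y) :+ (s :- b :* y) := (r :+ s) :- (a :+ b) :* y)
            ≈-refl r s (fromℤ a) (fromℤ b) y)
          (+-congˡ (-‿cong (*-congʳ (≈-sym (fromℤ-+ a b))))))
        (add rec p q)
    ; scale = λ n {r} (a , p) → n ℤ.* a , resp rec
        (≈-trans
          (solve 4 (λ n r a y → n :* (r :- a :* y) := n :* r :- (n :* a) :* y)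
            ≈-refl (fromℤ n) r (fromℤ a) y)
          (+-congˡ (-‿cong (*-congʳ (≈-sym (fromℤ-* n a))))))
        (scale rec n p)
    }
    where
    rec : IsSubmodule _
    rec = mod-isSubmodule isS Y

  span-isSubmodule : ∀ E → IsSubmodule (Span E)
  span-isSubmodule = mod-isSubmodule 0-isSubmodule

  mod-weaken : ∀ {S} → IsSubmodule S → ∀ y Y {r} → S mod Y ∋ r → S mod (y ∷ Y) ∋ r
  mod-weaken isS y Y {r} p = + 0 , resp (mod-isSubmodule isS Y)
    (solve 2 (λ r y → r := r :- con (+ 0) :* y) ≈-refl r y) p

  ⊆-mod : ∀ {S} → IsSubmodule S → ∀ Y {r} → S r → S mod Y ∋ r
  ⊆-mod isS []      p = p
  ⊆-mod isS (y ∷ Y) p = mod-weaken isS y Y (⊆-mod isS Y p)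

  ∈⇒mod : ∀ {S} → IsSubmodule S → ∀ {Y y} → y ∈ Y → S mod Y ∋ y
  ∈⇒mod isS {y ∷ Y} (here refl) = + 1 , resp (mod-isSubmodule isS Y)
    (solve 1 (λ y → con (+ 0) := y :- con (+ 1) :* y) ≈-refl y) (zero# (mod-isSubmodule isS Y))
  ∈⇒mod isS {y ∷ Y} (there p)   = mod-weaken isS y Y (∈⇒mod isS p)

  ∈⇒Span : ∀ {E e} → e ∈ E → Span E e
  ∈⇒Span = ∈⇒mod 0-isSubmodule

  mod-least : ∀ {S P} → IsSubmodule P → (∀ {r} → S r → P r) → ∀ Y → (∀ {y} → y ∈ Y → P y) →
              ∀ {r} → S mod Y ∋ r → P r
  mod-least isP S⊆P []      Y⊆P p           = S⊆P p
  mod-least isP S⊆P (y ∷ Y) Y⊆P {r} (a , p) = resp isP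
    (solve 3 (λ r a y → (r :- a :* y) :+ a :* y := r) ≈-refl r (fromℤ a) y)
    (add isP (mod-least isP S⊆P Y (Y⊆P ∘ there) p) (scale isP a (Y⊆P (here refl))))

  span-least : ∀ {P} → IsSubmodule P → ∀ E → (∀ {e} → e ∈ E → P e) → ∀ {r} → Span E r → P r
  span-least isP = mod-least isP (λ r≈0 → resp isP (≈-sym r≈0) (zero# isP))

  preimage-isSubmodule : ∀ {S} → IsSubmodule S → ∀ c → IsSubmodule (λ r → S (c * r))
  preimage-isSubmodule isS c = record
    { resp  = λ r≈s → resp isS (*-congˡ r≈s)
    ; zero# = resp isS (≈-sym (zeroʳ c)) (zero# isS)
    ; add   = λ p q → resp isS (≈-sym (distribˡ c _ _)) (add isS p q)
    ; scale = λ n {r} p → resp isS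
        (solve 3 (λ n c r → n :* (c :* r) := c :* (n :* r)) ≈-refl (fromℤ n) c r) (scale isS n p)
    }

  span-* : ∀ {E F} P → IsSubmodule P → (∀ {e f} → e ∈ E → f ∈ F → P (e * f)) →
           ∀ {r s} → Span E r → Span F s → P (r * s)
  span-* {E} {F} P isP EF⊆P {r} {s} p q =
    resp isP (*-comm s r) (span-least (preimage-isSubmodule isP s) E
      (λ {e} e∈E → resp isP (*-comm e s) (span-least (preimage-isSubmodule isP e) F (EF⊆P e∈E) q)) p)

  2# : A
  2# = 1# + 1#

  fromℤ-odd : ∀ k → fromℤ (odd k) ≈ 1# + 2# * fromℤ k
  fromℤ-odd k = ≈-trans (fromℤ-+ (+ 1) (+ 2 ℤ.* k)) (+-congˡ (fromℤ-* (+ 2) k))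

  OddMultiple : (A → Set) → A → Set
  OddMultiple S r = ∃[ k ] S (fromℤ (odd k) * r)

  OddMultiple-* : ∀ {S} → IsSubmodule S → ∀ k {r} → OddMultiple S (fromℤ (odd k) * r) → OddMultiple S r
  OddMultiple-* isS k {r} (l , p) = let m , eq = odd-* l k in m , resp isS
    (begin
      fromℤ (odd l) * (fromℤ (odd k) * r)  ≈⟨ *-assoc _ _ _ ⟨
      fromℤ (odd l) * fromℤ (odd k) * r    ≈⟨ *-congʳ (fromℤ-* (odd l) (odd k)) ⟨
      fromℤ (odd l ℤ.* odd k) * r          ≡⟨ cong (λ n → fromℤ n * r) eq ⟩
      fromℤ (odd m) * r                    ∎) p

  doubles : List A → List A
  doubles = map (2# *_)

  -- Nakayama's lemma for the localisation of ℤ at 2, by Gaussian elimination: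
  -- the diagonal entries stay odd because all the other coefficients are even.
  nakayama : ∀ {S} → IsSubmodule S → ∀ Y → All (OddMultiple (S mod doubles Y ∋_)) Y →
             ∃[ k ] ∀ {y} → y ∈ Y → S (fromℤ (odd k) * y)
  nakayama isS [] [] = + 0 , λ ()
  nakayama {S} isS (y ∷ Y) ((k , a , p) ∷ ps) = m , λ
      { (here refl) → resp isS (≈-trans (combine o₂ o₁ y) (*-congʳ (reflexive (cong fromℤ m≡)))) o₂o₁y
      ; (there {_} {xs} y′∈Y) → resp isS (≈-trans (combine o₁ o₂ _) (*-congʳ (reflexive (cong fromℤ (trans (ℤ.*-comm o₁ o₂) m≡))))) (scale isS o₁ (o₂Y y′∈Y)) }
    where
    T : A → Set
    T = S mod doubles Y ∋_

    isT : IsSubmodule T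
    isT = mod-isSubmodule isS (doubles Y)

    o₁ : ℤ
    o₁ = odd (k ℤ.- a)

    o₁y : T (fromℤ o₁ * y)
    o₁y = resp isT (begin
      fromℤ (odd k) * y - fromℤ a * (2# * y)
        ≈⟨ +-congʳ (*-congʳ (fromℤ-odd k)) ⟩
      (1# + 2# * fromℤ k) * y - fromℤ a * (2# * y)
        ≈⟨ solve 3 (λ k a y → (con (+ 1) :+ con (+ 2) :* k) :* y :- a :* (con (+ 2) :* y)
             := (con (+ 1) :+ con (+ 2) :* (k :- a)) :* y) ≈-refl (fromℤ k) (fromℤ a) y ⟩
      (1# + 2# * (fromℤ k - fromℤ a)) * y
        ≈⟨ *-congʳ (+-congˡ (*-congˡ (≈-trans (fromℤ-+ k (ℤ.- a)) (+-congˡ (fromℤ-neg a))))) ⟨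
      (1# + 2# * fromℤ (k ℤ.- a)) * y
        ≈⟨ *-congʳ (fromℤ-odd (k ℤ.- a)) ⟨
      fromℤ o₁ * y ∎) p

    eliminate : ∀ {y′} → OddMultiple (S mod doubles (y ∷ Y) ∋_) y′ → OddMultiple T y′
    eliminate {y′} (l , b , q) = OddMultiple-* isT l (k ℤ.- a , resp isT
      (solve 4 (λ o z b y → o :* (z :- b :* (con (+ 2) :* y)) :+ con (+ 2) :* (b :* (o :* y)) := o :* z)
        ≈-refl (fromℤ o₁) (fromℤ (odd l) * y′) (fromℤ b) y)
      (add isT (scale isT o₁ q) (scale isT (+ 2) (scale isT b o₁y))))

    rec : ∃[ l ] ∀ {y′} → y′ ∈ Y → S (fromℤ (odd l) * y′)
    rec = nakayama isS Y (All.map eliminate ps)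

    o₂ : ℤ
    o₂ = odd (proj₁ rec)

    o₂Y : ∀ {y′} → y′ ∈ Y → S (fromℤ o₂ * y′)
    o₂Y = proj₂ rec

    o₂o₁y : S (fromℤ o₂ * (fromℤ o₁ * y))
    o₂o₁y = mod-least (preimage-isSubmodule isS (fromℤ o₂)) (scale isS o₂) (doubles Y)
      (λ d∈ → let y′ , y′∈ , eq = ∈-map⁻ (2# *_) d∈ in resp isS
        (≈-trans (solve 2 (λ o z → con (+ 2) :* (o :* z) := o :* (con (+ 2) :* z)) ≈-refl (fromℤ o₂) y′)
          (*-congˡ (reflexive (sym eq))))
        (scale isS (+ 2) (o₂Y y′∈)))
      o₁y

    combine : ∀ a b r → fromℤ a * (fromℤ b * r) ≈ fromℤ (a ℤ.* b) * r
    combine a b r = ≈-trans (≈-sym (*-assoc _ _ _)) (*-congʳ (≈-sym (fromℤ-* a b)))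

    m : ℤ
    m = proj₁ (odd-* (proj₁ rec) (k ℤ.- a))

    m≡ : o₂ ℤ.* o₁ ≡ odd m
    m≡ = proj₂ (odd-* (proj₁ rec) (k ℤ.- a))

  sum-zero : ∀ {n} (f : Fin n → A) → (∀ i → f i ≈ 0#) → sum f ≈ 0#
  sum-zero {zero}  f f≈0 = ≈-refl
  sum-zero {suc n} f f≈0 = ≈-trans (+-cong (f≈0 Fin.zero) (sum-zero (f ∘ Fin.suc) (f≈0 ∘ Fin.suc))) (+-identityˡ 0#)

  Dependent : ∀ {n} → (Fin n → A) → Set
  Dependent {n} V = Σ (Fin n → ℤ) λ c → (∃ λ i → c i ≢ + 0) × sum (λ i → fromℤ (c i) * V i) ≈ 0#

  dependent : ∀ E {n} → length E ℕ.< n → (V : Fin n → A) → (∀ i → Span E (V i)) → Dependent V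
  dependent []      {suc n} _ V V≈0 = (λ _ → + 1) , (Fin.zero , λ ()) ,
    sum-zero (λ i → 1# * V i) (λ i → ≈-trans (*-identityˡ (V i)) (V≈0 i))
  dependent (e ∷ E) {suc n} (s≤s E<n) V V∈ with Fin.any? (λ i → ¬? (proj₁ (V∈ i) ℤ.≟ + 0))
  ... | no none = dependent E (ℕ.m≤n⇒m≤1+n E<n) V λ i → resp (span-isSubmodule E)
          (begin
            V i - fromℤ (a i) * e  ≡⟨ cong (λ b → V i - fromℤ b * e) (a≡0 i) ⟩
            V i - 0# * e           ≈⟨ solve 2 (λ v e → v :- con (+ 0) :* e := v) ≈-refl (V i) e ⟩
            V i                    ∎)
          (proj₂ (V∈ i))
    where
    a : Fin (suc n) → ℤ
    a i = proj₁ (V∈ i)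

    a≡0 : ∀ i → a i ≡ + 0
    a≡0 i with a i ℤ.≟ + 0
    ... | yes eq = eq
    ... | no neq = contradiction (i , neq) none
  ... | yes (p , aₚ≢0) = c , (punchIn p j , cⱼ≢0) , total
    where
    a : Fin (suc n) → ℤ
    a i = proj₁ (V∈ i)

    V′ : Fin n → A
    V′ j = fromℤ (a p) * V (punchIn p j) - fromℤ (a (punchIn p j)) * V p

    V′∈ : ∀ j → Span E (V′ j)
    V′∈ j = resp (span-isSubmodule E)
      (solve 5 (λ α v β w e → α :* (v :- β :* e) :- β :* (w :- α :* e) := α :* v :- β :* w)
        ≈-refl (fromℤ (a p)) (V (punchIn p j)) (fromℤ (a (punchIn p j))) (V p) e)
      (sub (span-isSubmodule E)
        (scale (span-isSubmodule E) (a p) (proj₂ (V∈ (punchIn p j))))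
        (scale (span-isSubmodule E) (a (punchIn p j)) (proj₂ (V∈ p))))

    rec : Dependent V′
    rec = dependent E E<n V′ V′∈

    c′ : Fin n → ℤ
    c′ = proj₁ rec

    j : Fin n
    j = proj₁ (proj₁ (proj₂ rec))

    c′ⱼ≢0 : c′ j ≢ + 0
    c′ⱼ≢0 = proj₂ (proj₁ (proj₂ rec))

    Σℤ : ∀ {m} → (Fin m → ℤ) → ℤ
    Σℤ = ℤSum.sum

    b : ℤ
    b = Σℤ (λ j → ℤ.- (c′ j ℤ.* a (punchIn p j)))

    fromℤ-Σ : ∀ {m} (f : Fin m → ℤ) → fromℤ (Σℤ f) ≈ sum (fromℤ ∘ f)
    fromℤ-Σ {zero}  f = ≈-refl
    fromℤ-Σ {suc m} f = ≈-trans (fromℤ-+ (f Fin.zero) _) (+-congˡ (fromℤ-Σ (f ∘ Fin.suc)))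

    c : Fin (suc n) → ℤ
    c = VecF.insertAt (λ j → c′ j ℤ.* a p) p b

    c-p : c p ≡ b
    c-p = VecF.insertAt-lookup (λ j → c′ j ℤ.* a p) p b

    c-punch : ∀ j → c (punchIn p j) ≡ c′ j ℤ.* a p
    c-punch = VecF.insertAt-punchIn (λ j → c′ j ℤ.* a p) p b

    cⱼ≢0 : c (punchIn p j) ≢ + 0
    cⱼ≢0 eq = [ c′ⱼ≢0 , aₚ≢0 ]′ (ℤ.i*j≡0⇒i≡0∨j≡0 (c′ j) (trans (sym (c-punch j)) eq))

    total : sum (λ i → fromℤ (c i) * V i) ≈ 0#
    total = begin
      sum (λ i → fromℤ (c i) * V i)
        ≈⟨ sum-remove {i = p} (λ i → fromℤ (c i) * V i) ⟩
      fromℤ (c p) * V p + sum (λ j → fromℤ (c (punchIn p j)) * V (punchIn p j))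
        ≈⟨ +-cong
             (begin
               fromℤ (c p) * V p                                                ≡⟨ cong (λ z → fromℤ z * V p) c-p ⟩
               fromℤ b * V p                                                    ≈⟨ *-comm _ _ ⟩
               V p * fromℤ b                                                    ≈⟨ *-congˡ (fromℤ-Σ (λ j → ℤ.- (c′ j ℤ.* a (punchIn p j)))) ⟩
               V p * sum (λ j → fromℤ (ℤ.- (c′ j ℤ.* a (punchIn p j))))         ≈⟨ *-distribˡ-sum (V p) (λ j → fromℤ (ℤ.- (c′ j ℤ.* a (punchIn p j)))) ⟩
               sum (λ j → V p * fromℤ (ℤ.- (c′ j ℤ.* a (punchIn p j))))         ∎)
             ≈-refl ⟩
      sum (λ j → V p * fromℤ (ℤ.- (c′ j ℤ.* a (punchIn p j)))) + sum (λ j → fromℤ (c (punchIn p j)) * V (punchIn p j))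
        ≈⟨ ∑-distrib-+ (λ j → V p * fromℤ (ℤ.- (c′ j ℤ.* a (punchIn p j)))) (λ j → fromℤ (c (punchIn p j)) * V (punchIn p j)) ⟨
      sum (λ j → V p * fromℤ (ℤ.- (c′ j ℤ.* a (punchIn p j))) + fromℤ (c (punchIn p j)) * V (punchIn p j))
        ≈⟨ sum-cong-≋ term ⟩
      sum (λ j → fromℤ (c′ j) * V′ j)
        ≈⟨ proj₂ (proj₂ rec) ⟩
      0# ∎
      where
      term : ∀ j → V p * fromℤ (ℤ.- (c′ j ℤ.* a (punchIn p j))) + fromℤ (c (punchIn p j)) * V (punchIn p j)
                   ≈ fromℤ (c′ j) * V′ j
      term j = begin
        V p * fromℤ (ℤ.- (c′ j ℤ.* a (punchIn p j))) + fromℤ (c (punchIn p j)) * V (punchIn p j)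
          ≈⟨ +-cong (*-congˡ (≈-trans (fromℤ-neg (c′ j ℤ.* a (punchIn p j))) (-‿cong (fromℤ-* (c′ j) (a (punchIn p j))))))
               (*-congʳ (≈-trans (reflexive (cong fromℤ (c-punch j))) (fromℤ-* (c′ j) (a p)))) ⟩
        V p * - (fromℤ (c′ j) * fromℤ (a (punchIn p j))) + fromℤ (c′ j) * fromℤ (a p) * V (punchIn p j)
          ≈⟨ solve 5 (λ w γ β α v → w :* :- (γ :* β) :+ γ :* α :* v := γ :* (α :* v :- β :* w)) ≈-refl
               (V p) (fromℤ (c′ j)) (fromℤ (a (punchIn p j))) (fromℤ (a p)) (V (punchIn p j)) ⟩
        fromℤ (c′ j) * V′ j ∎

  polynomial : List ℤ → A → A
  polynomial cs z = foldr (λ c acc → fromℤ c + z * acc) 0# cs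

  polynomial-tabulate : ∀ {n} (f : Fin n → ℤ) z →
                        polynomial (List.tabulate f) z ≈ sum (λ i → fromℤ (f i) * z ^ toℕ i)
  polynomial-tabulate {zero}  f z = ≈-refl
  polynomial-tabulate {suc n} f z = +-cong (≈-sym (*-identityʳ _)) (begin
    z * polynomial (List.tabulate (f ∘ Fin.suc)) z
      ≈⟨ *-congˡ (polynomial-tabulate (f ∘ Fin.suc) z) ⟩
    z * sum (λ i → fromℤ (f (Fin.suc i)) * z ^ toℕ i)
      ≈⟨ *-distribˡ-sum z (λ i → fromℤ (f (Fin.suc i)) * z ^ toℕ i) ⟩
    sum (λ i → z * (fromℤ (f (Fin.suc i)) * z ^ toℕ i))
      ≈⟨ sum-cong-≋ (λ i → solve 3 (λ z f p → z :* (f :* p) := f :* (z :* p)) ≈-refl z (fromℤ (f (Fin.suc i))) (z ^ toℕ i)) ⟩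
    sum (λ i → fromℤ (f (Fin.suc i)) * z ^ suc (toℕ i)) ∎)

  IsAlgebraicOver-ℤ : A → Set
  IsAlgebraicOver-ℤ z = ∃[ cs ] (Any (_≢ + 0) cs × polynomial cs z ≈ 0#)

  -- r acts on the ℤ₍₂₎-module generated by E.
  Stabilizes : List A → A → Set
  Stabilizes E r = ∃[ k ] ∀ {e} → e ∈ E → Span E (fromℤ (odd k) * (r * e))

  stabilizes⇒algebraic : ∀ E → Span E 1# → ∀ {z} → Stabilizes E z → IsAlgebraicOver-ℤ z
  stabilizes⇒algebraic E 1∈ {z} (k , z∈) =
    let c , (i , cᵢ≢0) , rel = dependent E (ℕ.n<1+n (length E)) power power∈
        d = λ j → c j ℤ.* odd k ℤ.^ toℕ j
    in List.tabulate d
     , Any.tabulate⁺ {f = d} i (λ eq → [ cᵢ≢0 , (λ eq′ → odd≢0 k (i^n≡0⇒i≡0 (odd k) (toℕ i) eq′)) ]′ (ℤ.i*j≡0⇒i≡0∨j≡0 (c i) eq))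
     , (begin
         polynomial (List.tabulate d) z            ≈⟨ polynomial-tabulate d z ⟩
         sum (λ j → fromℤ (d j) * z ^ toℕ j)       ≈⟨ sum-cong-≋ (λ j → ≈-trans (*-congʳ (≈-trans (fromℤ-* (c j) (odd k ℤ.^ toℕ j)) (*-congˡ (fromℤ-^ (toℕ j))))) (≈-trans (*-assoc _ _ _) (*-congˡ (^-* (toℕ j))))) ⟩
         sum (λ j → fromℤ (c j) * power j)         ≈⟨ rel ⟩
         0#                                        ∎)
    where
    power : Fin (suc (length E)) → A
    power j = (fromℤ (odd k) * z) ^ toℕ j

    power∈′ : ∀ n → Span E ((fromℤ (odd k) * z) ^ n)
    power∈′ zero    = 1∈
    power∈′ (suc n) = span-least (preimage-isSubmodule (span-isSubmodule E) (fromℤ (odd k) * z)) E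
      (λ e∈ → resp (span-isSubmodule E) (≈-sym (*-assoc _ _ _)) (z∈ e∈)) (power∈′ n)

    power∈ : ∀ j → Span E (power j)
    power∈ j = power∈′ (toℕ j)

    fromℤ-^ : ∀ n → fromℤ (odd k ℤ.^ n) ≈ fromℤ (odd k) ^ n
    fromℤ-^ zero    = ≈-refl
    fromℤ-^ (suc n) = ≈-trans (fromℤ-* (odd k) (odd k ℤ.^ n)) (*-congˡ (fromℤ-^ n))

    ^-* : ∀ n → fromℤ (odd k) ^ n * z ^ n ≈ (fromℤ (odd k) * z) ^ n
    ^-* zero    = *-identityˡ 1#
    ^-* (suc n) = ≈-trans
      (solve 4 (λ a b c d → a :* b :* (c :* d) := a :* c :* (b :* d)) ≈-refl _ _ _ _)
      (*-congˡ (^-* n))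

    i^n≡0⇒i≡0 : ∀ i n → i ℤ.^ n ≡ + 0 → i ≡ + 0
    i^n≡0⇒i≡0 i (suc n) eq = [ id , i^n≡0⇒i≡0 i n ]′ (ℤ.i*j≡0⇒i≡0∨j≡0 i eq)

  stabilizes-* : ∀ E {r s} → Stabilizes E r → Stabilizes E s → Stabilizes E (r * s)
  stabilizes-* E {r} {s} (k , p) (l , q) = let m , eq = odd-* k l in m , λ {e} e∈ →
    resp (span-isSubmodule E)
      (begin
        (fromℤ (odd k) * r) * (fromℤ (odd l) * (s * e))
          ≈⟨ solve 5 (λ a r b s e → (a :* r) :* (b :* (s :* e)) := (a :* b) :* (r :* s :* e)) ≈-refl _ _ _ _ _ ⟩
        (fromℤ (odd k) * fromℤ (odd l)) * (r * s * e)
          ≈⟨ *-congʳ (≈-trans (≈-sym (fromℤ-* (odd k) (odd l))) (reflexive (cong fromℤ eq))) ⟩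
        fromℤ (odd m) * (r * s * e) ∎)
      (span-least (preimage-isSubmodule (span-isSubmodule E) (fromℤ (odd k) * r)) E
        (λ e′∈ → resp (span-isSubmodule E) (≈-sym (*-assoc _ _ _)) (p e′∈)) (q e∈))

  stabilizers-isSubmodule : ∀ E → IsSubmodule (Stabilizes E)
  stabilizers-isSubmodule E = record
    { resp  = λ r≈s (k , p) → k , λ e∈ → resp isE (*-congˡ (*-congʳ r≈s)) (p e∈)
    ; zero# = + 0 , λ {e} _ → resp isE
        (solve 1 (λ e → con (+ 0) := con (+ 1) :* (con (+ 0) :* e)) ≈-refl e) (zero# isE)
    ; add   = λ {r} {s} (k , p) (l , q) → let m , eq = odd-* k l in m , λ {e} e∈ → resp isE
        (begin
          fromℤ (odd l) * (fromℤ (odd k) * (r * e)) + fromℤ (odd k) * (fromℤ (odd l) * (s * e))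
            ≈⟨ solve 5 (λ a b r s e → b :* (a :* (r :* e)) :+ a :* (b :* (s :* e)) := a :* b :* ((r :+ s) :* e))
                 ≈-refl (fromℤ (odd k)) (fromℤ (odd l)) r s e ⟩
          fromℤ (odd k) * fromℤ (odd l) * ((r + s) * e)
            ≈⟨ *-congʳ (≈-trans (≈-sym (fromℤ-* (odd k) (odd l))) (reflexive (cong fromℤ eq))) ⟩
          fromℤ (odd m) * ((r + s) * e) ∎)
        (add isE (scale isE (odd l) (p e∈)) (scale isE (odd k) (q e∈)))
    ; scale = λ n {r} (k , p) → k , λ {e} e∈ → resp isE
        (solve 4 (λ n o r e → n :* (o :* (r :* e)) := o :* (n :* r :* e)) ≈-refl (fromℤ n) (fromℤ (odd k)) r e)
        (scale isE n (p e∈))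
    }
    where
    isE : IsSubmodule (Span E)
    isE = span-isSubmodule E

module Filtration (R : CommutativeRing 0ℓ 0ℓ) (Cs Xs : List (CommutativeRing.Carrier R))
  (1∈Cs : Spans.Span R Cs (CommutativeRing.1# R))
  (Cs-closed : ∀ {c d} → c ∈ Cs → d ∈ Cs → Spans.Span R Cs (CommutativeRing._*_ R c d))
  (1∈Xs : CommutativeRing.1# R ∈ Xs) where
  open CommutativeRing R renaming (Carrier to A; refl to ≈-refl; sym to ≈-sym; trans to ≈-trans)
  open Spans R
  open Exp semiring using (_^_; ^-homo-*)
  open Solver using (solve; con; _:=_; _:+_; _:*_)

  words : ℕ → List A
  words zero    = Cs
  words (suc d) = cartesianProductWith _*_ Xs (words d)

  T : ℕ → A → Set
  T d = Span (words d)

  isT : ∀ d → IsSubmodule (T d)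
  isT d = span-isSubmodule (words d)

  T-var : ∀ d {x r} → x ∈ Xs → T d r → T (suc d) (x * r)
  T-var d {x} x∈ = span-least (preimage-isSubmodule (isT (suc d)) x) (words d)
    (λ w∈ → ∈⇒Span (∈-cartesianProductWith⁺ _*_ x∈ w∈))

  T-suc : ∀ d {r} → T d r → T (suc d) r
  T-suc d p = resp (isT (suc d)) (*-identityˡ _) (T-var d 1∈Xs p)

  T-≤′ : ∀ {d e} → d ℕ.≤′ e → ∀ {r} → T d r → T e r
  T-≤′ ℕ.≤′-refl              p = p
  T-≤′ (ℕ.≤′-step {n} d≤e) p = T-suc n (T-≤′ d≤e p)

  T-≤ : ∀ {d e} → d ≤ e → ∀ {r} → T d r → T e r
  T-≤ d≤e = T-≤′ (ℕ.≤⇒≤′ d≤e)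

  T-const : ∀ d {c r} → Span Cs c → T d r → T d (c * r)
  T-const zero        c∈ = span-* (T 0) (isT 0) Cs-closed c∈
  T-const (suc d) {c} c∈ = span-least (preimage-isSubmodule (isT (suc d)) c) (words (suc d)) λ w∈ →
    let x , w , x∈ , w∈′ , eq = ∈-cartesianProductWith⁻ _*_ Xs (words d) w∈
    in resp (isT (suc d))
         (≈-trans (solve 3 (λ x c w → x :* (c :* w) := c :* (x :* w)) ≈-refl x c w) (*-congˡ (reflexive (sym eq))))
         (T-var d x∈ (T-const d c∈ (∈⇒Span w∈′)))

  T-* : ∀ d {e r s} → T d r → T e s → T (d ℕ.+ e) (r * s)
  T-* zero    {e} p q = T-const e p q
  T-* (suc d) {e} {r} {s} p q = resp (isT (suc d ℕ.+ e)) (*-comm s r)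
    (span-least (preimage-isSubmodule (isT (suc d ℕ.+ e)) s) (words (suc d))
      (λ w∈ → let x , w , x∈ , w∈′ , eq = ∈-cartesianProductWith⁻ _*_ Xs (words d) w∈
              in resp (isT (suc d ℕ.+ e))
                   (≈-trans (solve 3 (λ x w s → x :* (w :* s) := s :* (x :* w)) ≈-refl x w s)
                     (*-congˡ (reflexive (sym eq))))
                   (T-var (d ℕ.+ e) x∈ (T-* d (∈⇒Span w∈′) q)))
      p)

  T-1 : ∀ d → T d 1#
  T-1 d = T-≤ {0} {d} z≤n 1∈Cs

  T-∈ : ∀ {x} → x ∈ Xs → T 1 x
  T-∈ x∈ = resp (isT 1) (*-identityʳ _) (T-var 0 x∈ (T-1 0))

  record Reducible (d : ℕ) (r : A) : Set where
    constructor reducible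
    field
      {p q} : A
      p∈    : T (suc d) p
      q∈    : T d q
      r≈    : r ≈ 2# * p + q

  lower⇒reducible : ∀ d {r} → T d r → Reducible d r
  lower⇒reducible d {r} p = reducible (zero# (isT (suc d))) p
    (solve 1 (λ r → r := con (+ 2) :* con (+ 0) :+ r) ≈-refl r)

  double⇒reducible : ∀ d {r} → T (suc d) r → Reducible d (r + r)
  double⇒reducible d {r} p = reducible p (zero# (isT d))
    (solve 1 (λ r → r :+ r := con (+ 2) :* r :+ con (+ 0)) ≈-refl r)

  reducible-isSubmodule : ∀ d → IsSubmodule (Reducible d)
  reducible-isSubmodule d = record
    { resp  = λ r≈s (reducible p q eq) → reducible p q (≈-trans (≈-sym r≈s) eq)
    ; zero# = lower⇒reducible d (zero# (isT d))
    ; add   = λ (reducible p q eq) (reducible p′ q′ eq′) →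
        reducible (add (isT (suc d)) p p′) (add (isT d) q q′)
          (≈-trans (+-cong eq eq′)
            (solve 4 (λ p q p′ q′ → (con (+ 2) :* p :+ q) :+ (con (+ 2) :* p′ :+ q′)
               := con (+ 2) :* (p :+ p′) :+ (q :+ q′)) ≈-refl _ _ _ _))
    ; scale = λ n (reducible p q eq) → reducible (scale (isT (suc d)) n p) (scale (isT d) n q)
        (≈-trans (*-congˡ eq)
          (solve 3 (λ n p q → n :* (con (+ 2) :* p :+ q) := con (+ 2) :* (n :* p) :+ n :* q) ≈-refl _ _ _))
    }

  reducible-* : ∀ e {d r s} → T e r → Reducible d s → Reducible (e ℕ.+ d) (r * s)
  reducible-* e {d} {r} r∈ (reducible {p} {q} p∈ q∈ eq) = reducible
    (subst (λ k → T k (r * p)) (ℕ.+-suc e d) (T-* e r∈ p∈)) (T-* e r∈ q∈)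
    (≈-trans (*-congˡ eq)
      (solve 3 (λ r p q → r :* (con (+ 2) :* p :+ q) := con (+ 2) :* (r :* p) :+ r :* q) ≈-refl _ _ _))

  data Monomial : List A → ℕ → A → Set where
    []  : ∀ {r} → r ≈ 1# → Monomial [] 0 r
    _^*_ : ∀ {x Ys d r s} (k : ℕ) → Monomial Ys d s → r ≈ x ^ k * s → Monomial (x ∷ Ys) (k ℕ.+ d) r

  monomial-1 : ∀ Ys → Monomial Ys 0 1#
  monomial-1 []       = [] ≈-refl
  monomial-1 (y ∷ Ys) = (0 ^* monomial-1 Ys) (≈-sym (*-identityˡ 1#))

  monomial-* : ∀ {x Ys d s} → x ∈ Ys → Monomial Ys d s → Monomial Ys (suc d) (x * s)
  monomial-* (here refl) ((k ^* m) eq) = (suc k ^* m) (≈-trans (*-congˡ eq) (≈-sym (*-assoc _ _ _)))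
  monomial-* {x} {y ∷ Ys} (there x∈) (_^*_ {d = d} {r} {s} k m eq) =
    subst (λ n → Monomial (y ∷ Ys) n (x * r)) (ℕ.+-suc k d)
      ((k ^* monomial-* x∈ m) (≈-trans (*-congˡ eq)
        (solve 3 (λ x p s → x :* (p :* s) := p :* (x :* s)) ≈-refl x (y ^ k) s)))

  T-^ : ∀ {x} k → x ∈ Xs → T k (x ^ k)
  T-^ zero    x∈ = T-1 0
  T-^ (suc k) x∈ = T-var k x∈ (T-^ k x∈)

  monomial⇒T : ∀ {Ys d r} → (∀ {y} → y ∈ Ys → y ∈ Xs) → Monomial Ys d r → T d r
  monomial⇒T Ys⊆ ([] eq) = resp (isT 0) (≈-sym eq) (T-1 0)
  monomial⇒T Ys⊆ (_^*_ {d = d} k m eq) = resp (isT (k ℕ.+ d)) (≈-sym eq)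
    (T-* k (T-^ k (Ys⊆ (here refl))) (monomial⇒T (Ys⊆ ∘ there) m))

  word⇒monomial : ∀ d {w} → w ∈ words d →
                  ∃[ c ] ∃[ s ] (c ∈ Cs × Monomial Xs d s × w ≈ c * s)
  word⇒monomial zero    {w} w∈ = w , 1# , w∈ , monomial-1 Xs , ≈-sym (*-identityʳ w)
  word⇒monomial (suc d) {w} w∈ =
    let x , w′ , x∈ , w′∈ , eq = ∈-cartesianProductWith⁻ _*_ Xs (words d) w∈
        c , s , c∈ , m , eq′ = word⇒monomial d w′∈
    in c , x * s , c∈ , monomial-* x∈ m , ≈-trans (reflexive eq) (≈-trans (*-congˡ eq′)
         (solve 3 (λ x c s → x :* (c :* s) := c :* (x :* s)) ≈-refl x c s))

  module _ (fourth-power : ∀ {x} → x ∈ Xs → Reducible 3 (x ^ 4)) where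

    monomial⇒reducible : ∀ {Ys m r d} → (∀ {y} → y ∈ Ys → y ∈ Xs) → Monomial Ys m r →
                         m ≡ suc d → 3 ℕ.* length Ys ≤ d → Reducible d r
    monomial⇒reducible Ys⊆ ([] _) () _
    monomial⇒reducible {y ∷ Ys} {d = d} Ys⊆ (_^*_ {d = e} {s = s} k m eq) k+e≡ 3l≤d
      with 4 ℕ.≤? k
    ... | yes (s≤s (s≤s (s≤s (s≤s {n = k′} _)))) = subst (λ n → Reducible n _)
          (trans (ℕ.+-comm (k′ ℕ.+ e) 3) (ℕ.suc-injective k+e≡))
          (resp (reducible-isSubmodule (k′ ℕ.+ e ℕ.+ 3))
            (≈-trans (solve 3 (λ a s b → a :* s :* b := b :* a :* s) ≈-refl (y ^ k′) s (y ^ 4))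
              (≈-trans (*-congʳ (≈-sym (^-homo-* y 4 k′))) (≈-sym eq)))
            (reducible-* (k′ ℕ.+ e) (T-* k′ (T-^ k′ (Ys⊆ (here refl))) (monomial⇒T (Ys⊆ ∘ there) m))
              (fourth-power (Ys⊆ (here refl)))))
    ... | no k≱4 = let e′ , e≡ , 3l≤e′ = predecessor small in subst (λ n → Reducible n _)
          (ℕ.suc-injective (trans (sym (ℕ.+-suc k e′)) (trans (cong (k ℕ.+_) (sym e≡)) k+e≡)))
          (resp (reducible-isSubmodule (k ℕ.+ e′)) (≈-sym eq)
            (reducible-* k (T-^ k (Ys⊆ (here refl)))
              (monomial⇒reducible (Ys⊆ ∘ there) m e≡ 3l≤e′)))
      where
      predecessor : ∀ {n e} → n ℕ.< e → ∃[ e′ ] (e ≡ suc e′ × n ≤ e′)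
      predecessor (s≤s {n = e′} n≤e′) = e′ , refl , n≤e′

      small : 3 ℕ.* length Ys ℕ.< e
      small = ℕ.+-cancelˡ-< 3 (3 ℕ.* length Ys) e (begin-strict
        3 ℕ.+ 3 ℕ.* length Ys  ≡⟨ ℕ.*-suc 3 (length Ys) ⟨
        3 ℕ.* suc (length Ys)  ≤⟨ 3l≤d ⟩
        d                      <⟨ ℕ.n<1+n d ⟩
        suc d                  ≡⟨ k+e≡ ⟨
        k ℕ.+ e                ≤⟨ ℕ.+-monoˡ-≤ e (ℕ.≤-pred (ℕ.≰⇒> k≱4)) ⟩
        3 ℕ.+ e                ∎)
        where open ℕ.≤-Reasoning

    degree : ℕ
    degree = 3 ℕ.* length Xs

    word-reducible : ∀ {w} → w ∈ words (suc degree) → Reducible degree w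
    word-reducible w∈ =
      let c , s , c∈ , m , eq = word⇒monomial (suc degree) w∈
      in resp (reducible-isSubmodule degree) (≈-sym eq)
           (reducible-* 0 (∈⇒Span c∈) (monomial⇒reducible id m refl ℕ.≤-refl))

    reducible⇒mod : ∀ d {r} → Reducible d r → T d mod doubles (words (suc d)) ∋ r
    reducible⇒mod d (reducible p∈ q∈ eq) = resp isM (≈-sym eq)
      (add isM
        (span-least (preimage-isSubmodule isM 2#) (words (suc d))
          (λ w∈ → ∈⇒mod (isT d) (∈-map⁺ (2# *_) w∈)) p∈)
        (⊆-mod (isT d) (doubles (words (suc d))) q∈))
      where
      isM : IsSubmodule (T d mod doubles (words (suc d)) ∋_)
      isM = mod-isSubmodule (isT d) (doubles (words (suc d)))

    basis : List A
    basis = words degree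

    1∈basis : Span basis 1#
    1∈basis = T-1 degree

    words-collapse : ∃[ k ] ∀ {w} → w ∈ words (suc degree) → T degree (fromℤ (odd k) * w)
    words-collapse = nakayama (isT degree) (words (suc degree)) (All.tabulate λ w∈ →
      + 0 , resp (mod-isSubmodule (isT degree) (doubles (words (suc degree)))) (≈-sym (*-identityˡ _))
        (reducible⇒mod degree (word-reducible w∈)))

    variable-stabilizes : ∀ {x} → x ∈ Xs → Stabilizes basis x
    variable-stabilizes x∈ = proj₁ words-collapse , λ w∈ →
      proj₂ words-collapse (∈-cartesianProductWith⁺ _*_ x∈ w∈)

    constant-stabilizes : ∀ {c} → Span Cs c → Stabilizes basis c
    constant-stabilizes c∈ = + 0 , λ w∈ →
      resp (isT degree) (≈-sym (*-identityˡ _)) (T-const degree c∈ (∈⇒Span w∈))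

    words-stabilize : ∀ d {w} → w ∈ words d → Stabilizes basis w
    words-stabilize zero    w∈ = constant-stabilizes (∈⇒Span w∈)
    words-stabilize (suc d) w∈ =
      let x , w′ , x∈ , w′∈ , eq = ∈-cartesianProductWith⁻ _*_ Xs (words d) w∈
      in resp (stabilizers-isSubmodule basis) (reflexive (sym eq))
           (stabilizes-* basis (variable-stabilizes x∈) (words-stabilize d w′∈))

    basis-stabilizes : ∀ {e} → e ∈ basis → Stabilizes basis e
    basis-stabilizes = words-stabilize degree

module Roots (R : CommutativeRing 0ℓ 0ℓ)
  (domain : ∀ x y → CommutativeRing._≈_ R (CommutativeRing._*_ R x y) (CommutativeRing.0# R) →
            CommutativeRing._≈_ R x (CommutativeRing.0# R) ⊎ CommutativeRing._≈_ R y (CommutativeRing.0# R))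
  (em : ExcludedMiddle 0ℓ) where
  open CommutativeRing R renaming (Carrier to A; refl to ≈-refl; sym to ≈-sym; trans to ≈-trans)
  open IntegerScalars R
  open RingProperties ring using (x∙y⁻¹≈ε⇒x≈y)
  open SetoidReasoning setoid
  open Solver using (solve; con; _:=_; _:+_; _:*_; _:-_)

  eval : List A → A → A
  eval cs z = foldr (λ c acc → c + z * acc) 0# cs

  quotient : List A → A → List A
  quotient []               c = []
  quotient (a ∷ [])         c = []
  quotient (a ∷ as@(_ ∷ _)) c = eval as c ∷ quotient as c

  length-quotient : ∀ a as c → length (quotient (a ∷ as) c) ≡ length as
  length-quotient a []        c = refl
  length-quotient a (b ∷ bs) c = cong suc (length-quotient b bs c)

  factor : ∀ as c z → eval as z ≈ (z - c) * eval (quotient as c) z + eval as c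
  factor []               c z = solve 2 (λ z c → con (+ 0) := (z :- c) :* con (+ 0) :+ con (+ 0)) ≈-refl z c
  factor (a ∷ [])         c z = solve 3 (λ a z c → a :+ z :* con (+ 0) := (z :- c) :* con (+ 0) :+ (a :+ c :* con (+ 0)))
                                  ≈-refl a z c
  factor (a ∷ as@(_ ∷ _)) c z = ≈-trans (+-congˡ (*-congˡ (factor as c z)))
    (solve 5 (λ a z c q p → a :+ z :* ((z :- c) :* q :+ p) := (z :- c) :* (p :+ z :* q) :+ (a :+ c :* p))
      ≈-refl a z c (eval (quotient as c) z) (eval as c))

  quotient-zero : ∀ as c → All (_≈ 0#) (quotient as c) → eval as c ≈ 0# → All (_≈ 0#) as
  quotient-zero []               c _         _  = []
  quotient-zero (a ∷ [])         c _         eq =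
    ≈-trans (solve 2 (λ a c → a := a :+ c :* con (+ 0)) ≈-refl a c) eq ∷ []
  quotient-zero (a ∷ as@(_ ∷ _)) c (p ∷ ps) eq =
    (begin
      a                 ≈⟨ solve 2 (λ a c → a := a :+ c :* con (+ 0)) ≈-refl a c ⟩
      a + c * 0#        ≈⟨ +-congˡ (*-congˡ p) ⟨
      a + c * eval as c ≈⟨ eq ⟩
      0#                ∎) ∷ quotient-zero as c ps p

  finitely-many-roots : ∀ as → ¬ All (_≈ 0#) as → ∃[ zs ] ∀ z → eval as z ≈ 0# → Any (z ≈_) zs
  finitely-many-roots as = roots-of (length as) as ℕ.≤-refl
    where
    roots-of : ∀ n as → length as ≤ n → ¬ All (_≈ 0#) as → ∃[ zs ] ∀ z → eval as z ≈ 0# → Any (z ≈_) zs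
    roots-of n       []       _        nz = contradiction [] nz
    roots-of (suc n) (a ∷ as) (s≤s l≤n) nz with em {∃[ c ] eval (a ∷ as) c ≈ 0#}
    ... | no  none     = [] , λ z root → contradiction (z , root) none
    ... | yes (c , pc) =
      let zs , complete = roots-of n (quotient (a ∷ as) c)
            (subst (_≤ n) (sym (length-quotient a as c)) l≤n)
            (λ q≈0 → nz (quotient-zero (a ∷ as) c q≈0 pc))
      in c ∷ zs , λ z pz →
        [ (λ z-c≈0 → here (x∙y⁻¹≈ε⇒x≈y z c z-c≈0)) , (λ q → there (complete z q)) ]′
          (domain (z - c) (eval (quotient (a ∷ as) c) z)
            (begin
              (z - c) * eval (quotient (a ∷ as) c) z                    ≈⟨ +-identityʳ _ ⟨
              (z - c) * eval (quotient (a ∷ as) c) z + 0#               ≈⟨ +-congˡ pc ⟨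
              (z - c) * eval (quotient (a ∷ as) c) z + eval (a ∷ as) c  ≈⟨ factor (a ∷ as) c z ⟨
              eval (a ∷ as) z                                           ≈⟨ pz ⟩
              0#                                                        ∎))

-- The exponential function

module Series (R : CommutativeRing 0ℓ 0ℓ) where
  open CommutativeRing R renaming (Carrier to A; refl to ≈-refl; sym to ≈-sym; trans to ≈-trans)
  open IntegerScalars R
  open Sum semiring using (sum)
  open SetoidReasoning setoid
  open Solver using (solve; con; _:=_; _:+_; _:*_; _:-_)

  ∑ : ℕ → (ℕ → A) → A
  ∑ zero    f = 0#
  ∑ (suc n) f = f 0 + ∑ n (f ∘ suc)

  sum≈∑ : ∀ n f → sum {n} (λ k → f (toℕ k)) ≈ ∑ n f
  sum≈∑ zero    f = ≈-refl
  sum≈∑ (suc n) f = +-congˡ (sum≈∑ n (f ∘ suc))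

  ∑-cong : ∀ n {f g} → (∀ k → k ℕ.< n → f k ≈ g k) → ∑ n f ≈ ∑ n g
  ∑-cong zero    f≈g = ≈-refl
  ∑-cong (suc n) f≈g = +-cong (f≈g 0 (s≤s z≤n)) (∑-cong n (λ k k<n → f≈g (suc k) (s≤s k<n)))

  ∑-last : ∀ n f → ∑ (suc n) f ≈ ∑ n f + f n
  ∑-last zero    f = +-comm _ _
  ∑-last (suc n) f = ≈-trans (+-congˡ (∑-last n (f ∘ suc))) (≈-sym (+-assoc _ _ _))

  ∑-split : ∀ m n f → ∑ (m ℕ.+ n) f ≈ ∑ m f + ∑ n (λ k → f (m ℕ.+ k))
  ∑-split zero    n f = ≈-sym (+-identityˡ _)
  ∑-split (suc m) n f = ≈-trans (+-congˡ (∑-split m n (f ∘ suc))) (≈-sym (+-assoc _ _ _))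

  ∑-+ : ∀ n f g → ∑ n (λ k → f k + g k) ≈ ∑ n f + ∑ n g
  ∑-+ zero    f g = ≈-sym (+-identityˡ 0#)
  ∑-+ (suc n) f g = ≈-trans (+-congˡ (∑-+ n (f ∘ suc) (g ∘ suc)))
    (solve 4 (λ a b c d → a :+ b :+ (c :+ d) := a :+ c :+ (b :+ d)) ≈-refl _ _ _ _)

  *-∑ : ∀ n c f → c * ∑ n f ≈ ∑ n (λ k → c * f k)
  *-∑ zero    c f = zeroʳ c
  *-∑ (suc n) c f = ≈-trans (distribˡ _ _ _) (+-congˡ (*-∑ n c (f ∘ suc)))

  convolution : (ℕ → A) → (ℕ → A) → ℕ → A
  convolution a b m = ∑ (suc m) (λ j → a j * b (m ℕ.∸ j))

  ∑-convolution : ∀ a b n → ∑ n (convolution a b) ≈ ∑ n (λ j → a j * ∑ (n ℕ.∸ j) b)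
  ∑-convolution a b zero    = ≈-refl
  ∑-convolution a b (suc n) = begin
    ∑ (suc n) (convolution a b)
      ≈⟨ ∑-last n (convolution a b) ⟩
    ∑ n (convolution a b) + convolution a b n
      ≈⟨ +-congʳ (∑-convolution a b n) ⟩
    ∑ n (λ j → a j * ∑ (n ℕ.∸ j) b) + convolution a b n
      ≈⟨ +-congʳ (≈-trans (≈-sym (+-identityʳ _)) (+-congˡ last≈0)) ⟩
    (∑ n (λ j → a j * ∑ (n ℕ.∸ j) b) + a n * ∑ (n ℕ.∸ n) b) + convolution a b n
      ≈⟨ +-congʳ (∑-last n (λ j → a j * ∑ (n ℕ.∸ j) b)) ⟨
    ∑ (suc n) (λ j → a j * ∑ (n ℕ.∸ j) b) + convolution a b n
      ≈⟨ ∑-+ (suc n) (λ j → a j * ∑ (n ℕ.∸ j) b) (λ j → a j * b (n ℕ.∸ j)) ⟨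
    ∑ (suc n) (λ j → a j * ∑ (n ℕ.∸ j) b + a j * b (n ℕ.∸ j))
      ≈⟨ ∑-cong (suc n) (λ { j (s≤s j≤n) → step j j≤n }) ⟩
    ∑ (suc n) (λ j → a j * ∑ (suc n ℕ.∸ j) b) ∎
    where
    last≈0 : 0# ≈ a n * ∑ (n ℕ.∸ n) b
    last≈0 = ≈-sym (≈-trans (*-congˡ (reflexive (cong (λ k → ∑ k b) (ℕ.n∸n≡0 n)))) (zeroʳ (a n)))

    step : ∀ j → j ≤ n → a j * ∑ (n ℕ.∸ j) b + a j * b (n ℕ.∸ j) ≈ a j * ∑ (suc n ℕ.∸ j) b
    step j j≤n = begin
      a j * ∑ (n ℕ.∸ j) b + a j * b (n ℕ.∸ j)  ≈⟨ distribˡ _ _ _ ⟨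
      a j * (∑ (n ℕ.∸ j) b + b (n ℕ.∸ j))      ≈⟨ *-congˡ (∑-last (n ℕ.∸ j) b) ⟨
      a j * ∑ (suc (n ℕ.∸ j)) b                ≡⟨ cong (λ k → a j * ∑ k b) (ℕ.+-∸-assoc 1 j≤n) ⟨
      a j * ∑ (suc n ℕ.∸ j) b                  ∎

  product-error : ∀ a b n → ∑ n a * ∑ n b - ∑ n (convolution a b)
                            ≈ ∑ n (λ j → a j * (∑ n b - ∑ (n ℕ.∸ j) b))
  product-error a b n = begin
    ∑ n a * ∑ n b - ∑ n (convolution a b)
      ≈⟨ +-cong (≈-trans (*-comm _ _) (*-∑ n (∑ n b) a)) (-‿cong (∑-convolution a b n)) ⟩
    ∑ n (λ j → ∑ n b * a j) - ∑ n (λ j → a j * ∑ (n ℕ.∸ j) b)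
      ≈⟨ +-congˡ (solve 1 (λ x → :- x := con (ℤ.- + 1) :* x) ≈-refl _) ⟩
    ∑ n (λ j → ∑ n b * a j) + fromℤ (ℤ.- + 1) * ∑ n (λ j → a j * ∑ (n ℕ.∸ j) b)
      ≈⟨ +-congˡ (*-∑ n (fromℤ (ℤ.- + 1)) (λ j → a j * ∑ (n ℕ.∸ j) b)) ⟩
    ∑ n (λ j → ∑ n b * a j) + ∑ n (λ j → fromℤ (ℤ.- + 1) * (a j * ∑ (n ℕ.∸ j) b))
      ≈⟨ ∑-+ n (λ j → ∑ n b * a j) (λ j → fromℤ (ℤ.- + 1) * (a j * ∑ (n ℕ.∸ j) b)) ⟨
    ∑ n (λ j → ∑ n b * a j + fromℤ (ℤ.- + 1) * (a j * ∑ (n ℕ.∸ j) b))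
      ≈⟨ ∑-cong n (λ j _ → solve 3 (λ s a t → s :* a :+ con (ℤ.- + 1) :* (a :* t) := a :* (s :- t))
           ≈-refl (∑ n b) (a j) (∑ (n ℕ.∸ j) b)) ⟩
    ∑ n (λ j → a j * (∑ n b - ∑ (n ℕ.∸ j) b)) ∎
    where open Solver using (:-_)

  -- The terms zᵏ/k! of the exponential series; inv k stands for 1/(k+1).
  module Exponential (inv : ℕ → A) (inv-inverse : ∀ k → fromℤ (+ suc k) * inv k ≈ 1#) where

    term : A → ℕ → A
    term z zero    = 1#
    term z (suc k) = z * inv k * term z k

    term-suc : ∀ z k → fromℤ (+ suc k) * term z (suc k) ≈ z * term z k
    term-suc z k = begin
      fromℤ (+ suc k) * (z * inv k * term z k)
        ≈⟨ solve 4 (λ n z i t → n :* (z :* i :* t) := (n :* i) :* (z :* t)) ≈-refl _ _ _ _ ⟩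
      (fromℤ (+ suc k) * inv k) * (z * term z k)
        ≈⟨ *-congʳ (inv-inverse k) ⟩
      1# * (z * term z k)
        ≈⟨ *-identityˡ _ ⟩
      z * term z k ∎

    binomial-step : ∀ z w m → fromℤ (+ suc m) * convolution (term z) (term w) (suc m)
                              ≈ (z + w) * convolution (term z) (term w) m
    binomial-step z w m = begin
      fromℤ (+ suc m) * ∑ (suc (suc m)) ab
        ≈⟨ *-∑ (suc (suc m)) (fromℤ (+ suc m)) ab ⟩
      ∑ (suc (suc m)) (λ j → fromℤ (+ suc m) * ab j)
        ≈⟨ ∑-cong (suc (suc m)) (λ { j (s≤s j≤) → weight j j≤ }) ⟩
      ∑ (suc (suc m)) (λ j → fromℤ (+ j) * ab j + fromℤ (+ (suc m ℕ.∸ j)) * ab j)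
        ≈⟨ ∑-+ (suc (suc m)) (λ j → fromℤ (+ j) * ab j) (λ j → fromℤ (+ (suc m ℕ.∸ j)) * ab j) ⟩
      ∑ (suc (suc m)) (λ j → fromℤ (+ j) * ab j) + ∑ (suc (suc m)) (λ j → fromℤ (+ (suc m ℕ.∸ j)) * ab j)
        ≈⟨ +-cong first second ⟩
      z * convolution a b m + w * convolution a b m
        ≈⟨ distribʳ _ _ _ ⟨
      (z + w) * convolution a b m ∎
      where
      a b : ℕ → A
      a = term z
      b = term w

      ab : ℕ → A
      ab j = a j * b (suc m ℕ.∸ j)

      weight : ∀ j → j ≤ suc m → fromℤ (+ suc m) * ab j ≈ fromℤ (+ j) * ab j + fromℤ (+ (suc m ℕ.∸ j)) * ab j
      weight j j≤ = begin
        fromℤ (+ suc m) * ab j                                    ≡⟨ cong (λ k → fromℤ (+ k) * ab j) (ℕ.m+[n∸m]≡n j≤) ⟨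
        fromℤ (+ j ℤ.+ + (suc m ℕ.∸ j)) * ab j                    ≈⟨ *-congʳ (fromℤ-+ (+ j) (+ (suc m ℕ.∸ j))) ⟩
        (fromℤ (+ j) + fromℤ (+ (suc m ℕ.∸ j))) * ab j            ≈⟨ distribʳ _ _ _ ⟩
        fromℤ (+ j) * ab j + fromℤ (+ (suc m ℕ.∸ j)) * ab j       ∎

      first : ∑ (suc (suc m)) (λ j → fromℤ (+ j) * ab j) ≈ z * convolution a b m
      first = begin
        0# * ab 0 + ∑ (suc m) (λ j → fromℤ (+ suc j) * ab (suc j))
          ≈⟨ ≈-trans (+-congʳ (zeroˡ _)) (+-identityˡ _) ⟩
        ∑ (suc m) (λ j → fromℤ (+ suc j) * ab (suc j))
          ≈⟨ ∑-cong (suc m) (λ j _ → ≈-trans (≈-sym (*-assoc _ _ _))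
               (≈-trans (*-congʳ (term-suc z j)) (*-assoc z (a j) (b (m ℕ.∸ j))))) ⟩
        ∑ (suc m) (λ j → z * (a j * b (m ℕ.∸ j)))
          ≈⟨ *-∑ (suc m) z (λ j → a j * b (m ℕ.∸ j)) ⟨
        z * convolution a b m ∎

      second : ∑ (suc (suc m)) (λ j → fromℤ (+ (suc m ℕ.∸ j)) * ab j) ≈ w * convolution a b m
      second = begin
        ∑ (suc (suc m)) (λ j → fromℤ (+ (suc m ℕ.∸ j)) * ab j)
          ≈⟨ ∑-last (suc m) (λ j → fromℤ (+ (suc m ℕ.∸ j)) * ab j) ⟩
        ∑ (suc m) (λ j → fromℤ (+ (suc m ℕ.∸ j)) * ab j) + fromℤ (+ (suc m ℕ.∸ suc m)) * ab (suc m)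
          ≈⟨ +-cong (∑-cong (suc m) (λ { j (s≤s j≤m) → shift j j≤m }))
               (≈-trans (*-congʳ (reflexive (cong (λ k → fromℤ (+ k)) (ℕ.n∸n≡0 m)))) (zeroˡ _)) ⟩
        ∑ (suc m) (λ j → w * (a j * b (m ℕ.∸ j))) + 0#
          ≈⟨ +-identityʳ _ ⟩
        ∑ (suc m) (λ j → w * (a j * b (m ℕ.∸ j)))
          ≈⟨ *-∑ (suc m) w (λ j → a j * b (m ℕ.∸ j)) ⟨
        w * convolution a b m ∎
        where
        shift : ∀ j → j ≤ m → fromℤ (+ (suc m ℕ.∸ j)) * ab j ≈ w * (a j * b (m ℕ.∸ j))
        shift j j≤m = begin
          fromℤ (+ (suc m ℕ.∸ j)) * (a j * b (suc m ℕ.∸ j))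
            ≡⟨ cong (λ k → fromℤ (+ k) * (a j * b k)) (ℕ.+-∸-assoc 1 j≤m) ⟩
          fromℤ (+ suc (m ℕ.∸ j)) * (a j * b (suc (m ℕ.∸ j)))
            ≈⟨ solve 3 (λ n a b → n :* (a :* b) := a :* (n :* b)) ≈-refl _ (a j) _ ⟩
          a j * (fromℤ (+ suc (m ℕ.∸ j)) * b (suc (m ℕ.∸ j)))
            ≈⟨ *-congˡ (term-suc w (m ℕ.∸ j)) ⟩
          a j * (w * b (m ℕ.∸ j))
            ≈⟨ solve 3 (λ a w b → a :* (w :* b) := w :* (a :* b)) ≈-refl (a j) w _ ⟩
          w * (a j * b (m ℕ.∸ j)) ∎

    term-+ : ∀ z w m → convolution (term z) (term w) m ≈ term (z + w) m
    term-+ z w zero    = ≈-trans (+-identityʳ _) (*-identityˡ 1#)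
    term-+ z w (suc m) = begin
      c (suc m)                                    ≈⟨ *-identityˡ _ ⟨
      1# * c (suc m)                               ≈⟨ *-congʳ (inv-inverse m) ⟨
      fromℤ (+ suc m) * inv m * c (suc m)          ≈⟨ solve 3 (λ n i c → n :* i :* c := i :* (n :* c)) ≈-refl _ _ _ ⟩
      inv m * (fromℤ (+ suc m) * c (suc m))        ≈⟨ *-congˡ (binomial-step z w m) ⟩
      inv m * ((z + w) * c m)                      ≈⟨ *-congˡ (*-congˡ (term-+ z w m)) ⟩
      inv m * ((z + w) * term (z + w) m)           ≈⟨ solve 3 (λ i s t → i :* (s :* t) := s :* i :* t) ≈-refl _ _ _ ⟩
      term (z + w) (suc m)                         ∎
      where
      c : ℕ → A
      c = convolution (term z) (term w)

module ℚS = ℚSolver.+-*-Solver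

inv : ℕ → ℚ
inv k = + 1 ℚ./ suc k

ℕ→ℚ : ℕ → ℚ
ℕ→ℚ n = ℤ→ℚ (+ n)

abstract
  private
    toℚᵘ-ℤ→ℚ : ∀ a → ℚ.toℚᵘ (ℤ→ℚ a) ℚᵘ.≃ ℚᵘ.mkℚᵘ a 0
    toℚᵘ-ℤ→ℚ a = ℚ.toℚᵘ-fromℚᵘ (ℚᵘ.mkℚᵘ a 0)

  ℤ→ℚ-+ : ∀ a b → ℤ→ℚ (a ℤ.+ b) ≡ ℤ→ℚ a ℚ.+ ℤ→ℚ b
  ℤ→ℚ-+ a b = ℚ.toℚᵘ-injective (begin
    ℚ.toℚᵘ (ℤ→ℚ (a ℤ.+ b))                  ≈⟨ toℚᵘ-ℤ→ℚ (a ℤ.+ b) ⟩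
    ℚᵘ.mkℚᵘ (a ℤ.+ b) 0                     ≡⟨ cong₂ (λ x y → ℚᵘ.mkℚᵘ (x ℤ.+ y) 0) (ℤ.*-identityʳ a) (ℤ.*-identityʳ b) ⟨
    ℚᵘ.mkℚᵘ a 0 ℚᵘ.+ ℚᵘ.mkℚᵘ b 0            ≈⟨ ℚᵘ.+-cong (toℚᵘ-ℤ→ℚ a) (toℚᵘ-ℤ→ℚ b) ⟨
    ℚ.toℚᵘ (ℤ→ℚ a) ℚᵘ.+ ℚ.toℚᵘ (ℤ→ℚ b)      ≈⟨ ℚ.toℚᵘ-homo-+ (ℤ→ℚ a) (ℤ→ℚ b) ⟨
    ℚ.toℚᵘ (ℤ→ℚ a ℚ.+ ℤ→ℚ b)                ∎)
    where open ℚᵘ.≃-Reasoning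

  ℤ→ℚ-* : ∀ a b → ℤ→ℚ (a ℤ.* b) ≡ ℤ→ℚ a ℚ.* ℤ→ℚ b
  ℤ→ℚ-* a b = ℚ.toℚᵘ-injective (begin
    ℚ.toℚᵘ (ℤ→ℚ (a ℤ.* b))                  ≈⟨ toℚᵘ-ℤ→ℚ (a ℤ.* b) ⟩
    ℚᵘ.mkℚᵘ a 0 ℚᵘ.* ℚᵘ.mkℚᵘ b 0            ≈⟨ ℚᵘ.*-cong (toℚᵘ-ℤ→ℚ a) (toℚᵘ-ℤ→ℚ b) ⟨
    ℚ.toℚᵘ (ℤ→ℚ a) ℚᵘ.* ℚ.toℚᵘ (ℤ→ℚ b)      ≈⟨ ℚ.toℚᵘ-homo-* (ℤ→ℚ a) (ℤ→ℚ b) ⟨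
    ℚ.toℚᵘ (ℤ→ℚ a ℚ.* ℤ→ℚ b)                ∎)
    where open ℚᵘ.≃-Reasoning

  ℤ→ℚ-neg : ∀ a → ℤ→ℚ (ℤ.- a) ≡ ℚ.- ℤ→ℚ a
  ℤ→ℚ-neg a = ℚ.toℚᵘ-injective (begin
    ℚ.toℚᵘ (ℤ→ℚ (ℤ.- a))    ≈⟨ toℚᵘ-ℤ→ℚ (ℤ.- a) ⟩
    ℚᵘ.- ℚᵘ.mkℚᵘ a 0        ≈⟨ ℚᵘ.-‿cong (toℚᵘ-ℤ→ℚ a) ⟨
    ℚᵘ.- ℚ.toℚᵘ (ℤ→ℚ a)     ≈⟨ ℚ.toℚᵘ-homo‿- (ℤ→ℚ a) ⟨
    ℚ.toℚᵘ (ℚ.- ℤ→ℚ a)      ∎)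
    where open ℚᵘ.≃-Reasoning

  ℤ→ℚ-injective : ∀ a b → ℤ→ℚ a ≡ ℤ→ℚ b → a ≡ b
  ℤ→ℚ-injective a b eq with ℚᵘ.≃-trans (ℚᵘ.≃-sym (toℚᵘ-ℤ→ℚ a)) (ℚᵘ.≃-trans (ℚᵘ.≃-reflexive (cong ℚ.toℚᵘ eq)) (toℚᵘ-ℤ→ℚ b))
  ... | ℚᵘ.*≡* a1≡b1 = trans (sym (ℤ.*-identityʳ a)) (trans a1≡b1 (ℤ.*-identityʳ b))

  ℤ→ℚ-mono : ∀ {a b} → a ℤ.≤ b → ℤ→ℚ a ℚ.≤ ℤ→ℚ b
  ℤ→ℚ-mono {a} {b} a≤b = ℚ.toℚᵘ-cancel-≤ (ℚᵘ.≤-respˡ-≃ (ℚᵘ.≃-sym (toℚᵘ-ℤ→ℚ a))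
    (ℚᵘ.≤-respʳ-≃ (ℚᵘ.≃-sym (toℚᵘ-ℤ→ℚ b)) (ℚᵘ.*≤* (ℤ.*-monoʳ-≤-nonNeg (+ 1) a≤b))))

  inv-inverse : ∀ k → ℕ→ℚ (suc k) ℚ.* inv k ≡ 1ℚ
  inv-inverse k = ℚ.toℚᵘ-injective (begin
    ℚ.toℚᵘ (ℕ→ℚ (suc k) ℚ.* inv k)               ≈⟨ ℚ.toℚᵘ-homo-* (ℕ→ℚ (suc k)) (inv k) ⟩
    ℚ.toℚᵘ (ℕ→ℚ (suc k)) ℚᵘ.* ℚ.toℚᵘ (inv k)     ≈⟨ ℚᵘ.*-cong (toℚᵘ-ℤ→ℚ (+ suc k)) (ℚ.toℚᵘ-fromℚᵘ (ℚᵘ.mkℚᵘ (+ 1) k)) ⟩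
    ℚᵘ.mkℚᵘ (+ suc k) 0 ℚᵘ.* ℚᵘ.mkℚᵘ (+ 1) k     ≈⟨ ℚᵘ.*≡* (cong +_ (cong suc (trans (ℕ.*-identityʳ _) (trans (ℕ.*-identityʳ k) (sym (trans (ℕ.+-identityʳ _) (ℕ.+-identityʳ k))))))) ⟩
    ℚᵘ.1ℚᵘ                                       ∎)
    where open ℚᵘ.≃-Reasoning

  0≤ℕ→ℚ : ∀ n → 0ℚ ℚ.≤ ℕ→ℚ n
  0≤ℕ→ℚ n = ℤ→ℚ-mono {+ 0} {+ n} (ℤ.+≤+ z≤n)

  *-mono-≤ : ∀ {p q r s} → 0ℚ ℚ.≤ p → 0ℚ ℚ.≤ s → p ℚ.≤ q → r ℚ.≤ s → p ℚ.* r ℚ.≤ q ℚ.* s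
  *-mono-≤ {p} {q} {r} {s} 0≤p 0≤s p≤q r≤s = ℚ.≤-trans
    (ℚ.*-monoˡ-≤-nonNeg p {{ℚ.nonNegative 0≤p}} r≤s)
    (ℚ.*-monoʳ-≤-nonNeg s {{ℚ.nonNegative 0≤s}} p≤q)

  0≤* : ∀ {p q} → 0ℚ ℚ.≤ p → 0ℚ ℚ.≤ q → 0ℚ ℚ.≤ p ℚ.* q
  0≤* {p} {q} 0≤p 0≤q = subst (ℚ._≤ p ℚ.* q) (ℚ.*-zeroˡ 0ℚ) (*-mono-≤ ℚ.≤-refl 0≤q 0≤p 0≤q)

  0≤+ : ∀ {p q} → 0ℚ ℚ.≤ p → 0ℚ ℚ.≤ q → 0ℚ ℚ.≤ p ℚ.+ q
  0≤+ {p} {q} 0≤p 0≤q = subst (ℚ._≤ p ℚ.+ q) (ℚ.+-identityˡ 0ℚ) (ℚ.+-mono-≤ 0≤p 0≤q)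

  0<inv : ∀ k → 0ℚ ℚ.< inv k
  0<inv k = ℚ.*-cancelˡ-<-nonNeg (ℕ→ℚ (suc k)) {{ℚ.nonNegative (0≤ℕ→ℚ (suc k))}}
    (ℚ.≤-<-trans (ℚ.≤-reflexive (ℚ.*-zeroʳ (ℕ→ℚ (suc k))))
      (ℚ.<-≤-trans (ℚ.positive⁻¹ 1ℚ) (ℚ.≤-reflexive (sym (inv-inverse k)))))

  archimedean : ∀ q ε → 0ℚ ℚ.< ε → ∃[ n ] q ℚ.≤ ℕ→ℚ n ℚ.* ε
  archimedean q ε 0<ε = ℤ.∣ ℚ.↥ q ∣ ℕ.* ℚ.↧ₙ ε , (begin
    q                                             ≤⟨ ≤∣↥∣ q ⟩
    ℕ→ℚ ℤ.∣ ℚ.↥ q ∣                               ≡⟨ ℚ.*-identityʳ _ ⟨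
    ℕ→ℚ ℤ.∣ ℚ.↥ q ∣ ℚ.* 1ℚ                        ≤⟨ ℚ.*-monoˡ-≤-nonNeg (ℕ→ℚ ℤ.∣ ℚ.↥ q ∣) {{ℚ.nonNegative (0≤ℕ→ℚ ℤ.∣ ℚ.↥ q ∣)}} (1≤↧* ε 0<ε) ⟩
    ℕ→ℚ ℤ.∣ ℚ.↥ q ∣ ℚ.* (ℕ→ℚ (ℚ.↧ₙ ε) ℚ.* ε)      ≡⟨ ℚ.*-assoc (ℕ→ℚ ℤ.∣ ℚ.↥ q ∣) (ℕ→ℚ (ℚ.↧ₙ ε)) ε ⟨
    ℕ→ℚ ℤ.∣ ℚ.↥ q ∣ ℚ.* ℕ→ℚ (ℚ.↧ₙ ε) ℚ.* ε        ≡⟨ cong (ℚ._* ε) (trans (cong ℤ→ℚ (ℤ.pos-* ℤ.∣ ℚ.↥ q ∣ (ℚ.↧ₙ ε))) (ℤ→ℚ-* (+ ℤ.∣ ℚ.↥ q ∣) (ℚ.↧ ε))) ⟨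
    ℕ→ℚ (ℤ.∣ ℚ.↥ q ∣ ℕ.* ℚ.↧ₙ ε) ℚ.* ε            ∎)
    where
    open ℚ.≤-Reasoning

    i≤∣i∣ : ∀ i → i ℤ.≤ + ℤ.∣ i ∣
    i≤∣i∣ (+ n)    = ℤ.≤-refl
    i≤∣i∣ -[1+ n ] = ℤ.-≤+

    ≤∣↥∣ : ∀ q → q ℚ.≤ ℕ→ℚ ℤ.∣ ℚ.↥ q ∣
    ≤∣↥∣ (ℚ.mkℚ n d _) = ℚ.toℚᵘ-cancel-≤ (ℚᵘ.≤-respʳ-≃ (ℚᵘ.≃-sym (toℚᵘ-ℤ→ℚ (+ ℤ.∣ n ∣)))
      (ℚᵘ.*≤* (ℤ.≤-trans (ℤ.≤-reflexive (ℤ.*-identityʳ n))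
        (ℤ.≤-trans (i≤∣i∣ n) (ℤ.≤-trans (ℤ.≤-reflexive (sym (ℤ.*-identityʳ _)))
          (ℤ.*-monoˡ-≤-nonNeg (+ ℤ.∣ n ∣) {+ 1} {+ suc d} (ℤ.+≤+ (s≤s z≤n))))))))

    1≤↧* : ∀ ε → 0ℚ ℚ.< ε → 1ℚ ℚ.≤ ℕ→ℚ (ℚ.↧ₙ ε) ℚ.* ε
    1≤↧* ε@(ℚ.mkℚ n d _) 0<ε = ℚ.toℚᵘ-cancel-≤ (ℚᵘ.≤-respʳ-≃ (ℚᵘ.≃-sym (ℚᵘ.≃-trans (ℚ.toℚᵘ-homo-* (ℕ→ℚ (suc d)) ε)
        (ℚᵘ.*-congʳ {ℚᵘ.mkℚᵘ n d} (toℚᵘ-ℤ→ℚ (+ suc d)))))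
      (ℚᵘ.*≤* (ℤ.≤-trans
        (ℤ.≤-reflexive (trans (ℤ.*-identityˡ _) (trans (cong (λ k → + suc k) (ℕ.+-identityʳ d)) (sym (ℤ.*-identityʳ _)))))
        (ℤ.≤-trans (ℤ.*-monoˡ-≤-nonNeg (+ suc d) {+ 1} {n} (0<⇒1≤ n (ℚ.positive 0<ε)))
          (ℤ.≤-reflexive (sym (ℤ.*-identityʳ _)))))))
      where
      0<⇒1≤ : ∀ i → ℤ.Positive i → + 1 ℤ.≤ i
      0<⇒1≤ ℤ.+[1+ k ] _ = ℤ.+≤+ (s≤s z≤n)

  inv-small : ∀ ε → 0ℚ ℚ.< ε → ∃[ k ] ∀ n → k ≤ n → inv n ℚ.≤ ε
  inv-small ε 0<ε = let k , 1≤ = archimedean 1ℚ ε 0<ε in k , λ n k≤n →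
    ℚ.≤-trans (ℚ.≤-reflexive (sym (ℚ.*-identityˡ (inv n)))) (ℚ.≤-trans
      (ℚ.*-monoʳ-≤-nonNeg (inv n) {{ℚ.nonNegative (ℚ.<⇒≤ (0<inv n))}} (ℚ.≤-trans 1≤
        (ℚ.*-monoʳ-≤-nonNeg ε {{ℚ.nonNegative (ℚ.<⇒≤ 0<ε)}} (ℤ→ℚ-mono {+ k} {+ suc n} (ℤ.+≤+ (ℕ.m≤n⇒m≤1+n k≤n))))))
      (ℚ.≤-reflexive (begin
        ℕ→ℚ (suc n) ℚ.* ε ℚ.* inv n       ≡⟨ ℚ.*-assoc (ℕ→ℚ (suc n)) ε (inv n) ⟩
        ℕ→ℚ (suc n) ℚ.* (ε ℚ.* inv n)     ≡⟨ cong (ℕ→ℚ (suc n) ℚ.*_) (ℚ.*-comm ε (inv n)) ⟩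
        ℕ→ℚ (suc n) ℚ.* (inv n ℚ.* ε)     ≡⟨ ℚ.*-assoc (ℕ→ℚ (suc n)) (inv n) ε ⟨
        ℕ→ℚ (suc n) ℚ.* inv n ℚ.* ε       ≡⟨ cong (ℚ._* ε) (inv-inverse n) ⟩
        1ℚ ℚ.* ε                          ≡⟨ ℚ.*-identityˡ ε ⟩
        ε                                 ∎)))
    where open ≡.≡-Reasoning

module ℂI = IntegerScalars ℂ-commutativeRing

infix 4 _≼_

‖_‖ : ℂ → ℕ → ℚ
‖ z ‖ n = ℚ.∣ seq (Re z) n ∣ ℚ.+ ℚ.∣ seq (Im z) n ∣

record _≼_ (z : ℂ) (q : ℚ) : Set where
  constructor mk≼
  field
    eventually : ∃[ k ] ∀ n → k ≤ n → ‖ z ‖ n ℚ.≤ q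

open _≼_

abstract
  0<1 : 0ℚ ℚ.< 1ℚ
  0<1 = ℚ.positive⁻¹ 1ℚ

  0≤‖‖ : ∀ z n → 0ℚ ℚ.≤ ‖ z ‖ n
  0≤‖‖ z n = 0≤+ (ℚ.0≤∣p∣ (seq (Re z) n)) (ℚ.0≤∣p∣ (seq (Im z) n))

  ‖+‖ : ∀ z w n → ‖ z +ℂ w ‖ n ℚ.≤ ‖ z ‖ n ℚ.+ ‖ w ‖ n
  ‖+‖ z w n = ℚ.≤-trans (ℚ.+-mono-≤ (ℚ.∣p+q∣≤∣p∣+∣q∣ (seq (Re z) n) (seq (Re w) n)) (ℚ.∣p+q∣≤∣p∣+∣q∣ (seq (Im z) n) (seq (Im w) n)))
    (ℚ.≤-reflexive (ℚS.solve 4 (λ a b c d → (a ℚS.:+ c) ℚS.:+ (b ℚS.:+ d) ℚS.:= (a ℚS.:+ b) ℚS.:+ (c ℚS.:+ d)) refl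
      ℚ.∣ seq (Re z) n ∣ ℚ.∣ seq (Im z) n ∣ ℚ.∣ seq (Re w) n ∣ ℚ.∣ seq (Im w) n ∣))

  ‖*‖ : ∀ z w n → ‖ z *ℂ w ‖ n ℚ.≤ ‖ z ‖ n ℚ.* ‖ w ‖ n
  ‖*‖ z w n = ℚ.≤-trans
    (ℚ.+-mono-≤
      (ℚ.≤-trans (ℚ.∣p-q∣≤∣p∣+∣q∣ (a ℚ.* c) (b ℚ.* d)) (ℚ.≤-reflexive (cong₂ ℚ._+_ (ℚ.∣p*q∣≡∣p∣*∣q∣ a c) (ℚ.∣p*q∣≡∣p∣*∣q∣ b d))))
      (ℚ.≤-trans (ℚ.∣p+q∣≤∣p∣+∣q∣ (a ℚ.* d) (b ℚ.* c)) (ℚ.≤-reflexive (cong₂ ℚ._+_ (ℚ.∣p*q∣≡∣p∣*∣q∣ a d) (ℚ.∣p*q∣≡∣p∣*∣q∣ b c)))))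
    (ℚ.≤-reflexive (ℚS.solve 4 (λ a b c d → (a ℚS.:* c ℚS.:+ b ℚS.:* d) ℚS.:+ (a ℚS.:* d ℚS.:+ b ℚS.:* c)
        ℚS.:= (a ℚS.:+ b) ℚS.:* (c ℚS.:+ d)) refl ℚ.∣ a ∣ ℚ.∣ b ∣ ℚ.∣ c ∣ ℚ.∣ d ∣))
    where
    a b c d : ℚ
    a = seq (Re z) n
    b = seq (Im z) n
    c = seq (Re w) n
    d = seq (Im w) n

  ‖-‖ : ∀ z n → ‖ -ℂ z ‖ n ≡ ‖ z ‖ n
  ‖-‖ z n = cong₂ ℚ._+_ (ℚ.∣-p∣≡∣p∣ (seq (Re z) n)) (ℚ.∣-p∣≡∣p∣ (seq (Im z) n))

  ≼-+ : ∀ {z w p q} → z ≼ p → w ≼ q → z +ℂ w ≼ p ℚ.+ q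
  ≼-+ {z} {w} (mk≼ (k , f)) (mk≼ (l , g)) = mk≼ (k ⊔ l , λ n kl≤n → ℚ.≤-trans (‖+‖ z w n)
    (ℚ.+-mono-≤ (f n (ℕ.m⊔n≤o⇒m≤o k l kl≤n)) (g n (ℕ.m⊔n≤o⇒n≤o k l kl≤n))))

  ≼-* : ∀ {z w p q} → z ≼ p → w ≼ q → z *ℂ w ≼ p ℚ.* q
  ≼-* {z} {w} (mk≼ (k , f)) (mk≼ (l , g)) = mk≼ (k ⊔ l , λ n kl≤n → ℚ.≤-trans (‖*‖ z w n)
    (*-mono-≤ (0≤‖‖ z n) (ℚ.≤-trans (0≤‖‖ w n) (g n (ℕ.m⊔n≤o⇒n≤o k l kl≤n)))
      (f n (ℕ.m⊔n≤o⇒m≤o k l kl≤n)) (g n (ℕ.m⊔n≤o⇒n≤o k l kl≤n))))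

  ≼-neg : ∀ {z p} → z ≼ p → -ℂ z ≼ p
  ≼-neg {z} {p} (mk≼ (k , f)) = mk≼ (k , λ n k≤n → subst (ℚ._≤ p) (sym (‖-‖ z n)) (f n k≤n))

  ≼-weaken : ∀ {z p q} → z ≼ p → p ℚ.≤ q → z ≼ q
  ≼-weaken (mk≼ (k , f)) p≤q = mk≼ (k , λ n k≤n → ℚ.≤-trans (f n k≤n) p≤q)

  ≼-ℚ : ∀ {p} → 0ℚ ℚ.≤ p → ℚ→ℂ p ≼ p
  ≼-ℚ {p} 0≤p = mk≼ (0 , λ _ _ → ℚ.≤-reflexive (trans (ℚ.+-identityʳ ℚ.∣ p ∣) (ℚ.0≤p⇒∣p∣≡p 0≤p)))

  ≼⇒0≤ : ∀ {z p} → z ≼ p → 0ℚ ℚ.≤ p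
  ≼⇒0≤ {z} (mk≼ (k , f)) = ℚ.≤-trans (0≤‖‖ z k) (f k ℕ.≤-refl)

  ≼-exists : ∀ z → ∃[ p ] z ≼ p
  ≼-exists z =
    let B , _ , k , f = bounded (seq (Re z)) (cauchy (Re z))
        C , _ , l , g = bounded (seq (Im z)) (cauchy (Im z))
    in B ℚ.+ C , mk≼ (k ⊔ l , λ n kl≤n →
         ℚ.+-mono-≤ (f n (ℕ.m⊔n≤o⇒m≤o k l kl≤n)) (g n (ℕ.m⊔n≤o⇒n≤o k l kl≤n)))

  halve : ∀ ε → ½ ℚ.* ε ℚ.+ ½ ℚ.* ε ≡ ε
  halve = ℚS.solve 1 (λ ε → ℚS.con ½ ℚS.:* ε ℚS.:+ ℚS.con ½ ℚS.:* ε ℚS.:= ε) refl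

  ½<1 : ∀ ε → 0ℚ ℚ.< ε → ½ ℚ.* ε ℚ.< ε
  ½<1 ε 0<ε = subst (½ ℚ.* ε ℚ.<_) (halve ε) (subst (ℚ._< ½ ℚ.* ε ℚ.+ ½ ℚ.* ε) (ℚ.+-identityʳ (½ ℚ.* ε))
    (ℚ.+-monoʳ-< (½ ℚ.* ε) (0<½* ε 0<ε)))

  ≈⇒≼ : ∀ {z w} → z ≈ℂ w → ∀ ε → 0ℚ ℚ.< ε → z +ℂ -ℂ w ≼ ε
  ≈⇒≼ (p , q) ε 0<ε =
    let k , f = close p (½ ℚ.* ε) (0<½* ε 0<ε)
        l , g = close q (½ ℚ.* ε) (0<½* ε 0<ε)
    in mk≼ (k ⊔ l , λ n kl≤n → subst (_ ℚ.≤_) (halve ε) (ℚ.+-mono-≤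
         (ℚ.<⇒≤ (f n n (ℕ.m⊔n≤o⇒m≤o k l kl≤n) (ℕ.m⊔n≤o⇒m≤o k l kl≤n)))
         (ℚ.<⇒≤ (g n n (ℕ.m⊔n≤o⇒n≤o k l kl≤n) (ℕ.m⊔n≤o⇒n≤o k l kl≤n)))))

  diagonal⇒≈ℝ : ∀ x y → (∀ ε → 0ℚ ℚ.< ε → ∃[ k ] ∀ n → k ≤ n → ℚ.∣ seq x n ℚ.- seq y n ∣ ℚ.≤ ε) → x ≈ℝ y
  diagonal⇒≈ℝ x y h = mk≈ λ ε 0<ε →
    let k , f = cauchy x (½ ℚ.* ε) (0<½* ε 0<ε)
        l , g = h (½ ℚ.* (½ ℚ.* ε)) (0<½* (½ ℚ.* ε) (0<½* ε 0<ε))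
    in k ⊔ l , λ m n ≤m ≤n →
      triangle-½ (seq x m ℚ.- seq x n) (seq x n ℚ.- seq y n) (seq x m ℚ.- seq y n) ε
        (sub-sub (seq x m) (seq x n) (seq y n))
        (f m n (ℕ.m⊔n≤o⇒m≤o k l ≤m) (ℕ.m⊔n≤o⇒m≤o k l ≤n))
        (ℚ.≤-<-trans (g n (ℕ.m⊔n≤o⇒n≤o k l ≤n)) (½<1 (½ ℚ.* ε) (0<½* ε 0<ε)))

  ≤+ˡ : ∀ {p q} → 0ℚ ℚ.≤ q → p ℚ.≤ p ℚ.+ q
  ≤+ˡ {p} 0≤q = ℚ.≤-trans (ℚ.≤-reflexive (sym (ℚ.+-identityʳ p))) (ℚ.+-monoʳ-≤ p 0≤q)

  ≤+ʳ : ∀ {p q} → 0ℚ ℚ.≤ q → p ℚ.≤ q ℚ.+ p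
  ≤+ʳ {p} 0≤q = ℚ.≤-trans (ℚ.≤-reflexive (sym (ℚ.+-identityˡ p))) (ℚ.+-monoˡ-≤ p 0≤q)

  ≼⇒≈ : ∀ z w → (∀ ε → 0ℚ ℚ.< ε → z +ℂ -ℂ w ≼ ε) → z ≈ℂ w
  ≼⇒≈ z w h =
      diagonal⇒≈ℝ (Re z) (Re w) (λ ε 0<ε → let k , f = eventually (h ε 0<ε) in
        k , λ n k≤n → ℚ.≤-trans (≤+ˡ (ℚ.0≤∣p∣ (seq (Im z) n ℚ.- seq (Im w) n))) (f n k≤n))
    , diagonal⇒≈ℝ (Im z) (Im w) (λ ε 0<ε → let k , f = eventually (h ε 0<ε) in
        k , λ n k≤n → ℚ.≤-trans (≤+ʳ (ℚ.0≤∣p∣ (seq (Re z) n ℚ.- seq (Re w) n))) (f n k≤n))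

  ≼-resp : ∀ {z w p} → z ≈ℂ w → z ≼ p → ∀ ε → 0ℚ ℚ.< ε → w ≼ p ℚ.+ ε
  ≼-resp {z} {w} z≈w z≼p ε 0<ε =
    let k , f = eventually (≼-+ z≼p (≈⇒≼ (ℂ-Ring.sym z≈w) ε 0<ε))
    in mk≼ (k , λ n k≤n → subst₂-≤ n (f n k≤n))
    where
    cancel : ∀ a b → a ℚ.+ (b ℚ.- a) ≡ b
    cancel = ℚS.solve 2 (λ a b → a ℚS.:+ (b ℚS.:- a) ℚS.:= b) refl

    subst₂-≤ : ∀ n {q} → ‖ z +ℂ (w +ℂ -ℂ z) ‖ n ℚ.≤ q → ‖ w ‖ n ℚ.≤ q
    subst₂-≤ n {q} = subst (ℚ._≤ q) (cong₂ (λ a b → ℚ.∣ a ∣ ℚ.+ ℚ.∣ b ∣)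
      (cancel (seq (Re z) n) (seq (Re w) n)) (cancel (seq (Im z) n) (seq (Im w) n)))

-- Every bound may be relaxed by an arbitrarily small amount, so ≼ respects ≈ℂ up to a factor 2.
≼-resp-½ : ∀ {z w} ε → 0ℚ ℚ.< ε → z ≈ℂ w → z ≼ ½ ℚ.* ε → w ≼ ε
≼-resp-½ {z} {w} ε 0<ε z≈w z≼ = subst (w ≼_) (halve ε) (≼-resp z≈w z≼ (½ ℚ.* ε) (0<½* ε 0<ε))

Null : (ℕ → ℂ) → Set
Null s = ∀ ε → 0ℚ ℚ.< ε → ∃[ k ] ∀ n → k ≤ n → s n ≼ ε

Tends : (ℕ → ℂ) → ℂ → Set
Tends s w = Null (λ n → s n +ℂ -ℂ w)

null-≈ : ∀ {s t} → (∀ n → s n ≈ℂ t n) → Null s → Null t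
null-≈ s≈t h ε 0<ε = let k , f = h (½ ℚ.* ε) (0<½* ε 0<ε) in
  k , λ n k≤n → ≼-resp-½ ε 0<ε (s≈t n) (f n k≤n)

null-+ : ∀ {s t} → Null s → Null t → Null (λ n → s n +ℂ t n)
null-+ {s} {t} g h ε 0<ε =
  let k , f = g (½ ℚ.* ε) (0<½* ε 0<ε)
      l , f′ = h (½ ℚ.* ε) (0<½* ε 0<ε)
  in k ⊔ l , λ n ≤n → subst (s n +ℂ t n ≼_) (halve ε)
       (≼-+ {s n} {t n} (f n (ℕ.m⊔n≤o⇒m≤o k l ≤n)) (f′ n (ℕ.m⊔n≤o⇒n≤o k l ≤n)))

null-neg : ∀ {s} → Null s → Null (λ n → -ℂ s n)
null-neg {s} h ε 0<ε = let k , f = h ε 0<ε in k , λ n k≤n → ≼-neg {s n} (f n k≤n)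

null-* : ∀ {s t : ℕ → ℂ} p → (∃[ k ] ∀ n → k ≤ n → s n ≼ p) → Null t → Null (λ n → s n *ℂ t n)
null-* {s} {t} p (k , f) h ε 0<ε =
  let 0≤p = ≼⇒0≤ (f k ℕ.≤-refl)
      0<p+1 = ℚ.+-mono-≤-< 0≤p 0<1
      δ , 0<δ , eq = divide (p ℚ.+ 1ℚ) ε 0<p+1 0<ε
      l , g = h δ 0<δ
  in k ⊔ l , λ n ≤n → subst (s n *ℂ t n ≼_) eq
       (≼-* {s n} {t n} (≼-weaken {s n} (f n (ℕ.m⊔n≤o⇒m≤o k l ≤n)) (≤+ˡ (ℚ.<⇒≤ 0<1))) (g n (ℕ.m⊔n≤o⇒n≤o k l ≤n)))

tends-unique : ∀ {s v w} → Tends s v → Tends s w → v ≈ℂ w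
tends-unique {s} {v} {w} h g = ≼⇒≈ v w λ ε 0<ε →
  let k , f = null-≈ (λ n → rearrange (s n) v w) (null-+ g (null-neg h)) ε 0<ε
  in f k ℕ.≤-refl
  where
  open ℂI.Solver
  rearrange : ∀ s v w → (s +ℂ -ℂ w) +ℂ -ℂ (s +ℂ -ℂ v) ≈ℂ v +ℂ -ℂ w
  rearrange = solve 3 (λ s v w → (s :- w) :- (s :- v) := v :- w) ℂ-Ring.refl

tends-≈ : ∀ {s t v} → (∀ n → s n ≈ℂ t n) → Tends s v → Tends t v
tends-≈ s≈t = null-≈ (λ n → ℂ-Ring.+-congʳ (s≈t n))

tends-difference : ∀ {s t v} → Null (λ n → s n +ℂ -ℂ t n) → Tends s v → Tends t v
tends-difference {s} {t} {v} h g = null-≈ (λ n → rearrange (s n) (t n) v) (null-+ g (null-neg h))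
  where
  open ℂI.Solver
  rearrange : ∀ s t v → (s +ℂ -ℂ v) +ℂ -ℂ (s +ℂ -ℂ t) ≈ℂ t +ℂ -ℂ v
  rearrange = solve 3 (λ s t v → (s :- v) :- (s :- t) := t :- v) ℂ-Ring.refl

tends-bounded : ∀ {s : ℕ → ℂ} {v} → Tends s v → ∃[ p ] ∃[ k ] ∀ n → k ≤ n → s n ≼ p
tends-bounded {s} {v} h =
  let p , v≼p = ≼-exists v
      k , f = h 1ℚ (0<1)
  in (p ℚ.+ 1ℚ) ℚ.+ 1ℚ , k , λ n k≤n →
       ≼-resp (rearrange (s n) v) (≼-+ v≼p (f n k≤n)) 1ℚ (0<1)
  where
  open ℂI.Solver
  rearrange : ∀ s v → v +ℂ (s +ℂ -ℂ v) ≈ℂ s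
  rearrange = solve 2 (λ s v → v :+ (s :- v) := s) ℂ-Ring.refl

tends-* : ∀ {s t v w} → Tends s v → Tends t w → Tends (λ n → s n *ℂ t n) (v *ℂ w)
tends-* {s} {t} {v} {w} g h =
  let p , k , f = tends-bounded {s} {v} g
      q , w≼q = ≼-exists w
  in null-≈ (λ n → rearrange (s n) (t n) v w)
       (null-+ (null-* {s} {λ n → t n +ℂ -ℂ w} p (k , f) h) (null-* {λ _ → w} {λ n → s n +ℂ -ℂ v} q (0 , λ _ _ → w≼q) g))
  where
  open ℂI.Solver
  rearrange : ∀ s t v w → s *ℂ (t +ℂ -ℂ w) +ℂ w *ℂ (s +ℂ -ℂ v) ≈ℂ s *ℂ t +ℂ -ℂ (v *ℂ w)
  rearrange = solve 4 (λ s t v w → s :* (t :- w) :+ w :* (s :- v) := s :* t :- v :* w) ℂ-Ring.refl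

abstract
  unit-min : ∀ ε → 0ℚ ℚ.< ε → ∃[ η ] (0ℚ ℚ.< η × η ℚ.≤ 1ℚ × η ℚ.≤ ε)
  unit-min ε 0<ε with ℚ.≤-total ε 1ℚ
  ... | inj₁ ε≤1 = ε , 0<ε , ε≤1 , ℚ.≤-refl
  ... | inj₂ 1≤ε = 1ℚ , 0<1 , ℚ.≤-refl , 1≤ε

  0≤square : ∀ a → 0ℚ ℚ.≤ a ℚ.* a
  0≤square a with ℚ.≤-total 0ℚ a
  ... | inj₁ 0≤a = 0≤* 0≤a 0≤a
  ... | inj₂ a≤0 = subst (0ℚ ℚ.≤_) (ℚS.solve 1 (λ a → (ℚS.:- a) ℚS.:* (ℚS.:- a) ℚS.:= a ℚS.:* a) refl a)
                     (0≤* (ℚ.neg-antimono-≤ a≤0) (ℚ.neg-antimono-≤ a≤0))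

  ∣∣*∣∣ : ∀ a → ℚ.∣ a ∣ ℚ.* ℚ.∣ a ∣ ≡ a ℚ.* a
  ∣∣*∣∣ a = trans (sym (ℚ.∣p*q∣≡∣p∣*∣q∣ a a)) (ℚ.0≤p⇒∣p∣≡p (0≤square a))

  square-cancel-≤ : ∀ {a δ} → 0ℚ ℚ.≤ δ → a ℚ.* a ℚ.≤ δ ℚ.* δ → ℚ.∣ a ∣ ℚ.≤ δ
  square-cancel-≤ {a} {δ} 0≤δ a²≤δ² with ℚ.∣ a ∣ ℚ.≤? δ
  ... | yes ∣a∣≤δ = ∣a∣≤δ
  ... | no  ∣a∣≰δ = contradiction (ℚ.<-≤-trans δ²<a² a²≤δ²) (ℚ.<-irrefl refl)
    where
    δ<∣a∣ : δ ℚ.< ℚ.∣ a ∣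
    δ<∣a∣ = ℚ.≰⇒> ∣a∣≰δ

    δ²<a² : δ ℚ.* δ ℚ.< a ℚ.* a
    δ²<a² = subst (δ ℚ.* δ ℚ.<_) (∣∣*∣∣ a) (ℚ.≤-<-trans
      (ℚ.*-monoˡ-≤-nonNeg δ {{ℚ.nonNegative 0≤δ}} (ℚ.<⇒≤ δ<∣a∣))
      (ℚ.*-monoˡ-<-pos ℚ.∣ a ∣ {{ℚ.positive (ℚ.≤-<-trans 0≤δ δ<∣a∣)}} δ<∣a∣))

  ∣∣²≤‖‖² : ∀ z n → seq (∣ z ∣²) n ℚ.≤ ‖ z ‖ n ℚ.* ‖ z ‖ n
  ∣∣²≤‖‖² z n = ℚ.≤-trans (ℚ.≤-reflexive (cong₂ ℚ._+_ (sym (∣∣*∣∣ a)) (sym (∣∣*∣∣ b)))) (ℚ.≤-trans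
    (≤+ˡ (0≤+ (0≤* (ℚ.0≤∣p∣ a) (ℚ.0≤∣p∣ b)) (0≤* (ℚ.0≤∣p∣ a) (ℚ.0≤∣p∣ b))))
    (ℚ.≤-reflexive (ℚS.solve 2 (λ a b → (a ℚS.:* a ℚS.:+ b ℚS.:* b) ℚS.:+ (a ℚS.:* b ℚS.:+ a ℚS.:* b)
      ℚS.:= (a ℚS.:+ b) ℚS.:* (a ℚS.:+ b)) refl ℚ.∣ a ∣ ℚ.∣ b ∣)))
    where
    a b : ℚ
    a = seq (Re z) n
    b = seq (Im z) n

  tends⇒⟶ : ∀ s w → Tends s w → s ⟶ w
  tends⇒⟶ s w h ε 0<ε =
    let η , 0<η , η≤1 , η≤½ε = unit-min (½ ℚ.* ε) (0<½* ε 0<ε)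
        k , f = h η 0<η
    in k , λ n k≤n → let l , g = _≼_.eventually (f n k≤n) in
      ½ ℚ.* ε , 0<½* ε 0<ε , l , λ m l≤m →
        ℚ.≤-trans (ℚ.+-monoˡ-≤ (½ ℚ.* ε) (ℚ.≤-trans (∣∣²≤‖‖² (s n +ℂ -ℂ w) m) (ℚ.≤-trans
          (*-mono-≤ (0≤‖‖ (s n +ℂ -ℂ w) m) (ℚ.<⇒≤ 0<η) (ℚ.≤-trans (g m l≤m) η≤1) (g m l≤m))
          (ℚ.≤-trans (ℚ.≤-reflexive (ℚ.*-identityˡ η)) η≤½ε))))
        (ℚ.≤-reflexive (halve ε))

  ⟶⇒tends : ∀ s w → s ⟶ w → Tends s w
  ⟶⇒tends s w h ε 0<ε =
    let δ = ½ ℚ.* ε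
        0<δ = 0<½* ε 0<ε
        k , f = h (δ ℚ.* δ) (ℚ.≤-<-trans (ℚ.≤-reflexive (sym (ℚ.*-zeroʳ δ))) (ℚ.*-monoʳ-<-pos δ {{ℚ.positive 0<δ}} 0<δ))
    in k , λ n k≤n → let η , 0<η , l , g = f n k≤n in mk≼ (l , λ m l≤m →
      let a = seq (Re (s n +ℂ -ℂ w)) m
          b = seq (Im (s n +ℂ -ℂ w)) m
          sum≤ = ℚ.≤-trans (≤+ˡ (ℚ.<⇒≤ 0<η)) (g m l≤m)
      in subst (‖ s n +ℂ -ℂ w ‖ m ℚ.≤_) (halve ε) (ℚ.+-mono-≤
           (square-cancel-≤ {a} (ℚ.<⇒≤ 0<δ) (ℚ.≤-trans (≤+ˡ (0≤square b)) sum≤))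
           (square-cancel-≤ {b} (ℚ.<⇒≤ 0<δ) (ℚ.≤-trans (≤+ʳ (0≤square a)) sum≤))))

rational : ℚ × ℚ → ℂ
rational (a , b) = ℚ→ℝ a +i ℚ→ℝ b

abstract
  approximate : ∀ z ε → 0ℚ ℚ.< ε → ∃[ c ] rational c +ℂ -ℂ z ≼ ε
  approximate z ε 0<ε =
    let k , f = cauchy (Re z) (½ ℚ.* ε) (0<½* ε 0<ε)
        l , g = cauchy (Im z) (½ ℚ.* ε) (0<½* ε 0<ε)
        K = k ⊔ l
    in (seq (Re z) K , seq (Im z) K) , mk≼ (K , λ n K≤n →
         subst (‖ rational (seq (Re z) K , seq (Im z) K) +ℂ -ℂ z ‖ n ℚ.≤_) (halve ε) (ℚ.+-mono-≤
           (ℚ.<⇒≤ (f K n (ℕ.m≤m⊔n k l) (ℕ.m⊔n≤o⇒m≤o k l K≤n)))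
           (ℚ.<⇒≤ (g K n (ℕ.m≤n⊔m k l) (ℕ.m⊔n≤o⇒n≤o k l K≤n)))))

  complete : ∀ (s : ℕ → ℂ) → (∀ ε → 0ℚ ℚ.< ε → ∃[ k ] ∀ m n → k ≤ m → k ≤ n → s m +ℂ -ℂ s n ≼ ε) →
             ∃[ w ] Tends s w
  complete s h = w , tends-difference close-to-s tends-w
    where
    c : ℕ → ℚ × ℚ
    c n = proj₁ (approximate (s n) (inv n) (0<inv n))

    c≼ : ∀ n → rational (c n) +ℂ -ℂ s n ≼ inv n
    c≼ n = proj₂ (approximate (s n) (inv n) (0<inv n))

    close-to-s : Null (λ n → rational (c n) +ℂ -ℂ s n)
    close-to-s ε 0<ε = let k , f = inv-small ε 0<ε in k , λ n k≤n → ≼-weaken (c≼ n) (f n k≤n)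

    rearrange : ∀ x y s t → (x +ℂ -ℂ s) +ℂ (-ℂ (y +ℂ -ℂ t) +ℂ (s +ℂ -ℂ t)) ≈ℂ x +ℂ -ℂ y
    rearrange = solve 4 (λ x y s t → (x :- s) :+ (:- (y :- t) :+ (s :- t)) := x :- y) ℂ-Ring.refl
      where open ℂI.Solver

    c-cauchy : ∀ ε → 0ℚ ℚ.< ε → ∃[ k ] ∀ m n → k ≤ m → k ≤ n → ‖ rational (c m) +ℂ -ℂ rational (c n) ‖ 0 ℚ.≤ ε
    c-cauchy ε 0<ε =
      let δ = ½ ℚ.* ε
          0<δ = 0<½* ε 0<ε
          δ′ = ½ ℚ.* δ
          0<δ′ = 0<½* δ 0<δ
          δ″ = ½ ℚ.* δ′
          0<δ″ = 0<½* δ′ 0<δ′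
          k , f = close-to-s δ′ 0<δ′
          l , g = close-to-s δ″ 0<δ″
          p , q = h δ″ 0<δ″
          K = k ⊔ (l ⊔ p)
      in K , λ m n K≤m K≤n →
        let bound = ≼-resp-½ ε 0<ε (rearrange (rational (c m)) (rational (c n)) (s m) (s n))
              (subst (_ ≼_) (halve δ) (≼-+ {rational (c m) +ℂ -ℂ s m}
                (f m (ℕ.m⊔n≤o⇒m≤o k (l ⊔ p) K≤m))
                (subst (_ ≼_) (halve δ′) (≼-+ {(-ℂ (rational (c n) +ℂ -ℂ s n))} {s m +ℂ -ℂ s n}
                  (≼-neg {rational (c n) +ℂ -ℂ s n} (g n (ℕ.m⊔n≤o⇒m≤o l p (ℕ.m⊔n≤o⇒n≤o k (l ⊔ p) K≤n))))
                  (q m n (ℕ.m⊔n≤o⇒n≤o l p (ℕ.m⊔n≤o⇒n≤o k (l ⊔ p) K≤m)) (ℕ.m⊔n≤o⇒n≤o l p (ℕ.m⊔n≤o⇒n≤o k (l ⊔ p) K≤n)))))))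
            j , r = _≼_.eventually bound
        in r j ℕ.≤-refl

    w : ℂ
    w = record { seq = λ n → proj₁ (c n) ; cauchy = λ ε 0<ε →
            let k , f = c-cauchy (½ ℚ.* ε) (0<½* ε 0<ε) in k , λ m n k≤m k≤n →
              ℚ.≤-<-trans (ℚ.≤-trans (≤+ˡ (ℚ.0≤∣p∣ (proj₂ (c m) ℚ.- proj₂ (c n)))) (f m n k≤m k≤n)) (½<1 ε 0<ε) }
      +i record { seq = λ n → proj₂ (c n) ; cauchy = λ ε 0<ε →
            let k , f = c-cauchy (½ ℚ.* ε) (0<½* ε 0<ε) in k , λ m n k≤m k≤n →
              ℚ.≤-<-trans (ℚ.≤-trans (≤+ʳ (ℚ.0≤∣p∣ (proj₁ (c m) ℚ.- proj₁ (c n)))) (f m n k≤m k≤n)) (½<1 ε 0<ε) }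

    tends-w : Tends (λ n → rational (c n)) w
    tends-w ε 0<ε = let k , f = c-cauchy ε 0<ε in k , λ n k≤n → mk≼ (k , λ m k≤m → f n m k≤n k≤m)

module ℚ∑ = Series ℚ.+-*-commutativeRing
module ℂ∑ = Series ℂ-commutativeRing
open ℚ∑ public using () renaming (∑ to ∑ℚ)
open ℂ∑ public using (∑)

abstract
  ∑-≼ : ∀ n (f : ℕ → ℂ) φ → (∀ k → k ℕ.< n → f k ≼ φ k) → ∑ n f ≼ ∑ℚ n φ
  ∑-≼ zero    f φ f≼φ = ≼-ℚ ℚ.≤-refl
  ∑-≼ (suc n) f φ f≼φ = ≼-+ (f≼φ 0 (s≤s z≤n)) (∑-≼ n (f ∘ suc) (φ ∘ suc) (λ k k<n → f≼φ (suc k) (s≤s k<n)))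

  ∑ℚ-nonNeg : ∀ n φ → (∀ k → 0ℚ ℚ.≤ φ k) → 0ℚ ℚ.≤ ∑ℚ n φ
  ∑ℚ-nonNeg zero    φ 0≤φ = ℚ.≤-refl
  ∑ℚ-nonNeg (suc n) φ 0≤φ = 0≤+ (0≤φ 0) (∑ℚ-nonNeg n (φ ∘ suc) (0≤φ ∘ suc))

record Majorant (α : ℕ → ℚ) : Set where
  field
    nonNeg  : ∀ k → 0ℚ ℚ.≤ α k
    onset   : ℕ
    halving : ∀ k → onset ≤ k → α (suc k) ℚ.+ α (suc k) ℚ.≤ α k

  abstract
    tail≤ : ∀ d h → onset ≤ h → ∑ℚ d (λ k → α (h ℕ.+ k)) ℚ.≤ α h ℚ.+ α h
    tail≤ zero    h _   = 0≤+ (nonNeg h) (nonNeg h)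
    tail≤ (suc d) h h≥  = ℚ.+-mono-≤ (ℚ.≤-reflexive (cong α (ℕ.+-identityʳ h))) (ℚ.≤-trans
      (ℚ.≤-reflexive (ℚ∑.∑-cong d (λ k _ → cong α (ℕ.+-suc h k))))
      (ℚ.≤-trans (tail≤ d (suc h) (ℕ.m≤n⇒m≤1+n h≥)) (halving h h≥)))

    decay : ∀ j → ℕ→ℚ (suc j) ℚ.* α (onset ℕ.+ j) ℚ.≤ α onset
    decay zero    = ℚ.≤-reflexive (trans (ℚ.*-identityˡ _) (cong α (ℕ.+-identityʳ onset)))
    decay (suc j) = begin
      ℕ→ℚ (suc (suc j)) ℚ.* x           ≡⟨ cong (ℚ._* x) (ℤ→ℚ-+ (+ 1) (+ suc j)) ⟩
      (1ℚ ℚ.+ ℕ→ℚ (suc j)) ℚ.* x        ≤⟨ ℚ.*-monoʳ-≤-nonNeg x {{ℚ.nonNegative 0≤x}} (ℚ.+-monoˡ-≤ (ℕ→ℚ (suc j)) 1≤) ⟩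
      (ℕ→ℚ (suc j) ℚ.+ ℕ→ℚ (suc j)) ℚ.* x  ≡⟨ ℚS.solve 2 (λ n x → (n ℚS.:+ n) ℚS.:* x ℚS.:= n ℚS.:* (x ℚS.:+ x)) refl (ℕ→ℚ (suc j)) x ⟩
      ℕ→ℚ (suc j) ℚ.* (x ℚ.+ x)         ≤⟨ ℚ.*-monoˡ-≤-nonNeg (ℕ→ℚ (suc j)) {{ℚ.nonNegative (0≤ℕ→ℚ (suc j))}} x+x≤ ⟩
      ℕ→ℚ (suc j) ℚ.* α (onset ℕ.+ j)   ≤⟨ decay j ⟩
      α onset                           ∎
      where
      open ℚ.≤-Reasoning
      x : ℚ
      x = α (onset ℕ.+ suc j)

      0≤x : 0ℚ ℚ.≤ x
      0≤x = nonNeg (onset ℕ.+ suc j)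

      1≤ : 1ℚ ℚ.≤ ℕ→ℚ (suc j)
      1≤ = ℤ→ℚ-mono {+ 1} {+ suc j} (ℤ.+≤+ (s≤s z≤n))

      x+x≤ : x ℚ.+ x ℚ.≤ α (onset ℕ.+ j)
      x+x≤ = ℚ.≤-trans (ℚ.≤-reflexive (cong (λ k → α k ℚ.+ α k) (ℕ.+-suc onset j)))
        (halving (onset ℕ.+ j) (ℕ.m≤m+n onset j))

    tail-small : ∀ ε → 0ℚ ℚ.< ε → ∃[ h ] ∀ h′ → h ≤ h′ → ∀ d → ∑ℚ d (λ k → α (h′ ℕ.+ k)) ℚ.≤ ε
    tail-small ε 0<ε = onset ℕ.+ N , λ h′ h≤h′ d →
      subst (λ m → ∑ℚ d (λ k → α (m ℕ.+ k)) ℚ.≤ ε) (ℕ.m+[n∸m]≡n (ℕ.≤-trans (ℕ.m≤m+n onset N) h≤h′))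
        (ℚ.≤-trans (tail≤ d (onset ℕ.+ (h′ ℕ.∸ onset)) (ℕ.m≤m+n onset _))
          (small (h′ ℕ.∸ onset) (ℕ.m+n≤o⇒m≤o∸n N (ℕ.≤-trans (ℕ.≤-reflexive (ℕ.+-comm N onset)) h≤h′))))
      where
      N : ℕ
      N = proj₁ (archimedean (α onset ℚ.+ α onset) ε 0<ε)

      small : ∀ j → N ≤ j → α (onset ℕ.+ j) ℚ.+ α (onset ℕ.+ j) ℚ.≤ ε
      small j N≤j = ℚ.*-cancelˡ-≤-pos (ℕ→ℚ (suc j)) {{ℚ.positive 0<1+j}} (begin
        ℕ→ℚ (suc j) ℚ.* (x ℚ.+ x)                   ≡⟨ ℚ.*-distribˡ-+ (ℕ→ℚ (suc j)) x x ⟩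
        ℕ→ℚ (suc j) ℚ.* x ℚ.+ ℕ→ℚ (suc j) ℚ.* x     ≤⟨ ℚ.+-mono-≤ (decay j) (decay j) ⟩
        α onset ℚ.+ α onset                         ≤⟨ proj₂ (archimedean (α onset ℚ.+ α onset) ε 0<ε) ⟩
        ℕ→ℚ N ℚ.* ε                                 ≤⟨ ℚ.*-monoʳ-≤-nonNeg ε {{ℚ.nonNegative (ℚ.<⇒≤ 0<ε)}} (ℤ→ℚ-mono {+ N} {+ suc j} (ℤ.+≤+ (ℕ.m≤n⇒m≤1+n N≤j))) ⟩
        ℕ→ℚ (suc j) ℚ.* ε                           ∎)
        where
        open ℚ.≤-Reasoning
        x : ℚ
        x = α (onset ℕ.+ j)

        0<1+j : 0ℚ ℚ.< ℕ→ℚ (suc j)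
        0<1+j = ℚ.<-≤-trans 0<1 (ℤ→ℚ-mono {+ 1} {+ suc j} (ℤ.+≤+ (s≤s z≤n)))

    total-bounded : ∃[ C ] (0ℚ ℚ.< C × ∀ n → ∑ℚ n α ℚ.≤ C)
    total-bounded = let h , f = tail-small 1ℚ 0<1 in
        ∑ℚ h α ℚ.+ 1ℚ , ℚ.+-mono-≤-< (∑ℚ-nonNeg h α nonNeg) 0<1
      , λ n → ℚ.≤-trans (≤+ˡ (∑ℚ-nonNeg h (λ k → α (n ℕ.+ k)) (λ k → nonNeg (n ℕ.+ k)))) (ℚ.≤-trans
          (ℚ.≤-reflexive (trans (sym (ℚ∑.∑-split n h α)) (trans (cong (λ m → ∑ℚ m α) (ℕ.+-comm n h)) (ℚ∑.∑-split h n α))))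
          (ℚ.+-monoʳ-≤ (∑ℚ h α) (f h ℕ.≤-refl n)))

module Dominated {α : ℕ → ℚ} (maj : Majorant α) where
  open Majorant maj
  open ℂ∑ using (∑-split; ∑-cong; convolution; product-error)

  abstract
    segment : ∀ (a : ℕ → ℂ) → (∀ k → a k ≼ α k) → ∀ ε → 0ℚ ℚ.< ε →
              ∃[ h ] ∀ m n → h ≤ m → m ≤ n → ∑ n a +ℂ -ℂ ∑ m a ≼ ε
    segment a a≼α ε 0<ε =
      let h , f = tail-small (½ ℚ.* ε) (0<½* ε 0<ε)
      in h , λ m n h≤m m≤n → ≼-resp-½ ε 0<ε (difference m n m≤n)
           (≼-weaken (∑-≼ (n ℕ.∸ m) (λ k → a (m ℕ.+ k)) (λ k → α (m ℕ.+ k)) (λ k _ → a≼α (m ℕ.+ k)))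
             (f m h≤m (n ℕ.∸ m)))
      where
      open ℂI.Solver
      difference : ∀ m n → m ≤ n → ∑ (n ℕ.∸ m) (λ k → a (m ℕ.+ k)) ≈ℂ ∑ n a +ℂ -ℂ ∑ m a
      difference m n m≤n = ℂ-Ring.trans
        (solve 2 (λ x y → y := (x :+ y) :- x) ℂ-Ring.refl (∑ m a) (∑ (n ℕ.∸ m) (λ k → a (m ℕ.+ k))))
        (ℂ-Ring.+-congʳ (ℂ-Ring.trans (ℂ-Ring.sym (∑-split m (n ℕ.∸ m) a))
          (ℂ-Ring.reflexive (cong (λ k → ∑ k a) (ℕ.m+[n∸m]≡n m≤n)))))

    converges : ∀ (a : ℕ → ℂ) → (∀ k → a k ≼ α k) → ∃[ w ] Tends (λ n → ∑ n a) w
    converges a a≼α = complete (λ n → ∑ n a) λ ε 0<ε →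
      let h , f = segment a a≼α (½ ℚ.* ε) (0<½* ε 0<ε)
      in h , λ m n h≤m h≤n →
           [ (λ m≤n → ≼-resp-½ ε 0<ε (flip-difference (∑ n a) (∑ m a)) (≼-neg {∑ n a +ℂ -ℂ ∑ m a} (f m n h≤m m≤n)))
           , (λ n≤m → ≼-weaken (f n m h≤n n≤m) (ℚ.<⇒≤ (½<1 ε 0<ε))) ]′ (ℕ.≤-total m n)
      where
      open ℂI.Solver
      flip-difference : ∀ x y → -ℂ (x +ℂ -ℂ y) ≈ℂ y +ℂ -ℂ x
      flip-difference = solve 2 (λ x y → :- (x :- y) := y :- x) ℂ-Ring.refl

    cauchy-product : ∀ (a b : ℕ → ℂ) → (∀ k → a k ≼ α k) → (∀ k → b k ≼ α k) →
                     Null (λ n → ∑ n a *ℂ ∑ n b +ℂ -ℂ ∑ n (convolution a b))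
    cauchy-product a b a≼α b≼α = null-≈ (λ n → ℂ-Ring.sym (product-error a b n)) λ ε 0<ε →
      let C , 0<C , ∑≤C = total-bounded
          0<3C = ℚ.+-mono-< 0<C (ℚ.+-mono-< 0<C 0<C)
          δ , 0<δ , 3Cδ≡ = divide (C ℚ.+ (C ℚ.+ C)) (½ ℚ.* ε) 0<3C (0<½* ε 0<ε)
          h , f = tail-small δ 0<δ
          l , g = segment b b≼α δ 0<δ
          K = h ⊔ l
      in K ℕ.+ K , λ n 2K≤n → bound C 0<C ∑≤C δ 0<δ ε 0<ε 3Cδ≡ K (n ℕ.∸ K)
           (λ d → f K (ℕ.m≤m⊔n h l) d)
           (λ m m′ K≤m m≤m′ → g m m′ (ℕ.≤-trans (ℕ.m≤n⊔m h l) K≤m) m≤m′)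
           n (ℕ.m+[n∸m]≡n (ℕ.≤-trans (ℕ.m≤m+n K K) 2K≤n)) 2K≤n
      where
      error : ℕ → ℕ → ℂ
      error n j = a j *ℂ (∑ n b +ℂ -ℂ ∑ (n ℕ.∸ j) b)

      ∑ℚ-*ʳ : ∀ n φ c → ∑ℚ n (λ k → φ k ℚ.* c) ≡ ∑ℚ n φ ℚ.* c
      ∑ℚ-*ʳ n φ c = trans (ℚ∑.∑-cong n (λ k _ → ℚ.*-comm (φ k) c))
        (trans (sym (ℚ∑.*-∑ n c φ)) (ℚ.*-comm c (∑ℚ n φ)))

      bound : ∀ C → 0ℚ ℚ.< C → (∀ n → ∑ℚ n α ℚ.≤ C) → ∀ δ → 0ℚ ℚ.< δ → ∀ ε → 0ℚ ℚ.< ε →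
              (C ℚ.+ (C ℚ.+ C)) ℚ.* δ ≡ ½ ℚ.* ε → ∀ K d →
              (∀ d → ∑ℚ d (λ k → α (K ℕ.+ k)) ℚ.≤ δ) →
              (∀ m n → K ≤ m → m ≤ n → ∑ n b +ℂ -ℂ ∑ m b ≼ δ) →
              ∀ n → K ℕ.+ d ≡ n → K ℕ.+ K ≤ n → ∑ n (error n) ≼ ε
      bound C 0<C ∑≤C δ 0<δ ε 0<ε eq K d tail seg n refl 2K≤n =
        ≼-resp-½ ε 0<ε (ℂ-Ring.sym (∑-split K d (error n)))
          (≼-weaken (≼-+ {∑ K (error n)} {∑ d (λ i → error n (K ℕ.+ i))}
              (≼-weaken (∑-≼ K (error n) (λ j → α j ℚ.* δ) (λ j j<K →
                  ≼-* {a j} (a≼α j) (seg (n ℕ.∸ j) n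
                    (ℕ.≤-trans (ℕ.≤-reflexive (sym (ℕ.m+n∸m≡n K K))) (ℕ.≤-trans (ℕ.∸-monoʳ-≤ (K ℕ.+ K) (ℕ.<⇒≤ j<K)) (ℕ.∸-monoˡ-≤ j 2K≤n)))
                    (ℕ.m∸n≤m n j))))
                (ℚ.≤-trans (ℚ.≤-reflexive (∑ℚ-*ʳ K α δ))
                  (ℚ.*-monoʳ-≤-nonNeg δ {{ℚ.nonNegative (ℚ.<⇒≤ 0<δ)}} (∑≤C K))))
              (≼-weaken (∑-≼ d (λ i → error n (K ℕ.+ i)) (λ i → α (K ℕ.+ i) ℚ.* (C ℚ.+ C)) (λ i _ →
                  ≼-* {a (K ℕ.+ i)} (a≼α (K ℕ.+ i)) (≼-+ {∑ n b} (total≼ n) (≼-neg {∑ (n ℕ.∸ (K ℕ.+ i)) b} (total≼ (n ℕ.∸ (K ℕ.+ i)))))))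
                (ℚ.≤-trans (ℚ.≤-reflexive (∑ℚ-*ʳ d (λ i → α (K ℕ.+ i)) (C ℚ.+ C)))
                  (ℚ.*-monoʳ-≤-nonNeg (C ℚ.+ C) {{ℚ.nonNegative (0≤+ (ℚ.<⇒≤ 0<C) (ℚ.<⇒≤ 0<C))}} (tail d)))))
            (ℚ.≤-reflexive (trans (ℚS.solve 2 (λ C δ → C ℚS.:* δ ℚS.:+ δ ℚS.:* (C ℚS.:+ C) ℚS.:= (C ℚS.:+ (C ℚS.:+ C)) ℚS.:* δ) refl C δ) eq)))
        where
        total≼ : ∀ m → ∑ m b ≼ C
        total≼ m = ≼-weaken (∑-≼ m b α (λ k _ → b≼α k)) (∑≤C m)

abstract
  ℚ→ℂ-+ : ∀ p q → ℚ→ℂ (p ℚ.+ q) ≈ℂ ℚ→ℂ p +ℂ ℚ→ℂ q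
  ℚ→ℂ-+ p q = pointwise (ℚ→ℝ (p ℚ.+ q)) (ℚ→ℝ p +ℝ ℚ→ℝ q) (λ _ → refl) , ℝ-Ring.sym (ℝ-Ring.+-identityˡ (ℚ→ℝ 0ℚ))

  ℚ→ℂ-* : ∀ p q → ℚ→ℂ (p ℚ.* q) ≈ℂ ℚ→ℂ p *ℂ ℚ→ℂ q
  ℚ→ℂ-* p q =
      pointwise (ℚ→ℝ (p ℚ.* q)) (Re (ℚ→ℂ p *ℂ ℚ→ℂ q)) (λ _ → sym (ℚ.+-identityʳ (p ℚ.* q)))
    , pointwise (ℚ→ℝ 0ℚ) (Im (ℚ→ℂ p *ℂ ℚ→ℂ q)) (λ _ →
        sym (trans (cong₂ ℚ._+_ (ℚ.*-zeroʳ p) (ℚ.*-zeroˡ q)) (ℚ.+-identityˡ 0ℚ)))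

  ℚ→ℂ-injective : ∀ p q → ℚ→ℂ p ≈ℂ ℚ→ℂ q → p ≡ q
  ℚ→ℂ-injective p q (eq , _) with p ℚ.≟ q
  ... | yes p≡q = p≡q
  ... | no  p≢q =
    let k , f = close eq ℚ.∣ p ℚ.- q ∣ 0<∣p-q∣
    in contradiction (f k k ℕ.≤-refl ℕ.≤-refl) (ℚ.<-irrefl refl)
    where
    0<∣p-q∣ : 0ℚ ℚ.< ℚ.∣ p ℚ.- q ∣
    0<∣p-q∣ with 0ℚ ℚ.<? ℚ.∣ p ℚ.- q ∣
    ... | yes 0< = 0<
    ... | no  ≮  = contradiction
      (trans (sym (sub-cancel p q)) (trans (cong (ℚ._+ q) (ℚ.∣p∣≡0⇒p≡0 (p ℚ.- q) (ℚ.≤-antisym (ℚ.≮⇒≥ ≮) (ℚ.0≤∣p∣ (p ℚ.- q))))) (ℚ.+-identityˡ q))) p≢q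

  fromℕ≈ℕ→ℂ : ∀ n → ℂI.fromℤ (+ n) ≈ℂ ℕ→ℂ n
  fromℕ≈ℕ→ℂ zero  = ℂ-Ring.refl
  fromℕ≈ℕ→ℂ (suc n) = begin
    ℂI.fromℤ (+ 1 ℤ.+ + n)              ≈⟨ ℂI.fromℤ-+ (+ 1) (+ n) ⟩
    ℂI.fromℤ (+ 1) +ℂ ℂI.fromℤ (+ n)    ≈⟨ ℂ-Ring.+-congˡ (fromℕ≈ℕ→ℂ n) ⟩
    ℚ→ℂ 1ℚ +ℂ ℤ→ℂ (+ n)                 ≈⟨ ℚ→ℂ-+ 1ℚ (ℕ→ℚ n) ⟨
    ℚ→ℂ (1ℚ ℚ.+ ℕ→ℚ n)                  ≡⟨ cong ℚ→ℂ (ℤ→ℚ-+ (+ 1) (+ n)) ⟨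
    ℤ→ℂ (+ suc n)                       ∎
    where open SetoidReasoning ℂ-Ring.setoid

  fromℤ≈ℤ→ℂ : ∀ k → ℂI.fromℤ k ≈ℂ ℤ→ℂ k
  fromℤ≈ℤ→ℂ (+ n)     = fromℕ≈ℕ→ℂ n
  fromℤ≈ℤ→ℂ -[1+ n ]  = begin
    -ℂ ℂI.fromℤ (+ suc n)     ≈⟨ ℂ-Ring.-‿cong (fromℕ≈ℕ→ℂ (suc n)) ⟩
    -ℂ ℤ→ℂ (+ suc n)          ≈⟨ pointwise (-ℝ ℚ→ℝ (ℕ→ℚ (suc n))) (ℚ→ℝ (ℚ.- ℕ→ℚ (suc n))) (λ _ → refl) , pointwise (-ℝ ℚ→ℝ 0ℚ) (ℚ→ℝ 0ℚ) (λ _ → refl) ⟩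
    ℚ→ℂ (ℚ.- ℕ→ℚ (suc n))     ≡⟨ cong ℚ→ℂ (ℤ→ℚ-neg (+ suc n)) ⟨
    ℤ→ℂ -[1+ n ]              ∎
    where open SetoidReasoning ℂ-Ring.setoid

  fromℤ-injective : ∀ a b → ℂI.fromℤ a ≈ℂ ℂI.fromℤ b → a ≡ b
  fromℤ-injective a b eq = ℤ→ℚ-injective a b (ℚ→ℂ-injective (ℤ→ℚ a) (ℤ→ℚ b)
    (ℂ-Ring.trans (ℂ-Ring.sym (fromℤ≈ℤ→ℂ a)) (ℂ-Ring.trans eq (fromℤ≈ℤ→ℂ b))))

  invℂ-inverse : ∀ k → ℂI.fromℤ (+ suc k) *ℂ ℚ→ℂ (inv k) ≈ℂ 1ℂ
  invℂ-inverse k = begin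
    ℂI.fromℤ (+ suc k) *ℂ ℚ→ℂ (inv k)   ≈⟨ ℂ-Ring.*-congʳ (fromℤ≈ℤ→ℂ (+ suc k)) ⟩
    ℚ→ℂ (ℕ→ℚ (suc k)) *ℂ ℚ→ℂ (inv k)    ≈⟨ ℚ→ℂ-* (ℕ→ℚ (suc k)) (inv k) ⟨
    ℚ→ℂ (ℕ→ℚ (suc k) ℚ.* inv k)         ≡⟨ cong ℚ→ℂ (inv-inverse k) ⟩
    1ℂ                                  ∎
    where open SetoidReasoning ℂ-Ring.setoid

module ℂExp = ℂ∑.Exponential (λ k → ℚ→ℂ (inv k)) invℂ-inverse
open ℂExp public using (term; term-+)

fromℤℚ : ∀ n → IntegerScalars.fromℤ ℚ.+-*-commutativeRing (+ n) ≡ ℕ→ℚ n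
fromℤℚ zero    = refl
fromℤℚ (suc n) = trans (IntegerScalars.fromℤ-+ ℚ.+-*-commutativeRing (+ 1) (+ n))
  (trans (cong (1ℚ ℚ.+_) (fromℤℚ n)) (sym (ℤ→ℚ-+ (+ 1) (+ n))))

module ℚExp = ℚ∑.Exponential inv (λ k → trans (cong (ℚ._* inv k) (fromℤℚ (suc k))) (inv-inverse k))

-- The terms Bᵏ/k! halve as soon as k ≥ 2B.
exponential-majorant : ∀ B → Majorant (ℚExp.term (ℕ→ℚ B))
exponential-majorant B = record
  { nonNeg  = nonNeg
  ; onset   = B ℕ.+ B
  ; halving = λ k 2B≤k → ℚ.≤-trans
      (ℚ.≤-reflexive (ℚS.solve 3 (λ b i t → b ℚS.:* i ℚS.:* t ℚS.:+ b ℚS.:* i ℚS.:* t ℚS.:= (b ℚS.:+ b) ℚS.:* i ℚS.:* t) refl (ℕ→ℚ B) (inv k) (ℚExp.term (ℕ→ℚ B) k)))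
      (ℚ.≤-trans (ℚ.*-monoʳ-≤-nonNeg (ℚExp.term (ℕ→ℚ B) k) {{ℚ.nonNegative (nonNeg k)}} (ratio k 2B≤k))
        (ℚ.≤-reflexive (ℚ.*-identityˡ _)))
  }
  where
  nonNeg : ∀ k → 0ℚ ℚ.≤ ℚExp.term (ℕ→ℚ B) k
  nonNeg zero    = ℚ.<⇒≤ 0<1
  nonNeg (suc k) = 0≤* (0≤* (0≤ℕ→ℚ B) (ℚ.<⇒≤ (0<inv k))) (nonNeg k)

  ratio : ∀ k → B ℕ.+ B ≤ k → (ℕ→ℚ B ℚ.+ ℕ→ℚ B) ℚ.* inv k ℚ.≤ 1ℚ
  ratio k 2B≤k = ℚ.≤-trans (ℚ.*-monoʳ-≤-nonNeg (inv k) {{ℚ.nonNegative (ℚ.<⇒≤ (0<inv k))}}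
      (ℚ.≤-trans (ℚ.≤-reflexive (sym (ℤ→ℚ-+ (+ B) (+ B)))) (ℤ→ℚ-mono {+ (B ℕ.+ B)} {+ suc k} (ℤ.+≤+ (ℕ.m≤n⇒m≤1+n 2B≤k)))))
    (ℚ.≤-reflexive (inv-inverse k))

abstract
  ≼-natural : ∀ z → ∃[ B ] z ≼ ℕ→ℚ B
  ≼-natural z =
    let p , z≼p = ≼-exists z
        B , p≤ = archimedean p 1ℚ 0<1
    in B , ≼-weaken z≼p (ℚ.≤-trans p≤ (ℚ.≤-reflexive (ℚ.*-identityʳ (ℕ→ℚ B))))

  term-≼ : ∀ {z} B → z ≼ ℕ→ℚ B → ∀ k → term z k ≼ ℚExp.term (ℕ→ℚ B) k
  term-≼ B z≼B zero    = ≼-ℚ (ℚ.<⇒≤ 0<1)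
  term-≼ {z} B z≼B (suc k) = ≼-* {z *ℂ ℚ→ℂ (inv k)} {term z k} (≼-* {z} {ℚ→ℂ (inv k)} z≼B (≼-ℚ (ℚ.<⇒≤ (0<inv k)))) (term-≼ B z≼B k)

  exponential-converges : ∀ z → ∃[ w ] Tends (λ n → ∑ n (term z)) w
  exponential-converges z = let B , z≼B = ≼-natural z in
    Dominated.converges (exponential-majorant B) (term z) (term-≼ B z≼B)

  exponential-product : ∀ z w {v v′} → Tends (λ n → ∑ n (term z)) v → Tends (λ n → ∑ n (term w)) v′ →
                        Tends (λ n → ∑ n (term (z +ℂ w))) (v *ℂ v′)
  exponential-product z w h g =
    let B , z≼B = ≼-natural z
        C , w≼C = ≼-natural w
        z≼ = ≼-weaken z≼B (ℤ→ℚ-mono {+ B} {+ (B ℕ.+ C)} (ℤ.+≤+ (ℕ.m≤m+n B C)))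
        w≼ = ≼-weaken w≼C (ℤ→ℚ-mono {+ C} {+ (B ℕ.+ C)} (ℤ.+≤+ (ℕ.m≤n+m C B)))
    in tends-≈ (λ n → ℂ∑.∑-cong n (λ k _ → term-+ z w k))
         (tends-difference
           (Dominated.cauchy-product (exponential-majorant (B ℕ.+ C)) (term z) (term w)
             (term-≼ (B ℕ.+ C) z≼) (term-≼ (B ℕ.+ C) w≼))
           (tends-* {λ n → ∑ n (term z)} {λ n → ∑ n (term w)} h g))

  term-cong : ∀ {z w} → z ≈ℂ w → ∀ k → term z k ≈ℂ term w k
  term-cong z≈w zero    = ℂ-Ring.refl
  term-cong z≈w (suc k) = ℂ-Ring.*-cong (ℂ-Ring.*-congʳ z≈w) (term-cong z≈w k)

  exponential-0 : Tends (λ n → ∑ n (term (ℚ→ℂ 0ℚ))) 1ℂ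
  exponential-0 ε 0<ε = 1 , λ { (suc n) _ → ≈⇒≼ (∑≈1 n) ε 0<ε }
    where
    zeros : ∀ n k → ∑ n (λ j → term (ℚ→ℂ 0ℚ) (suc (k ℕ.+ j))) ≈ℂ ℚ→ℂ 0ℚ
    zeros zero    k = ℂ-Ring.refl
    zeros (suc n) k = ℂ-Ring.trans (ℂ-Ring.+-cong
        (ℂ-Ring.trans (ℂ-Ring.*-congʳ (ℂ-Ring.zeroˡ _)) (ℂ-Ring.zeroˡ _))
        (ℂ-Ring.trans (ℂ∑.∑-cong n (λ j _ → ℂ-Ring.reflexive (cong (λ m → term (ℚ→ℂ 0ℚ) (suc m)) (ℕ.+-suc k j)))) (zeros n (suc k))))
      (ℂ-Ring.+-identityˡ (ℚ→ℂ 0ℚ))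

    ∑≈1 : ∀ n → ∑ (suc n) (term (ℚ→ℂ 0ℚ)) ≈ℂ 1ℂ
    ∑≈1 n = ℂ-Ring.trans (ℂ-Ring.+-congˡ (zeros n 0)) (ℂ-Ring.+-identityʳ 1ℂ)

half-unique : (R : CommutativeRing 0ℓ 0ℓ) → let open CommutativeRing R in
              ∀ {h two p i z} → (1# + 1#) * h ≈ 1# → two ≈ 1# + 1# → z + z ≈ two * p * i → z ≈ i * p
half-unique R {h} {two} {p} {i} {z} 2h≈1 two≈2 2z≈ = begin
  z                            ≈⟨ *-identityˡ z ⟨
  1# * z                       ≈⟨ *-congʳ 2h≈1 ⟨
  (1# + 1#) * h * z            ≈⟨ solve 2 (λ h z → con (+ 2) :* h :* z := h :* (z :+ z)) ≈-refl h z ⟩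
  h * (z + z)                  ≈⟨ *-congˡ (≈-trans 2z≈ (*-congʳ (*-congʳ two≈2))) ⟩
  h * ((1# + 1#) * p * i)      ≈⟨ solve 3 (λ h p i → h :* (con (+ 2) :* p :* i) := con (+ 2) :* h :* (i :* p)) ≈-refl h p i ⟩
  (1# + 1#) * h * (i * p)      ≈⟨ *-congʳ 2h≈1 ⟩
  1# * (i * p)                 ≈⟨ *-identityˡ _ ⟩
  i * p                        ∎
  where
  open CommutativeRing R renaming (Carrier to A; refl to ≈-refl; sym to ≈-sym; trans to ≈-trans)
  open IntegerScalars.Solver R
  open SetoidReasoning setoid

conjugate : ℂ → ℂ
conjugate z = Re z +i (-ℝ Im z)

module Analysis (em : ExcludedMiddle 0ℓ) where
  open Classical em
  open ℂ-Ring using (_≈_; _+_; _*_; _-_; -_; 0#; 1#; semiring; +-cong; +-congˡ; +-congʳ; *-cong; *-congˡ; *-congʳ; *-assoc; *-comm; *-identityˡ; *-identityʳ; zeroˡ; zeroʳ; +-identityˡ; +-identityʳ; reflexive; -‿cong; setoid) renaming (refl to ≈-refl; sym to ≈-sym; trans to ≈-trans)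
  open import Algebra.Definitions.RawSemiring (Semiring.rawSemiring semiring) using (_^_; sum; product)
  open SetoidReasoning setoid
  open ℂI using (fromℤ; fromℤ-+; fromℤ-*; fromℤ-neg)
  open ℂI.Solver using (solve; con; _:=_; _:+_; _:*_; _:-_; :-_)

  choose-satisfies : ∀ {A : Set} (d : A) (P : A → Set) → ∃ P → P (choose d P)
  choose-satisfies d P ∃P with em {∃ P}
  ... | yes (x , Px) = Px
  ... | no  ∄P       = contradiction ∃P ∄P

  choose-cases : ∀ {A : Set} (d : A) (P : A → Set) → P (choose d P) ⊎ choose d P ≡ d
  choose-cases d P with em {∃ P}
  ... | yes (x , Px) = inj₁ Px
  ... | no  _        = inj₂ refl

  lim-unique : ∀ {s w} → Tends s w → lim s ≈ w
  lim-unique {s} {w} h = tends-unique (⟶⇒tends s (lim s) (choose-satisfies 0# (s ⟶_) (w , tends⇒⟶ s w h))) h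

  inverse-unique : ∀ {z w} → z * w ≈ 1# → z ⁻¹ ≈ w
  inverse-unique {z} {w} zw≈1 = begin
    z ⁻¹              ≈⟨ *-identityˡ _ ⟨
    1# * z ⁻¹         ≈⟨ *-congʳ zw≈1 ⟨
    z * w * z ⁻¹      ≈⟨ solve 3 (λ z w v → z :* w :* v := w :* (z :* v)) ≈-refl z w (z ⁻¹) ⟩
    w * (z * z ⁻¹)    ≈⟨ *-congˡ (choose-satisfies 0# (λ v → z * v ≈ 1#) (w , zw≈1)) ⟩
    w * 1#            ≈⟨ *-identityʳ w ⟩
    w                 ∎

  inverse-cases : ∀ z → z * z ⁻¹ ≈ 1# ⊎ z ⁻¹ ≡ 0#
  inverse-cases z = choose-cases 0# (λ w → z * w ≈ 1#)

  private
    apart : ∀ z → ¬ z ≈ 0# → ∃[ ε ] (0ℚ ℚ.< ε × ∃[ k ] ∀ n → k ≤ n → ε ℚ.≤ ‖ z ‖ n)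
    apart z z≉0 with em {∃[ ε ] (0ℚ ℚ.< ε × ∃[ k ] ∀ n → k ≤ n → ε ℚ.≤ ‖ z ‖ n)}
    ... | yes ap  = ap
    ... | no  ¬ap = contradiction (≼⇒≈ z 0# λ ε 0<ε → mk≼ (bound ε 0<ε)) z≉0
      where
      drift : ∀ m n → ‖ z ‖ n ℚ.≤ ‖ z ‖ m ℚ.+ (ℚ.∣ seq (Re z) m ℚ.- seq (Re z) n ∣ ℚ.+ ℚ.∣ seq (Im z) m ℚ.- seq (Im z) n ∣)
      drift m n = ℚ.≤-trans (ℚ.+-mono-≤ (one (seq (Re z) m) (seq (Re z) n)) (one (seq (Im z) m) (seq (Im z) n)))
        (ℚ.≤-reflexive (ℚS.solve 4 (λ a b c d → (a ℚS.:+ b) ℚS.:+ (c ℚS.:+ d) ℚS.:= (a ℚS.:+ c) ℚS.:+ (b ℚS.:+ d)) refl ℚ.∣ seq (Re z) m ∣ ℚ.∣ seq (Re z) m ℚ.- seq (Re z) n ∣ ℚ.∣ seq (Im z) m ∣ ℚ.∣ seq (Im z) m ℚ.- seq (Im z) n ∣))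
        where
        one : ∀ x y → ℚ.∣ y ∣ ℚ.≤ ℚ.∣ x ∣ ℚ.+ ℚ.∣ x ℚ.- y ∣
        one x y = ℚ.≤-trans (triangle x (ℚ.- (x ℚ.- y)) y (ℚS.solve 2 (λ x y → x ℚS.:+ ℚS.:- (x ℚS.:- y) ℚS.:= y) refl x y))
          (ℚ.≤-reflexive (cong (ℚ.∣ x ∣ ℚ.+_) (ℚ.∣-p∣≡∣p∣ (x ℚ.- y))))

      bound′ : ∀ ε → 0ℚ ℚ.< ε → ∃[ k ] ∀ n → k ≤ n → ‖ z ‖ n ℚ.≤ ε
      bound′ ε 0<ε =
        let δ = ½ ℚ.* ε
            0<δ = 0<½* ε 0<ε
            k , f = cauchy (Re z) (½ ℚ.* δ) (0<½* δ 0<δ)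
            l , g = cauchy (Im z) (½ ℚ.* δ) (0<½* δ 0<δ)
            K = k ⊔ l
        in case em {∃[ m ] (K ≤ m × ‖ z ‖ m ℚ.≤ δ)} of λ
          { (yes (m , K≤m , z≤δ)) → K , λ n K≤n → subst (‖ z ‖ n ℚ.≤_) (halve ε)
              (ℚ.≤-trans (drift m n) (ℚ.+-mono-≤ z≤δ (subst (_ ℚ.≤_) (halve δ) (ℚ.+-mono-≤
                (ℚ.<⇒≤ (f m n (ℕ.m⊔n≤o⇒m≤o k l K≤m) (ℕ.m⊔n≤o⇒m≤o k l K≤n)))
                (ℚ.<⇒≤ (g m n (ℕ.m⊔n≤o⇒n≤o k l K≤m) (ℕ.m⊔n≤o⇒n≤o k l K≤n)))))))
          ; (no none) → contradiction (δ , 0<δ , K , λ n K≤n → large none n K≤n) ¬ap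
          }
        where
        large : ∀ {K δ} → ¬ (∃[ m ] (K ≤ m × ‖ z ‖ m ℚ.≤ δ)) → ∀ n → K ≤ n → δ ℚ.≤ ‖ z ‖ n
        large {K} {δ} none n K≤n with ℚ.≤-total δ (‖ z ‖ n)
        ... | inj₁ le = le
        ... | inj₂ ge = contradiction (n , K≤n , ge) none

      bound : ∀ ε → 0ℚ ℚ.< ε → ∃[ k ] ∀ n → k ≤ n → ‖ z - 0# ‖ n ℚ.≤ ε
      bound ε 0<ε = let k , f = bound′ ε 0<ε in k , λ n k≤n →
        ℚ.≤-trans (ℚ.≤-reflexive (cong₂ (λ a b → ℚ.∣ a ∣ ℚ.+ ℚ.∣ b ∣) (ℚ.+-identityʳ (seq (Re z) n)) (ℚ.+-identityʳ (seq (Im z) n)))) (f n k≤n)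

    -- With ρ = a² + b², z = a + b i: ½ ‖z‖² ‖w‖ ≤ ρ ‖w‖ = ‖z̄ (z w)‖ ≤ ‖z‖ ‖z w‖.
    norm-* : ∀ z w n → ½ ℚ.* (‖ z ‖ n ℚ.* ‖ z ‖ n) ℚ.* ‖ w ‖ n ℚ.≤ ‖ z ‖ n ℚ.* ‖ z * w ‖ n
    norm-* z w n = begin′
      where
      a b c d ρ : ℚ
      a = seq (Re z) n
      b = seq (Im z) n
      c = seq (Re w) n
      d = seq (Im w) n
      ρ = a ℚ.* a ℚ.+ b ℚ.* b

      half≤ρ : ½ ℚ.* (‖ z ‖ n ℚ.* ‖ z ‖ n) ℚ.≤ ρ
      half≤ρ = ℚ.≤-trans (≤+ˡ (0≤* {½} (ℚ.nonNegative⁻¹ ½) (0≤square (ℚ.∣ a ∣ ℚ.- ℚ.∣ b ∣))))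
        (ℚ.≤-reflexive (trans (ℚS.solve 2 (λ x y → ℚS.con ½ ℚS.:* ((x ℚS.:+ y) ℚS.:* (x ℚS.:+ y)) ℚS.:+ ℚS.con ½ ℚS.:* ((x ℚS.:- y) ℚS.:* (x ℚS.:- y))
          ℚS.:= x ℚS.:* x ℚS.:+ y ℚS.:* y) refl ℚ.∣ a ∣ ℚ.∣ b ∣) (cong₂ ℚ._+_ (∣∣*∣∣ a) (∣∣*∣∣ b))))

      0≤ρ : 0ℚ ℚ.≤ ρ
      0≤ρ = 0≤+ (0≤square a) (0≤square b)

      ∣ρ*∣ : ∀ x → ρ ℚ.* ℚ.∣ x ∣ ≡ ℚ.∣ ρ ℚ.* x ∣
      ∣ρ*∣ x = trans (cong (ℚ._* ℚ.∣ x ∣) (sym (ℚ.0≤p⇒∣p∣≡p 0≤ρ))) (sym (ℚ.∣p*q∣≡∣p∣*∣q∣ ρ x))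

      ρw≡ : ρ ℚ.* ‖ w ‖ n ≡ ‖ conjugate z * (z * w) ‖ n
      ρw≡ = trans (ℚ.*-distribˡ-+ ρ ℚ.∣ c ∣ ℚ.∣ d ∣) (cong₂ ℚ._+_
        (trans (∣ρ*∣ c) (cong ℚ.∣_∣ (ℚS.solve 4 (λ a b c d → (a ℚS.:* a ℚS.:+ b ℚS.:* b) ℚS.:* c
          ℚS.:= a ℚS.:* (a ℚS.:* c ℚS.:- b ℚS.:* d) ℚS.:- (ℚS.:- b) ℚS.:* (a ℚS.:* d ℚS.:+ b ℚS.:* c)) refl a b c d)))
        (trans (∣ρ*∣ d) (cong ℚ.∣_∣ (ℚS.solve 4 (λ a b c d → (a ℚS.:* a ℚS.:+ b ℚS.:* b) ℚS.:* d
          ℚS.:= a ℚS.:* (a ℚS.:* d ℚS.:+ b ℚS.:* c) ℚS.:+ (ℚS.:- b) ℚS.:* (a ℚS.:* c ℚS.:- b ℚS.:* d)) refl a b c d))))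

      conjugate≡ : ‖ conjugate z ‖ n ≡ ‖ z ‖ n
      conjugate≡ = cong (ℚ.∣ a ∣ ℚ.+_) (ℚ.∣-p∣≡∣p∣ b)

      begin′ : ½ ℚ.* (‖ z ‖ n ℚ.* ‖ z ‖ n) ℚ.* ‖ w ‖ n ℚ.≤ ‖ z ‖ n ℚ.* ‖ z * w ‖ n
      begin′ = ℚ.≤-trans (ℚ.*-monoʳ-≤-nonNeg (‖ w ‖ n) {{ℚ.nonNegative (0≤‖‖ w n)}} half≤ρ)
        (ℚ.≤-trans (ℚ.≤-reflexive ρw≡) (ℚ.≤-trans (‖*‖ (conjugate z) (z * w) n)
          (ℚ.≤-reflexive (cong (ℚ._* ‖ z * w ‖ n) conjugate≡))))

    ‖-0‖ : ∀ w n → ‖ w - 0# ‖ n ≡ ‖ w ‖ n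
    ‖-0‖ w n = cong₂ (λ a b → ℚ.∣ a ∣ ℚ.+ ℚ.∣ b ∣) (ℚ.+-identityʳ (seq (Re w) n)) (ℚ.+-identityʳ (seq (Im w) n))

  abstract
    domain : ∀ z w → z * w ≈ 0# → z ≈ 0# ⊎ w ≈ 0#
    domain z w zw≈0 with em {z ≈ 0#}
    ... | yes z≈0 = inj₁ z≈0
    ... | no  z≉0 = inj₂ (≼⇒≈ w 0# λ δ 0<δ →
      let ε , 0<ε , k , ε≤z = apart z z≉0
          B , mk≼ (l , z≤B) = ≼-exists z
          c = ½ ℚ.* (ε ℚ.* ε)
          0<c = 0<½* (ε ℚ.* ε) (ℚ.≤-<-trans (ℚ.≤-reflexive (sym (ℚ.*-zeroʳ ε))) (ℚ.*-monoʳ-<-pos ε {{ℚ.positive 0<ε}} 0<ε))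
          0≤B = ≼⇒0≤ {z} (mk≼ (l , z≤B))
          η , 0<η , eq = divide (B ℚ.+ 1ℚ) (c ℚ.* δ) (ℚ.+-mono-≤-< 0≤B 0<1)
                           (ℚ.≤-<-trans (ℚ.≤-reflexive (sym (ℚ.*-zeroʳ c))) (ℚ.*-monoʳ-<-pos c {{ℚ.positive 0<c}} 0<δ))
          mk≼ (m , zw≤) = ≈⇒≼ zw≈0 η 0<η
          K = k ⊔ (l ⊔ m)
      in mk≼ (K , λ n K≤n →
        let k≤n = ℕ.m⊔n≤o⇒m≤o k (l ⊔ m) K≤n
            l≤n = ℕ.m⊔n≤o⇒m≤o l m (ℕ.m⊔n≤o⇒n≤o k (l ⊔ m) K≤n)
            m≤n = ℕ.m⊔n≤o⇒n≤o l m (ℕ.m⊔n≤o⇒n≤o k (l ⊔ m) K≤n)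
            εε≤ = *-mono-≤ (ℚ.<⇒≤ 0<ε) (0≤‖‖ z n) (ε≤z n k≤n) (ε≤z n k≤n)
            chain = ℚ.≤-trans (ℚ.*-monoʳ-≤-nonNeg (‖ w ‖ n) {{ℚ.nonNegative (0≤‖‖ w n)}}
                        (ℚ.*-monoˡ-≤-nonNeg ½ εε≤))
                      (ℚ.≤-trans (norm-* z w n)
                        (ℚ.≤-trans (*-mono-≤ (0≤‖‖ z n) (ℚ.<⇒≤ 0<η) (ℚ.≤-trans (z≤B n l≤n) (≤+ˡ (ℚ.<⇒≤ 0<1)))
                            (ℚ.≤-trans (ℚ.≤-reflexive (sym (‖-0‖ (z * w) n))) (zw≤ n m≤n)))
                          (ℚ.≤-reflexive eq)))
        in ℚ.≤-trans (ℚ.≤-reflexive (‖-0‖ w n)) (ℚ.*-cancelˡ-≤-pos c {{ℚ.positive 0<c}} chain)))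

  ℕ→ℂ-inverse : ∀ k → ℕ→ℂ (suc k) * ℚ→ℂ (inv k) ≈ 1#
  ℕ→ℂ-inverse k = ≈-trans (*-congʳ (≈-sym (fromℕ≈ℕ→ℂ (suc k)))) (invℂ-inverse k)

  ÷-inv : ∀ z k → z ÷ ℕ→ℂ (suc k) ≈ z * ℚ→ℂ (inv k)
  ÷-inv z k = *-congˡ (inverse-unique (ℕ→ℂ-inverse k))

  private
    factorial-term : ∀ k → ℕ→ℂ (k !) * term 1# k ≈ 1#
    factorial-term zero    = *-identityˡ 1#
    factorial-term (suc k) = begin
      ℕ→ℂ (suc k ℕ.* k !) * (1# * ℚ→ℂ (inv k) * term 1# k)
        ≡⟨ cong (λ q → ℚ→ℂ q * (1# * ℚ→ℂ (inv k) * term 1# k)) (trans (cong ℤ→ℚ (ℤ.pos-* (suc k) (k !))) (ℤ→ℚ-* (+ suc k) (+ (k !)))) ⟩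
      ℚ→ℂ (ℕ→ℚ (suc k) ℚ.* ℕ→ℚ (k !)) * (1# * ℚ→ℂ (inv k) * term 1# k)
        ≈⟨ *-congʳ (ℚ→ℂ-* (ℕ→ℚ (suc k)) (ℕ→ℚ (k !))) ⟩
      ℕ→ℂ (suc k) * ℕ→ℂ (k !) * (1# * ℚ→ℂ (inv k) * term 1# k)
        ≈⟨ solve 4 (λ a b c d → a :* b :* (con (+ 1) :* c :* d) := (a :* c) :* (b :* d)) ≈-refl _ _ _ _ ⟩
      (ℕ→ℂ (suc k) * ℚ→ℂ (inv k)) * (ℕ→ℂ (k !) * term 1# k)
        ≈⟨ *-cong (ℕ→ℂ-inverse k) (factorial-term k) ⟩
      1# * 1#
        ≈⟨ *-identityˡ 1# ⟩
      1# ∎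

    power-term : ∀ z k → z ^ k * term 1# k ≈ term z k
    power-term z zero    = *-identityˡ 1#
    power-term z (suc k) = ≈-trans
      (solve 4 (λ z p i t → z :* p :* (con (+ 1) :* i :* t) := z :* i :* (p :* t)) ≈-refl z (z ^ k) (ℚ→ℂ (inv k)) (term 1# k))
      (*-congˡ (power-term z k))

  abstract
    exp-unique : ∀ {z w} → Tends (λ n → ∑ n (term z)) w → exp z ≈ w
    exp-unique {z} h = lim-unique (tends-≈ (λ n → ≈-sym (≈-trans (ℂ∑.sum≈∑ n (λ k → z ^ k ÷ ℕ→ℂ (k !)))
      (ℂ∑.∑-cong n (λ k _ → ≈-trans (*-congˡ (inverse-unique (factorial-term k))) (power-term z k))))) h)

    exp-tends : ∀ z → Tends (λ n → ∑ n (term z)) (exp z)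
    exp-tends z =
      let w , h = exponential-converges z
      in null-≈ (λ n → +-congˡ (-‿cong (≈-sym (exp-unique h)))) h

    exp-+ : ∀ z w → exp (z + w) ≈ exp z * exp w
    exp-+ z w = exp-unique (exponential-product z w (exp-tends z) (exp-tends w))

    exp-cong : ∀ {z w} → z ≈ w → exp z ≈ exp w
    exp-cong {z} {w} z≈w = exp-unique (tends-≈ (λ n → ℂ∑.∑-cong n (λ k _ → term-cong (≈-sym z≈w) k)) (exp-tends w))

    exp-0 : ∀ {z} → z ≈ 0# → exp z ≈ 1#
    exp-0 z≈0 = ≈-trans (exp-cong z≈0) (exp-unique exponential-0)

  θ : ℂ
  θ = ℕ→ℂ 2 * ℝ→ℂ π * i

  -- If π were undefined, it would be 0 and exp (iπ) = 1; this possibility costs nothing below.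
  exp-iπ : exp (i * ℝ→ℂ π) ≈ - 1# ⊎ exp (i * ℝ→ℂ π) ≈ 1#
  exp-iπ = Sum⊎.map (λ (_ , eq , _) → eq)
    (λ π≡0 → exp-0 (≈-trans (*-congˡ (reflexive (cong ℝ→ℂ π≡0))) (zeroʳ i)))
    (choose-cases (ℚ→ℝ 0ℚ) (λ t →
        ℚ→ℝ 0ℚ <ℝ t
      × exp (i * ℝ→ℂ t) ≈ - 1#
      × (∀ t′ → ℚ→ℝ 0ℚ <ℝ t′ → t′ <ℝ t → ¬ exp (i * ℝ→ℂ t′) ≈ - 1#)))

  private
    2≈ : ℕ→ℂ 2 ≈ 1# + 1#
    2≈ = ≈-sym (fromℕ≈ℕ→ℂ 2)

    exp-half : ∀ {z} → z + z ≈ θ → (exp z ≈ - 1# ⊎ exp z ≈ 1#)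
    exp-half {z} 2z≈θ = Sum⊎.map (≈-trans (exp-cong z≈iπ)) (≈-trans (exp-cong z≈iπ)) exp-iπ
      where
      z≈iπ : z ≈ i * ℝ→ℂ π
      z≈iπ = half-unique ℂ-commutativeRing (invℂ-inverse 1) 2≈ 2z≈θ

    arg : ∀ M x → ℤ→ℂ x ÷ ℕ→ℂ (suc M) ≈ fromℤ x * ℚ→ℂ (inv M)
    arg M x = ≈-trans (÷-inv (ℤ→ℂ x) M) (*-congʳ (≈-sym (fromℤ≈ℤ→ℂ x)))

  abstract
    exp-θ : exp θ ≈ 1#
    exp-θ = begin
      exp θ                              ≈⟨ exp-cong (≈-trans (*-congʳ (*-congʳ 2≈)) (solve 2 (λ p i → con (+ 2) :* p :* i := i :* p :+ i :* p) ≈-refl (ℝ→ℂ π) i)) ⟩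
      exp (i * ℝ→ℂ π + i * ℝ→ℂ π)        ≈⟨ exp-+ (i * ℝ→ℂ π) (i * ℝ→ℂ π) ⟩
      exp (i * ℝ→ℂ π) * exp (i * ℝ→ℂ π)  ≈⟨ square exp-iπ ⟩
      1#                                 ∎
      where
      square : ∀ {z} → z ≈ - 1# ⊎ z ≈ 1# → z * z ≈ 1#
      square (inj₁ z≈-1) = ≈-trans (*-cong z≈-1 z≈-1) (solve 0 (:- con (+ 1) :* :- con (+ 1) := con (+ 1)) ≈-refl)
      square (inj₂ z≈1)  = ≈-trans (*-cong z≈1 z≈1) (*-identityˡ 1#)

    e-+ : ∀ K {M} → K ≡ suc M → ∀ x y → e K (x ℤ.+ y) ≈ e K x * e K y
    e-+ _ {M} refl x y = ≈-trans (exp-cong (begin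
      θ * (ℤ→ℂ (x ℤ.+ y) ÷ ℕ→ℂ (suc M))                 ≈⟨ *-congˡ (arg M (x ℤ.+ y)) ⟩
      θ * (fromℤ (x ℤ.+ y) * ℚ→ℂ (inv M))               ≈⟨ *-congˡ (*-congʳ (fromℤ-+ x y)) ⟩
      θ * ((fromℤ x + fromℤ y) * ℚ→ℂ (inv M))           ≈⟨ solve 4 (λ t x y k → t :* ((x :+ y) :* k) := t :* (x :* k) :+ t :* (y :* k)) ≈-refl θ (fromℤ x) (fromℤ y) (ℚ→ℂ (inv M)) ⟩
      θ * (fromℤ x * ℚ→ℂ (inv M)) + θ * (fromℤ y * ℚ→ℂ (inv M))
        ≈⟨ +-cong (*-congˡ (arg M x)) (*-congˡ (arg M y)) ⟨
      θ * (ℤ→ℂ x ÷ ℕ→ℂ (suc M)) + θ * (ℤ→ℂ y ÷ ℕ→ℂ (suc M)) ∎)) (exp-+ _ _)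

    e-0 : ∀ K {M} → K ≡ suc M → e K (+ 0) ≈ 1#
    e-0 _ {M} refl = exp-0 (begin
      θ * (ℤ→ℂ (+ 0) ÷ ℕ→ℂ (suc M))  ≈⟨ *-congˡ (zeroˡ _) ⟩
      θ * 0#                         ≈⟨ zeroʳ θ ⟩
      0#                             ∎)

    e-period : ∀ K {M} → K ≡ suc M → e K (+ K) ≈ 1#
    e-period _ {M} refl = ≈-trans (exp-cong (≈-trans (*-congˡ (≈-trans (arg M (+ suc M)) (invℂ-inverse M))) (*-identityʳ θ))) exp-θ

    inv-double : ∀ M → (1# + 1#) * ℚ→ℂ (inv (M ℕ.+ suc (M ℕ.+ 0))) ≈ ℚ→ℂ (inv M)
    inv-double M = begin
      (1# + 1#) * j                     ≈⟨ *-identityˡ _ ⟨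
      1# * ((1# + 1#) * j)              ≈⟨ *-congʳ (invℂ-inverse M) ⟨
      n * k * ((1# + 1#) * j)           ≈⟨ solve 3 (λ n k j → n :* k :* (con (+ 2) :* j) := con (+ 2) :* n :* j :* k) ≈-refl n k j ⟩
      (1# + 1#) * n * j * k             ≈⟨ *-congʳ (*-congʳ (fromℤ-* (+ 2) (+ suc M))) ⟨
      fromℤ (+ 2 ℤ.* + suc M) * j * k   ≈⟨ *-congʳ (invℂ-inverse (M ℕ.+ suc (M ℕ.+ 0))) ⟩
      1# * k                            ≈⟨ *-identityˡ k ⟩
      k                                 ∎
      where
      n k j : ℂ
      n = fromℤ (+ suc M)
      k = ℚ→ℂ (inv M)
      j = ℚ→ℂ (inv (M ℕ.+ suc (M ℕ.+ 0)))

    e-double : ∀ M x → e (2 ℕ.* suc M) (+ 2 ℤ.* x) ≈ e (suc M) x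
    e-double M x = exp-cong (*-congˡ (begin
      ℤ→ℂ (+ 2 ℤ.* x) ÷ ℕ→ℂ (2 ℕ.* suc M)      ≈⟨ arg (M ℕ.+ suc (M ℕ.+ 0)) (+ 2 ℤ.* x) ⟩
      fromℤ (+ 2 ℤ.* x) * j                    ≈⟨ *-congʳ (fromℤ-* (+ 2) x) ⟩
      (1# + 1#) * fromℤ x * j                  ≈⟨ solve 2 (λ x j → con (+ 2) :* x :* j := x :* (con (+ 2) :* j)) ≈-refl (fromℤ x) j ⟩
      fromℤ x * ((1# + 1#) * j)                ≈⟨ *-congˡ (inv-double M) ⟩
      fromℤ x * ℚ→ℂ (inv M)                    ≈⟨ arg M x ⟨
      ℤ→ℂ x ÷ ℕ→ℂ (suc M)                      ∎))
      where
      j : ℂ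
      j = ℚ→ℂ (inv (M ℕ.+ suc (M ℕ.+ 0)))

    e-half : ∀ M → e (2 ℕ.* suc M) (+ suc M) ≈ - 1# ⊎ e (2 ℕ.* suc M) (+ suc M) ≈ 1#
    e-half M = exp-half (begin
      θ * (ℤ→ℂ (+ suc M) ÷ ℕ→ℂ (2 ℕ.* suc M)) + θ * (ℤ→ℂ (+ suc M) ÷ ℕ→ℂ (2 ℕ.* suc M))
        ≈⟨ +-cong (*-congˡ (arg M′ (+ suc M))) (*-congˡ (arg M′ (+ suc M))) ⟩
      θ * (fromℤ (+ suc M) * j) + θ * (fromℤ (+ suc M) * j)
        ≈⟨ solve 3 (λ t n j → t :* (n :* j) :+ t :* (n :* j) := t :* (n :* (con (+ 2) :* j))) ≈-refl θ (fromℤ (+ suc M)) j ⟩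
      θ * (fromℤ (+ suc M) * ((1# + 1#) * j))
        ≈⟨ *-congˡ (≈-trans (*-congˡ (inv-double M)) (invℂ-inverse M)) ⟩
      θ * 1#
        ≈⟨ *-identityʳ θ ⟩
      θ ∎)
      where
      M′ : ℕ
      M′ = M ℕ.+ suc (M ℕ.+ 0)

      j : ℂ
      j = ℚ→ℂ (inv M′)

-- Character sums over G_γ

module ℤS = ℤSolver.+-*-Solver

open Signed using () renaming (_∣_ to _∣ˢ_)

2·_ : ℤ² → ℤ²
2· u = u ⊕ u

module Lattice {N : ℕ} (γ : Γ N) where
  open Γ γ using (matrix; trace)
  open Mat matrix
  open ℤᴹ using (_▹_)

  φ : ℤ² → ℤ²
  φ u = u ▹ matrix ⊖ u

  abstract
    N≡ : + N ≡ a ℤ.+ d ℤ.- + 2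
    N≡ = trans (ℤS.solve 1 (λ n → n ℤS.:= (n ℤS.:+ ℤS.con (+ 2)) ℤS.:- ℤS.con (+ 2)) refl (+ N)) (cong (ℤ._- + 2) (sym trace))

    φ-⊕ : ∀ u v → φ (u ⊕ v) ≡ φ u ⊕ φ v
    φ-⊕ (u₁ , u₂) (v₁ , v₂) = cong₂ _,_
      (ℤS.solve 6 (λ u₁ u₂ v₁ v₂ a c → (u₁ ℤS.:+ v₁) ℤS.:* a ℤS.:+ (u₂ ℤS.:+ v₂) ℤS.:* c ℤS.:- (u₁ ℤS.:+ v₁)
        ℤS.:= (u₁ ℤS.:* a ℤS.:+ u₂ ℤS.:* c ℤS.:- u₁) ℤS.:+ (v₁ ℤS.:* a ℤS.:+ v₂ ℤS.:* c ℤS.:- v₁)) refl u₁ u₂ v₁ v₂ a c)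
      (ℤS.solve 6 (λ u₁ u₂ v₁ v₂ b d → (u₁ ℤS.:+ v₁) ℤS.:* b ℤS.:+ (u₂ ℤS.:+ v₂) ℤS.:* d ℤS.:- (u₂ ℤS.:+ v₂)
        ℤS.:= (u₁ ℤS.:* b ℤS.:+ u₂ ℤS.:* d ℤS.:- u₂) ℤS.:+ (v₁ ℤS.:* b ℤS.:+ v₂ ℤS.:* d ℤS.:- v₂)) refl u₁ u₂ v₁ v₂ b d)

    φ-⊝ : ∀ u → φ (⊝ u) ≡ ⊝ (φ u)
    φ-⊝ (u₁ , u₂) = cong₂ _,_
      (ℤS.solve 4 (λ u₁ u₂ a c → (ℤS.:- u₁) ℤS.:* a ℤS.:+ (ℤS.:- u₂) ℤS.:* c ℤS.:- (ℤS.:- u₁)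
        ℤS.:= ℤS.:- (u₁ ℤS.:* a ℤS.:+ u₂ ℤS.:* c ℤS.:- u₁)) refl u₁ u₂ a c)
      (ℤS.solve 4 (λ u₁ u₂ b d → (ℤS.:- u₁) ℤS.:* b ℤS.:+ (ℤS.:- u₂) ℤS.:* d ℤS.:- (ℤS.:- u₂)
        ℤS.:= ℤS.:- (u₁ ℤS.:* b ℤS.:+ u₂ ℤS.:* d ℤS.:- u₂)) refl u₁ u₂ b d)

  infix 4 _~_

  record _~_ (u v : ℤ²) : Set where
    constructor mk~
    field
      difference : InΛ γ (u ⊖ v)

  open _~_ public

  abstract
    Λ-intro : ∀ u → + N ∣ˢ proj₁ (φ u) → + N ∣ˢ proj₂ (φ u) → InΛ γ u
    Λ-intro u p q = Signed.∣⇒∣ᵤ p , Signed.∣⇒∣ᵤ q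

    Λ-elim : ∀ u → InΛ γ u → + N ∣ˢ proj₁ (φ u) × + N ∣ˢ proj₂ (φ u)
    Λ-elim u (p , q) = Signed.∣ᵤ⇒∣ p , Signed.∣ᵤ⇒∣ q

    Λ-⊕ : ∀ u v → InΛ γ u → InΛ γ v → InΛ γ (u ⊕ v)
    Λ-⊕ u v p q = let p₁ , p₂ = Λ-elim u p; q₁ , q₂ = Λ-elim v q in Λ-intro (u ⊕ v)
      (subst (+ N ∣ˢ_) (sym (cong proj₁ (φ-⊕ u v))) (Signed.∣m∣n⇒∣m+n p₁ q₁))
      (subst (+ N ∣ˢ_) (sym (cong proj₂ (φ-⊕ u v))) (Signed.∣m∣n⇒∣m+n p₂ q₂))

    Λ-⊝ : ∀ u → InΛ γ u → InΛ γ (⊝ u)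
    Λ-⊝ u p = let p₁ , p₂ = Λ-elim u p in Λ-intro (⊝ u)
      (subst (+ N ∣ˢ_) (sym (cong proj₁ (φ-⊝ u))) (Signed.∣m⇒∣-m p₁))
      (subst (+ N ∣ˢ_) (sym (cong proj₂ (φ-⊝ u))) (Signed.∣m⇒∣-m p₂))

    Λ-𝟎 : InΛ γ 𝟎
    Λ-𝟎 = ℕ._∣0 N , ℕ._∣0 N

    multiple∈Λ : ∀ u → + N ∣ˢ proj₁ u → + N ∣ˢ proj₂ u → InΛ γ u
    multiple∈Λ u p q = Λ-intro u
      (Signed.∣m∣n⇒∣m-n (Signed.∣m∣n⇒∣m+n (Signed.∣m⇒∣m*n a p) (Signed.∣m⇒∣m*n c q)) p)
      (Signed.∣m∣n⇒∣m-n (Signed.∣m∣n⇒∣m+n (Signed.∣m⇒∣m*n b p) (Signed.∣m⇒∣m*n d q)) q)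

  Λ-≡ : ∀ {u v} → u ≡ v → InΛ γ u → InΛ γ v
  Λ-≡ refl p = p

  ℤ²-ext : ∀ {u v : ℤ²} → proj₁ u ≡ proj₁ v → proj₂ u ≡ proj₂ v → u ≡ v
  ℤ²-ext = cong₂ _,_

  ~-refl : ∀ {u} → u ~ u
  ~-refl {u} = mk~ $ Λ-≡ {𝟎} {u ⊖ u} (ℤ²-ext (sym (ℤ.+-inverseʳ (proj₁ u))) (sym (ℤ.+-inverseʳ (proj₂ u)))) Λ-𝟎

  ~-reflexive : ∀ {u v} → u ≡ v → u ~ v
  ~-reflexive refl = ~-refl

  private
    swap : ∀ x y → ℤ.- (x ℤ.- y) ≡ y ℤ.- x
    swap = ℤS.solve 2 (λ x y → ℤS.:- (x ℤS.:- y) ℤS.:= y ℤS.:- x) refl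

    chain : ∀ x y z → (x ℤ.- y) ℤ.+ (y ℤ.- z) ≡ x ℤ.- z
    chain = ℤS.solve 3 (λ x y z → (x ℤS.:- y) ℤS.:+ (y ℤS.:- z) ℤS.:= x ℤS.:- z) refl

    pairs : ∀ x y z w → (x ℤ.- y) ℤ.+ (z ℤ.- w) ≡ (x ℤ.+ z) ℤ.- (y ℤ.+ w)
    pairs = ℤS.solve 4 (λ x y z w → (x ℤS.:- y) ℤS.:+ (z ℤS.:- w) ℤS.:= (x ℤS.:+ z) ℤS.:- (y ℤS.:+ w)) refl

    negs : ∀ x y → ℤ.- (x ℤ.- y) ≡ (ℤ.- x) ℤ.- (ℤ.- y)
    negs = ℤS.solve 2 (λ x y → ℤS.:- (x ℤS.:- y) ℤS.:= (ℤS.:- x) ℤS.:- (ℤS.:- y)) refl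

  ~-sym : ∀ {u v} → u ~ v → v ~ u
  ~-sym {u} {v} (mk~ p) = mk~ $ Λ-≡ {⊝ (u ⊖ v)} {v ⊖ u} (ℤ²-ext (swap (proj₁ u) (proj₁ v)) (swap (proj₂ u) (proj₂ v))) (Λ-⊝ (u ⊖ v) p)

  ~-trans : ∀ {u v w} → u ~ v → v ~ w → u ~ w
  ~-trans {u} {v} {w} (mk~ p) (mk~ q) = mk~ $ Λ-≡ {(u ⊖ v) ⊕ (v ⊖ w)} {u ⊖ w} (ℤ²-ext (chain (proj₁ u) (proj₁ v) (proj₁ w)) (chain (proj₂ u) (proj₂ v) (proj₂ w))) (Λ-⊕ (u ⊖ v) (v ⊖ w) p q)

  ~-⊕ : ∀ {u v u′ v′} → u ~ v → u′ ~ v′ → u ⊕ u′ ~ v ⊕ v′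
  ~-⊕ {u} {v} {u′} {v′} (mk~ p) (mk~ q) = mk~ $ Λ-≡ {(u ⊖ v) ⊕ (u′ ⊖ v′)} {(u ⊕ u′) ⊖ (v ⊕ v′)} (ℤ²-ext (pairs (proj₁ u) (proj₁ v) (proj₁ u′) (proj₁ v′)) (pairs (proj₂ u) (proj₂ v) (proj₂ u′) (proj₂ v′))) (Λ-⊕ (u ⊖ v) (u′ ⊖ v′) p q)

  ~-⊝ : ∀ {u v} → u ~ v → ⊝ u ~ ⊝ v
  ~-⊝ {u} {v} (mk~ p) = mk~ $ Λ-≡ {⊝ (u ⊖ v)} {(⊝ u) ⊖ (⊝ v)} (ℤ²-ext (negs (proj₁ u) (proj₁ v)) (negs (proj₂ u) (proj₂ v))) (Λ-⊝ (u ⊖ v) p)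

  ~-⊖ : ∀ {u v u′ v′} → u ~ v → u′ ~ v′ → u ⊖ u′ ~ v ⊖ v′
  ~-⊖ p q = ~-⊕ p (~-⊝ q)

  Λ⇒~𝟎 : ∀ {u} → InΛ γ u → u ~ 𝟎
  Λ⇒~𝟎 {u} p = mk~ (Λ-≡ {u} {u ⊖ 𝟎} (ℤ²-ext (sym (ℤ.+-identityʳ (proj₁ u))) (sym (ℤ.+-identityʳ (proj₂ u)))) p)

  ~𝟎⇒Λ : ∀ {u} → u ~ 𝟎 → InΛ γ u
  ~𝟎⇒Λ {u} (mk~ p) = Λ-≡ {u ⊖ 𝟎} {u} (ℤ²-ext (ℤ.+-identityʳ (proj₁ u)) (ℤ.+-identityʳ (proj₂ u))) p

  quotientSetoid : DecSetoid 0ℓ 0ℓ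
  quotientSetoid = record
    { Carrier = ℤ²
    ; _≈_ = λ u v → InΛ γ (u ⊖ v)
    ; isDecEquivalence = record
      { isEquivalence = record
        { refl  = λ {u} → difference (~-refl {u})
        ; sym   = λ {u} {v} p → difference (~-sym {u} {v} (mk~ p))
        ; trans = λ {u} {v} {w} p q → difference (~-trans {u} {v} {w} (mk~ p) (mk~ q))
        }
      ; _≟_ = λ u v → InΛ? γ (u ⊖ v)
      }
    }

  reps : List ℤ²
  reps = representatives γ

  reps-distinct : AllPairs (λ u v → ¬ u ~ v) reps
  reps-distinct = AllPairs.map (λ u≁v u~v → u≁v (difference u~v)) $ deduplicate-! quotientSetoid (cartesianProduct (map +_ (upTo N)) (map +_ (upTo N)))

  reps-complete : .{{_ : ℕ.NonZero N}} → ∀ u → ∃[ v ] (v ∈ reps × v ~ u)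
  reps-complete u@(u₁ , u₂) =
    let w , w∈ , w~v = find (Any.deduplicate⁺ (λ u v → InΛ? γ (u ⊖ v)) {P = _~ v}
          (λ {x} {y} y~x x~v → ~-trans {y} {x} {v} (mk~ y~x) x~v) (lose {P = _~ v} v∈ (~-refl {v})))
    in w , w∈ , ~-trans w~v (~-sym {u} {v} (mk~ (multiple∈Λ (u ⊖ v) (remainder u₁) (remainder u₂))))
    where
    v : ℤ²
    v = + (u₁ ℤ.%ℕ N) , + (u₂ ℤ.%ℕ N)

    v∈ : v ∈ cartesianProduct (map +_ (upTo N)) (map +_ (upTo N))
    v∈ = ∈-cartesianProduct⁺ (∈-map⁺ +_ (∈-upTo⁺ (ℤ.n%ℕd<d u₁ N))) (∈-map⁺ +_ (∈-upTo⁺ (ℤ.n%ℕd<d u₂ N)))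

    remainder : ∀ x → + N ∣ˢ x ℤ.- + (x ℤ.%ℕ N)
    remainder x = Signed.divides (x ℤ./ℕ N)
      (trans (cong (ℤ._- + (x ℤ.%ℕ N)) (ℤ.a≡a%ℕn+[a/ℕn]*n x N))
        (ℤS.solve 3 (λ r q n → (r ℤS.:+ q ℤS.:* n) ℤS.:- r ℤS.:= q ℤS.:* n) refl (+ (x ℤ.%ℕ N)) (x ℤ./ℕ N) (+ N)))

∈⇒↭ : ∀ {B : Set} {x : B} {l} → x ∈ l → ∃[ l′ ] l ↭ x ∷ l′
∈⇒↭ {x = x} x∈ with ∈-∃++ x∈
... | ys , zs , refl = ys ++ zs , Perm.shift x ys zs

module ListSums (R : CommutativeRing 0ℓ 0ℓ) {B : Set} where
  open CommutativeRing R renaming (Carrier to A; refl to ≈-refl; sym to ≈-sym; trans to ≈-trans)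
  open IntegerScalars R
  open SetoidReasoning setoid
  open Solver using (solve; con; _:=_; _:+_; _:*_)

  ΣL : List B → (B → A) → A
  ΣL l F = foldr (λ x acc → F x + acc) 0# l

  ΣL-cong : ∀ l {F G} → (∀ x → x ∈ l → F x ≈ G x) → ΣL l F ≈ ΣL l G
  ΣL-cong []      h = ≈-refl
  ΣL-cong (x ∷ l) h = +-cong (h x (here refl)) (ΣL-cong l (λ y y∈ → h y (there y∈)))

  ΣL-+ : ∀ l F G → ΣL l (λ x → F x + G x) ≈ ΣL l F + ΣL l G
  ΣL-+ []      F G = ≈-sym (+-identityˡ 0#)
  ΣL-+ (x ∷ l) F G = ≈-trans (+-congˡ (ΣL-+ l F G))
    (solve 4 (λ a b c d → a :+ b :+ (c :+ d) := a :+ c :+ (b :+ d)) ≈-refl _ _ _ _)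

  *-ΣL : ∀ l c F → c * ΣL l F ≈ ΣL l (λ x → c * F x)
  *-ΣL []      c F = zeroʳ c
  *-ΣL (x ∷ l) c F = ≈-trans (distribˡ _ _ _) (+-congˡ (*-ΣL l c F))

  ΣL-zero : ∀ l {F} → (∀ x → x ∈ l → F x ≈ 0#) → ΣL l F ≈ 0#
  ΣL-zero []      h = ≈-refl
  ΣL-zero (x ∷ l) h = ≈-trans (+-cong (h x (here refl)) (ΣL-zero l (λ y y∈ → h y (there y∈)))) (+-identityˡ 0#)

  ΣL-const : ∀ l c → ΣL l (λ _ → c) ≈ fromℤ (+ length l) * c
  ΣL-const []      c = ≈-sym (zeroˡ c)
  ΣL-const (x ∷ l) c = begin
    c + ΣL l (λ _ → c)                       ≈⟨ +-cong (≈-sym (*-identityˡ c)) (ΣL-const l c) ⟩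
    1# * c + fromℤ (+ length l) * c          ≈⟨ distribʳ c _ _ ⟨
    (1# + fromℤ (+ length l)) * c            ≈⟨ *-congʳ (fromℤ-+ (+ 1) (+ length l)) ⟨
    fromℤ (+ suc (length l)) * c             ∎

  ΣL-swap : ∀ l l′ (F : B → B → A) → ΣL l (λ x → ΣL l′ (F x)) ≈ ΣL l′ (λ y → ΣL l (λ x → F x y))
  ΣL-swap []      l′ F = ≈-sym (ΣL-zero l′ (λ _ _ → ≈-refl))
  ΣL-swap (x ∷ l) l′ F = ≈-trans (+-congˡ (ΣL-swap l l′ F)) (≈-sym (ΣL-+ l′ (F x) (λ y → ΣL l (λ x → F x y))))

  ΣL-map : ∀ l (f : B → B) F → ΣL (map f l) F ≈ ΣL l (F ∘ f)
  ΣL-map []      f F = ≈-refl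
  ΣL-map (x ∷ l) f F = +-congˡ (ΣL-map l f F)

  ΣL-↭ : ∀ {l l′} → l ↭ l′ → ∀ F → ΣL l F ≈ ΣL l′ F
  ΣL-↭ _↭_.refl         F = ≈-refl
  ΣL-↭ (_↭_.prep x p)   F = +-congˡ (ΣL-↭ p F)
  ΣL-↭ (_↭_.swap x y p) F = ≈-trans (+-congˡ (+-congˡ (ΣL-↭ p F)))
    (solve 3 (λ a b c → a :+ (b :+ c) := b :+ (a :+ c)) ≈-refl _ _ _)
  ΣL-↭ (_↭_.trans p q)  F = ≈-trans (ΣL-↭ p F) (ΣL-↭ q F)

  module Transversals (_~_ : B → B → Set) (~-refl : ∀ {x} → x ~ x) (~-sym : ∀ {x y} → x ~ y → y ~ x)
                      (~-trans : ∀ {x y z} → x ~ y → y ~ z → x ~ z) where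

    Distinct : List B → Set
    Distinct = AllPairs (λ x y → ¬ x ~ y)

    Distinct-↭ : ∀ {l l′} → l ↭ l′ → Distinct l → Distinct l′
    Distinct-↭ _↭_.refl         d                            = d
    Distinct-↭ (_↭_.prep x p)   (x≁ ∷ d)                     = Perm.All-resp-↭ p x≁ ∷ Distinct-↭ p d
    Distinct-↭ (_↭_.swap x y p) ((x≁y ∷ x≁) ∷ (y≁ ∷ d))      =
      ((x≁y ∘ ~-sym) ∷ Perm.All-resp-↭ p y≁) ∷ (Perm.All-resp-↭ p x≁ ∷ Distinct-↭ p d)
    Distinct-↭ (_↭_.trans p q)  d                            = Distinct-↭ q (Distinct-↭ p d)

    transversal-sum : ∀ l l′ → Distinct l → Distinct l′ →
                      (∀ {x} → x ∈ l → ∃[ y ] (y ∈ l′ × y ~ x)) → (∀ {y} → y ∈ l′ → ∃[ x ] (x ∈ l × x ~ y)) →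
                      ∀ {F} → (∀ {x y} → x ~ y → F x ≈ F y) → ΣL l F ≈ ΣL l′ F
    transversal-sum []      []       _        _  _ _ _ = ≈-refl
    transversal-sum []      (y ∷ l′) _        _  _ g _ with g (here refl)
    ... | _ , () , _
    transversal-sum (x ∷ l) l′       (x≁ ∷ d) d′ f g {F} F-cong with f (here refl)
    ... | y , y∈ , y~x with ∈⇒↭ y∈
    ...   | l″ , perm = begin
      F x + ΣL l F    ≈⟨ +-cong (F-cong (~-sym y~x)) (transversal-sum l l″ d (AllPairs.tail dy) f′ g′ F-cong) ⟩
      F y + ΣL l″ F   ≈⟨ ΣL-↭ perm F ⟨
      ΣL l′ F         ∎
      where
      dy : Distinct (y ∷ l″)
      dy = Distinct-↭ perm d′

      f′ : ∀ {z} → z ∈ l → ∃[ w ] (w ∈ l″ × w ~ z)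
      f′ z∈ with f (there z∈)
      ... | w , w∈ , w~z with Perm.∈-resp-↭ perm w∈
      ...   | here refl = contradiction (~-trans (~-sym y~x) w~z) (All.lookup x≁ z∈)
      ...   | there w∈″ = w , w∈″ , w~z

      g′ : ∀ {w} → w ∈ l″ → ∃[ z ] (z ∈ l × z ~ w)
      g′ w∈ with g (Perm.∈-resp-↭ (↭-sym perm) (there w∈))
      ... | z , here refl , z~w = contradiction (~-trans y~x z~w) (All.lookup (AllPairs.head dy) w∈)
      ... | z , there z∈ , z~w = z , z∈ , z~w

    sum-of-support : ∀ l {F x₀} → x₀ ∈ l → Distinct l → (∀ x → ¬ x ~ x₀ → F x ≈ 0#) → ΣL l F ≈ F x₀
    sum-of-support l {F} {x₀} x₀∈ d F≈0 = let l′ , perm = ∈⇒↭ x₀∈ in begin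
      ΣL l F           ≈⟨ ΣL-↭ perm F ⟩
      F x₀ + ΣL l′ F   ≈⟨ +-congˡ (ΣL-zero l′ (λ x x∈ → F≈0 x
                            (λ x~x₀ → All.lookup (AllPairs.head (Distinct-↭ perm d)) x∈ (~-sym x~x₀)))) ⟩
      F x₀ + 0#        ≈⟨ +-identityʳ (F x₀) ⟩
      F x₀             ∎

    -- The terms of the sum are grouped along the orbits of the involution σ.
    involution-sum : ∀ (Q : A → Set) → (∀ {r s} → r ≈ s → Q r → Q s) → Q 0# → (∀ {r s} → Q r → Q s → Q (r + s)) →
                     ∀ (σ : B → B) → (∀ {x y} → x ~ y → σ x ~ σ y) → (∀ x → σ (σ x) ~ x) →
                     ∀ (F : B → A) → (∀ x y → y ~ σ x → Q (F x + F y)) →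
                     ∀ l → Distinct l → (∀ {x} → x ∈ l → ∃[ y ] (y ∈ l × y ~ σ x)) →
                     (∀ {x} → x ∈ l → x ~ σ x → Q (F x)) → Q (ΣL l F)
    involution-sum Q Q-resp Q-0 Q-+ σ σ-cong σσ~ F F-pair l = go (length l) l ℕ.≤-refl
      where
      go : ∀ n l → length l ≤ n → Distinct l → (∀ {x} → x ∈ l → ∃[ y ] (y ∈ l × y ~ σ x)) →
           (∀ {x} → x ∈ l → x ~ σ x → Q (F x)) → Q (ΣL l F)
      go n       []      _          _        _      _     = Q-0
      go (suc n) (x ∷ l) (s≤s l≤n) (x≁ ∷ d) closed fixed with closed (here refl)
      ... | y , here refl , x~σx = Q-+ (fixed (here refl) x~σx) (go n l l≤n d closed′ (fixed ∘ there))
        where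
        closed′ : ∀ {w} → w ∈ l → ∃[ z ] (z ∈ l × z ~ σ w)
        closed′ w∈ with closed (there w∈)
        ... | z , there z∈ , z~σw = z , z∈ , z~σw
        ... | z , here refl , x~σw = contradiction
          (~-trans x~σx (~-trans (σ-cong x~σw) (σσ~ _))) (All.lookup x≁ w∈)
      ... | y , there y∈ , y~σx with ∈⇒↭ y∈
      ...   | l″ , perm = Q-resp
          (≈-trans (+-assoc (F x) (F y) (ΣL l″ F)) (+-congˡ (≈-sym (ΣL-↭ perm F))))
          (Q-+ (F-pair x y y~σx) (go n l″ (ℕ.≤-trans (ℕ.n≤1+n _) (ℕ.≤-trans (ℕ.≤-reflexive (sym (Perm.↭-length perm))) l≤n))
            (AllPairs.tail dy) closed′ (λ w∈ → fixed (there (Perm.∈-resp-↭ (↭-sym perm) (there w∈))))))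
        where
        dy : Distinct (y ∷ l″)
        dy = Distinct-↭ perm d

        closed′ : ∀ {w} → w ∈ l″ → ∃[ z ] (z ∈ l″ × z ~ σ w)
        closed′ {w} w∈ with closed (there (Perm.∈-resp-↭ (↭-sym perm) (there w∈)))
        ... | z , here refl , x~σw = contradiction
          (~-trans y~σx (~-trans (σ-cong x~σw) (σσ~ w))) (All.lookup (AllPairs.head dy) w∈)
        ... | z , there z∈ , z~σw with Perm.∈-resp-↭ perm z∈
        ...   | there z∈″ = z , z∈″ , z~σw
        ...   | here refl = contradiction
          (~-trans (~-sym (σσ~ x)) (~-trans (σ-cong (~-trans (~-sym y~σx) z~σw)) (σσ~ w)))
          (All.lookup x≁ (Perm.∈-resp-↭ (↭-sym perm) (there w∈)))

module RootsOfUnity (R : CommutativeRing 0ℓ 0ℓ) (M : ℕ) where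
  open CommutativeRing R renaming (Carrier to A; refl to ≈-refl; sym to ≈-sym; trans to ≈-trans)
  open Spans R
  open Exp semiring using (_^_)
  open Solver using (solve; con; _:=_; _:+_; _:*_; _:-_; :-_)

  N : ℕ
  N = suc M

  infix 4 _≈±_

  _≈±_ : A → A → Set
  z ≈± w = z ≈ w ⊎ z ≈ - w

  ±-refl : ∀ {z} → z ≈± z
  ±-refl = inj₁ ≈-refl

  ±-sym : ∀ {z w} → z ≈± w → w ≈± z
  ±-sym {z} {w} = Sum⊎.map ≈-sym (λ z≈-w → ≈-trans (solve 1 (λ w → w := :- (:- w)) ≈-refl w) (-‿cong (≈-sym z≈-w)))

  ±-trans : ∀ {z w v} → z ≈± w → w ≈± v → z ≈± v
  ±-trans (inj₁ p) = Sum⊎.map (≈-trans p) (≈-trans p)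
  ±-trans {v = v} (inj₂ p) (inj₁ q) = inj₂ (≈-trans p (-‿cong q))
  ±-trans {v = v} (inj₂ p) (inj₂ q) = inj₁ (≈-trans p (≈-trans (-‿cong q) (solve 1 (λ v → :- (:- v) := v) ≈-refl v)))

  ±-* : ∀ {z w z′ w′} → z ≈± w → z′ ≈± w′ → z * z′ ≈± w * w′
  ±-* (inj₁ p) (inj₁ q) = inj₁ (*-cong p q)
  ±-* {w = w} {w′ = w′} (inj₁ p) (inj₂ q) = inj₂ (≈-trans (*-cong p q) (solve 2 (λ w v → w :* :- v := :- (w :* v)) ≈-refl w w′))
  ±-* {w = w} {w′ = w′} (inj₂ p) (inj₁ q) = inj₂ (≈-trans (*-cong p q) (solve 2 (λ w v → :- w :* v := :- (w :* v)) ≈-refl w w′))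
  ±-* {w = w} {w′ = w′} (inj₂ p) (inj₂ q) = inj₁ (≈-trans (*-cong p q) (solve 2 (λ w v → :- w :* :- v := w :* v) ≈-refl w w′))

  ±-≈ : ∀ {z w} → z ≈ w → z ≈± w
  ±-≈ = inj₁

  ±1-power : ∀ z → z ≈± 1# → ∀ n → z ^ n ≈± 1#
  ±1-power z z± zero    = ±-refl
  ±1-power z z± (suc n) = ±-trans (±-* z± (±1-power z z± n)) (±-≈ (*-identityˡ 1#))

  multiple≈1 : (h : ℤ → A) → (∀ k l → h (k ℤ.+ l) ≈ h k * h l) → h (+ 0) ≈ 1# →
               ∀ {m} → h (+ m) ≈ 1# → ∀ q → h (q ℤ.* + m) ≈ 1#
  multiple≈1 h h-+ h-0 {m} h-m (+ zero)  = h-0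
  multiple≈1 h h-+ h-0 {m} h-m (+ suc n) = ≈-trans (≈-trans (reflexive (cong h (ℤ.suc-* (+ n) (+ m)))) (h-+ (+ m) (+ n ℤ.* + m)))
    (≈-trans (*-cong h-m (multiple≈1 h h-+ h-0 h-m (+ n))) (*-identityˡ 1#))
  multiple≈1 h h-+ h-0 {m} h-m -[1+ zero ] = ≈-trans (≈-sym (*-identityˡ _)) (≈-trans (*-congʳ (≈-sym h-m))
    (≈-trans (≈-sym (h-+ (+ m) (-[1+ 0 ] ℤ.* + m)))
      (≈-trans (reflexive (cong h (ℤS.solve 1 (λ m → m ℤS.:+ ℤS.con -[1+ 0 ] ℤS.:* m ℤS.:= ℤS.con (+ 0)) refl (+ m)))) h-0)))
  multiple≈1 h h-+ h-0 {m} h-m -[1+ suc n ] = ≈-trans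
    (≈-trans (reflexive (cong h (ℤS.solve 2 (λ n m → (ℤS.:- (ℤS.con (+ 2) ℤS.:+ n)) ℤS.:* m ℤS.:= ℤS.con -[1+ 0 ] ℤS.:* m ℤS.:+ (ℤS.:- (ℤS.con (+ 1) ℤS.:+ n)) ℤS.:* m) refl (+ n) (+ m))))
      (h-+ (-[1+ 0 ] ℤ.* + m) (-[1+ n ] ℤ.* + m)))
    (≈-trans (*-cong (multiple≈1 h h-+ h-0 h-m -[1+ 0 ]) (multiple≈1 h h-+ h-0 h-m -[1+ n ])) (*-identityˡ 1#))

  -- E behaves as k ↦ exp (2πik/2N), except that E N is only known up to sign.
  record IsCharacter (E : ℤ → A) : Set where
    field
      E-+  : ∀ k l → E (k ℤ.+ l) ≈ E k * E l
      E-0  : E (+ 0) ≈ 1#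
      E-N  : E (+ suc M) ≈± 1#
      E-2N : E (+ (2 ℕ.* suc M)) ≈ 1#

module Constants (R : CommutativeRing 0ℓ 0ℓ) (M : ℕ) (E : ℤ → CommutativeRing.Carrier R)
  (isCharacter : RootsOfUnity.IsCharacter R M E) (r : CommutativeRing.Carrier R)
  (r²-integer : ∃[ n ] CommutativeRing._≈_ R (CommutativeRing._*_ R r r) (IntegerScalars.fromℤ R (+ n))) where
  open CommutativeRing R renaming (Carrier to A; refl to ≈-refl; sym to ≈-sym; trans to ≈-trans)
  open Spans R
  open RootsOfUnity R M
  open IsCharacter isCharacter
  open Solver using (solve; con; _:=_; _:+_; _:*_; _:-_; :-_)

  E-inverse : ∀ k → E k * E (ℤ.- k) ≈ 1#
  E-inverse k = ≈-trans (≈-sym (E-+ k (ℤ.- k))) (≈-trans (reflexive (cong E (ℤ.+-inverseʳ k))) E-0)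

  private
    E-Nn : ∀ n → E (+ n ℤ.* + N) ≈± 1#
    E-Nn zero    = ±-≈ E-0
    E-Nn (suc n) = ±-trans (±-≈ (≈-trans (reflexive (cong E (ℤ.suc-* (+ n) (+ N)))) (E-+ (+ N) (+ n ℤ.* + N))))
      (±-trans (±-* E-N (E-Nn n)) (±-≈ (*-identityˡ 1#)))

    ±1-inverse : ∀ {z w} → z * w ≈ 1# → z ≈± 1# → w ≈± 1#
    ±1-inverse {z} {w} zw≈1 = Sum⊎.map
      (λ z≈1 → ≈-trans (≈-sym (*-identityˡ w)) (≈-trans (*-congʳ (≈-sym z≈1)) zw≈1))
      (λ z≈-1 → ≈-trans (solve 1 (λ w → w := :- (:- con (+ 1) :* w)) ≈-refl w) (-‿cong (≈-trans (*-congʳ (≈-sym z≈-1)) zw≈1)))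

  abstract
    E-multiple : ∀ q → E (q ℤ.* + N) ≈± 1#
    E-multiple (+ n)    = E-Nn n
    E-multiple -[1+ n ] = ±1-inverse
      (≈-trans (*-congˡ (reflexive (cong E (sym (ℤ.neg-distribˡ-* (+ suc n) (+ N)))))) (E-inverse (+ suc n ℤ.* + N)))
      (E-Nn (suc n))

    E-periodic : ∀ q → E (q ℤ.* + (2 ℕ.* N)) ≈ 1#
    E-periodic = multiple≈1 E E-+ E-0 E-2N

  Root : A → ℤ → Set
  Root z k = z ≈± E k

  root-* : ∀ {z w k l} → Root z k → Root w l → Root (z * w) (k ℤ.+ l)
  root-* {k = k} {l} p q = ±-trans (±-* p q) (±-≈ (≈-sym (E-+ k l)))

  root-invert : ∀ {z k} → Root z k → ∃[ w ] (z * w ≈ 1# × Root w (ℤ.- k))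
  root-invert {z} {k} (inj₁ p) = E (ℤ.- k) , ≈-trans (*-congʳ p) (E-inverse k) , ±-refl
  root-invert {z} {k} (inj₂ p) = - E (ℤ.- k)
    , ≈-trans (*-congʳ p) (≈-trans (solve 2 (λ x y → :- x :* :- y := x :* y) ≈-refl (E k) (E (ℤ.- k))) (E-inverse k))
    , inj₂ ≈-refl

  root-close : ∀ {z w k l} → Root z k → Root w l → + N ∣ˢ k ℤ.- l → z ≈± w
  root-close {z} {w} {k} {l} p q (Signed.divides m eq) = ±-trans p (±-trans Ek≈±El (±-sym q))
    where
    k≡ : k ≡ m ℤ.* + N ℤ.+ l
    k≡ = trans (ℤS.solve 2 (λ k l → k ℤS.:= (k ℤS.:- l) ℤS.:+ l) refl k l) (cong (ℤ._+ l) eq)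

    Ek≈±El : E k ≈± E l
    Ek≈±El = ±-trans (±-≈ (≈-trans (reflexive (cong E k≡)) (E-+ (m ℤ.* + N) l)))
      (±-trans (±-* (E-multiple m) ±-refl) (±-≈ (*-identityˡ (E l))))

  constants : List A
  constants = map (λ k → E (+ k)) (upTo (2 ℕ.* N)) ++ map (λ k → E (+ k) * r) (upTo (2 ℕ.* N))

  private
    reduce : ∀ k → ∃[ j ] (j ∈ upTo (2 ℕ.* N) × E k ≈ E (+ j))
    reduce k = k ℤ.%ℕ (2 ℕ.* N) , ∈-upTo⁺ (ℤ.n%ℕd<d k (2 ℕ.* N)) ,
      ≈-trans (reflexive (cong E (ℤ.a≡a%ℕn+[a/ℕn]*n k (2 ℕ.* N))))
        (≈-trans (E-+ (+ (k ℤ.%ℕ (2 ℕ.* N))) (k ℤ./ℕ (2 ℕ.* N) ℤ.* + (2 ℕ.* N)))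
          (≈-trans (*-congˡ (E-periodic (k ℤ./ℕ (2 ℕ.* N)))) (*-identityʳ _)))

  E∈constants : ∀ k → Span constants (E k)
  E∈constants k = let j , j∈ , eq = reduce k in
    resp (span-isSubmodule constants) (≈-sym eq) (∈⇒Span (∈-++⁺ˡ (∈-map⁺ (λ k → E (+ k)) j∈)))

  Er∈constants : ∀ k → Span constants (E k * r)
  Er∈constants k = let j , j∈ , eq = reduce k in
    resp (span-isSubmodule constants) (*-congʳ (≈-sym eq))
      (∈⇒Span (∈-++⁺ʳ (map (λ k → E (+ k)) (upTo (2 ℕ.* N))) (∈-map⁺ (λ k → E (+ k) * r) j∈)))

  1∈constants : Span constants 1#
  1∈constants = resp (span-isSubmodule constants) E-0 (E∈constants (+ 0))

  root∈constants : ∀ {z k} → Root z k → Span constants z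
  root∈constants {k = k} (inj₁ p) = resp (span-isSubmodule constants) (≈-sym p) (E∈constants k)
  root∈constants {k = k} (inj₂ p) = resp (span-isSubmodule constants) (≈-sym p) (neg (span-isSubmodule constants) (E∈constants k))

  root*r∈constants : ∀ {z k} → Root z k → Span constants (z * r)
  root*r∈constants {k = k} (inj₁ p) = resp (span-isSubmodule constants) (*-congʳ (≈-sym p)) (Er∈constants k)
  root*r∈constants {z} {k = k} (inj₂ p) = resp (span-isSubmodule constants)
    (≈-trans (solve 2 (λ e r → :- (e :* r) := (:- e) :* r) ≈-refl (E k) r) (*-congʳ (≈-sym p)))
    (neg (span-isSubmodule constants) (Er∈constants k))

  private
    data Shape (c : A) : Set where
      plain  : ∀ k → c ≡ E k → Shape c
      with-r : ∀ k → c ≡ E k * r → Shape c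

    shape : ∀ {c} → c ∈ constants → Shape c
    shape c∈ = [ (λ p → let k , _ , eq = ∈-map⁻ (λ k → E (+ k)) p in plain (+ k) eq)
               , (λ p → let k , _ , eq = ∈-map⁻ (λ k → E (+ k) * r) p in with-r (+ k) eq) ]′
      (∈-++⁻ (map (λ k → E (+ k)) (upTo (2 ℕ.* N))) c∈)

    shapes-closed : ∀ {c d} → Shape c → Shape d → Span constants (c * d)
    shapes-closed (plain k refl)  (plain l refl)  = resp (span-isSubmodule constants) (E-+ k l) (E∈constants (k ℤ.+ l))
    shapes-closed (plain k refl)  (with-r l refl) = resp (span-isSubmodule constants)
      (≈-trans (*-congʳ (E-+ k l)) (*-assoc (E k) (E l) r)) (Er∈constants (k ℤ.+ l))
    shapes-closed (with-r k refl) (plain l refl)  = resp (span-isSubmodule constants)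
      (≈-trans (*-congʳ (E-+ k l)) (solve 3 (λ x y r → x :* y :* r := x :* r :* y) ≈-refl (E k) (E l) r)) (Er∈constants (k ℤ.+ l))
    shapes-closed (with-r k refl) (with-r l refl) = let n , r²≈n = r²-integer in resp (span-isSubmodule constants)
      (≈-trans (*-cong (≈-sym r²≈n) (E-+ k l)) (solve 3 (λ x y r → r :* r :* (x :* y) := x :* r :* (y :* r)) ≈-refl (E k) (E l) r))
      (scale (span-isSubmodule constants) (+ n) (E∈constants (k ℤ.+ l)))

  constants-closed : ∀ {c d} → c ∈ constants → d ∈ constants → Span constants (c * d)
  constants-closed c∈ d∈ = shapes-closed (shape c∈) (shape d∈)

-- Distribution data of elements of order 2

⁻¹ℚ-inverse : ∀ q → q ≢ 0ℚ → q ℚ.* q ⁻¹ℚ ≡ 1ℚ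
⁻¹ℚ-inverse q q≢0 with q ℚ.≟ 0ℚ
... | yes q≡0 = contradiction q≡0 q≢0
... | no  q≢0 = ℚ.*-inverseʳ q {{ℚ.≢-nonZero q≢0}}

data Parity (i : ℤ) : Set where
  even′ : ∀ k → i ≡ + 2 ℤ.* k → Parity i
  odd′  : ∀ k → i ≡ odd k → Parity i

parity : ∀ i → Parity i
parity i with i ℤ.%ℕ 2 | ℤ.n%ℕd<d i 2 | ℤ.a≡a%ℕn+[a/ℕn]*n i 2
... | 0 | _ | eq = even′ (i ℤ./ℕ 2) (trans eq (trans (ℤ.+-identityˡ _) (ℤ.*-comm (i ℤ./ℕ 2) (+ 2))))
... | 1 | _ | eq = odd′ (i ℤ./ℕ 2) (trans eq (cong (ℤ._+_ (+ 1)) (ℤ.*-comm (i ℤ./ℕ 2) (+ 2))))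
... | suc (suc _) | s≤s (s≤s ()) | _

odd≢2* : ∀ k l → odd k ≢ + 2 ℤ.* l
odd≢2* k l eq = odd≢0 (k ℤ.- l) (trans
  (ℤS.solve 2 (λ k l → ℤS.con (+ 1) ℤS.:+ ℤS.con (+ 2) ℤS.:* (k ℤS.:- l)
     ℤS.:= (ℤS.con (+ 1) ℤS.:+ ℤS.con (+ 2) ℤS.:* k) ℤS.:- ℤS.con (+ 2) ℤS.:* l) refl k l)
  (trans (cong (ℤ._- + 2 ℤ.* l) eq) (ℤ.+-inverseʳ (+ 2 ℤ.* l))))

odd-coprime-2 : ∀ k → Coprime ℤ.∣ odd k ∣ 2
odd-coprime-2 k {d} (d∣odd , d∣2) with ℕ.∣⇒≤ d∣2
odd-coprime-2 k {0}             (_ , 0∣2)   | _ = contradiction (ℕ.0∣⇒≡0 0∣2) λ ()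
odd-coprime-2 k {1}             _           | _ = refl
odd-coprime-2 k {2}             (2∣odd , _) | _ = contradiction
  (trans (_∣ˢ_.equality 2∣) (ℤ.*-comm (_∣ˢ_.quotient 2∣) (+ 2))) (odd≢2* k (_∣ˢ_.quotient 2∣))
  where
  2∣ : + 2 ∣ˢ odd k
  2∣ = Signed.∣ᵤ⇒∣ 2∣odd
odd-coprime-2 k {suc (suc (suc _))} _       | s≤s (s≤s ())


module OrderTwo {N : ℕ} (γ : Γ N) (N≢0 : + N ≢ + 0) (g : ℤ²) (2g∈Λ : InΛ γ (2 ⊛ g)) (g∉Λ : ¬ InΛ γ g) where
  open Γ γ using (matrix; det≡1; c>0; trace)
  open Mat matrix
  open Lattice γ
  open ℤS using (solve; con; _:=_; _:+_; _:*_; _:-_; :-_)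

  m k : ℤ
  m = proj₁ g
  k = proj₂ g

  private
    P₁∣ : + N ∣ˢ proj₁ (φ (2 ⊛ g))
    P₁∣ = proj₁ (Λ-elim (2 ⊛ g) 2g∈Λ)

    P₂∣ : + N ∣ˢ proj₂ (φ (2 ⊛ g))
    P₂∣ = proj₂ (Λ-elim (2 ⊛ g) 2g∈Λ)

    P₁ P₂ : ℤ
    P₁ = _∣ˢ_.quotient P₁∣
    P₂ = _∣ˢ_.quotient P₂∣

    P₁-eq : + 2 ℤ.* m ℤ.* a ℤ.+ + 2 ℤ.* k ℤ.* c ℤ.- + 2 ℤ.* m ≡ P₁ ℤ.* + N
    P₁-eq = _∣ˢ_.equality P₁∣

    P₂-eq : + 2 ℤ.* m ℤ.* b ℤ.+ + 2 ℤ.* k ℤ.* d ℤ.- + 2 ℤ.* k ≡ P₂ ℤ.* + N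
    P₂-eq = _∣ˢ_.equality P₂∣

  -- 2g (γ - 1) = N P gives 2g (1 - γ)⁻¹ = ρ.
  ρ₁ ρ₂ : ℤ
  ρ₁ = c ℤ.* P₂ ℤ.- d ℤ.* P₁
  ρ₂ = b ℤ.* P₁ ℤ.- a ℤ.* P₂

  private
    N*-cancel : ∀ {x y} → x ℤ.* + N ≡ y ℤ.* + N → x ≡ y
    N*-cancel {x} {y} = ℤ.*-cancelʳ-≡ x y (+ N) {{ℤ.≢-nonZero N≢0}}

    det-eq : a ℤ.* d ℤ.- b ℤ.* c ≡ + 1
    det-eq = det≡1

  abstract
    ρ₁-numerator : + 2 ℤ.* (m ℤ.* (+ 1 ℤ.- d) ℤ.+ k ℤ.* c) ≡ ℤ.- (ρ₁ ℤ.* + N)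
    ρ₁-numerator = begin
      + 2 ℤ.* (m ℤ.* (+ 1 ℤ.- d) ℤ.+ k ℤ.* c)
        ≡⟨ cong (λ δ → + 2 ℤ.* (m ℤ.* (δ ℤ.- d) ℤ.+ k ℤ.* c)) det-eq ⟨
      + 2 ℤ.* (m ℤ.* ((a ℤ.* d ℤ.- b ℤ.* c) ℤ.- d) ℤ.+ k ℤ.* c)
        ≡⟨ solve 6 (λ a b c d m k → con (+ 2) :* (m :* ((a :* d :- b :* c) :- d) :+ k :* c)
             := d :* (con (+ 2) :* m :* a :+ con (+ 2) :* k :* c :- con (+ 2) :* m)
                :- c :* (con (+ 2) :* m :* b :+ con (+ 2) :* k :* d :- con (+ 2) :* k)) refl a b c d m k ⟩
      d ℤ.* (+ 2 ℤ.* m ℤ.* a ℤ.+ + 2 ℤ.* k ℤ.* c ℤ.- + 2 ℤ.* m) ℤ.- c ℤ.* (+ 2 ℤ.* m ℤ.* b ℤ.+ + 2 ℤ.* k ℤ.* d ℤ.- + 2 ℤ.* k)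
        ≡⟨ cong₂ (λ x y → d ℤ.* x ℤ.- c ℤ.* y) P₁-eq P₂-eq ⟩
      d ℤ.* (P₁ ℤ.* + N) ℤ.- c ℤ.* (P₂ ℤ.* + N)
        ≡⟨ solve 5 (λ c d p q n → d :* (p :* n) :- c :* (q :* n) := :- ((c :* q :- d :* p) :* n)) refl c d P₁ P₂ (+ N) ⟩
      ℤ.- (ρ₁ ℤ.* + N) ∎
      where open ≡.≡-Reasoning

    ρ₂-numerator : + 2 ℤ.* (m ℤ.* b ℤ.+ k ℤ.* (+ 1 ℤ.- a)) ≡ ℤ.- (ρ₂ ℤ.* + N)
    ρ₂-numerator = begin
      + 2 ℤ.* (m ℤ.* b ℤ.+ k ℤ.* (+ 1 ℤ.- a))
        ≡⟨ cong (λ δ → + 2 ℤ.* (m ℤ.* b ℤ.+ k ℤ.* (δ ℤ.- a))) det-eq ⟨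
      + 2 ℤ.* (m ℤ.* b ℤ.+ k ℤ.* ((a ℤ.* d ℤ.- b ℤ.* c) ℤ.- a))
        ≡⟨ solve 6 (λ a b c d m k → con (+ 2) :* (m :* b :+ k :* ((a :* d :- b :* c) :- a))
             := a :* (con (+ 2) :* m :* b :+ con (+ 2) :* k :* d :- con (+ 2) :* k)
                :- b :* (con (+ 2) :* m :* a :+ con (+ 2) :* k :* c :- con (+ 2) :* m)) refl a b c d m k ⟩
      a ℤ.* (+ 2 ℤ.* m ℤ.* b ℤ.+ + 2 ℤ.* k ℤ.* d ℤ.- + 2 ℤ.* k) ℤ.- b ℤ.* (+ 2 ℤ.* m ℤ.* a ℤ.+ + 2 ℤ.* k ℤ.* c ℤ.- + 2 ℤ.* m)
        ≡⟨ cong₂ (λ x y → a ℤ.* y ℤ.- b ℤ.* x) P₁-eq P₂-eq ⟩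
      a ℤ.* (P₂ ℤ.* + N) ℤ.- b ℤ.* (P₁ ℤ.* + N)
        ≡⟨ solve 5 (λ a b p q n → a :* (q :* n) :- b :* (p :* n) := :- ((b :* p :- a :* q) :* n)) refl a b P₁ P₂ (+ N) ⟩
      ℤ.- (ρ₂ ℤ.* + N) ∎
      where open ≡.≡-Reasoning

    ρ-first : ρ₁ ℤ.* (+ 1 ℤ.- a) ℤ.- ρ₂ ℤ.* c ≡ + 2 ℤ.* m
    ρ-first = N*-cancel (begin
      (ρ₁ ℤ.* (+ 1 ℤ.- a) ℤ.- ρ₂ ℤ.* c) ℤ.* + N
        ≡⟨ solve 5 (λ x y a c n → (x :* (con (+ 1) :- a) :- y :* c) :* n := (:- (x :* n)) :* (a :- con (+ 1)) :+ (:- (y :* n)) :* c) refl ρ₁ ρ₂ a c (+ N) ⟩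
      ℤ.- (ρ₁ ℤ.* + N) ℤ.* (a ℤ.- + 1) ℤ.+ ℤ.- (ρ₂ ℤ.* + N) ℤ.* c
        ≡⟨ cong₂ (λ x y → x ℤ.* (a ℤ.- + 1) ℤ.+ y ℤ.* c) ρ₁-numerator ρ₂-numerator ⟨
      + 2 ℤ.* (m ℤ.* (+ 1 ℤ.- d) ℤ.+ k ℤ.* c) ℤ.* (a ℤ.- + 1) ℤ.+ + 2 ℤ.* (m ℤ.* b ℤ.+ k ℤ.* (+ 1 ℤ.- a)) ℤ.* c
        ≡⟨ solve 6 (λ a b c d m k → con (+ 2) :* (m :* (con (+ 1) :- d) :+ k :* c) :* (a :- con (+ 1)) :+ con (+ 2) :* (m :* b :+ k :* (con (+ 1) :- a)) :* c
             := con (+ 2) :* m :* ((a :+ d :- con (+ 1)) :- (a :* d :- b :* c))) refl a b c d m k ⟩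
      + 2 ℤ.* m ℤ.* ((a ℤ.+ d ℤ.- + 1) ℤ.- (a ℤ.* d ℤ.- b ℤ.* c))
        ≡⟨ cong (λ δ → + 2 ℤ.* m ℤ.* ((a ℤ.+ d ℤ.- + 1) ℤ.- δ)) det-eq ⟩
      + 2 ℤ.* m ℤ.* ((a ℤ.+ d ℤ.- + 1) ℤ.- + 1)
        ≡⟨ cong (+ 2 ℤ.* m ℤ.*_) (trans (solve 2 (λ a d → (a :+ d :- con (+ 1)) :- con (+ 1) := a :+ d :- con (+ 2)) refl a d) (sym N≡)) ⟩
      + 2 ℤ.* m ℤ.* + N ∎)
      where open ≡.≡-Reasoning

    ρ-second : ρ₂ ℤ.* (+ 1 ℤ.- d) ℤ.- ρ₁ ℤ.* b ≡ + 2 ℤ.* k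
    ρ-second = N*-cancel (begin
      (ρ₂ ℤ.* (+ 1 ℤ.- d) ℤ.- ρ₁ ℤ.* b) ℤ.* + N
        ≡⟨ solve 5 (λ x y d b n → (y :* (con (+ 1) :- d) :- x :* b) :* n := (:- (y :* n)) :* (d :- con (+ 1)) :+ (:- (x :* n)) :* b) refl ρ₁ ρ₂ d b (+ N) ⟩
      ℤ.- (ρ₂ ℤ.* + N) ℤ.* (d ℤ.- + 1) ℤ.+ ℤ.- (ρ₁ ℤ.* + N) ℤ.* b
        ≡⟨ cong₂ (λ x y → y ℤ.* (d ℤ.- + 1) ℤ.+ x ℤ.* b) ρ₁-numerator ρ₂-numerator ⟨
      + 2 ℤ.* (m ℤ.* b ℤ.+ k ℤ.* (+ 1 ℤ.- a)) ℤ.* (d ℤ.- + 1) ℤ.+ + 2 ℤ.* (m ℤ.* (+ 1 ℤ.- d) ℤ.+ k ℤ.* c) ℤ.* b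
        ≡⟨ solve 6 (λ a b c d m k → con (+ 2) :* (m :* b :+ k :* (con (+ 1) :- a)) :* (d :- con (+ 1)) :+ con (+ 2) :* (m :* (con (+ 1) :- d) :+ k :* c) :* b
             := con (+ 2) :* k :* ((a :+ d :- con (+ 1)) :- (a :* d :- b :* c))) refl a b c d m k ⟩
      + 2 ℤ.* k ℤ.* ((a ℤ.+ d ℤ.- + 1) ℤ.- (a ℤ.* d ℤ.- b ℤ.* c))
        ≡⟨ cong (λ δ → + 2 ℤ.* k ℤ.* ((a ℤ.+ d ℤ.- + 1) ℤ.- δ)) det-eq ⟩
      + 2 ℤ.* k ℤ.* ((a ℤ.+ d ℤ.- + 1) ℤ.- + 1)
        ≡⟨ cong (+ 2 ℤ.* k ℤ.*_) (trans (solve 2 (λ a d → (a :+ d :- con (+ 1)) :- con (+ 1) := a :+ d :- con (+ 2)) refl a d) (sym N≡)) ⟩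
      + 2 ℤ.* k ℤ.* + N ∎)
      where open ≡.≡-Reasoning

  private
    module Q = ℚS

    ι : ℤ → ℚ
    ι = ℤ→ℚ

    Δ : ℚ
    Δ = ℚᴹ.det (ℚᴹ.𝟙 ℚᴹ.⊟ Matℤ→ℚ matrix)

    Δ≡ : Δ ≡ ℚ.- ι (+ N)
    Δ≡ = begin
      (1ℚ ℚ.- ι a) ℚ.* (1ℚ ℚ.- ι d) ℚ.- (0ℚ ℚ.- ι b) ℚ.* (0ℚ ℚ.- ι c)
        ≡⟨ Q.solve 4 (λ a b c d → (Q.con 1ℚ Q.:- a) Q.:* (Q.con 1ℚ Q.:- d) Q.:- (Q.con 0ℚ Q.:- b) Q.:* (Q.con 0ℚ Q.:- c)
             Q.:= (Q.con 1ℚ Q.:+ (a Q.:* d Q.:- b Q.:* c)) Q.:- (a Q.:+ d)) refl (ι a) (ι b) (ι c) (ι d) ⟩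
      (1ℚ ℚ.+ (ι a ℚ.* ι d ℚ.- ι b ℚ.* ι c)) ℚ.- (ι a ℚ.+ ι d)
        ≡⟨ cong₂ (λ x y → (1ℚ ℚ.+ x) ℚ.- y) ι-det (trans (sym (ℤ→ℚ-+ a d)) (cong ι a+d≡)) ⟩
      (1ℚ ℚ.+ 1ℚ) ℚ.- ι (+ N ℤ.+ + 2)
        ≡⟨ cong (λ x → (1ℚ ℚ.+ 1ℚ) ℚ.- x) (ℤ→ℚ-+ (+ N) (+ 2)) ⟩
      (1ℚ ℚ.+ 1ℚ) ℚ.- (ι (+ N) ℚ.+ ι (+ 2))
        ≡⟨ Q.solve 1 (λ n → Q.con (ι (+ 2)) Q.:- (n Q.:+ Q.con (ι (+ 2))) Q.:= Q.:- n) refl (ι (+ N)) ⟩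
      ℚ.- ι (+ N) ∎
      where
      open ≡.≡-Reasoning

      a+d≡ : a ℤ.+ d ≡ + N ℤ.+ + 2
      a+d≡ = trace

      ι-det : ι a ℚ.* ι d ℚ.- ι b ℚ.* ι c ≡ 1ℚ
      ι-det = begin
        ι a ℚ.* ι d ℚ.- ι b ℚ.* ι c              ≡⟨ cong₂ ℚ._-_ (ℤ→ℚ-* a d) (ℤ→ℚ-* b c) ⟨
        ι (a ℤ.* d) ℚ.- ι (b ℤ.* c)              ≡⟨ cong (ι (a ℤ.* d) ℚ.+_) (ℤ→ℚ-neg (b ℤ.* c)) ⟨
        ι (a ℤ.* d) ℚ.+ ι (ℤ.- (b ℤ.* c))        ≡⟨ ℤ→ℚ-+ (a ℤ.* d) (ℤ.- (b ℤ.* c)) ⟨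
        ι (a ℤ.* d ℤ.- b ℤ.* c)                  ≡⟨ cong ι det-eq ⟩
        1ℚ                                       ∎

    Δ≢0 : Δ ≢ 0ℚ
    Δ≢0 eq = N≢0 (ℤ→ℚ-injective (+ N) (+ 0) (begin
      ι (+ N)              ≡⟨ Q.solve 1 (λ n → n Q.:= Q.:- (Q.:- n)) refl (ι (+ N)) ⟩
      ℚ.- (ℚ.- ι (+ N))    ≡⟨ cong ℚ.-_ (trans (sym Δ≡) eq) ⟩
      0ℚ                   ∎))
      where open ≡.≡-Reasoning

    Δ*Δ⁻¹ : Δ ℚ.* Δ ⁻¹ℚ ≡ 1ℚ
    Δ*Δ⁻¹ = ⁻¹ℚ-inverse Δ Δ≢0

    -- x / Δ = ρ / 2 as soon as 2 x = - N ρ.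
    quotient≡ : ∀ x ρ → + 2 ℤ.* x ≡ ℤ.- (ρ ℤ.* + N) → Δ ⁻¹ℚ ℚ.* ι x ≡ ½ ℚ.* ι ρ
    quotient≡ x ρ eq = begin
      Δ ⁻¹ℚ ℚ.* ι x                            ≡⟨ Q.solve 2 (λ i x → i Q.:* x Q.:= Q.con ½ Q.:* i Q.:* (Q.con (ι (+ 2)) Q.:* x)) refl (Δ ⁻¹ℚ) (ι x) ⟩
      ½ ℚ.* Δ ⁻¹ℚ ℚ.* (ι (+ 2) ℚ.* ι x)        ≡⟨ cong (½ ℚ.* Δ ⁻¹ℚ ℚ.*_) (trans (sym (ℤ→ℚ-* (+ 2) x)) (trans (cong ι eq) (trans (ℤ→ℚ-neg (ρ ℤ.* + N)) (cong ℚ.-_ (ℤ→ℚ-* ρ (+ N)))))) ⟩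
      ½ ℚ.* Δ ⁻¹ℚ ℚ.* (ℚ.- (ι ρ ℚ.* ι (+ N)))  ≡⟨ Q.solve 3 (λ i r n → Q.con ½ Q.:* i Q.:* (Q.:- (r Q.:* n)) Q.:= Q.con ½ Q.:* r Q.:* ((Q.:- n) Q.:* i)) refl (Δ ⁻¹ℚ) (ι ρ) (ι (+ N)) ⟩
      ½ ℚ.* ι ρ ℚ.* (ℚ.- ι (+ N) ℚ.* Δ ⁻¹ℚ)    ≡⟨ cong (λ δ → ½ ℚ.* ι ρ ℚ.* (δ ℚ.* Δ ⁻¹ℚ)) Δ≡ ⟨
      ½ ℚ.* ι ρ ℚ.* (Δ ℚ.* Δ ⁻¹ℚ)              ≡⟨ cong (½ ℚ.* ι ρ ℚ.*_) Δ*Δ⁻¹ ⟩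
      ½ ℚ.* ι ρ ℚ.* 1ℚ                         ≡⟨ ℚ.*-identityʳ _ ⟩
      ½ ℚ.* ι ρ                                ∎
      where open ≡.≡-Reasoning

    ι-linear : ∀ x y z w → ι (x ℤ.* (+ 1 ℤ.- y) ℤ.+ z ℤ.* w) ≡ ι x ℚ.* (1ℚ ℚ.- ι y) ℚ.+ ι z ℚ.* ι w
    ι-linear x y z w = trans (ℤ→ℚ-+ (x ℤ.* (+ 1 ℤ.- y)) (z ℤ.* w)) (cong₂ ℚ._+_
      (trans (ℤ→ℚ-* x (+ 1 ℤ.- y)) (cong (ι x ℚ.*_) (trans (ℤ→ℚ-+ (+ 1) (ℤ.- y)) (cong (1ℚ ℚ.+_) (ℤ→ℚ-neg y)))))
      (ℤ→ℚ-* z w))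

  abstract
    r₁≡ : proj₁ (rowTimesInverse γ g) ≡ ½ ℚ.* ι ρ₁
    r₁≡ = trans
      (trans (Q.solve 5 (λ i m k d c → m Q.:* (i Q.:* (Q.con 1ℚ Q.:- d)) Q.:+ k Q.:* (i Q.:* (Q.:- (Q.con 0ℚ Q.:- c)))
          Q.:= i Q.:* (m Q.:* (Q.con 1ℚ Q.:- d) Q.:+ k Q.:* c)) refl (Δ ⁻¹ℚ) (ι m) (ι k) (ι d) (ι c))
        (cong (Δ ⁻¹ℚ ℚ.*_) (sym (ι-linear m d k c))))
      (quotient≡ (m ℤ.* (+ 1 ℤ.- d) ℤ.+ k ℤ.* c) ρ₁ ρ₁-numerator)

    r₂≡ : proj₂ (rowTimesInverse γ g) ≡ ½ ℚ.* ι ρ₂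
    r₂≡ = trans
      (trans (Q.solve 5 (λ i m k a b → m Q.:* (i Q.:* (Q.:- (Q.con 0ℚ Q.:- b))) Q.:+ k Q.:* (i Q.:* (Q.con 1ℚ Q.:- a))
          Q.:= i Q.:* (k Q.:* (Q.con 1ℚ Q.:- a) Q.:+ m Q.:* b)) refl (Δ ⁻¹ℚ) (ι m) (ι k) (ι a) (ι b))
        (cong (Δ ⁻¹ℚ ℚ.*_) (trans (sym (ι-linear k a m b)) (cong ι (ℤ.+-comm (k ℤ.* (+ 1 ℤ.- a)) (m ℤ.* b))))))
      (quotient≡ (m ℤ.* b ℤ.+ k ℤ.* (+ 1 ℤ.- a)) ρ₂ ρ₂-numerator)

    half-not-integer : ∀ t → ¬ IsInteger (½ ℚ.* ι (odd t))
    half-not-integer t (l , eq) = odd≢2* t l (ℤ→ℚ-injective (odd t) (+ 2 ℤ.* l) (begin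
      ι (odd t)                       ≡⟨ Q.solve 1 (λ x → x Q.:= Q.con (ι (+ 2)) Q.:* (Q.con ½ Q.:* x)) refl (ι (odd t)) ⟩
      ι (+ 2) ℚ.* (½ ℚ.* ι (odd t))   ≡⟨ cong (ι (+ 2) ℚ.*_) eq ⟩
      ι (+ 2) ℚ.* ι l                 ≡⟨ ℤ→ℚ-* (+ 2) l ⟨
      ι (+ 2 ℤ.* l)                   ∎))
      where open ≡.≡-Reasoning

  abstract
    even⇒∈Λ : ∀ s t → ρ₁ ≡ + 2 ℤ.* s → ρ₂ ≡ + 2 ℤ.* t → InΛ γ g
    even⇒∈Λ s t eq₁ eq₂ = Λ-intro g
      (Signed.divides (ℤ.- (s ℤ.* a ℤ.+ t ℤ.* c)) (begin
        m ℤ.* a ℤ.+ k ℤ.* c ℤ.- m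
          ≡⟨ cong₂ (λ m k → m ℤ.* a ℤ.+ k ℤ.* c ℤ.- m) m≡ k≡ ⟩
        (s ℤ.* (+ 1 ℤ.- a) ℤ.- t ℤ.* c) ℤ.* a ℤ.+ (t ℤ.* (+ 1 ℤ.- d) ℤ.- s ℤ.* b) ℤ.* c ℤ.- (s ℤ.* (+ 1 ℤ.- a) ℤ.- t ℤ.* c)
          ≡⟨ solve 6 (λ s t a b c d → (s :* (con (+ 1) :- a) :- t :* c) :* a :+ (t :* (con (+ 1) :- d) :- s :* b) :* c :- (s :* (con (+ 1) :- a) :- t :* c)
               := (:- (s :* a :+ t :* c)) :* (a :+ d :- con (+ 2)) :- s :* (con (+ 1) :- (a :* d :- b :* c))) refl s t a b c d ⟩
        ℤ.- (s ℤ.* a ℤ.+ t ℤ.* c) ℤ.* (a ℤ.+ d ℤ.- + 2) ℤ.- s ℤ.* (+ 1 ℤ.- (a ℤ.* d ℤ.- b ℤ.* c))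
          ≡⟨ cong₂ (λ n δ → ℤ.- (s ℤ.* a ℤ.+ t ℤ.* c) ℤ.* n ℤ.- s ℤ.* (+ 1 ℤ.- δ)) (sym N≡) det-eq ⟩
        ℤ.- (s ℤ.* a ℤ.+ t ℤ.* c) ℤ.* + N ℤ.- s ℤ.* + 0
          ≡⟨ solve 2 (λ x s → x :- s :* con (+ 0) := x) refl (ℤ.- (s ℤ.* a ℤ.+ t ℤ.* c) ℤ.* + N) s ⟩
        ℤ.- (s ℤ.* a ℤ.+ t ℤ.* c) ℤ.* + N ∎))
      (Signed.divides (ℤ.- (s ℤ.* b ℤ.+ t ℤ.* d)) (begin
        m ℤ.* b ℤ.+ k ℤ.* d ℤ.- k
          ≡⟨ cong₂ (λ m k → m ℤ.* b ℤ.+ k ℤ.* d ℤ.- k) m≡ k≡ ⟩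
        (s ℤ.* (+ 1 ℤ.- a) ℤ.- t ℤ.* c) ℤ.* b ℤ.+ (t ℤ.* (+ 1 ℤ.- d) ℤ.- s ℤ.* b) ℤ.* d ℤ.- (t ℤ.* (+ 1 ℤ.- d) ℤ.- s ℤ.* b)
          ≡⟨ solve 6 (λ s t a b c d → (s :* (con (+ 1) :- a) :- t :* c) :* b :+ (t :* (con (+ 1) :- d) :- s :* b) :* d :- (t :* (con (+ 1) :- d) :- s :* b)
               := (:- (s :* b :+ t :* d)) :* (a :+ d :- con (+ 2)) :- t :* (con (+ 1) :- (a :* d :- b :* c))) refl s t a b c d ⟩
        ℤ.- (s ℤ.* b ℤ.+ t ℤ.* d) ℤ.* (a ℤ.+ d ℤ.- + 2) ℤ.- t ℤ.* (+ 1 ℤ.- (a ℤ.* d ℤ.- b ℤ.* c))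
          ≡⟨ cong₂ (λ n δ → ℤ.- (s ℤ.* b ℤ.+ t ℤ.* d) ℤ.* n ℤ.- t ℤ.* (+ 1 ℤ.- δ)) (sym N≡) det-eq ⟩
        ℤ.- (s ℤ.* b ℤ.+ t ℤ.* d) ℤ.* + N ℤ.- t ℤ.* + 0
          ≡⟨ solve 2 (λ x s → x :- s :* con (+ 0) := x) refl (ℤ.- (s ℤ.* b ℤ.+ t ℤ.* d) ℤ.* + N) t ⟩
        ℤ.- (s ℤ.* b ℤ.+ t ℤ.* d) ℤ.* + N ∎))
      where
      open ≡.≡-Reasoning

      m≡ : m ≡ s ℤ.* (+ 1 ℤ.- a) ℤ.- t ℤ.* c
      m≡ = ℤ.*-cancelˡ-≡ (+ 2) m _ (trans (sym ρ-first) (trans (cong₂ (λ x y → x ℤ.* (+ 1 ℤ.- a) ℤ.- y ℤ.* c) eq₁ eq₂)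
        (solve 4 (λ s t a c → con (+ 2) :* s :* (con (+ 1) :- a) :- con (+ 2) :* t :* c := con (+ 2) :* (s :* (con (+ 1) :- a) :- t :* c)) refl s t a c)))

      k≡ : k ≡ t ℤ.* (+ 1 ℤ.- d) ℤ.- s ℤ.* b
      k≡ = ℤ.*-cancelˡ-≡ (+ 2) k _ (trans (sym ρ-second) (trans (cong₂ (λ x y → y ℤ.* (+ 1 ℤ.- d) ℤ.- x ℤ.* b) eq₁ eq₂)
        (solve 4 (λ s t b d → con (+ 2) :* t :* (con (+ 1) :- d) :- con (+ 2) :* s :* b := con (+ 2) :* (t :* (con (+ 1) :- d) :- s :* b)) refl s t b d)))

  -- The index of the sublattice on which γ′ lives is 2, so membership in Λ_γ′ is detected by 2p.
  Good : DistributionData γ g → Set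
  Good D = ∀ p → InΛ (DistributionData.γ′ D) (DistributionData.image D p) → InΛ γ (2· p)

  private
    half-even : ∀ x → ½ ℚ.* ι (+ 2 ℤ.* x) ≡ ι x
    half-even x = trans (cong (½ ℚ.*_) (ℤ→ℚ-* (+ 2) x))
      (Q.solve 1 (λ x → Q.con ½ Q.:* (Q.con (ι (+ 2)) Q.:* x) Q.:= x) refl (ι x))

    integer : ∀ k {q} → q ≡ ι k → IsInteger q
    integer k eq = k , eq

    0-integer : ∀ {q} → q ≡ 0ℚ → IsInteger q
    0-integer = integer (+ 0)

    -- ρ₁ odd: h = 2, y = 1, w = 1 and f = ρ₂.
    module Case₁ (t : ℤ) (ρ₁-odd : ρ₁ ≡ odd t) where
      f β : ℤ
      f = ρ₂
      β = f ℤ.* m ℤ.- f ℤ.* t ℤ.* (+ 1 ℤ.- a) ℤ.- k ℤ.- t ℤ.* b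

      2β≡ : + 2 ℤ.* β ≡ b ℤ.+ f ℤ.* (d ℤ.- a) ℤ.- f ℤ.* f ℤ.* c
      2β≡ = begin
        + 2 ℤ.* β
          ≡⟨ solve 6 (λ f m t a k b → con (+ 2) :* (f :* m :- f :* t :* (con (+ 1) :- a) :- k :- t :* b)
               := f :* (con (+ 2) :* m) :- con (+ 2) :* f :* t :* (con (+ 1) :- a) :- con (+ 2) :* k :- con (+ 2) :* t :* b) refl f m t a k b ⟩
        f ℤ.* (+ 2 ℤ.* m) ℤ.- + 2 ℤ.* f ℤ.* t ℤ.* (+ 1 ℤ.- a) ℤ.- + 2 ℤ.* k ℤ.- + 2 ℤ.* t ℤ.* b
          ≡⟨ cong₂ (λ x y → f ℤ.* x ℤ.- + 2 ℤ.* f ℤ.* t ℤ.* (+ 1 ℤ.- a) ℤ.- y ℤ.- + 2 ℤ.* t ℤ.* b)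
               (trans (sym ρ-first) (cong (λ ρ → ρ ℤ.* (+ 1 ℤ.- a) ℤ.- f ℤ.* c) ρ₁-odd))
               (trans (sym ρ-second) (cong (λ ρ → f ℤ.* (+ 1 ℤ.- d) ℤ.- ρ ℤ.* b) ρ₁-odd)) ⟩
        f ℤ.* (odd t ℤ.* (+ 1 ℤ.- a) ℤ.- f ℤ.* c) ℤ.- + 2 ℤ.* f ℤ.* t ℤ.* (+ 1 ℤ.- a) ℤ.- (f ℤ.* (+ 1 ℤ.- d) ℤ.- odd t ℤ.* b) ℤ.- + 2 ℤ.* t ℤ.* b
          ≡⟨ solve 6 (λ f t a b c d → f :* ((con (+ 1) :+ con (+ 2) :* t) :* (con (+ 1) :- a) :- f :* c) :- con (+ 2) :* f :* t :* (con (+ 1) :- a)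
                 :- (f :* (con (+ 1) :- d) :- (con (+ 1) :+ con (+ 2) :* t) :* b) :- con (+ 2) :* t :* b
               := b :+ f :* (d :- a) :- f :* f :* c) refl f t a b c d ⟩
        b ℤ.+ f ℤ.* (d ℤ.- a) ℤ.- f ℤ.* f ℤ.* c ∎
        where open ≡.≡-Reasoning

      γ′ : Γ N
      γ′ = record
        { matrix = mat (a ℤ.+ f ℤ.* c) β (+ 2 ℤ.* c) (d ℤ.- f ℤ.* c)
        ; det≡1  = begin
            (a ℤ.+ f ℤ.* c) ℤ.* (d ℤ.- f ℤ.* c) ℤ.- β ℤ.* (+ 2 ℤ.* c)
              ≡⟨ solve 5 (λ a d f c β → (a :+ f :* c) :* (d :- f :* c) :- β :* (con (+ 2) :* c)
                   := (a :+ f :* c) :* (d :- f :* c) :- con (+ 2) :* β :* c) refl a d f c β ⟩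
            (a ℤ.+ f ℤ.* c) ℤ.* (d ℤ.- f ℤ.* c) ℤ.- + 2 ℤ.* β ℤ.* c
              ≡⟨ cong (λ x → (a ℤ.+ f ℤ.* c) ℤ.* (d ℤ.- f ℤ.* c) ℤ.- x ℤ.* c) 2β≡ ⟩
            (a ℤ.+ f ℤ.* c) ℤ.* (d ℤ.- f ℤ.* c) ℤ.- (b ℤ.+ f ℤ.* (d ℤ.- a) ℤ.- f ℤ.* f ℤ.* c) ℤ.* c
              ≡⟨ solve 5 (λ a b c d f → (a :+ f :* c) :* (d :- f :* c) :- (b :+ f :* (d :- a) :- f :* f :* c) :* c := a :* d :- b :* c) refl a b c d f ⟩
            a ℤ.* d ℤ.- b ℤ.* c
              ≡⟨ det-eq ⟩
            + 1 ∎
        ; c>0    = ℤ.*-monoˡ-<-pos (+ 2) c>0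
        ; trace  = trans (solve 4 (λ a d f c → a :+ f :* c :+ (d :- f :* c) := a :+ d) refl a d f c) trace
        }
        where open ≡.≡-Reasoning

      ιβ≡ : ι β ≡ ½ ℚ.* (ι b ℚ.+ ι f ℚ.* (ι d ℚ.- ι a) ℚ.- ι f ℚ.* ι f ℚ.* ι c)
      ιβ≡ = begin
        ι β                     ≡⟨ half-even β ⟨
        ½ ℚ.* ι (+ 2 ℤ.* β)     ≡⟨ cong (λ x → ½ ℚ.* ι x) 2β≡ ⟩
        ½ ℚ.* ι (b ℤ.+ f ℤ.* (d ℤ.- a) ℤ.- f ℤ.* f ℤ.* c)
          ≡⟨ cong (½ ℚ.*_) (trans (ℤ→ℚ-+ (b ℤ.+ f ℤ.* (d ℤ.- a)) (ℤ.- (f ℤ.* f ℤ.* c)))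
               (cong₂ ℚ._+_
                 (trans (ℤ→ℚ-+ b (f ℤ.* (d ℤ.- a))) (cong (ι b ℚ.+_) (trans (ℤ→ℚ-* f (d ℤ.- a)) (cong (ι f ℚ.*_) (trans (ℤ→ℚ-+ d (ℤ.- a)) (cong (ι d ℚ.+_) (ℤ→ℚ-neg a)))))))
                 (trans (ℤ→ℚ-neg (f ℤ.* f ℤ.* c)) (cong ℚ.-_ (trans (ℤ→ℚ-* (f ℤ.* f) c) (cong (ℚ._* ι c) (ℤ→ℚ-* f f))))))) ⟩
        ½ ℚ.* (ι b ℚ.+ ι f ℚ.* (ι d ℚ.- ι a) ℚ.- ι f ℚ.* ι f ℚ.* ι c) ∎
        where open ≡.≡-Reasoning

      V⁻¹≡ : V f 2 ⁻¹ᴹ ≡ mat 1ℚ (ℚ.- (½ ℚ.* ι f)) 0ℚ ½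
      V⁻¹≡ = trans (cong (λ δ → ℚᴹ.scale (δ ⁻¹ℚ) (ℚᴹ.adj (V f 2)))
          (Q.solve 1 (λ f → Q.con 1ℚ Q.:* Q.con (ι (+ 2)) Q.:- f Q.:* Q.con 0ℚ Q.:= Q.con (ι (+ 2))) refl (ι f)))
        (cong (λ x → mat 1ℚ x 0ℚ ½) (Q.solve 1 (λ f → Q.con ½ Q.:* (Q.:- f) Q.:= Q.:- (Q.con ½ Q.:* f)) refl (ι f)))

      γ′-def : Matℤ→ℚ (Γ.matrix γ′) ≡ V f 2 ℚᴹ.· U 1 ⁻¹ᴹ ℚᴹ.· Matℤ→ℚ matrix ℚᴹ.· U 1 ℚᴹ.· V f 2 ⁻¹ᴹ
      γ′-def = trans entries (cong (λ W → V f 2 ℚᴹ.· U 1 ⁻¹ᴹ ℚᴹ.· Matℤ→ℚ matrix ℚᴹ.· U 1 ℚᴹ.· W) (sym V⁻¹≡))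
        where
        mat-cong : ∀ {x x′ y y′ z z′ w w′ : ℚ} → x ≡ x′ → y ≡ y′ → z ≡ z′ → w ≡ w′ → mat x y z w ≡ mat x′ y′ z′ w′
        mat-cong refl refl refl refl = refl

        entries : Matℤ→ℚ (Γ.matrix γ′) ≡ V f 2 ℚᴹ.· U 1 ⁻¹ᴹ ℚᴹ.· Matℤ→ℚ matrix ℚᴹ.· U 1 ℚᴹ.· mat 1ℚ (ℚ.- (½ ℚ.* ι f)) 0ℚ ½
        entries = mat-cong
          (trans (trans (ℤ→ℚ-+ a (f ℤ.* c)) (cong (ι a ℚ.+_) (ℤ→ℚ-* f c)))
            (Q.solve 5 (λ a b c d f → a Q.:+ f Q.:* c Q.:=
              ((p a c f Q.:* Q.con 1ℚ Q.:+ p b d f Q.:* Q.con 0ℚ) Q.:* Q.con 1ℚ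
                Q.:+ (p a c f Q.:* Q.con 0ℚ Q.:+ p b d f Q.:* Q.con 1ℚ) Q.:* Q.con 0ℚ)) refl (ι a) (ι b) (ι c) (ι d) (ι f)))
          (trans ιβ≡
            (Q.solve 5 (λ a b c d f → Q.con ½ Q.:* (b Q.:+ f Q.:* (d Q.:- a) Q.:- f Q.:* f Q.:* c) Q.:=
              ((p a c f Q.:* Q.con 1ℚ Q.:+ p b d f Q.:* Q.con 0ℚ) Q.:* (Q.:- (Q.con ½ Q.:* f))
                Q.:+ (p a c f Q.:* Q.con 0ℚ Q.:+ p b d f Q.:* Q.con 1ℚ) Q.:* Q.con ½)) refl (ι a) (ι b) (ι c) (ι d) (ι f)))
          (trans (ℤ→ℚ-* (+ 2) c)
            (Q.solve 4 (λ a b c d → Q.con (ι (+ 2)) Q.:* c Q.:=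
              ((q a c Q.:* Q.con 1ℚ Q.:+ q b d Q.:* Q.con 0ℚ) Q.:* Q.con 1ℚ
                Q.:+ (q a c Q.:* Q.con 0ℚ Q.:+ q b d Q.:* Q.con 1ℚ) Q.:* Q.con 0ℚ)) refl (ι a) (ι b) (ι c) (ι d)))
          (trans (trans (ℤ→ℚ-+ d (ℤ.- (f ℤ.* c))) (cong (ι d ℚ.+_) (trans (ℤ→ℚ-neg (f ℤ.* c)) (cong ℚ.-_ (ℤ→ℚ-* f c)))))
            (Q.solve 5 (λ a b c d f → d Q.:- f Q.:* c Q.:=
              ((q a c Q.:* Q.con 1ℚ Q.:+ q b d Q.:* Q.con 0ℚ) Q.:* (Q.:- (Q.con ½ Q.:* f))
                Q.:+ (q a c Q.:* Q.con 0ℚ Q.:+ q b d Q.:* Q.con 1ℚ) Q.:* Q.con ½)) refl (ι a) (ι b) (ι c) (ι d) (ι f)))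
          where
          p : ∀ {n} → Q.Polynomial n → Q.Polynomial n → Q.Polynomial n → Q.Polynomial n
          p x z f = (Q.con 1ℚ Q.:* Q.con 1ℚ Q.:+ f Q.:* Q.con 0ℚ) Q.:* x Q.:+ (Q.con 1ℚ Q.:* Q.con 0ℚ Q.:+ f Q.:* Q.con 1ℚ) Q.:* z

          q : ∀ {n} → Q.Polynomial n → Q.Polynomial n → Q.Polynomial n
          q x z = (Q.con 0ℚ Q.:* Q.con 1ℚ Q.:+ Q.con (ι (+ 2)) Q.:* Q.con 0ℚ) Q.:* x Q.:+ (Q.con 0ℚ Q.:* Q.con 0ℚ Q.:+ Q.con (ι (+ 2)) Q.:* Q.con 1ℚ) Q.:* z

      data₁ : DistributionData γ g
      data₁ = record
        { h = 2 ; y = 1 ; x = ρ₂ ; w = + 1 ; f = f ; γ′ = γ′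
        ; h-least = (s≤s z≤n , integer ρ₁ (trans (cong (ι (+ 2) ℚ.*_) r₁≡)
              (Q.solve 1 (λ x → Q.con (ι (+ 2)) Q.:* (Q.con ½ Q.:* x) Q.:= x) refl (ι ρ₁))))
            , λ { (suc zero) (_ , l , eq) → contradiction (l , trans (sym (trans (ℚ.*-identityˡ _) (trans r₁≡ (cong (λ ρ → ½ ℚ.* ι ρ) ρ₁-odd)))) eq) (half-not-integer t)
                ; (suc (suc n)) _ → s≤s (s≤s z≤n) }
        ; y≥1 = s≤s z≤n
        ; xy-coprime = Coprimality.sym (Coprimality.1-coprimeTo ℤ.∣ ρ₂ ∣)
        ; hr₂≡x/y = 0-integer (trans (cong (λ r → ι (+ 2) ℚ.* r ℚ.- ι ρ₂ ℚ.* 1ℚ) r₂≡)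
            (Q.solve 1 (λ x → Q.con (ι (+ 2)) Q.:* (Q.con ½ Q.:* x) Q.:- x Q.:* Q.con 1ℚ Q.:= Q.con 0ℚ) refl (ι ρ₂)))
        ; wr₁≡1/h = integer t (trans (cong (λ r → 1ℚ ℚ.* r ℚ.- ½) (trans r₁≡ (cong (λ ρ → ½ ℚ.* ι ρ) ρ₁-odd)))
            (trans (cong (λ x → 1ℚ ℚ.* (½ ℚ.* x) ℚ.- ½) (trans (ℤ→ℚ-+ (+ 1) (+ 2 ℤ.* t)) (cong (1ℚ ℚ.+_) (ℤ→ℚ-* (+ 2) t))))
              (Q.solve 1 (λ t → Q.con 1ℚ Q.:* (Q.con ½ Q.:* (Q.con 1ℚ Q.:+ Q.con (ι (+ 2)) Q.:* t)) Q.:- Q.con ½ Q.:= t) refl (ι t))))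
        ; wyr₂≡f/h = 0-integer (trans (cong (λ r → 1ℚ ℚ.* 1ℚ ℚ.* r ℚ.- ι f ℚ.* ½) r₂≡)
            (Q.solve 1 (λ x → Q.con 1ℚ Q.:* Q.con 1ℚ Q.:* (Q.con ½ Q.:* x) Q.:- x Q.:* Q.con ½ Q.:= Q.con 0ℚ) refl (ι ρ₂)))
        ; γ′-def = γ′-def
        }

      good₁ : Good data₁
      good₁ p@(p₁ , p₂) q∈ =
        let q = DistributionData.image data₁ p
            D₁ , D₂ = Lattice.Λ-elim γ′ q q∈
        in Λ-intro (2· p)
             (subst (+ N ∣ˢ_) (solve 5 (λ p₁ p₂ a c f →
                 (con (+ 2) :* p₁) :* (a :+ f :* c) :+ (con (+ 1) :* p₂ :- f :* p₁) :* (con (+ 2) :* c) :- con (+ 2) :* p₁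
                 := (p₁ :+ p₁) :* a :+ (p₂ :+ p₂) :* c :- (p₁ :+ p₁)) refl p₁ p₂ a c f) D₁)
             (subst (+ N ∣ˢ_) (trans (solve 8 (λ p₁ p₂ a b c d f β →
                 f :* ((con (+ 2) :* p₁) :* (a :+ f :* c) :+ (con (+ 1) :* p₂ :- f :* p₁) :* (con (+ 2) :* c) :- con (+ 2) :* p₁)
                   :+ con (+ 2) :* ((con (+ 2) :* p₁) :* β :+ (con (+ 1) :* p₂ :- f :* p₁) :* (d :- f :* c) :- (con (+ 1) :* p₂ :- f :* p₁))
                 := (p₁ :+ p₁) :* (con (+ 2) :* β :- f :* (d :- a) :+ f :* f :* c) :+ (p₂ :+ p₂) :* d :- (p₂ :+ p₂)) refl p₁ p₂ a b c d f β)
                 (cong (λ x → (p₁ ℤ.+ p₁) ℤ.* x ℤ.+ (p₂ ℤ.+ p₂) ℤ.* d ℤ.- (p₂ ℤ.+ p₂)) (trans (cong (λ x → x ℤ.- f ℤ.* (d ℤ.- a) ℤ.+ f ℤ.* f ℤ.* c) 2β≡)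
                   (solve 5 (λ a b c d f → b :+ f :* (d :- a) :- f :* f :* c :- f :* (d :- a) :+ f :* f :* c := b) refl a b c d f))))
               (Signed.∣m∣n⇒∣m+n (Signed.∣n⇒∣m*n f D₁) (Signed.∣n⇒∣m*n (+ 2) D₂)))

    -- ρ₁ even and ρ₂ odd: h = 1, y = 2 and w = f = 0.
    module Case₂ (t s : ℤ) (ρ₁-even : ρ₁ ≡ + 2 ℤ.* t) (ρ₂-odd : ρ₂ ≡ odd s) where
      c′ : ℤ
      c′ = t ℤ.* (+ 1 ℤ.- a) ℤ.- m ℤ.- s ℤ.* c

      2c′≡ : + 2 ℤ.* c′ ≡ c
      2c′≡ = begin
        + 2 ℤ.* c′
          ≡⟨ solve 5 (λ t a m s c → con (+ 2) :* (t :* (con (+ 1) :- a) :- m :- s :* c)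
               := con (+ 2) :* t :* (con (+ 1) :- a) :- con (+ 2) :* m :- con (+ 2) :* s :* c) refl t a m s c ⟩
        + 2 ℤ.* t ℤ.* (+ 1 ℤ.- a) ℤ.- + 2 ℤ.* m ℤ.- + 2 ℤ.* s ℤ.* c
          ≡⟨ cong (λ x → + 2 ℤ.* t ℤ.* (+ 1 ℤ.- a) ℤ.- x ℤ.- + 2 ℤ.* s ℤ.* c)
               (trans (sym ρ-first) (cong₂ (λ x y → x ℤ.* (+ 1 ℤ.- a) ℤ.- y ℤ.* c) ρ₁-even ρ₂-odd)) ⟩
        + 2 ℤ.* t ℤ.* (+ 1 ℤ.- a) ℤ.- (+ 2 ℤ.* t ℤ.* (+ 1 ℤ.- a) ℤ.- odd s ℤ.* c) ℤ.- + 2 ℤ.* s ℤ.* c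
          ≡⟨ solve 4 (λ t a s c → con (+ 2) :* t :* (con (+ 1) :- a) :- (con (+ 2) :* t :* (con (+ 1) :- a) :- (con (+ 1) :+ con (+ 2) :* s) :* c) :- con (+ 2) :* s :* c
               := c) refl t a s c ⟩
        c ∎
        where open ≡.≡-Reasoning

      c′>0 : + 0 ℤ.< c′
      c′>0 = ℤ.*-cancelˡ-<-nonNeg (+ 2) (subst (+ 0 ℤ.<_) (sym 2c′≡) c>0)

      γ′ : Γ N
      γ′ = record
        { matrix = mat a (+ 2 ℤ.* b) c′ d
        ; det≡1  = trans (solve 4 (λ a b c′ d → a :* d :- (con (+ 2) :* b) :* c′ := a :* d :- b :* (con (+ 2) :* c′)) refl a b c′ d)
            (trans (cong (λ c → a ℤ.* d ℤ.- b ℤ.* c) 2c′≡) det-eq)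
        ; c>0    = c′>0
        ; trace  = trace
        }

      γ′-def : Matℤ→ℚ (Γ.matrix γ′) ≡ V (+ 0) 1 ℚᴹ.· U 2 ⁻¹ᴹ ℚᴹ.· Matℤ→ℚ matrix ℚᴹ.· U 2 ℚᴹ.· V (+ 0) 1 ⁻¹ᴹ
      γ′-def = mat-cong
          (Q.solve 4 (λ a b c d → a Q.:= (p a c Q.:* Q.con 1ℚ Q.:+ p b d Q.:* Q.con 0ℚ) Q.:* Q.con 1ℚ Q.:+ (p a c Q.:* Q.con 0ℚ Q.:+ p b d Q.:* Q.con (ι (+ 2))) Q.:* Q.con 0ℚ)
            refl (ι a) (ι b) (ι c) (ι d))
          (trans (ℤ→ℚ-* (+ 2) b) (Q.solve 4 (λ a b c d → Q.con (ι (+ 2)) Q.:* b Q.:= (p a c Q.:* Q.con 1ℚ Q.:+ p b d Q.:* Q.con 0ℚ) Q.:* Q.con 0ℚ Q.:+ (p a c Q.:* Q.con 0ℚ Q.:+ p b d Q.:* Q.con (ι (+ 2))) Q.:* Q.con 1ℚ)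
            refl (ι a) (ι b) (ι c) (ι d)))
          (trans (sym (half-even c′)) (trans (cong (λ x → ½ ℚ.* ι x) 2c′≡) (Q.solve 4 (λ a b c d → Q.con ½ Q.:* c Q.:= (q a c Q.:* Q.con 1ℚ Q.:+ q b d Q.:* Q.con 0ℚ) Q.:* Q.con 1ℚ Q.:+ (q a c Q.:* Q.con 0ℚ Q.:+ q b d Q.:* Q.con (ι (+ 2))) Q.:* Q.con 0ℚ)
            refl (ι a) (ι b) (ι c) (ι d))))
          (Q.solve 4 (λ a b c d → d Q.:= (q a c Q.:* Q.con 1ℚ Q.:+ q b d Q.:* Q.con 0ℚ) Q.:* Q.con 0ℚ Q.:+ (q a c Q.:* Q.con 0ℚ Q.:+ q b d Q.:* Q.con (ι (+ 2))) Q.:* Q.con 1ℚ)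
            refl (ι a) (ι b) (ι c) (ι d))
        where
        mat-cong : ∀ {x x′ y y′ z z′ w w′ : ℚ} → x ≡ x′ → y ≡ y′ → z ≡ z′ → w ≡ w′ → mat x y z w ≡ mat x′ y′ z′ w′
        mat-cong refl refl refl refl = refl

        p q : ∀ {n} → Q.Polynomial n → Q.Polynomial n → Q.Polynomial n
        p x z = Q.con 1ℚ Q.:* x Q.:+ Q.con 0ℚ Q.:* z
        q x z = Q.con 0ℚ Q.:* x Q.:+ Q.con ½ Q.:* z

      data₂ : DistributionData γ g
      data₂ = record
        { h = 1 ; y = 2 ; x = ρ₂ ; w = + 0 ; f = + 0 ; γ′ = γ′
        ; h-least = (s≤s z≤n , integer t (trans (ℚ.*-identityˡ _) (trans r₁≡ (trans (cong (λ ρ → ½ ℚ.* ι ρ) ρ₁-even) (half-even t)))))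
            , λ _ → proj₁
        ; y≥1 = s≤s z≤n
        ; xy-coprime = subst (λ ρ → Coprime ℤ.∣ ρ ∣ 2) (sym ρ₂-odd) (odd-coprime-2 s)
        ; hr₂≡x/y = 0-integer (trans (cong (λ r → 1ℚ ℚ.* r ℚ.- ι ρ₂ ℚ.* ½) r₂≡)
            (Q.solve 1 (λ x → Q.con 1ℚ Q.:* (Q.con ½ Q.:* x) Q.:- x Q.:* Q.con ½ Q.:= Q.con 0ℚ) refl (ι ρ₂)))
        ; wr₁≡1/h = integer (ℤ.- + 1) (cong (ℚ._- 1ℚ) (ℚ.*-zeroˡ (proj₁ (rowTimesInverse γ g))))
        ; wyr₂≡f/h = 0-integer (trans (cong (λ r → 0ℚ ℚ.* ι (+ 2) ℚ.* r ℚ.- 0ℚ ℚ.* 1ℚ) r₂≡)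
            (Q.solve 1 (λ x → Q.con 0ℚ Q.:* Q.con (ι (+ 2)) Q.:* (Q.con ½ Q.:* x) Q.:- Q.con 0ℚ Q.:* Q.con 1ℚ Q.:= Q.con 0ℚ) refl (ι ρ₂)))
        ; γ′-def = γ′-def
        }

      good₂ : Good data₂
      good₂ p@(p₁ , p₂) q∈ =
        let D₁ , D₂ = Lattice.Λ-elim γ′ (DistributionData.image data₂ p) q∈
        in Λ-intro (2· p)
             (subst (+ N ∣ˢ_) (trans (solve 4 (λ p₁ p₂ a c′ →
                 con (+ 2) :* ((con (+ 1) :* p₁) :* a :+ (con (+ 2) :* p₂ :- con (+ 0) :* p₁) :* c′ :- con (+ 1) :* p₁)
                 := (p₁ :+ p₁) :* a :+ (p₂ :+ p₂) :* (con (+ 2) :* c′) :- (p₁ :+ p₁)) refl p₁ p₂ a c′)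
                 (cong (λ c → (p₁ ℤ.+ p₁) ℤ.* a ℤ.+ (p₂ ℤ.+ p₂) ℤ.* c ℤ.- (p₁ ℤ.+ p₁)) 2c′≡)) (Signed.∣n⇒∣m*n (+ 2) D₁))
             (subst (+ N ∣ˢ_) (solve 4 (λ p₁ p₂ b d →
                 (con (+ 1) :* p₁) :* (con (+ 2) :* b) :+ (con (+ 2) :* p₂ :- con (+ 0) :* p₁) :* d :- (con (+ 2) :* p₂ :- con (+ 0) :* p₁)
                 := (p₁ :+ p₁) :* b :+ (p₂ :+ p₂) :* d :- (p₂ :+ p₂)) refl p₁ p₂ b d) D₂)

  distributionData : ∃[ D ] Good D
  distributionData with parity ρ₁ | parity ρ₂
  ... | odd′ t eq    | _            = Case₁.data₁ t eq , Case₁.good₁ t eq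
  ... | even′ t eq   | odd′ s eq′   = Case₂.data₂ t s eq eq′ , Case₂.good₂ t s eq eq′
  ... | even′ t eq   | even′ s eq′  = contradiction (even⇒∈Λ t s eq eq′) g∉Λ

-- Conjugacy classes of trace N + 2

module Conjugacy where
  open ℤᴹ using (_·_; adj; det; tr; _▹_; 𝟙)
  open ℤS using (solve; con; _:=_; _:+_; _:*_; _:-_; :-_)

  mat-≡ : ∀ {A : Set} {x x′ y y′ z z′ w w′ : A} → x ≡ x′ → y ≡ y′ → z ≡ z′ → w ≡ w′ → mat x y z w ≡ mat x′ y′ z′ w′
  mat-≡ refl refl refl refl = refl

  Conjugate : Mat ℤ → Mat ℤ → Set
  Conjugate A B = ∃[ δ ] B ≡ SL₂ℤ.matrix δ · A · adj (SL₂ℤ.matrix δ)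

  conjugate-refl : ∀ A → Conjugate A A
  conjugate-refl (mat a b c d) = record { matrix = 𝟙 ; det≡1 = refl } , mat-≡
    (solve 4 (λ a b c d → a := (con (+ 1) :* a :+ con (+ 0) :* c) :* con (+ 1) :+ (con (+ 1) :* b :+ con (+ 0) :* d) :* con (+ 0)) refl a b c d)
    (solve 4 (λ a b c d → b := (con (+ 1) :* a :+ con (+ 0) :* c) :* con (+ 0) :+ (con (+ 1) :* b :+ con (+ 0) :* d) :* con (+ 1)) refl a b c d)
    (solve 4 (λ a b c d → c := (con (+ 0) :* a :+ con (+ 1) :* c) :* con (+ 1) :+ (con (+ 0) :* b :+ con (+ 1) :* d) :* con (+ 0)) refl a b c d)
    (solve 4 (λ a b c d → d := (con (+ 0) :* a :+ con (+ 1) :* c) :* con (+ 0) :+ (con (+ 0) :* b :+ con (+ 1) :* d) :* con (+ 1)) refl a b c d)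

  abstract
    ·-assoc : ∀ A B C → A · B · C ≡ A · (B · C)
    ·-assoc (mat a b c d) (mat a′ b′ c′ d′) (mat a″ b″ c″ d″) = mat-≡ (entry a b a″ c″) (entry a b b″ d″) (entry c d a″ c″) (entry c d b″ d″)
      where
      entry : ∀ x y z w → (x ℤ.* a′ ℤ.+ y ℤ.* c′) ℤ.* z ℤ.+ (x ℤ.* b′ ℤ.+ y ℤ.* d′) ℤ.* w
                        ≡ x ℤ.* (a′ ℤ.* z ℤ.+ b′ ℤ.* w) ℤ.+ y ℤ.* (c′ ℤ.* z ℤ.+ d′ ℤ.* w)
      entry x y z w = solve 8 (λ x y z w a b c d → (x :* a :+ y :* c) :* z :+ (x :* b :+ y :* d) :* w
        := x :* (a :* z :+ b :* w) :+ y :* (c :* z :+ d :* w)) refl x y z w a′ b′ c′ d′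

    adj-· : ∀ A B → adj (A · B) ≡ adj B · adj A
    adj-· (mat a b c d) (mat a′ b′ c′ d′) = mat-≡
      (solve 8 (λ a b c d a′ b′ c′ d′ → c :* b′ :+ d :* d′ := d′ :* d :+ (:- b′) :* (:- c)) refl a b c d a′ b′ c′ d′)
      (solve 8 (λ a b c d a′ b′ c′ d′ → :- (a :* b′ :+ b :* d′) := d′ :* (:- b) :+ (:- b′) :* a) refl a b c d a′ b′ c′ d′)
      (solve 8 (λ a b c d a′ b′ c′ d′ → :- (c :* a′ :+ d :* c′) := (:- c′) :* d :+ a′ :* (:- c)) refl a b c d a′ b′ c′ d′)
      (solve 8 (λ a b c d a′ b′ c′ d′ → a :* a′ :+ b :* c′ := (:- c′) :* (:- b) :+ a′ :* a) refl a b c d a′ b′ c′ d′)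

    det-· : ∀ A B → det (A · B) ≡ det A ℤ.* det B
    det-· (mat a b c d) (mat a′ b′ c′ d′) =
      solve 8 (λ a b c d a′ b′ c′ d′ → (a :* a′ :+ b :* c′) :* (c :* b′ :+ d :* d′) :- (a :* b′ :+ b :* d′) :* (c :* a′ :+ d :* c′)
        := (a :* d :- b :* c) :* (a′ :* d′ :- b′ :* c′)) refl a b c d a′ b′ c′ d′

  conjugate-trans : ∀ {A B C} → Conjugate A B → Conjugate B C → Conjugate A C
  conjugate-trans {A} (δ , refl) (ε , refl) =
      record { matrix = E · D ; det≡1 = trans (det-· E D) (cong₂ ℤ._*_ (SL₂ℤ.det≡1 ε) (SL₂ℤ.det≡1 δ)) }
    , (begin
        E · (D · A · adj D) · adj E      ≡⟨ cong (_· adj E) (·-assoc E (D · A) (adj D)) ⟨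
        E · (D · A) · adj D · adj E      ≡⟨ ·-assoc (E · (D · A)) (adj D) (adj E) ⟩
        E · (D · A) · (adj D · adj E)    ≡⟨ cong₂ _·_ (sym (·-assoc E D A)) (sym (adj-· E D)) ⟩
        E · D · A · adj (E · D)          ∎)
    where
    open ≡.≡-Reasoning
    D E : Mat ℤ
    D = SL₂ℤ.matrix δ
    E = SL₂ℤ.matrix ε

  translate : ℤ → Mat ℤ → Mat ℤ
  translate k (mat a b c d) = mat (a ℤ.+ k ℤ.* c) (b ℤ.+ k ℤ.* (d ℤ.- a) ℤ.- k ℤ.* k ℤ.* c) c (d ℤ.- k ℤ.* c)

  translate-conjugate : ∀ k A → Conjugate A (translate k A)
  translate-conjugate k (mat a b c d) = record { matrix = mat (+ 1) k (+ 0) (+ 1) ; det≡1 = solve 1 (λ k → con (+ 1) :* con (+ 1) :- k :* con (+ 0) := con (+ 1)) refl k } , mat-≡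
    (solve 5 (λ a b c d k → a :+ k :* c := (con (+ 1) :* a :+ k :* c) :* con (+ 1) :+ (con (+ 1) :* b :+ k :* d) :* con (+ 0)) refl a b c d k)
    (solve 5 (λ a b c d k → b :+ k :* (d :- a) :- k :* k :* c := (con (+ 1) :* a :+ k :* c) :* (:- k) :+ (con (+ 1) :* b :+ k :* d) :* con (+ 1)) refl a b c d k)
    (solve 5 (λ a b c d k → c := (con (+ 0) :* a :+ con (+ 1) :* c) :* con (+ 1) :+ (con (+ 0) :* b :+ con (+ 1) :* d) :* con (+ 0)) refl a b c d k)
    (solve 5 (λ a b c d k → d :- k :* c := (con (+ 0) :* a :+ con (+ 1) :* c) :* (:- k) :+ (con (+ 0) :* b :+ con (+ 1) :* d) :* con (+ 1)) refl a b c d k)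

  flip-mat : Mat ℤ → Mat ℤ
  flip-mat (mat a b c d) = mat d (ℤ.- c) (ℤ.- b) a

  flip-conjugate : ∀ A → Conjugate A (flip-mat A)
  flip-conjugate (mat a b c d) = record { matrix = mat (+ 0) (ℤ.- + 1) (+ 1) (+ 0) ; det≡1 = refl } , mat-≡
    (solve 4 (λ a b c d → d := (con (+ 0) :* a :+ con (ℤ.- + 1) :* c) :* con (+ 0) :+ (con (+ 0) :* b :+ con (ℤ.- + 1) :* d) :* (:- con (+ 1))) refl a b c d)
    (solve 4 (λ a b c d → :- c := (con (+ 0) :* a :+ con (ℤ.- + 1) :* c) :* (:- con (ℤ.- + 1)) :+ (con (+ 0) :* b :+ con (ℤ.- + 1) :* d) :* con (+ 0)) refl a b c d)
    (solve 4 (λ a b c d → :- b := (con (+ 1) :* a :+ con (+ 0) :* c) :* con (+ 0) :+ (con (+ 1) :* b :+ con (+ 0) :* d) :* (:- con (+ 1))) refl a b c d)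
    (solve 4 (λ a b c d → a := (con (+ 1) :* a :+ con (+ 0) :* c) :* (:- con (ℤ.- + 1)) :+ (con (+ 1) :* b :+ con (+ 0) :* d) :* con (+ 0)) refl a b c d)

  square-abs : ∀ i → i ℤ.* i ≡ + (ℤ.∣ i ∣ ℕ.* ℤ.∣ i ∣)
  square-abs (+ n)    = sym (ℤ.pos-* n n)
  square-abs -[1+ n ] = refl

  centered-remainder : ∀ e c → c ≢ + 0 → ∃[ k ] ℤ.∣ e ℤ.+ + 2 ℤ.* k ℤ.* c ∣ ≤ ℤ.∣ c ∣
  centered-remainder e c c≢0 = direction c refl
    where
    instance
      _ : ℕ.NonZero ℤ.∣ c ∣
      _ = ℤ.≢-nonZero c≢0

    C n : ℕ
    C = ℤ.∣ c ∣
    n = C ℕ.+ C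

    n≢0 : ℕ.NonZero n
    n≢0 = ℕ.>-nonZero (ℕ.≤-trans (ℕ.>-nonZero⁻¹ C) (ℕ.m≤m+n C C))

    q : ℤ
    q = ((e ℤ.+ + C) ℤ./ℕ n) {{n≢0}}

    ρ : ℕ
    ρ = ((e ℤ.+ + C) ℤ.%ℕ n) {{n≢0}}

    division : e ℤ.- q ℤ.* (+ C ℤ.+ + C) ≡ + ρ ℤ.- + C
    division = trans (solve 3 (λ e C x → e :- x := (e :+ C) :- x :- C) refl e (+ C) (q ℤ.* (+ C ℤ.+ + C)))
      (cong (ℤ._- + C) (trans (cong (ℤ._- q ℤ.* (+ C ℤ.+ + C)) (ℤ.a≡a%ℕn+[a/ℕn]*n (e ℤ.+ + C) n {{n≢0}}))
        (solve 2 (λ r x → (r :+ x) :- x := r) refl (+ ρ) (q ℤ.* (+ C ℤ.+ + C)))))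

    bound : ℤ.∣ e ℤ.- q ℤ.* (+ C ℤ.+ + C) ∣ ≤ C
    bound = subst (_≤ C) (sym (trans (cong ℤ.∣_∣ (trans division (ℤ.[+m]-[+n]≡m⊖n ρ C))) refl)) (∣⊖∣≤ (ℤ.n%ℕd<d (e ℤ.+ + C) n {{n≢0}}))
      where
      ∣⊖∣≤ : ρ ℕ.< n → ℤ.∣ ρ ℤ.⊖ C ∣ ≤ C
      ∣⊖∣≤ ρ<n = [ (λ ρ≤C → subst (_≤ C) (sym (ℤ.∣⊖∣-≤ ρ≤C)) (ℕ.m∸n≤m C ρ))
                 , (λ C≤ρ → subst (_≤ C) (sym (trans (ℤ.∣m⊖n∣≡∣n⊖m∣ ρ C) (ℤ.∣⊖∣-≤ C≤ρ)))
                     (ℕ.m≤n+o⇒m∸n≤o ρ C (ℕ.<⇒≤ ρ<n))) ]′ (ℕ.≤-total ρ C)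

    direction : ∀ z → c ≡ z → ∃[ k ] ℤ.∣ e ℤ.+ + 2 ℤ.* k ℤ.* c ∣ ≤ C
    direction (+ m)    refl = ℤ.- q , subst (λ x → ℤ.∣ x ∣ ≤ C)
      (solve 3 (λ e q c → e :- q :* (c :+ c) := e :+ con (+ 2) :* (:- q) :* c) refl e q c) bound
    direction -[1+ m ] refl = q , subst (λ x → ℤ.∣ x ∣ ≤ C)
      (solve 3 (λ e q c → e :- q :* (:- c :+ :- c) := e :+ con (+ 2) :* q :* c) refl e q c) bound

  record Bounded (B : ℕ) (A : Mat ℤ) : Set where
    field
      ∣a∣≤ : ℤ.∣ Mat.a A ∣ ≤ B
      ∣b∣≤ : ℤ.∣ Mat.b A ∣ ≤ B
      ∣c∣≤ : ℤ.∣ Mat.c A ∣ ≤ B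
      ∣d∣≤ : ℤ.∣ Mat.d A ∣ ≤ B

  module _ (N : ℕ) (N≥1 : 1 ≤ N) where
    discriminant bound : ℕ
    discriminant = N ℕ.* N ℕ.+ 4 ℕ.* N
    bound        = N ℕ.+ 2 ℕ.+ discriminant

    Admissible : Mat ℤ → Set
    Admissible A = det A ≡ + 1 × tr A ≡ + (N ℕ.+ 2)

    translate-admissible : ∀ k A → Admissible A → Admissible (translate k A)
    translate-admissible k (mat a b c d) (p , q) =
        trans (solve 5 (λ a b c d k → (a :+ k :* c) :* (d :- k :* c) :- (b :+ k :* (d :- a) :- k :* k :* c) :* c := a :* d :- b :* c) refl a b c d k) p
      , trans (solve 4 (λ a c d k → a :+ k :* c :+ (d :- k :* c) := a :+ d) refl a c d k) q

    flip-admissible : ∀ A → Admissible A → Admissible (flip-mat A)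
    flip-admissible (mat a b c d) (p , q) =
        trans (solve 4 (λ a b c d → d :* a :- (:- c) :* (:- b) := a :* d :- b :* c) refl a b c d) p
      , trans (ℤ.+-comm d a) q

    bc-nonzero : ∀ A → Admissible A → Mat.b A ℤ.* Mat.c A ≢ + 0
    bc-nonzero (mat a b c d) (p , q) bc≡0 = ≢2 (units a d ad≡1) q
      where
      ad≡1 : a ℤ.* d ≡ + 1
      ad≡1 = trans (solve 2 (λ x y → x := (x :- y) :+ y) refl (a ℤ.* d) (b ℤ.* c)) (cong₂ ℤ._+_ p bc≡0)

      units : ∀ a d → a ℤ.* d ≡ + 1 → a ℤ.+ d ≡ + 2 ⊎ a ℤ.+ d ≡ -[1+ 1 ]
      units a d eq = cases a d eq (ℕ.m*n≡1⇒m≡1 ℤ.∣ a ∣ ℤ.∣ d ∣ abs) (ℕ.m*n≡1⇒n≡1 ℤ.∣ a ∣ ℤ.∣ d ∣ abs)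
        where
        abs : ℤ.∣ a ∣ ℕ.* ℤ.∣ d ∣ ≡ 1
        abs = trans (sym (ℤ.abs-* a d)) (cong ℤ.∣_∣ eq)

        cases : ∀ a d → a ℤ.* d ≡ + 1 → ℤ.∣ a ∣ ≡ 1 → ℤ.∣ d ∣ ≡ 1 → a ℤ.+ d ≡ + 2 ⊎ a ℤ.+ d ≡ -[1+ 1 ]
        cases (+ 1)    (+ 1)    _  _ _ = inj₁ refl
        cases -[1+ 0 ] -[1+ 0 ] _  _ _ = inj₂ refl
        cases (+ 1)    -[1+ 0 ] () _ _
        cases -[1+ 0 ] (+ 1)    () _ _

      ≢2 : a ℤ.+ d ≡ + 2 ⊎ a ℤ.+ d ≡ -[1+ 1 ] → a ℤ.+ d ≢ + (N ℕ.+ 2)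
      ≢2 (inj₁ eq) eq′ = contradiction N≥1 (ℕ.<⇒≱ (s≤s (ℕ.≤-reflexive (ℕ.+-cancelʳ-≡ 2 N 0 (ℤ.+-injective (trans (sym eq′) eq))))))
      ≢2 (inj₂ eq) eq′ with trans (sym eq) eq′
      ... | ()

    b≢0 : ∀ A → Admissible A → Mat.b A ≢ + 0
    b≢0 A adm eq = bc-nonzero A adm (trans (cong (ℤ._* Mat.c A) eq) (ℤ.*-zeroˡ (Mat.c A)))

    c≢0 : ∀ A → Admissible A → Mat.c A ≢ + 0
    c≢0 A adm eq = bc-nonzero A adm (trans (cong (Mat.b A ℤ.*_) eq) (ℤ.*-zeroʳ (Mat.b A)))

    -- 4bc = N² + 4N - (a - d)²
    discriminant-eq : ∀ a b c d → Admissible (mat a b c d) →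
                      + 4 ℤ.* (b ℤ.* c) ℤ.+ (a ℤ.- d) ℤ.* (a ℤ.- d) ≡ + discriminant
    discriminant-eq a b c d (p , q) = begin
      + 4 ℤ.* (b ℤ.* c) ℤ.+ (a ℤ.- d) ℤ.* (a ℤ.- d)
        ≡⟨ solve 4 (λ a b c d → con (+ 4) :* (b :* c) :+ (a :- d) :* (a :- d) := (a :+ d) :* (a :+ d) :- con (+ 4) :* (a :* d :- b :* c)) refl a b c d ⟩
      (a ℤ.+ d) ℤ.* (a ℤ.+ d) ℤ.- + 4 ℤ.* (a ℤ.* d ℤ.- b ℤ.* c)
        ≡⟨ cong₂ (λ t δ → t ℤ.* t ℤ.- + 4 ℤ.* δ) q p ⟩
      (+ N ℤ.+ + 2) ℤ.* (+ N ℤ.+ + 2) ℤ.- + 4 ℤ.* + 1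
        ≡⟨ solve 1 (λ n → (n :+ con (+ 2)) :* (n :+ con (+ 2)) :- con (+ 4) :* con (+ 1) := n :* n :+ con (+ 4) :* n) refl (+ N) ⟩
      + N ℤ.* + N ℤ.+ + 4 ℤ.* + N
        ≡⟨ cong₂ ℤ._+_ (ℤ.pos-* N N) (ℤ.pos-* 4 N) ⟨
      + discriminant ∎
      where open ≡.≡-Reasoning

    Reduced : Mat ℤ → Set
    Reduced A = Admissible A × + 0 ℤ.< Mat.c A × Bounded bound A

    private
      flip-reduced-or-not : ∀ a b c d → Admissible (mat a b c d) → ℤ.∣ b ∣ ≤ discriminant → ℤ.∣ c ∣ ≤ discriminant →
                            ℤ.∣ a ℤ.- d ∣ ≤ ℤ.∣ c ∣ → + 0 ℤ.< b ℤ.* c → ∃[ B ] (Conjugate (mat a b c d) B × Reduced B)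
      flip-reduced-or-not a b c d adm@(_ , q) b≤ c≤ e≤ bc>0 = split c refl
        where
        widen : ∀ {x} → x ≤ discriminant → x ≤ bound
        widen x≤ = ℕ.≤-trans x≤ (ℕ.m≤n+m discriminant (N ℕ.+ 2))

        half : ∀ x y → x ℤ.+ x ≡ + (N ℕ.+ 2) ℤ.+ y → ℤ.∣ y ∣ ≤ discriminant → ℤ.∣ x ∣ ≤ bound
        half x y eq y≤ = ℕ.≤-trans (ℕ.m≤m+n ℤ.∣ x ∣ ℤ.∣ x ∣) (subst (_≤ bound) (double x)
          (ℕ.≤-trans (ℕ.≤-reflexive (cong ℤ.∣_∣ eq)) (ℕ.≤-trans (ℤ.∣i+j∣≤∣i∣+∣j∣ (+ (N ℕ.+ 2)) y) (ℕ.+-monoʳ-≤ (N ℕ.+ 2) y≤))))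
          where
          double : ∀ x → ℤ.∣ x ℤ.+ x ∣ ≡ ℤ.∣ x ∣ ℕ.+ ℤ.∣ x ∣
          double (+ n)    = refl
          double -[1+ n ] = cong suc (sym (ℕ.+-suc n n))

        a≤ : ℤ.∣ a ∣ ≤ bound
        a≤ = half a (a ℤ.- d) (trans (solve 2 (λ a d → a :+ a := (a :+ d) :+ (a :- d)) refl a d) (cong (ℤ._+ (a ℤ.- d)) q)) (ℕ.≤-trans e≤ c≤)

        d≤ : ℤ.∣ d ∣ ≤ bound
        d≤ = half d (d ℤ.- a) (trans (solve 2 (λ a d → d :+ d := (a :+ d) :+ (d :- a)) refl a d) (cong (ℤ._+ (d ℤ.- a)) q))
          (ℕ.≤-trans (ℕ.≤-reflexive (ℤ.∣i-j∣≡∣j-i∣ d a)) (ℕ.≤-trans e≤ c≤))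

        split : ∀ z → c ≡ z → ∃[ B ] (Conjugate (mat a b c d) B × Reduced B)
        split (+ zero)  refl = contradiction refl (c≢0 (mat a b c d) adm)
        split (+ suc n) refl = mat a b c d , conjugate-refl (mat a b c d) , adm , ℤ.+<+ (s≤s z≤n)
          , record { ∣a∣≤ = a≤ ; ∣b∣≤ = widen b≤ ; ∣c∣≤ = widen c≤ ; ∣d∣≤ = d≤ }
        split -[1+ n ]  refl = flip-mat (mat a b c d) , flip-conjugate (mat a b c d) , flip-admissible (mat a b c d) adm , -b>0 b bc>0
          , record { ∣a∣≤ = d≤ ; ∣b∣≤ = widen c≤ ; ∣c∣≤ = subst (_≤ bound) (sym (ℤ.∣-i∣≡∣i∣ b)) (widen b≤) ; ∣d∣≤ = a≤ }
          where
          -b>0 : ∀ b → + 0 ℤ.< b ℤ.* -[1+ n ] → + 0 ℤ.< ℤ.- b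
          -b>0 (+ zero)  (ℤ.+<+ ())
          -b>0 (+ suc m) ()
          -b>0 -[1+ m ]  _ = ℤ.+<+ (s≤s z≤n)

    reduce : ∀ A → Admissible A → ∃[ B ] (Conjugate A B × Reduced B)
    reduce A adm = go A adm (ℕ.<-wellFounded ℤ.∣ Mat.c A ∣)
      where
      go : ∀ A → Admissible A → Acc ℕ._<_ ℤ.∣ Mat.c A ∣ → ∃[ B ] (Conjugate A B × Reduced B)
      go A@(mat a b c d) adm (acc rec) with centered-remainder (a ℤ.- d) c (c≢0 A adm)
      ... | k , e≤ with ℤ.∣ Mat.b (translate k A) ∣ ℕ.<? ℤ.∣ c ∣
      ...   | yes b<c =
              let A′ = translate k A
                  adm′ = translate-admissible k A adm
                  B , conj , red = go (flip-mat A′) (flip-admissible A′ adm′)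
                    (rec (subst (ℕ._< ℤ.∣ c ∣) (sym (ℤ.∣-i∣≡∣i∣ (Mat.b A′))) b<c))
              in B , conjugate-trans (translate-conjugate k A) (conjugate-trans (flip-conjugate A′) conj) , red
      ...   | no b≮c =
              let B , conj , red = finish (b′ ℤ.* c) refl
              in B , conjugate-trans (translate-conjugate k A) conj , red
        where
        a′ b′ d′ : ℤ
        a′ = Mat.a (translate k A)
        b′ = Mat.b (translate k A)
        d′ = Mat.d (translate k A)

        adm′ : Admissible (mat a′ b′ c d′)
        adm′ = translate-admissible k A adm

        e′≤ : ℤ.∣ a′ ℤ.- d′ ∣ ≤ ℤ.∣ c ∣
        e′≤ = subst (λ x → ℤ.∣ x ∣ ≤ ℤ.∣ c ∣)
          (solve 4 (λ a c d k → a :- d :+ con (+ 2) :* k :* c := (a :+ k :* c) :- (d :- k :* c)) refl a c d k) e≤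

        E : ℕ
        E = ℤ.∣ a′ ℤ.- d′ ∣ ℕ.* ℤ.∣ a′ ℤ.- d′ ∣

        eq : + 4 ℤ.* (b′ ℤ.* c) ℤ.+ + E ≡ + discriminant
        eq = trans (cong (ℤ._+_ (+ 4 ℤ.* (b′ ℤ.* c))) (sym (square-abs (a′ ℤ.- d′)))) (discriminant-eq a′ b′ c d′ adm′)

        1≤∣c∣ : 1 ≤ ℤ.∣ c ∣
        1≤∣c∣ = ℕ.>-nonZero⁻¹ ℤ.∣ c ∣ {{ℤ.≢-nonZero (c≢0 A adm)}}

        1≤∣b∣ : 1 ≤ ℤ.∣ b′ ∣
        1≤∣b∣ = ℕ.>-nonZero⁻¹ ℤ.∣ b′ ∣ {{ℤ.≢-nonZero (b≢0 (translate k A) adm′)}}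

        finish : ∀ p → b′ ℤ.* c ≡ p → ∃[ B ] (Conjugate (translate k A) B × Reduced B)
        finish (+ zero)  bc≡ = contradiction bc≡ (bc-nonzero (translate k A) adm′)
        finish (+ suc n) bc≡ = flip-reduced-or-not a′ b′ c d′ adm′
            (ℕ.≤-trans (subst (_≤ ℤ.∣ b′ ∣ ℕ.* ℤ.∣ c ∣) (ℕ.*-identityʳ _) (ℕ.*-monoʳ-≤ ℤ.∣ b′ ∣ 1≤∣c∣)) product≤)
            (ℕ.≤-trans (subst (_≤ ℤ.∣ b′ ∣ ℕ.* ℤ.∣ c ∣) (ℕ.*-identityˡ _) (ℕ.*-monoˡ-≤ ℤ.∣ c ∣ 1≤∣b∣)) product≤)
            e′≤ (subst (+ 0 ℤ.<_) (sym bc≡) (ℤ.+<+ (s≤s z≤n)))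
          where
          eqℕ : 4 ℕ.* suc n ℕ.+ E ≡ discriminant
          eqℕ = ℤ.+-injective (trans (cong (λ p → + 4 ℤ.* p ℤ.+ + E) (sym bc≡)) eq)

          product≤ : ℤ.∣ b′ ∣ ℕ.* ℤ.∣ c ∣ ≤ discriminant
          product≤ = begin
            ℤ.∣ b′ ∣ ℕ.* ℤ.∣ c ∣    ≡⟨ ℤ.abs-* b′ c ⟨
            ℤ.∣ b′ ℤ.* c ∣          ≡⟨ cong ℤ.∣_∣ bc≡ ⟩
            suc n                   ≤⟨ ℕ.m≤n*m (suc n) 4 ⟩
            4 ℕ.* suc n             ≤⟨ ℕ.m≤m+n (4 ℕ.* suc n) E ⟩
            4 ℕ.* suc n ℕ.+ E       ≡⟨ eqℕ ⟩
            discriminant            ∎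
            where open ℕ.≤-Reasoning
        finish -[1+ n ]  bc≡ = contradiction 4c≤c (ℕ.<⇒≱ c<4c)
          where
          eqℕ : E ≡ discriminant ℕ.+ 4 ℕ.* suc n
          eqℕ = ℤ.+-injective (begin
            + E                                                     ≡⟨ solve 2 (λ e p → e := (con (+ 4) :* (:- p) :+ e) :+ con (+ 4) :* p) refl (+ E) (+ suc n) ⟩
            (+ 4 ℤ.* -[1+ n ] ℤ.+ + E) ℤ.+ + 4 ℤ.* + suc n          ≡⟨ cong (ℤ._+ + 4 ℤ.* + suc n) (trans (cong (λ p → + 4 ℤ.* p ℤ.+ + E) (sym bc≡)) eq) ⟩
            + discriminant ℤ.+ + 4 ℤ.* + suc n                      ≡⟨ cong (ℤ._+_ (+ discriminant)) (ℤ.pos-* 4 (suc n)) ⟨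
            + (discriminant ℕ.+ 4 ℕ.* suc n)                        ∎)
            where open ≡.≡-Reasoning

          c²-bound : 4 ℕ.* ℤ.∣ c ∣ ℕ.* ℤ.∣ c ∣ ≤ ℤ.∣ c ∣ ℕ.* ℤ.∣ c ∣
          c²-bound = begin
            4 ℕ.* ℤ.∣ c ∣ ℕ.* ℤ.∣ c ∣        ≤⟨ ℕ.*-monoˡ-≤ ℤ.∣ c ∣ (ℕ.*-monoʳ-≤ 4 (ℕ.≮⇒≥ b≮c)) ⟩
            4 ℕ.* ℤ.∣ b′ ∣ ℕ.* ℤ.∣ c ∣       ≡⟨ ℕ.*-assoc 4 ℤ.∣ b′ ∣ ℤ.∣ c ∣ ⟩
            4 ℕ.* (ℤ.∣ b′ ∣ ℕ.* ℤ.∣ c ∣)     ≡⟨ cong (4 ℕ.*_) (trans (sym (ℤ.abs-* b′ c)) (cong ℤ.∣_∣ bc≡)) ⟩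
            4 ℕ.* suc n                      ≤⟨ ℕ.m≤n+m (4 ℕ.* suc n) discriminant ⟩
            discriminant ℕ.+ 4 ℕ.* suc n     ≡⟨ eqℕ ⟨
            E                                ≤⟨ ℕ.*-mono-≤ e′≤ e′≤ ⟩
            ℤ.∣ c ∣ ℕ.* ℤ.∣ c ∣              ∎
            where open ℕ.≤-Reasoning

          4c≤c : 4 ℕ.* ℤ.∣ c ∣ ≤ ℤ.∣ c ∣
          4c≤c = ℕ.*-cancelʳ-≤ (4 ℕ.* ℤ.∣ c ∣) ℤ.∣ c ∣ ℤ.∣ c ∣ {{ℤ.≢-nonZero (c≢0 A adm)}} c²-bound

          c<4c : ℤ.∣ c ∣ ℕ.< 4 ℕ.* ℤ.∣ c ∣
          c<4c = ℕ.≤-trans (ℕ.+-monoˡ-≤ ℤ.∣ c ∣ 1≤∣c∣) (ℕ.≤-trans (ℕ.≤-reflexive (cong (ℤ.∣ c ∣ ℕ.+_) (sym (ℕ.+-identityʳ ℤ.∣ c ∣)))) (ℕ.*-monoˡ-≤ ℤ.∣ c ∣ {2} {4} (s≤s (s≤s z≤n))))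

    private
      toΓ : Mat ℤ → List (Γ N)
      toΓ A with det A ℤ.≟ + 1 | + 0 ℤ.<? Mat.c A | tr A ℤ.≟ + (N ℕ.+ 2)
      ... | yes p | yes q | yes t = record { matrix = A ; det≡1 = p ; c>0 = q ; trace = t } ∷ []
      ... | _     | _     | _     = []

      toΓ-complete : ∀ A → Admissible A → + 0 ℤ.< Mat.c A → ∃[ γ ] (γ ∈ toΓ A × Γ.matrix γ ≡ A)
      toΓ-complete A (p , t) q with det A ℤ.≟ + 1 | + 0 ℤ.<? Mat.c A | tr A ℤ.≟ + (N ℕ.+ 2)
      ... | yes _ | yes _ | yes _ = _ , here refl , refl
      ... | no ¬p | _     | _     = contradiction p ¬p
      ... | yes _ | no ¬q | _     = contradiction q ¬q
      ... | yes _ | yes _ | no ¬t = contradiction t ¬t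

      integers : List ℤ
      integers = map +_ (upTo (suc bound)) ++ map (λ n → ℤ.- (+ n)) (upTo (suc bound))

      integers-complete : ∀ i → ℤ.∣ i ∣ ≤ bound → i ∈ integers
      integers-complete (+ n)    n≤ = ∈-++⁺ˡ (∈-map⁺ +_ (∈-upTo⁺ (s≤s n≤)))
      integers-complete -[1+ n ] n≤ = ∈-++⁺ʳ (map +_ (upTo (suc bound))) (∈-map⁺ (λ n → ℤ.- (+ n)) (∈-upTo⁺ {i = suc n} (s≤s n≤)))

      matrices : List (Mat ℤ)
      matrices = cartesianProductWith (λ (a , b) (c , d) → mat a b c d) (cartesianProduct integers integers) (cartesianProduct integers integers)

    classes : List (Γ N)
    classes = concatMap toΓ matrices

    classes-complete : ∀ (γ : Γ N) → ∃[ γ′ ] (γ′ ∈ classes × Conjugate (Γ.matrix γ) (Γ.matrix γ′))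
    classes-complete γ =
      let A , conj , adm , c>0 , bdd = reduce (Γ.matrix γ) (Γ.det≡1 γ , Γ.trace γ)
          open Bounded bdd
          γ′ , γ′∈ , eq = toΓ-complete A adm c>0
          A∈ = ∈-cartesianProductWith⁺ (λ (a , b) (c , d) → mat a b c d)
                 (∈-cartesianProduct⁺ (integers-complete (Mat.a A) ∣a∣≤) (integers-complete (Mat.b A) ∣b∣≤))
                 (∈-cartesianProduct⁺ (integers-complete (Mat.c A) ∣c∣≤) (integers-complete (Mat.d A) ∣d∣≤))
      in γ′ , ∈-concatMap⁺ toΓ (lose A∈ γ′∈) , subst (Conjugate (Γ.matrix γ)) (sym eq) conj

-- The equations over an arbitrary ring

-- The equations of X_N with all divisions cleared, over an arbitrary commutative ring;
-- I γ y stands for 1 / X⁻ γ y.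
record Model (R : CommutativeRing 0ℓ 0ℓ) (M : ℕ) (E : ℤ → CommutativeRing.Carrier R) (r : CommutativeRing.Carrier R) : Set where
  open CommutativeRing R renaming (Carrier to A)
  open IntegerScalars R using (fromℤ)
  open RootsOfUnity R M using (_≈±_)
  open ListSums R using (ΣL)

  N : ℕ
  N = suc M

  field
    pair : Γ N → ℤ² → ℤ² → A
    quad : Γ N → ℤ² → A
    μ    : Γ N → A
    X    : Sign → Γ N → ℤ² → A

  X⁺ : Γ N → ℤ² → A
  X⁺ = X Sign.+

  X⁻ : Γ N → ℤ² → A
  X⁻ = X Sign.-

  I : Γ N → ℤ² → A
  I γ y = quad γ (⊝ y) * X⁺ γ (⊝ y)

  field
    pair-root : ∀ γ u v → pair γ u v ≈± E (+ 2 ℤ.* ω (Lattice.φ γ u) v)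
    pair-⊕    : ∀ γ u u′ v → pair γ (u ⊕ u′) v ≈ pair γ u v * pair γ u′ v
    pair-Λ    : ∀ γ u v → InΛ γ u → pair γ u v ≈ 1#
    pair-sym  : ∀ γ u v → pair γ u v ≈ pair γ v u
    quad-root : ∀ γ u → quad γ u ≈± E (ω (u ℤᴹ.▹ Γ.matrix γ) u)
    quad-𝟎    : ∀ γ → quad γ 𝟎 ≈ 1#
    r²≈N      : ∀ (γ : Γ N) u → ¬ InΛ γ u → r * r ≈ fromℤ (+ N)
    periodic  : ∀ s γ {u v} → Lattice._~_ γ u v → X s γ u ≈ X s γ v
    sign-independent : ∀ γ u → ¬ InΛ γ u → X⁺ γ u ≈ X⁻ γ u
    conjugation      : ∀ s (δ : SL₂ℤ) (γ γ′ : Γ N) u →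
      Γ.matrix γ′ ≡ SL₂ℤ.matrix δ ℤᴹ.· Γ.matrix γ ℤᴹ.· ℤᴹ.adj (SL₂ℤ.matrix δ) →
      X s γ′ (u ℤᴹ.▹ ℤᴹ.adj (SL₂ℤ.matrix δ)) ≈ X s γ u
    squares-at-𝟎 : ∀ γ → X⁺ γ 𝟎 * X⁺ γ 𝟎 + X⁻ γ 𝟎 * X⁻ γ 𝟎 ≈ fromℤ (+ (N ℕ.+ 2))
    inversion    : ∀ γ u → X⁺ γ u * X⁻ γ (⊝ u) * quad γ u ≈ 1#
    fourier      : ∀ γ u w → ¬ InΛ γ w → ΣL (representatives γ) (λ x → pair γ x u * X⁺ γ x) ≈ r * (μ γ * I γ u)
    convolution  : ∀ γ u v → ¬ (InΛ γ u × InΛ γ v) →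
      ΣL (representatives γ) (λ x → pair γ x u * (X⁺ γ x * I γ (x ⊕ v))) ≈ r * (X⁺ γ (u ⊕ v) * (I γ u * I γ v))
    distribution : ∀ γ g → IsOrder γ g 2 → (D : DistributionData γ g) → ∀ p κ κ′ →
      μ γ * κ ≈ 1# → μ (DistributionData.γ′ D) * κ′ ≈ 1# →
      κ * κ * (X⁺ γ (p ⊕ 1 ⊛ g) * X⁺ γ (p ⊕ 2 ⊛ g)) ≈ κ′ * X⁺ (DistributionData.γ′ D) (DistributionData.image D p)

⊝⊝ : ∀ u → ⊝ ⊝ u ≡ u
⊝⊝ (u₁ , u₂) = cong₂ _,_ (ℤ.neg-involutive u₁) (ℤ.neg-involutive u₂)

⊕𝟎 : ∀ u → u ⊕ 𝟎 ≡ u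
⊕𝟎 (u₁ , u₂) = cong₂ _,_ (ℤ.+-identityʳ u₁) (ℤ.+-identityʳ u₂)

module ModelLemmas {R : CommutativeRing 0ℓ 0ℓ} {M : ℕ} {E : ℤ → CommutativeRing.Carrier R} {r : CommutativeRing.Carrier R}
                   (model : Model R M E r) where
  open Model model
  open CommutativeRing R renaming (Carrier to A; refl to ≈-refl; sym to ≈-sym; trans to ≈-trans)
  open IntegerScalars R
  open Solver using (solve; con; _:=_; _:+_; _:*_; _:-_; :-_)
  open SetoidReasoning setoid

  unique-inverse : ∀ {x y z} → x * y ≈ 1# → x * z ≈ 1# → y ≈ z
  unique-inverse {x} {y} {z} xy≈1 xz≈1 = begin
    y            ≈⟨ *-identityʳ y ⟨
    y * 1#       ≈⟨ *-congˡ xz≈1 ⟨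
    y * (x * z)  ≈⟨ solve 3 (λ x y z → y :* (x :* z) := x :* y :* z) ≈-refl x y z ⟩
    x * y * z    ≈⟨ *-congʳ xy≈1 ⟩
    1# * z       ≈⟨ *-identityˡ z ⟩
    z            ∎

  I-inverse : ∀ γ y → X⁻ γ y * I γ y ≈ 1#
  I-inverse γ y = begin
    X⁻ γ y * (quad γ (⊝ y) * X⁺ γ (⊝ y))       ≡⟨ cong (λ z → X⁻ γ z * (quad γ (⊝ y) * X⁺ γ (⊝ y))) (⊝⊝ y) ⟨
    X⁻ γ (⊝ ⊝ y) * (quad γ (⊝ y) * X⁺ γ (⊝ y)) ≈⟨ solve 3 (λ a b c → a :* (b :* c) := c :* a :* b) ≈-refl _ _ _ ⟩
    X⁺ γ (⊝ y) * X⁻ γ (⊝ ⊝ y) * quad γ (⊝ y)   ≈⟨ inversion γ (⊝ y) ⟩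
    1#                                         ∎

  tt′≈1 : ∀ γ → X⁺ γ 𝟎 * X⁻ γ 𝟎 ≈ 1#
  tt′≈1 γ = ≈-trans (≈-sym (*-identityʳ _)) (≈-trans (*-congˡ (≈-sym (quad-𝟎 γ))) (inversion γ 𝟎))

  I-periodic : ∀ γ {u v} → Lattice._~_ γ u v → I γ u ≈ I γ v
  I-periodic γ {u} {v} u~v = unique-inverse (I-inverse γ u)
    (≈-trans (*-congʳ (periodic Sign.- γ u~v)) (I-inverse γ v))

n²+2nN≢4N : ∀ M n → let N = suc M in n ℕ.* n ℕ.+ 2 ℕ.* n ℕ.* N ≢ 4 ℕ.* N
n²+2nN≢4N M 0 ()
n²+2nN≢4N M 1 eq = ℕ.1+n≢0 (sym (ℕ.suc-injective (trans
  (ℕ.+-cancelʳ-≡ (2 ℕ.* N) 1 (2 ℕ.* N) (trans eq (ℕS.solve 1 (λ n → ℕS.con 4 ℕS.:* n ℕS.:= ℕS.con 2 ℕS.:* n ℕS.:+ ℕS.con 2 ℕS.:* n) refl N)))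
  (cong suc (ℕ.+-suc M (M ℕ.+ 0))))))
  where
  module ℕS = ℕSolver.+-*-Solver

  N : ℕ
  N = suc M
n²+2nN≢4N M (suc (suc k)) eq = ℕ.<-irrefl (sym eq) (begin-strict
  4 ℕ.* N                                                           ≤⟨ ℕ.*-monoˡ-≤ N (ℕ.*-monoʳ-≤ 2 {2} {suc (suc k)} (s≤s (s≤s z≤n))) ⟩
  2 ℕ.* suc (suc k) ℕ.* N                                           <⟨ ℕ.n<1+n _ ⟩
  1 ℕ.+ 2 ℕ.* suc (suc k) ℕ.* N                                     ≤⟨ ℕ.+-monoˡ-≤ (2 ℕ.* suc (suc k) ℕ.* N) {1} {suc (suc k) ℕ.* suc (suc k)} (s≤s z≤n) ⟩
  suc (suc k) ℕ.* suc (suc k) ℕ.+ 2 ℕ.* suc (suc k) ℕ.* N           ∎)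
  where
  open ℕ.≤-Reasoning

  N : ℕ
  N = suc M

module Orthogonality {R : CommutativeRing 0ℓ 0ℓ} {M : ℕ} {E : ℤ → CommutativeRing.Carrier R} {r : CommutativeRing.Carrier R}
  (model : Model R M E r)
  (domain : ∀ x y → CommutativeRing._≈_ R (CommutativeRing._*_ R x y) (CommutativeRing.0# R) →
            CommutativeRing._≈_ R x (CommutativeRing.0# R) ⊎ CommutativeRing._≈_ R y (CommutativeRing.0# R))
  (fromℤ-injective : ∀ a b → CommutativeRing._≈_ R (IntegerScalars.fromℤ R a) (IntegerScalars.fromℤ R b) → a ≡ b)
  (inv : ℕ → CommutativeRing.Carrier R)
  (inv-inverse : ∀ k → CommutativeRing._≈_ R (CommutativeRing._*_ R (IntegerScalars.fromℤ R (+ suc k)) (inv k)) (CommutativeRing.1# R))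
  (γ : Γ (suc M)) (w₀ : ℤ²) (w₀∉Λ : ¬ InΛ γ w₀) where
  open Model model
  open ModelLemmas model
  open CommutativeRing R renaming (Carrier to A; refl to ≈-refl; sym to ≈-sym; trans to ≈-trans)
  open IntegerScalars R
  open RingProperties ring using (x∙y⁻¹≈ε⇒x≈y)
  open ListSums R {ℤ²}
  open Lattice γ
  open Transversals _~_ ~-refl ~-sym ~-trans
  open Solver using (solve; con; _:=_; _:+_; _:*_; _:-_; :-_)
  open SetoidReasoning setoid

  t t′ : A
  t  = X⁺ γ 𝟎
  t′ = X⁻ γ 𝟎

  n : ℤ
  n = + length reps

  σ : ℤ² → A
  σ u = ΣL reps (λ x → pair γ x u)

  private
    x₀ : ℤ²
    x₀ = proj₁ (reps-complete 𝟎)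

    x₀∈ : x₀ ∈ reps
    x₀∈ = proj₁ (proj₂ (reps-complete 𝟎))

    x₀~𝟎 : x₀ ~ 𝟎
    x₀~𝟎 = proj₂ (proj₂ (reps-complete 𝟎))

    I𝟎≈t : I γ 𝟎 ≈ t
    I𝟎≈t = unique-inverse (I-inverse γ 𝟎) (≈-trans (*-comm t′ t) (tt′≈1 γ))

    pair-periodic : ∀ {x y} u → x ~ y → pair γ x u ≈ pair γ y u
    pair-periodic {x} {y} u x~y = begin
      pair γ x u                         ≡⟨ cong (λ z → pair γ z u) (cong₂ _,_ (rearrange (proj₁ x) (proj₁ y)) (rearrange (proj₂ x) (proj₂ y))) ⟩
      pair γ ((x ⊖ y) ⊕ y) u             ≈⟨ pair-⊕ γ (x ⊖ y) y u ⟩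
      pair γ (x ⊖ y) u * pair γ y u      ≈⟨ *-congʳ (pair-Λ γ (x ⊖ y) u (difference x~y)) ⟩
      1# * pair γ y u                    ≈⟨ *-identityˡ _ ⟩
      pair γ y u                         ∎
      where
      rearrange : ∀ a b → a ≡ (a ℤ.- b) ℤ.+ b
      rearrange = ℤS.solve 2 (λ a b → a ℤS.:= (a ℤS.:- b) ℤS.:+ b) refl

    not~𝟎⇒∉Λ : ∀ {x} → ¬ x ~ x₀ → ¬ InΛ γ x
    not~𝟎⇒∉Λ x≁ x∈Λ = x≁ (~-trans (Λ⇒~𝟎 x∈Λ) (~-sym x₀~𝟎))

    -- The convolution equation at v = 0 evaluates the character sum σ u.
    σ-equation : ∀ u → ¬ InΛ γ u → σ u + (t * t - 1#) ≈ r * t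
    σ-equation u u∉Λ = begin
      σ u + (t * t - 1#)
        ≈⟨ +-congˡ (≈-sym support) ⟩
      σ u + ΣL reps (λ x → pair γ x u * δ x)
        ≈⟨ ΣL-+ reps (λ x → pair γ x u) (λ x → pair γ x u * δ x) ⟨
      ΣL reps (λ x → pair γ x u + pair γ x u * δ x)
        ≈⟨ ΣL-cong reps (λ x _ → solve 2 (λ p g → p :+ p :* (g :- con (+ 1)) := p :* g) ≈-refl (pair γ x u) (X⁺ γ x * I γ (x ⊕ 𝟎))) ⟩
      ΣL reps (λ x → pair γ x u * (X⁺ γ x * I γ (x ⊕ 𝟎)))
        ≈⟨ convolution γ u 𝟎 (λ (u∈ , _) → u∉Λ u∈) ⟩
      r * (X⁺ γ (u ⊕ 𝟎) * (I γ u * I γ 𝟎))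
        ≈⟨ *-congˡ (≈-trans (≈-sym (*-assoc (X⁺ γ (u ⊕ 𝟎)) (I γ u) (I γ 𝟎))) (*-cong X*I≈1 I𝟎≈t)) ⟩
      r * (1# * t)
        ≈⟨ *-congˡ (*-identityˡ t) ⟩
      r * t ∎
      where
      δ : ℤ² → A
      δ x = X⁺ γ x * I γ (x ⊕ 𝟎) - 1#

      ∉Λ⇒X*I≈1 : ∀ x → ¬ InΛ γ x → X⁺ γ x * I γ (x ⊕ 𝟎) ≈ 1#
      ∉Λ⇒X*I≈1 x x∉ = ≈-trans (*-cong (sign-independent γ x x∉) (reflexive (cong (I γ) (⊕𝟎 x)))) (I-inverse γ x)

      X*I≈1 : X⁺ γ (u ⊕ 𝟎) * I γ u ≈ 1#
      X*I≈1 = ≈-trans (*-congʳ (≈-trans (reflexive (cong (X⁺ γ) (⊕𝟎 u))) (sign-independent γ u u∉Λ))) (I-inverse γ u)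

      support : ΣL reps (λ x → pair γ x u * δ x) ≈ t * t - 1#
      support = begin
        ΣL reps (λ x → pair γ x u * δ x)
          ≈⟨ sum-of-support reps x₀∈ reps-distinct (λ x x≁ →
               ≈-trans (*-congˡ (≈-trans (+-congʳ (∉Λ⇒X*I≈1 x (not~𝟎⇒∉Λ x≁))) (-‿inverseʳ 1#))) (zeroʳ _)) ⟩
        pair γ x₀ u * δ x₀
          ≈⟨ *-cong (pair-Λ γ x₀ u (~𝟎⇒Λ x₀~𝟎)) (+-congʳ (*-cong (periodic Sign.+ γ x₀~𝟎)
               (≈-trans (reflexive (cong (I γ) (⊕𝟎 x₀))) (≈-trans (I-periodic γ x₀~𝟎) I𝟎≈t)))) ⟩
        1# * (t * t - 1#)
          ≈⟨ *-identityˡ _ ⟩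
        t * t - 1# ∎

    σ-translate : ∀ y u → σ u * pair γ y u ≈ σ u
    σ-translate y u = begin
      σ u * pair γ y u                              ≈⟨ *-comm _ _ ⟩
      pair γ y u * σ u                              ≈⟨ *-ΣL reps (pair γ y u) (λ x → pair γ x u) ⟩
      ΣL reps (λ x → pair γ y u * pair γ x u)       ≈⟨ ΣL-cong reps (λ x _ → pair-⊕ γ y x u) ⟨
      ΣL reps (λ x → pair γ (y ⊕ x) u)              ≈⟨ ΣL-map reps (y ⊕_) (λ x → pair γ x u) ⟨
      ΣL (map (y ⊕_) reps) (λ x → pair γ x u)       ≈⟨ transversal-sum (map (y ⊕_) reps) reps distinct reps-distinct
                                                         (λ {x} _ → reps-complete x) back (pair-periodic u) ⟩
      σ u                                           ∎
      where
      cancel : ∀ {x x′} → y ⊕ x ~ y ⊕ x′ → x ~ x′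
      cancel {x} {x′} p = ~-trans (~-reflexive (eq x)) (~-trans (~-⊖ p (~-refl {y})) (~-reflexive (sym (eq x′))))
        where
        eq : ∀ x → x ≡ (y ⊕ x) ⊖ y
        eq x = cong₂ _,_ (rearrange (proj₁ y) (proj₁ x)) (rearrange (proj₂ y) (proj₂ x))
          where
          rearrange : ∀ a b → b ≡ (a ℤ.+ b) ℤ.- a
          rearrange = ℤS.solve 2 (λ a b → b ℤS.:= (a ℤS.:+ b) ℤS.:- a) refl

      distinct : Distinct (map (y ⊕_) reps)
      distinct = AllPairsP.map⁺ (AllPairs.map (λ x≁ p → x≁ (cancel p)) reps-distinct)

      back : ∀ {x} → x ∈ reps → ∃[ z ] (z ∈ map (y ⊕_) reps × z ~ x)
      back {x} _ = let w , w∈ , w~ = reps-complete (x ⊖ y) in y ⊕ w , ∈-map⁺ (y ⊕_) w∈ ,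
        ~-trans (~-⊕ (~-refl {y}) w~) (~-reflexive (cong₂ _,_ (rearrange (proj₁ y) (proj₁ x)) (rearrange (proj₂ y) (proj₂ x))))
        where
        rearrange : ∀ a b → a ℤ.+ (b ℤ.- a) ≡ b
        rearrange = ℤS.solve 2 (λ a b → a ℤS.:+ (b ℤS.:- a) ℤS.:= b) refl

    σ²≈nσ : ∀ u → σ u * σ u ≈ fromℤ n * σ u
    σ²≈nσ u = begin
      σ u * σ u                                ≈⟨ *-ΣL reps (σ u) (λ y → pair γ y u) ⟩
      ΣL reps (λ y → σ u * pair γ y u)         ≈⟨ ΣL-cong reps (λ y _ → σ-translate y u) ⟩
      ΣL reps (λ _ → σ u)                      ≈⟨ ΣL-const reps (σ u) ⟩
      fromℤ n * σ u                            ∎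

  σ≈0 : ∀ u → ¬ InΛ γ u → σ u ≈ 0#
  σ≈0 u u∉Λ = [ id , (λ σ-n≈0 → ⊥-elim (absurd (x∙y⁻¹≈ε⇒x≈y (σ u) (fromℤ n) σ-n≈0))) ]′
    (domain (σ u) (σ u - fromℤ n) (begin
      σ u * (σ u - fromℤ n)           ≈⟨ solve 2 (λ s n → s :* (s :- n) := s :* s :- n :* s) ≈-refl (σ u) (fromℤ n) ⟩
      σ u * σ u - fromℤ n * σ u       ≈⟨ +-congʳ (σ²≈nσ u) ⟩
      fromℤ n * σ u - fromℤ n * σ u   ≈⟨ -‿inverseʳ _ ⟩
      0#                              ∎))
    where
    N# n# d : A
    N# = fromℤ (+ N)
    n# = fromℤ n
    d  = t - t′

    absurd : σ u ≈ fromℤ n → ⊥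
    absurd σ≈n = [ n≉0 , n≈2rt ]′ (domain n# (r + d) (begin
        n# * (r + d)                    ≈⟨ *-identityʳ _ ⟨
        n# * (r + d) * 1#               ≈⟨ *-congˡ (tt′≈1 γ) ⟨
        n# * (r + d) * (t * t′)         ≈⟨ solve 4 (λ n s t t′ → n :* s :* (t :* t′) := t :* ((n :* t′) :* s)) ≈-refl n# (r + d) t t′ ⟩
        t * ((n# * t′) * (r + d))       ≈⟨ *-congˡ (*-congʳ nt′≈) ⟩
        t * ((r - d) * (r + d))         ≈⟨ *-congˡ (solve 2 (λ r d → (r :- d) :* (r :+ d) := r :* r :- d :* d) ≈-refl r d) ⟩
        t * (r * r - d * d)             ≈⟨ *-congˡ (+-cong (r²≈N γ u u∉Λ) (-‿cong d²≈N)) ⟩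
        t * (N# - N#)                   ≈⟨ *-congˡ (-‿inverseʳ N#) ⟩
        t * 0#                          ≈⟨ zeroʳ t ⟩
        0#                              ∎))
      where
      d²≈N : d * d ≈ N#
      d²≈N = begin
        d * d
          ≈⟨ solve 2 (λ t t′ → (t :- t′) :* (t :- t′) := (t :* t :+ t′ :* t′) :- con (+ 2) :* (t :* t′)) ≈-refl t t′ ⟩
        (t * t + t′ * t′) - (1# + 1#) * (t * t′)
          ≈⟨ +-cong (≈-trans (squares-at-𝟎 γ) (fromℤ-+ (+ N) (+ 2))) (-‿cong (*-congˡ (tt′≈1 γ))) ⟩
        (N# + (1# + 1#)) - (1# + 1#) * 1#
          ≈⟨ solve 1 (λ n → (n :+ con (+ 2)) :- con (+ 2) :* con (+ 1) := n) ≈-refl N# ⟩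
        N# ∎

      nt′≈ : n# * t′ ≈ r - d
      nt′≈ = begin
        n# * t′
          ≈⟨ solve 3 (λ n t t′ → n :* t′ := (n :+ (t :* t :- con (+ 1))) :* t′ :- t :* (t :* t′) :+ t′) ≈-refl n# t t′ ⟩
        (n# + (t * t - 1#)) * t′ - t * (t * t′) + t′
          ≈⟨ +-congʳ (+-cong (*-congʳ (≈-trans (+-congʳ (≈-sym σ≈n)) (σ-equation u u∉Λ))) (-‿cong (*-congˡ (tt′≈1 γ)))) ⟩
        (r * t) * t′ - t * 1# + t′
          ≈⟨ solve 3 (λ r t t′ → (r :* t) :* t′ :- t :* con (+ 1) :+ t′ := r :* (t :* t′) :- (t :- t′)) ≈-refl r t t′ ⟩
        r * (t * t′) - d
          ≈⟨ +-congʳ (≈-trans (*-congˡ (tt′≈1 γ)) (*-identityʳ r)) ⟩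
        r - d ∎

      n≉0 : n# ≈ 0# → ⊥
      n≉0 n≈0 = nonempty reps x₀∈ (ℤ.+-injective (fromℤ-injective n (+ 0) n≈0))
        where
        nonempty : ∀ l {x : ℤ²} → x ∈ l → length l ≢ 0
        nonempty (_ ∷ _) _ ()

      n≈2rt : r + d ≈ 0# → ⊥
      n≈2rt r+d≈0 = n²+2nN≢4N M (length reps) (ℤ.+-injective (trans
          (cong₂ ℤ._+_ (ℤ.pos-* (length reps) (length reps)) (trans (ℤ.pos-* (2 ℕ.* length reps) N) (cong (ℤ._* + N) (ℤ.pos-* 2 (length reps)))))
          (trans integer-eq (sym (ℤ.pos-* 4 N)))))
        where
        d≈-r : d ≈ - r
        d≈-r = ≈-trans (solve 2 (λ r d → d := (r :+ d) :- r) ≈-refl r d) (≈-trans (+-congʳ r+d≈0) (+-identityˡ (- r)))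

        nt′≈2r : n# * t′ ≈ (1# + 1#) * r
        nt′≈2r = ≈-trans nt′≈ (≈-trans (+-congˡ (-‿cong d≈-r)) (solve 1 (λ r → r :- (:- r) := con (+ 2) :* r) ≈-refl r))

        nt≈ : n# * t ≈ (1# + 1#) * r - n# * r
        nt≈ = begin
          n# * t                        ≈⟨ solve 3 (λ n t t′ → n :* t := n :* t′ :+ n :* (t :- t′)) ≈-refl n# t t′ ⟩
          n# * t′ + n# * d              ≈⟨ +-cong nt′≈2r (*-congˡ d≈-r) ⟩
          (1# + 1#) * r + n# * - r      ≈⟨ solve 2 (λ r n → con (+ 2) :* r :+ n :* (:- r) := con (+ 2) :* r :- n :* r) ≈-refl r n# ⟩
          (1# + 1#) * r - n# * r        ∎

        integer-eq : n ℤ.* n ℤ.+ + 2 ℤ.* n ℤ.* + N ≡ + 4 ℤ.* + N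
        integer-eq = fromℤ-injective _ _ (begin
          fromℤ (n ℤ.* n ℤ.+ + 2 ℤ.* n ℤ.* + N)
            ≈⟨ ≈-trans (fromℤ-+ (n ℤ.* n) (+ 2 ℤ.* n ℤ.* + N)) (+-cong (fromℤ-* n n) (≈-trans (fromℤ-* (+ 2 ℤ.* n) (+ N)) (*-congʳ (fromℤ-* (+ 2) n)))) ⟩
          n# * n# + (1# + 1#) * n# * N#
            ≈⟨ +-congʳ (≈-trans (≈-sym (*-identityʳ _)) (*-congˡ (≈-sym (tt′≈1 γ)))) ⟩
          n# * n# * (t * t′) + (1# + 1#) * n# * N#
            ≈⟨ +-congʳ (solve 3 (λ n t t′ → n :* n :* (t :* t′) := (n :* t′) :* (n :* t)) ≈-refl n# t t′) ⟩
          (n# * t′) * (n# * t) + (1# + 1#) * n# * N#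
            ≈⟨ +-cong (*-cong nt′≈2r nt≈) (*-congˡ (≈-sym (r²≈N γ u u∉Λ))) ⟩
          ((1# + 1#) * r) * ((1# + 1#) * r - n# * r) + (1# + 1#) * n# * (r * r)
            ≈⟨ solve 2 (λ r n → (con (+ 2) :* r) :* (con (+ 2) :* r :- n :* r) :+ con (+ 2) :* n :* (r :* r) := con (+ 4) :* (r :* r)) ≈-refl r n# ⟩
          fromℤ (+ 4) * (r * r)
            ≈⟨ *-congˡ (r²≈N γ u u∉Λ) ⟩
          fromℤ (+ 4) * N#
            ≈⟨ fromℤ-* (+ 4) (+ N) ⟨
          fromℤ (+ 4 ℤ.* + N) ∎)

  μ-invertible : ∃[ κ ] μ γ * κ ≈ 1#
  μ-invertible = κ , (begin
      μ γ * (r * S * t′ * inv (ℕ.pred (length reps)))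
        ≈⟨ solve 5 (λ m r s t i → m :* (r :* s :* t :* i) := (r :* m :* s) :* t :* i) ≈-refl (μ γ) r S t′ (inv (ℕ.pred (length reps))) ⟩
      (r * μ γ * S) * t′ * inv (ℕ.pred (length reps))
        ≈⟨ *-congʳ (*-congʳ total) ⟨
      t * fromℤ n * t′ * inv (ℕ.pred (length reps))
        ≈⟨ solve 4 (λ t n t′ i → t :* n :* t′ :* i := (t :* t′) :* (n :* i)) ≈-refl t (fromℤ n) t′ _ ⟩
      (t * t′) * (fromℤ n * inv (ℕ.pred (length reps)))
        ≈⟨ *-cong (tt′≈1 γ) (≈-trans (*-congʳ (reflexive (cong (λ k → fromℤ (+ k)) (length≡ reps x₀∈)))) (inv-inverse (ℕ.pred (length reps)))) ⟩
      1# * 1#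
        ≈⟨ *-identityˡ 1# ⟩
      1# ∎)
    where
    S κ : A
    S = ΣL reps (I γ)
    κ = r * S * t′ * inv (ℕ.pred (length reps))

    length≡ : ∀ l {x : ℤ²} → x ∈ l → length l ≡ suc (ℕ.pred (length l))
    length≡ (_ ∷ _) _ = refl

    total : t * fromℤ n ≈ r * μ γ * S
    total = begin
      t * fromℤ n
        ≈⟨ *-congʳ (periodic Sign.+ γ x₀~𝟎) ⟨
      X⁺ γ x₀ * fromℤ n
        ≈⟨ *-congˡ (≈-trans (≈-sym (*-identityʳ _)) (≈-trans (≈-sym (ΣL-const reps 1#)) (ΣL-cong reps (λ u _ → ≈-sym (pair-Λ γ x₀ u (~𝟎⇒Λ x₀~𝟎)))))) ⟩
      X⁺ γ x₀ * τ x₀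
        ≈⟨ sum-of-support reps x₀∈ reps-distinct (λ x x≁ → ≈-trans (*-congˡ (≈-trans (τ≈σ x) (σ≈0 x (not~𝟎⇒∉Λ x≁)))) (zeroʳ _)) ⟨
      ΣL reps (λ x → X⁺ γ x * τ x)
        ≈⟨ ΣL-cong reps (λ x _ → ≈-trans (*-ΣL reps (X⁺ γ x) (pair γ x)) (ΣL-cong reps (λ u _ → *-comm (X⁺ γ x) (pair γ x u)))) ⟩
      ΣL reps (λ x → ΣL reps (λ u → pair γ x u * X⁺ γ x))
        ≈⟨ ΣL-swap reps reps (λ x u → pair γ x u * X⁺ γ x) ⟩
      ΣL reps (λ u → ΣL reps (λ x → pair γ x u * X⁺ γ x))
        ≈⟨ ΣL-cong reps (λ u _ → ≈-trans (fourier γ u w₀ w₀∉Λ) (≈-sym (*-assoc r (μ γ) (I γ u)))) ⟩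
      ΣL reps (λ u → r * μ γ * I γ u)
        ≈⟨ *-ΣL reps (r * μ γ) (I γ) ⟨
      r * μ γ * S ∎
      where
      τ : ℤ² → A
      τ x = ΣL reps (pair γ x)

      τ≈σ : ∀ x → τ x ≈ σ x
      τ≈σ x = ΣL-cong reps (λ u _ → pair-sym γ x u)

module Partner {N : ℕ} (γ : Γ N) (p : ℤ²) where
  open Γ γ using (matrix)
  open Mat matrix
  open Lattice γ
  open ℤᴹ using (_▹_)

  partner : ℤ² → ℤ²
  partner x = 2· p ⊖ x

  exponent : ℤ² → ℤ
  exponent x = + 2 ℤ.* ω (φ x) p ℤ.+ ω (partner x ▹ matrix) (partner x)

  partner-involutive : ∀ x → partner (partner x) ≡ x
  partner-involutive (x₁ , x₂) = cong₂ _,_ (cancel (proj₁ (2· p)) x₁) (cancel (proj₂ (2· p)) x₂)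
    where
    cancel : ∀ q x → q ℤ.- (q ℤ.- x) ≡ x
    cancel = ℤS.solve 2 (λ q x → q ℤS.:- (q ℤS.:- x) ℤS.:= x) refl

  partner-cong : ∀ {x y} → x ~ y → partner x ~ partner y
  partner-cong = ~-⊖ (~-refl {2· p})

  abstract
    ω-φ-divisible : ∀ l v → InΛ γ l → + N ∣ˢ ω (φ l) v
    ω-φ-divisible l (v₁ , v₂) l∈ = let p₁ , p₂ = Λ-elim l l∈ in
      Signed.∣m∣n⇒∣m-n (Signed.∣m⇒∣m*n v₂ p₁) (Signed.∣m⇒∣m*n v₁ p₂)

    -- The quadratic phases of x and of its partner differ by an integral multiple of N.
    exponent-partner : ∀ x y → y ~ partner x → + N ∣ˢ exponent y ℤ.- exponent x
    exponent-partner x@(x₁ , x₂) y@(y₁ , y₂) (mk~ l∈) = subst (+ N ∣ˢ_) (sym difference≡)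
      (Signed.∣m∣n⇒∣m-n
        (Signed.∣m∣n⇒∣m+n (Signed.∣m∣n⇒∣m+n
          (Signed.∣m∣n⇒∣m-n (Signed.∣n⇒∣m*n (+ 2) (ω-φ-divisible l p l∈)) (Signed.∣n⇒∣m*n (+ 2) (ω-φ-divisible l x l∈)))
          (Signed.∣m⇒∣m*n (ω l x) N∣a+d-2)) (ω-φ-divisible l l l∈))
        (Signed.∣m⇒∣m*n (+ 2 ℤ.* ω x p) N∣a+d-2))
      where
      l : ℤ²
      l = y ⊖ partner x

      N∣a+d-2 : + N ∣ˢ a ℤ.+ d ℤ.- + 2
      N∣a+d-2 = subst (+ N ∣ˢ_) N≡ Signed.∣-refl

      difference≡ : exponent y ℤ.- exponent x
        ≡ (+ 2 ℤ.* ω (φ l) p ℤ.- + 2 ℤ.* ω (φ l) x) ℤ.+ (a ℤ.+ d ℤ.- + 2) ℤ.* ω l x ℤ.+ ω (φ l) l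
          ℤ.- (a ℤ.+ d ℤ.- + 2) ℤ.* (+ 2 ℤ.* ω x p)
      difference≡ = ℤS.solve 10 (λ a b c d p₁ p₂ x₁ x₂ y₁ y₂ →
        let module P = ℤS
            w₁ = λ x₁ → (p₁ P.:+ p₁) P.:- x₁
            w₂ = λ x₂ → (p₂ P.:+ p₂) P.:- x₂
            ω′ = λ u₁ u₂ v₁ v₂ → u₁ P.:* v₂ P.:- u₂ P.:* v₁
            φ₁ = λ u₁ u₂ → (u₁ P.:* a P.:+ u₂ P.:* c) P.:- u₁
            φ₂ = λ u₁ u₂ → (u₁ P.:* b P.:+ u₂ P.:* d) P.:- u₂
            ex = λ x₁ x₂ → P.con (+ 2) P.:* ω′ (φ₁ x₁ x₂) (φ₂ x₁ x₂) p₁ p₂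
                   P.:+ ω′ (w₁ x₁ P.:* a P.:+ w₂ x₂ P.:* c) (w₁ x₁ P.:* b P.:+ w₂ x₂ P.:* d) (w₁ x₁) (w₂ x₂)
            l₁ = y₁ P.:- w₁ x₁
            l₂ = y₂ P.:- w₂ x₂
            n = (a P.:+ d) P.:- P.con (+ 2)
        in ex y₁ y₂ P.:- ex x₁ x₂
             P.:= (((P.con (+ 2) P.:* ω′ (φ₁ l₁ l₂) (φ₂ l₁ l₂) p₁ p₂ P.:- P.con (+ 2) P.:* ω′ (φ₁ l₁ l₂) (φ₂ l₁ l₂) x₁ x₂)
                    P.:+ n P.:* ω′ l₁ l₂ x₁ x₂) P.:+ ω′ (φ₁ l₁ l₂) (φ₂ l₁ l₂) l₁ l₂) P.:- n P.:* (P.con (+ 2) P.:* ω′ x₁ x₂ p₁ p₂))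
        refl a b c d (proj₁ p) (proj₂ p) x₁ x₂ y₁ y₂

module FourthPowers {R : CommutativeRing 0ℓ 0ℓ} {M : ℕ} {E : ℤ → CommutativeRing.Carrier R} {r : CommutativeRing.Carrier R}
  (isCharacter : RootsOfUnity.IsCharacter R M E)
  (r²-integer : ∃[ n ] CommutativeRing._≈_ R (CommutativeRing._*_ R r r) (IntegerScalars.fromℤ R (+ n)))
  (model : Model R M E r)
  (μ-invertible : ∀ γ w → ¬ InΛ γ w → ∃[ κ ] CommutativeRing._≈_ R (CommutativeRing._*_ R (Model.μ model γ) κ) (CommutativeRing.1# R))
  (Xs : List (CommutativeRing.Carrier R)) (1∈Xs : CommutativeRing.1# R ∈ Xs)
  (cover : ∀ s γ u → ∃[ x ] (x ∈ Xs × CommutativeRing._≈_ R (Model.X model s γ u) x)) where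
  open Model model
  open ModelLemmas model
  open CommutativeRing R renaming (Carrier to A; refl to ≈-refl; sym to ≈-sym; trans to ≈-trans)
  open Spans R
  open RootsOfUnity R M using (_≈±_; ±-refl; ±-sym; ±-trans; ±-*; ±-≈)
  open Constants R M E isCharacter r r²-integer
  open Filtration R constants Xs 1∈constants constants-closed 1∈Xs
  open Exp semiring using (_^_)
  open Solver using (solve; con; _:=_; _:+_; _:*_; _:-_; :-_)
  open SetoidReasoning setoid

  T-X : ∀ s γ u → T 1 (X s γ u)
  T-X s γ u = let x , x∈ , eq = cover s γ u in resp (isT 1) (≈-sym eq) (T-∈ x∈)

  T-root : ∀ d {z k} → Root z k → ∀ {x} → T d x → T d (z * x)
  T-root d p = T-const d (root∈constants p)

  root-cancel : ∀ {z k} → Root z k → ∀ {x y} → z * x ≈ y → ∃[ w ] (x ≈ w * y × Root w (ℤ.- k))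
  root-cancel {z} p {x} {y} eq = let w , zw≈1 , q = root-invert p in w , (begin
    x            ≈⟨ *-identityˡ x ⟨
    1# * x       ≈⟨ *-congʳ zw≈1 ⟨
    z * w * x    ≈⟨ solve 3 (λ z w x → z :* w :* x := w :* (z :* x)) ≈-refl z w x ⟩
    w * (z * x)  ≈⟨ *-congˡ eq ⟩
    w * y        ∎) , q

  private
    power-4 : ∀ x → x ^ 4 ≈ x * x * (x * x)
    power-4 x = solve 1 (λ x → x :* (x :* (x :* (x :* con (+ 1)))) := x :* x :* (x :* x)) ≈-refl x

  ∉Λ-⊝ : ∀ (γ : Γ N) u → ¬ InΛ γ u → ¬ InΛ γ (⊝ u)
  ∉Λ-⊝ γ u u∉ ⊝u∈ = u∉ (Lattice.Λ-≡ γ (⊝⊝ u) (Lattice.Λ-⊝ γ (⊝ u) ⊝u∈))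

  -- X(u) X(-u) = ⟨u⟩⁻¹ for u ≠ 0
  inverse-root : ∀ (γ : Γ N) u → ¬ InΛ γ u → ∃[ q ] (X⁺ γ u * X⁺ γ (⊝ u) ≈ q × ∃ (Root q) × ∃[ q⁻ ] (q * q⁻ ≈ 1# × ∃ (Root q⁻)))
  inverse-root γ u u∉ =
    let w , qw≈1 , wr = root-invert (quad-root γ u)
    in w , unique-inverse (begin
         quad γ u * (X⁺ γ u * X⁺ γ (⊝ u))    ≈⟨ *-congˡ (*-congˡ (sign-independent γ (⊝ u) (∉Λ-⊝ γ u u∉))) ⟩
         quad γ u * (X⁺ γ u * X⁻ γ (⊝ u))    ≈⟨ *-comm _ _ ⟩
         X⁺ γ u * X⁻ γ (⊝ u) * quad γ u      ≈⟨ inversion γ u ⟩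
         1#                                  ∎) qw≈1
       , (_ , wr) , (quad γ u , ≈-trans (*-comm w _) qw≈1 , (_ , quad-root γ u))

  module _ (γ : Γ N) where
    open Lattice γ

    -- The distribution relation for an element x - p of order 2.
    distribution-square : ∀ p x → ¬ InΛ γ (2· p) → 2· x ~ 2· p → ¬ x ~ p →
      T 2 ((X⁺ γ p * X⁺ γ x) * (X⁺ γ p * X⁺ γ x))
    distribution-square p x 2p∉ 2x~2p x≁p = resp (isT 2) (≈-sym final)
      (T-const 2 (root∈constants (proj₂ ρ-root)) (T-* 1 {1} (T-X Sign.+ γ′ b) (T-X Sign.+ γ′ b)))
      where
      g : ℤ²
      g = x ⊖ p

      2g∈ : InΛ γ (2 ⊛ g)
      2g∈ = Λ-≡ (cong₂ _,_ (double (proj₁ x) (proj₁ p)) (double (proj₂ x) (proj₂ p))) (difference 2x~2p)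
        where
        double : ∀ x p → (x ℤ.+ x) ℤ.- (p ℤ.+ p) ≡ + 2 ℤ.* (x ℤ.- p)
        double = ℤS.solve 2 (λ x p → (x ℤS.:+ x) ℤS.:- (p ℤS.:+ p) ℤS.:= ℤS.con (+ 2) ℤS.:* (x ℤS.:- p)) refl

      g∉ : ¬ InΛ γ g
      g∉ g∈ = x≁p (mk~ g∈)

      1⊛g : ∀ g → 1 ⊛ g ≡ g
      1⊛g (g₁ , g₂) = cong₂ _,_ (ℤ.*-identityˡ g₁) (ℤ.*-identityˡ g₂)

      order : IsOrder γ g 2
      order = (s≤s z≤n , 2g∈) , λ
        { (suc zero) (_ , g∈) → contradiction (Λ-≡ (1⊛g g) g∈) g∉
        ; (suc (suc n)) _ → s≤s (s≤s z≤n) }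

      D : DistributionData γ g
      D = proj₁ (OrderTwo.distributionData γ (λ ()) g 2g∈ g∉)

      good : OrderTwo.Good γ (λ ()) g 2g∈ g∉ D
      good = proj₂ (OrderTwo.distributionData γ (λ ()) g 2g∈ g∉)

      open DistributionData D using (γ′; image)

      b : ℤ²
      b = image p

      b∉ : ¬ InΛ γ′ b
      b∉ b∈ = 2p∉ (good p b∈)

      p∉ : ¬ InΛ γ p
      p∉ p∈ = 2p∉ (Λ-⊕ p p p∈ p∈)

      x∉ : ¬ InΛ γ x
      x∉ x∈ = 2p∉ (~𝟎⇒Λ (~-trans (~-sym 2x~2p) (Λ⇒~𝟎 (Λ-⊕ x x x∈ x∈))))

      κ κ′ : A
      κ  = proj₁ (μ-invertible γ p p∉)
      κ′ = proj₁ (μ-invertible γ′ b b∉)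

      p+g≡x : p ⊕ 1 ⊛ g ≡ x
      p+g≡x = cong₂ _,_ (eq (proj₁ p) (proj₁ x)) (eq (proj₂ p) (proj₂ x))
        where
        eq : ∀ p x → p ℤ.+ + 1 ℤ.* (x ℤ.- p) ≡ x
        eq = ℤS.solve 2 (λ p x → p ℤS.:+ ℤS.con (+ 1) ℤS.:* (x ℤS.:- p) ℤS.:= x) refl

      p+2g~p : p ⊕ 2 ⊛ g ~ p
      p+2g~p = ~-trans (~-⊕ (~-refl {p}) (Λ⇒~𝟎 2g∈)) (~-reflexive (⊕𝟎 p))

      -p+g~-x : (⊝ p) ⊕ 1 ⊛ g ~ ⊝ x
      -p+g~-x = ~-trans (~-reflexive (cong₂ _,_ (eq (proj₁ p) (proj₁ x)) (eq (proj₂ p) (proj₂ x))))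
        (~-trans (~-⊕ (~-refl {⊝ x}) (Λ⇒~𝟎 2g∈)) (~-reflexive (⊕𝟎 (⊝ x))))
        where
        eq : ∀ p x → ℤ.- p ℤ.+ + 1 ℤ.* (x ℤ.- p) ≡ ℤ.- x ℤ.+ + 2 ℤ.* (x ℤ.- p)
        eq = ℤS.solve 2 (λ p x → ℤS.:- p ℤS.:+ ℤS.con (+ 1) ℤS.:* (x ℤS.:- p) ℤS.:= ℤS.:- x ℤS.:+ ℤS.con (+ 2) ℤS.:* (x ℤS.:- p)) refl

      -p+2g~-p : (⊝ p) ⊕ 2 ⊛ g ~ ⊝ p
      -p+2g~-p = ~-trans (~-⊕ (~-refl {⊝ p}) (Λ⇒~𝟎 2g∈)) (~-reflexive (⊕𝟎 (⊝ p)))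

      image-⊝ : image (⊝ p) ≡ ⊝ b
      image-⊝ = cong₂ _,_ (sym (ℤ.neg-distribʳ-* (+ DistributionData.h D) (proj₁ p)))
        (ℤS.solve 4 (λ y f p₁ p₂ → y ℤS.:* (ℤS.:- p₂) ℤS.:- f ℤS.:* (ℤS.:- p₁) ℤS.:= ℤS.:- (y ℤS.:* p₂ ℤS.:- f ℤS.:* p₁)) refl
          (+ DistributionData.y D) (DistributionData.f D) (proj₁ p) (proj₂ p))

      at-p : κ * κ * (X⁺ γ x * X⁺ γ p) ≈ κ′ * X⁺ γ′ b
      at-p = ≈-trans (*-congˡ (*-cong (reflexive (cong (X⁺ γ) (sym p+g≡x))) (≈-sym (periodic Sign.+ γ p+2g~p))))
        (distribution γ g order D p κ κ′ (proj₂ (μ-invertible γ p p∉)) (proj₂ (μ-invertible γ′ b b∉)))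

      at--p : κ * κ * (X⁺ γ (⊝ x) * X⁺ γ (⊝ p)) ≈ κ′ * X⁺ γ′ (⊝ b)
      at--p = ≈-trans (*-congˡ (*-cong (≈-sym (periodic Sign.+ γ -p+g~-x)) (≈-sym (periodic Sign.+ γ -p+2g~-p))))
        (≈-trans (distribution γ g order D (⊝ p) κ κ′ (proj₂ (μ-invertible γ p p∉)) (proj₂ (μ-invertible γ′ b b∉)))
          (*-congˡ (reflexive (cong (X⁺ γ′) image-⊝))))

      qx qp qb qb⁻ ρ m : A
      qx  = proj₁ (inverse-root γ x x∉)
      qp  = proj₁ (inverse-root γ p p∉)
      qb  = proj₁ (inverse-root γ′ b b∉)
      qb⁻ = proj₁ (proj₂ (proj₂ (proj₂ (inverse-root γ′ b b∉))))
      ρ   = qx * qp * qb⁻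
      m   = μ γ

      qb*qb⁻≈1 : qb * qb⁻ ≈ 1#
      qb*qb⁻≈1 = proj₁ (proj₂ (proj₂ (proj₂ (proj₂ (inverse-root γ′ b b∉)))))

      ρ-root : ∃ (Root ρ)
      ρ-root = _ , root-* (root-* (proj₂ (proj₁ (proj₂ (proj₂ (inverse-root γ x x∉))))) (proj₂ (proj₁ (proj₂ (proj₂ (inverse-root γ p p∉))))))
        (proj₂ (proj₂ (proj₂ (proj₂ (proj₂ (proj₂ (inverse-root γ′ b b∉)))))))

      m⁴κ⁴≈1 : m * m * (m * m) * (κ * κ * (κ * κ)) ≈ 1#
      m⁴κ⁴≈1 = begin
        m * m * (m * m) * (κ * κ * (κ * κ))
          ≈⟨ solve 2 (λ m κ → m :* m :* (m :* m) :* (κ :* κ :* (κ :* κ)) := (m :* κ) :* (m :* κ) :* ((m :* κ) :* (m :* κ))) ≈-refl m κ ⟩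
        (m * κ) * (m * κ) * ((m * κ) * (m * κ))
          ≈⟨ *-cong (*-cong mκ≈1 mκ≈1) (*-cong mκ≈1 mκ≈1) ⟩
        1# * 1# * (1# * 1#)
          ≈⟨ solve 0 (con (+ 1) :* con (+ 1) :* (con (+ 1) :* con (+ 1)) := con (+ 1)) ≈-refl ⟩
        1# ∎
        where
        mκ≈1 : m * κ ≈ 1#
        mκ≈1 = proj₂ (μ-invertible γ p p∉)

      κ′²≈ : κ′ * κ′ ≈ κ * κ * (κ * κ) * ρ
      κ′²≈ = begin
        κ′ * κ′
          ≈⟨ *-identityʳ _ ⟨
        κ′ * κ′ * 1#
          ≈⟨ *-congˡ (≈-trans (*-congʳ (proj₁ (proj₂ (inverse-root γ′ b b∉)))) qb*qb⁻≈1) ⟨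
        κ′ * κ′ * (X⁺ γ′ b * X⁺ γ′ (⊝ b) * qb⁻)
          ≈⟨ solve 4 (λ k x y q → k :* k :* (x :* y :* q) := (k :* x) :* (k :* y) :* q) ≈-refl κ′ (X⁺ γ′ b) (X⁺ γ′ (⊝ b)) qb⁻ ⟩
        (κ′ * X⁺ γ′ b) * (κ′ * X⁺ γ′ (⊝ b)) * qb⁻
          ≈⟨ *-congʳ (*-cong (≈-sym at-p) (≈-sym at--p)) ⟩
        (κ * κ * (X⁺ γ x * X⁺ γ p)) * (κ * κ * (X⁺ γ (⊝ x) * X⁺ γ (⊝ p))) * qb⁻
          ≈⟨ solve 6 (λ k x p x′ p′ q → (k :* k :* (x :* p)) :* (k :* k :* (x′ :* p′)) :* q := k :* k :* (k :* k) :* ((x :* x′) :* (p :* p′) :* q))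
               ≈-refl κ (X⁺ γ x) (X⁺ γ p) (X⁺ γ (⊝ x)) (X⁺ γ (⊝ p)) qb⁻ ⟩
        κ * κ * (κ * κ) * ((X⁺ γ x * X⁺ γ (⊝ x)) * (X⁺ γ p * X⁺ γ (⊝ p)) * qb⁻)
          ≈⟨ *-congˡ (*-congʳ (*-cong (proj₁ (proj₂ (inverse-root γ x x∉))) (proj₁ (proj₂ (inverse-root γ p p∉))))) ⟩
        κ * κ * (κ * κ) * ρ ∎

      final : (X⁺ γ p * X⁺ γ x) * (X⁺ γ p * X⁺ γ x) ≈ ρ * (X⁺ γ′ b * X⁺ γ′ b)
      final = begin
        (X⁺ γ p * X⁺ γ x) * (X⁺ γ p * X⁺ γ x)
          ≈⟨ ≈-trans (*-congʳ m⁴κ⁴≈1) (*-identityˡ _) ⟨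
        m * m * (m * m) * (κ * κ * (κ * κ)) * ((X⁺ γ p * X⁺ γ x) * (X⁺ γ p * X⁺ γ x))
          ≈⟨ solve 4 (λ m k p x → m :* m :* (m :* m) :* (k :* k :* (k :* k)) :* ((p :* x) :* (p :* x))
               := m :* m :* (m :* m) :* ((k :* k :* (x :* p)) :* (k :* k :* (x :* p)))) ≈-refl m κ (X⁺ γ p) (X⁺ γ x) ⟩
        m * m * (m * m) * ((κ * κ * (X⁺ γ x * X⁺ γ p)) * (κ * κ * (X⁺ γ x * X⁺ γ p)))
          ≈⟨ *-congˡ (*-cong at-p at-p) ⟩
        m * m * (m * m) * ((κ′ * X⁺ γ′ b) * (κ′ * X⁺ γ′ b))
          ≈⟨ *-congˡ (solve 2 (λ k x → (k :* x) :* (k :* x) := k :* k :* (x :* x)) ≈-refl κ′ (X⁺ γ′ b)) ⟩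
        m * m * (m * m) * (κ′ * κ′ * (X⁺ γ′ b * X⁺ γ′ b))
          ≈⟨ *-congˡ (*-congʳ κ′²≈) ⟩
        m * m * (m * m) * (κ * κ * (κ * κ) * ρ * (X⁺ γ′ b * X⁺ γ′ b))
          ≈⟨ solve 4 (λ a b c d → a :* (b :* c :* d) := a :* b :* (c :* d)) ≈-refl (m * m * (m * m)) (κ * κ * (κ * κ)) ρ (X⁺ γ′ b * X⁺ γ′ b) ⟩
        m * m * (m * m) * (κ * κ * (κ * κ)) * (ρ * (X⁺ γ′ b * X⁺ γ′ b))
          ≈⟨ ≈-trans (*-congʳ m⁴κ⁴≈1) (*-identityˡ _) ⟩
        ρ * (X⁺ γ′ b * X⁺ γ′ b) ∎

  open ListSums R {ℤ²}

  -- The convolution equation at (p, -2p), multiplied by X(p)²: its terms pair up under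
  -- x ↔ 2p - x, and those with 2x = 2p, x ≠ p drop to degree 2 by the distribution relations.
  module Generic (γ : Γ N) (p : ℤ²) (2p∉ : ¬ InΛ γ (2· p)) where
    open Lattice γ
    open Transversals _~_ ~-refl ~-sym ~-trans
    open Partner γ p

    private
      p∉ : ¬ InΛ γ p
      p∉ p∈ = 2p∉ (Λ-⊕ p p p∈ p∈)

      v : ℤ²
      v = ⊝ (2· p)

      z : A
      z = X⁺ γ p

      phase : ℤ² → A
      phase x = pair γ x p * quad γ (partner x)

      phase-root : ∀ x → Root (phase x) (exponent x)
      phase-root x = root-* (pair-root γ x p) (quad-root γ (partner x))

      F : ℤ² → A
      F x = z * z * (phase x * (X⁺ γ x * X⁺ γ (partner x)))

      F∈ : ∀ x → T 4 (F x)
      F∈ x = T-* 2 {2} (T-* 1 {1} (T-X Sign.+ γ p) (T-X Sign.+ γ p))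
        (T-root 2 (phase-root x) (T-* 1 {1} (T-X Sign.+ γ x) (T-X Sign.+ γ (partner x))))

      term≈ : ∀ x → z * z * (pair γ x p * (X⁺ γ x * I γ (x ⊕ v))) ≈ F x
      term≈ x = begin
        z * z * (pair γ x p * (X⁺ γ x * (quad γ (⊝ (x ⊕ v)) * X⁺ γ (⊝ (x ⊕ v)))))
          ≡⟨ cong (λ y → z * z * (pair γ x p * (X⁺ γ x * (quad γ y * X⁺ γ y)))) (cong₂ _,_ (eq (proj₁ x) (proj₁ (2· p))) (eq (proj₂ x) (proj₂ (2· p)))) ⟩
        z * z * (pair γ x p * (X⁺ γ x * (quad γ (partner x) * X⁺ γ (partner x))))
          ≈⟨ *-congˡ (solve 4 (λ a b c d → a :* (b :* (c :* d)) := a :* c :* (b :* d)) ≈-refl _ _ _ _) ⟩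
        F x ∎
        where
        eq : ∀ x q → ℤ.- (x ℤ.+ ℤ.- q) ≡ q ℤ.- x
        eq = ℤS.solve 2 (λ x q → ℤS.:- (x ℤS.:+ ℤS.:- q) ℤS.:= q ℤS.:- x) refl

      F-partner : ∀ x y → y ~ partner x → F y ≈± F x
      F-partner x y y~ = ±-* (±-≈ ≈-refl) (±-*
        (root-close (phase-root y) (phase-root x) (exponent-partner x y y~))
        (±-≈ (≈-trans (*-cong (periodic Sign.+ γ y~)
            (≈-trans (periodic Sign.+ γ (partner-cong y~)) (reflexive (cong (X⁺ γ) (partner-involutive x)))))
          (*-comm _ _))))

      F-pair : ∀ x y → y ~ partner x → Reducible 3 (F x + F y)
      F-pair x y y~ = [ (λ Fy≈Fx → resp (reducible-isSubmodule 3) (+-congˡ (≈-sym Fy≈Fx)) (double⇒reducible 3 (F∈ x)))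
                      , (λ Fy≈-Fx → resp (reducible-isSubmodule 3) (≈-trans (≈-sym (-‿inverseʳ (F x))) (+-congˡ (≈-sym Fy≈-Fx)))
                          (zero# (reducible-isSubmodule 3))) ]′ (F-partner x y y~)

      p₀ : ℤ²
      p₀ = proj₁ (reps-complete p)

      p₀∈ : p₀ ∈ reps
      p₀∈ = proj₁ (proj₂ (reps-complete p))

      p₀~p : p₀ ~ p
      p₀~p = proj₂ (proj₂ (reps-complete p))

      others : List ℤ²
      others = proj₁ (∈⇒↭ p₀∈)

      reps↭ : reps ↭ p₀ ∷ others
      reps↭ = proj₂ (∈⇒↭ p₀∈)

      distinct : Distinct (p₀ ∷ others)
      distinct = Distinct-↭ reps↭ reps-distinct

      ≁p : ∀ {x} → x ∈ others → ¬ x ~ p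
      ≁p x∈ x~p = All.lookup (AllPairs.head distinct) x∈ (~-trans p₀~p (~-sym x~p))

      partner-p~p : ∀ {x} → x ~ p → partner x ~ p
      partner-p~p x~p = ~-trans (partner-cong x~p) (~-reflexive (cong₂ _,_ (eq (proj₁ p)) (eq (proj₂ p))))
        where
        eq : ∀ p → (p ℤ.+ p) ℤ.- p ≡ p
        eq = ℤS.solve 1 (λ p → (p ℤS.:+ p) ℤS.:- p ℤS.:= p) refl

      closed : ∀ {x} → x ∈ others → ∃[ y ] (y ∈ others × y ~ partner x)
      closed {x} x∈ = locate (reps-complete (partner x))
        where
        locate : ∃[ y ] (y ∈ reps × y ~ partner x) → ∃[ y ] (y ∈ others × y ~ partner x)
        locate (y , y∈ , y~) with Perm.∈-resp-↭ reps↭ y∈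
        ... | there y∈′ = y , y∈′ , y~
        ... | here refl = contradiction
          (~-trans (~-reflexive (sym (partner-involutive x))) (partner-p~p (~-trans (~-sym y~) p₀~p))) (≁p x∈)

      fixed : ∀ {x} → x ∈ others → x ~ partner x → Reducible 3 (F x)
      fixed {x} x∈ x~ = lower⇒reducible 3 (T-suc 2 (resp (isT 2)
        (begin
          phase x * ((z * X⁺ γ x) * (z * X⁺ γ x))
            ≈⟨ solve 3 (λ f z x → f :* ((z :* x) :* (z :* x)) := z :* z :* (f :* (x :* x))) ≈-refl (phase x) z (X⁺ γ x) ⟩
          z * z * (phase x * (X⁺ γ x * X⁺ γ x))
            ≈⟨ *-congˡ (*-congˡ (*-congˡ (periodic Sign.+ γ x~))) ⟩
          F x ∎)
        (T-root 2 (phase-root x) (distribution-square γ p x 2p∉ 2x~2p (≁p x∈)))))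
        where
        2x~2p : 2· x ~ 2· p
        2x~2p = ~-trans (~-⊕ x~ (~-refl {x})) (~-reflexive (cong₂ _,_ (eq (proj₁ (2· p)) (proj₁ x)) (eq (proj₂ (2· p)) (proj₂ x))))
          where
          eq : ∀ q x → (q ℤ.- x) ℤ.+ x ≡ q
          eq = ℤS.solve 2 (λ q x → (q ℤS.:- x) ℤS.:+ x ℤS.:= q) refl

      others-reducible : Reducible 3 (ΣL others F)
      others-reducible = involution-sum (Reducible 3) (resp (reducible-isSubmodule 3)) (zero# (reducible-isSubmodule 3))
        (add (reducible-isSubmodule 3)) partner partner-cong (λ x → ~-reflexive (partner-involutive x)) F F-pair others
        (AllPairs.tail distinct) closed fixed

      Ip : A
      Ip = I γ p

      zI≈1 : z * Ip ≈ 1#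
      zI≈1 = ≈-trans (*-congʳ (sign-independent γ p p∉)) (I-inverse γ p)

      ⊝p≡ : p ⊕ v ≡ ⊝ p
      ⊝p≡ = cong₂ _,_ (eq (proj₁ p)) (eq (proj₂ p))
        where
        eq : ∀ p → p ℤ.+ ℤ.- (p ℤ.+ p) ≡ ℤ.- p
        eq = ℤS.solve 1 (λ p → p ℤS.:+ ℤS.:- (p ℤS.:+ p) ℤS.:= ℤS.:- p) refl

      q : A
      q = proj₁ (inverse-root γ p p∉)

      rhs : A
      rhs = (q * quad γ (⊝ v) * r) * X⁺ γ (⊝ v)

      sum≈ : ΣL reps F ≈ rhs
      sum≈ = begin
        ΣL reps F
          ≈⟨ ΣL-cong reps (λ x _ → term≈ x) ⟨
        ΣL reps (λ x → z * z * (pair γ x p * (X⁺ γ x * I γ (x ⊕ v))))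
          ≈⟨ *-ΣL reps (z * z) (λ x → pair γ x p * (X⁺ γ x * I γ (x ⊕ v))) ⟨
        z * z * ΣL reps (λ x → pair γ x p * (X⁺ γ x * I γ (x ⊕ v)))
          ≈⟨ *-congˡ (convolution γ p v (λ (p∈ , _) → p∉ p∈)) ⟩
        z * z * (r * (X⁺ γ (p ⊕ v) * (Ip * (quad γ (⊝ v) * X⁺ γ (⊝ v)))))
          ≡⟨ cong (λ y → z * z * (r * (X⁺ γ y * (Ip * (quad γ (⊝ v) * X⁺ γ (⊝ v)))))) ⊝p≡ ⟩
        z * z * (r * (X⁺ γ (⊝ p) * (Ip * (quad γ (⊝ v) * X⁺ γ (⊝ v)))))
          ≈⟨ solve 6 (λ z r y i c x → z :* z :* (r :* (y :* (i :* (c :* x)))) := ((z :* y) :* (z :* i)) :* c :* r :* x) ≈-refl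
               z r (X⁺ γ (⊝ p)) Ip (quad γ (⊝ v)) (X⁺ γ (⊝ v)) ⟩
        ((z * X⁺ γ (⊝ p)) * (z * Ip)) * quad γ (⊝ v) * r * X⁺ γ (⊝ v)
          ≈⟨ *-congʳ (*-congʳ (*-congʳ (≈-trans (*-cong (proj₁ (proj₂ (inverse-root γ p p∉))) zI≈1) (*-identityʳ q)))) ⟩
        rhs ∎

      rhs-reducible : Reducible 3 rhs
      rhs-reducible = lower⇒reducible 3 (T-≤ {1} {3} (s≤s z≤n)
        (T-const 1 (root*r∈constants (root-* (proj₂ (proj₁ (proj₂ (proj₂ (inverse-root γ p p∉))))) (quad-root γ (⊝ v)))) (T-X Sign.+ γ (⊝ v))))

      F-p₀ : F p₀ ≈ phase p₀ * (z * z * (z * z))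
      F-p₀ = ≈-trans (*-congˡ (*-congˡ (*-cong (periodic Sign.+ γ p₀~p) (periodic Sign.+ γ (partner-p~p p₀~p)))))
        (solve 2 (λ z f → z :* z :* (f :* (z :* z)) := f :* (z :* z :* (z :* z))) ≈-refl z (phase p₀))

      phase*z⁴-reducible : Reducible 3 (phase p₀ * (z * z * (z * z)))
      phase*z⁴-reducible = resp (reducible-isSubmodule 3)
        (begin
          rhs - ΣL others F                            ≈⟨ +-congʳ (≈-sym sum≈) ⟩
          ΣL reps F - ΣL others F                      ≈⟨ +-congʳ (ΣL-↭ reps↭ F) ⟩
          (F p₀ + ΣL others F) - ΣL others F           ≈⟨ solve 2 (λ f s → (f :+ s) :- s := f) ≈-refl (F p₀) (ΣL others F) ⟩
          F p₀                                         ≈⟨ F-p₀ ⟩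
          phase p₀ * (z * z * (z * z))                 ∎)
        (sub (reducible-isSubmodule 3) rhs-reducible others-reducible)

    generic : Reducible 3 (X⁺ γ p ^ 4)
    generic = let w , z⁴≈ , wr = root-cancel (phase-root p₀) ≈-refl in
      resp (reducible-isSubmodule 3) (≈-trans (≈-sym z⁴≈) (≈-sym (power-4 z)))
        (reducible-* 0 (root∈constants wr) phase*z⁴-reducible)

  private
    -- t⁴ = (N + 2) t² - 1, as t t′ = 1 and t² + t′² = N + 2.
    at-𝟎 : ∀ {t t′} → T 1 t → t * t′ ≈ 1# → t * t + t′ * t′ ≈ fromℤ (+ (N ℕ.+ 2)) → Reducible 3 (t ^ 4)
    at-𝟎 {t} {t′} t∈ tt′≈1 t²+t′²≈ = lower⇒reducible 3 (T-suc 2 (resp (isT 2)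
      (begin
        fromℤ (+ (N ℕ.+ 2)) * (t * t) - 1#
          ≈⟨ +-cong (*-congʳ (≈-sym t²+t′²≈)) (-‿cong (≈-trans (≈-sym (*-identityˡ 1#)) (*-cong (≈-sym tt′≈1) (≈-sym tt′≈1)))) ⟩
        (t * t + t′ * t′) * (t * t) - (t * t′) * (t * t′)
          ≈⟨ solve 2 (λ t t′ → (t :* t :+ t′ :* t′) :* (t :* t) :- (t :* t′) :* (t :* t′) := t :* t :* (t :* t)) ≈-refl t t′ ⟩
        t * t * (t * t)
          ≈⟨ power-4 t ⟨
        t ^ 4 ∎)
      (sub (isT 2) (scale (isT 2) (+ (N ℕ.+ 2)) (T-* 1 {1} t∈ t∈)) (T-1 2))))

  fourth-power : ∀ s γ u → Reducible 3 (X s γ u ^ 4)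
  fourth-power s γ u = cases s (InΛ? γ u) (InΛ? γ (2· u))
    where
    open Lattice γ

    power-cong : ∀ {x y} → x ≈ y → Reducible 3 (y ^ 4) → Reducible 3 (x ^ 4)
    power-cong {x} {y} x≈y = resp (reducible-isSubmodule 3) (≈-trans (power-4 y)
      (≈-trans (*-cong (*-cong (≈-sym x≈y) (≈-sym x≈y)) (*-cong (≈-sym x≈y) (≈-sym x≈y))) (≈-sym (power-4 x))))

    cases⁺ : ¬ InΛ γ u → Dec (InΛ γ (2· u)) → Reducible 3 (X⁺ γ u ^ 4)
    cases⁺ u∉ (no 2u∉)  = Generic.generic γ u 2u∉
    cases⁺ u∉ (yes 2u∈) = let q , Xu²≈q , (_ , qr) , _ = inverse-root γ u u∉ in
      lower⇒reducible 3 (T-≤ {0} {3} z≤n (resp (isT 0)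
        (≈-trans (*-cong (≈-sym (≈-trans (*-congˡ (periodic Sign.+ γ u~⊝u)) Xu²≈q)) (≈-sym (≈-trans (*-congˡ (periodic Sign.+ γ u~⊝u)) Xu²≈q)))
          (≈-sym (power-4 (X⁺ γ u))))
        (root∈constants (root-* qr qr))))
      where
      u~⊝u : u ~ ⊝ u
      u~⊝u = mk~ (Λ-≡ (cong₂ _,_ (eq (proj₁ u)) (eq (proj₂ u))) 2u∈)
        where
        eq : ∀ u → u ℤ.+ u ≡ u ℤ.- (ℤ.- u)
        eq = ℤS.solve 1 (λ u → u ℤS.:+ u ℤS.:= u ℤS.:- (ℤS.:- u)) refl

    cases : ∀ s → Dec (InΛ γ u) → Dec (InΛ γ (2· u)) → Reducible 3 (X s γ u ^ 4)
    cases Sign.+ (yes u∈) _   = power-cong (periodic Sign.+ γ (Λ⇒~𝟎 u∈)) (at-𝟎 (T-X Sign.+ γ 𝟎) (tt′≈1 γ) (squares-at-𝟎 γ))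
    cases Sign.- (yes u∈) _   = power-cong (periodic Sign.- γ (Λ⇒~𝟎 u∈)) (at-𝟎 (T-X Sign.- γ 𝟎)
      (≈-trans (*-comm _ _) (tt′≈1 γ)) (≈-trans (+-comm _ _) (squares-at-𝟎 γ)))
    cases Sign.+ (no u∉)  2u? = cases⁺ u∉ 2u?
    cases Sign.- (no u∉)  2u? = power-cong (≈-sym (sign-independent γ u u∉)) (cases⁺ u∉ 2u?)

module ClearDivisions (R : CommutativeRing 0ℓ 0ℓ) (M : ℕ) where
  open CommutativeRing R renaming (Carrier to A; refl to ≈-refl; sym to ≈-sym; trans to ≈-trans)
  open IntegerScalars R
  open RootsOfUnity R M
  open ListSums R {ℤ²}
  open Exp semiring using (_^_)
  open Solver using (solve; con; _:=_; _:+_; _:*_; _:-_; :-_)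
  open SetoidReasoning setoid

  record RawModel : Set₁ where
    infix 8 _⁻¹
    field
      _⁻¹            : A → A
      inverse-unique : ∀ {z w} → z * w ≈ 1# → z ⁻¹ ≈ w
      inverse-cases  : ∀ z → z * z ⁻¹ ≈ 1# ⊎ z ⁻¹ ≡ 0#
      1≉0            : ¬ 1# ≈ 0#
      half           : A
      2*half≈1       : fromℤ (+ 2) * half ≈ 1#
      E e₁           : ℤ → A
      isCharacter    : IsCharacter E
      e₁-+           : ∀ k l → e₁ (k ℤ.+ l) ≈ e₁ k * e₁ l
      e₁-0           : e₁ (+ 0) ≈ 1#
      e₁-N           : e₁ (+ suc M) ≈ 1#
      E-double       : ∀ k → E (+ 2 ℤ.* k) ≈ e₁ k
      r              : A
      r-cases        : r * r ≈ fromℤ (+ N) ⊎ r ≡ 0#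
      μ              : Γ N → A
      X              : Sign → Γ N → ℤ² → A

      X⁺ X⁻          : Γ N → ℤ² → A
      X⁺≡            : ∀ γ u → X⁺ γ u ≡ X Sign.+ γ u
      X⁻≡            : ∀ γ u → X⁻ γ u ≡ X Sign.- γ u
      pair           : Γ N → ℤ² → ℤ² → A
      pair≡          : ∀ γ u v → pair γ u v ≡ e₁ (ω (Lattice.φ γ u) v)
      quad           : Γ N → ℤ² → A
      quad≡          : ∀ γ u → quad γ u ≡ (- 1#) ^ ℤ.∣ proj₁ u ℤ.+ proj₂ u ℤ.+ proj₁ u ℤ.* proj₂ u ∣ * E (ω (u ℤᴹ.▹ Γ.matrix γ) u)
      periodic         : ∀ s γ u u′ → InΛ γ (u ⊖ u′) → X s γ u ≈ X s γ u′
      sign-independent : ∀ γ u → ¬ InΛ γ u → X⁺ γ u ≈ X⁻ γ u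
      conjugation      : ∀ s (δ : SL₂ℤ) (γ γ′ : Γ N) u →
        Γ.matrix γ′ ≡ SL₂ℤ.matrix δ ℤᴹ.· Γ.matrix γ ℤᴹ.· ℤᴹ.adj (SL₂ℤ.matrix δ) →
        X s γ′ (u ℤᴹ.▹ ℤᴹ.adj (SL₂ℤ.matrix δ)) ≈ X s γ u
      w                : A
      value⁺           : ∀ γ → X Sign.+ γ 𝟎 * X Sign.+ γ 𝟎 ≈ (fromℤ (+ (N ℕ.+ 2)) + w) * half ⊎ X Sign.+ γ 𝟎 ≈ 0#
      value⁻           : ∀ γ → X Sign.- γ 𝟎 * X Sign.- γ 𝟎 ≈ (fromℤ (+ (N ℕ.+ 2)) + - w) * half ⊎ X Sign.- γ 𝟎 ≈ 0#
      inversion        : ∀ γ u → X⁺ γ u * X⁻ γ (⊝ u) ≈ quad γ u ⁻¹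
      fourier-sum      : Γ N → ℤ² → A
      fourier-sum≈     : ∀ γ u → fourier-sum γ u ≈ ΣL (representatives γ) (λ x → pair γ x u * X⁺ γ x)
      fourier          : ∀ γ u → r ⁻¹ * fourier-sum γ u ≈ μ γ * X⁻ γ u ⁻¹
      convolution-sum  : Γ N → ℤ² → ℤ² → A
      convolution-sum≈ : ∀ γ u v → convolution-sum γ u v ≈ ΣL (representatives γ) (λ x → pair γ x u * (X⁺ γ x * X⁻ γ (x ⊕ v) ⁻¹))
      convolution      : ∀ γ u v → ¬ (InΛ γ u × InΛ γ v) →
        r ⁻¹ * convolution-sum γ u v ≈ X⁺ γ (u ⊕ v) * (X⁻ γ u * X⁻ γ v) ⁻¹
      distribution-lhs  : Γ N → ℤ² → ℤ² → A
      distribution-lhs≈ : ∀ γ g p κ → μ γ * κ ≈ 1# →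
        distribution-lhs γ g p ≈ κ * κ * (X Sign.+ γ (p ⊕ 1 ⊛ g) * X Sign.+ γ (p ⊕ 2 ⊛ g))
      distribution      : ∀ γ g → IsOrder γ g 2 → (D : DistributionData γ g) → ∀ p →
        distribution-lhs γ g p ≈ μ (DistributionData.γ′ D) ⁻¹ * X Sign.+ (DistributionData.γ′ D) (DistributionData.image D p)

  module _ (raw : RawModel) where
    open RawModel raw
    open IsCharacter isCharacter
    open Constants R M E isCharacter 0# (0 , zeroˡ 0#) using (root-invert)

    I : Γ N → ℤ² → A
    I γ y = quad γ (⊝ y) * X⁺ γ (⊝ y)

    pair-root : ∀ γ u v → pair γ u v ≈± E (+ 2 ℤ.* ω (Lattice.φ γ u) v)
    pair-root γ u v = ±-≈ (≈-trans (reflexive (pair≡ γ u v)) (≈-sym (E-double (ω (Lattice.φ γ u) v))))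

    quad-root : ∀ γ u → quad γ u ≈± E (ω (u ℤᴹ.▹ Γ.matrix γ) u)
    quad-root γ u = ±-trans (±-≈ (reflexive (quad≡ γ u))) $ ±-trans (±-* (±1-power (- 1#) (inj₂ ≈-refl) ℤ.∣ proj₁ u ℤ.+ proj₂ u ℤ.+ proj₁ u ℤ.* proj₂ u ∣) ±-refl) (±-≈ (*-identityˡ _))

    e₁-divisible : ∀ {k} → + N ∣ˢ k → e₁ k ≈ 1#
    e₁-divisible (Signed.divides q eq) = ≈-trans (reflexive (cong e₁ eq)) (multiple≈1 e₁ e₁-+ e₁-0 e₁-N q)

    pair-⊕ : ∀ γ u u′ v → pair γ (u ⊕ u′) v ≈ pair γ u v * pair γ u′ v
    pair-⊕ γ u u′ v@(v₁ , v₂) = ≈-trans (reflexive (trans (pair≡ γ (u ⊕ u′) v) $ cong e₁ (trans (cong (λ l → ω l v) (Lattice.φ-⊕ γ u u′))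
        (ℤS.solve 6 (λ a b c d v₁ v₂ → (a ℤS.:+ c) ℤS.:* v₂ ℤS.:- (b ℤS.:+ d) ℤS.:* v₁ ℤS.:= (a ℤS.:* v₂ ℤS.:- b ℤS.:* v₁) ℤS.:+ (c ℤS.:* v₂ ℤS.:- d ℤS.:* v₁)) refl
          (proj₁ (Lattice.φ γ u)) (proj₂ (Lattice.φ γ u)) (proj₁ (Lattice.φ γ u′)) (proj₂ (Lattice.φ γ u′)) v₁ v₂))))
      (≈-trans (e₁-+ (ω (Lattice.φ γ u) v) (ω (Lattice.φ γ u′) v)) (*-cong (reflexive (sym (pair≡ γ u v))) (reflexive (sym (pair≡ γ u′ v)))))

    pair-Λ : ∀ γ u v → InΛ γ u → pair γ u v ≈ 1#
    pair-Λ γ u v u∈ = ≈-trans (reflexive (pair≡ γ u v)) $ e₁-divisible (Partner.ω-φ-divisible γ 𝟎 u v u∈)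

    pair-sym : ∀ γ u v → pair γ u v ≈ pair γ v u
    pair-sym γ u@(u₁ , u₂) v@(v₁ , v₂) = ≈-trans (reflexive (trans (pair≡ γ u v) (cong e₁ eq)))
      (≈-trans (e₁-+ (ω (Lattice.φ γ v) u) (ω u v ℤ.* + N))
        (≈-trans (*-congˡ (multiple≈1 e₁ e₁-+ e₁-0 e₁-N (ω u v))) (≈-trans (*-identityʳ _) (reflexive (sym (pair≡ γ v u))))))
      where
      open Mat (Γ.matrix γ)
      eq : ω (Lattice.φ γ u) v ≡ ω (Lattice.φ γ v) u ℤ.+ ω u v ℤ.* + N
      eq = trans (ℤS.solve 8 (λ a b c d u₁ u₂ v₁ v₂ →
            ((u₁ ℤS.:* a ℤS.:+ u₂ ℤS.:* c) ℤS.:- u₁) ℤS.:* v₂ ℤS.:- ((u₁ ℤS.:* b ℤS.:+ u₂ ℤS.:* d) ℤS.:- u₂) ℤS.:* v₁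
            ℤS.:= (((v₁ ℤS.:* a ℤS.:+ v₂ ℤS.:* c) ℤS.:- v₁) ℤS.:* u₂ ℤS.:- ((v₁ ℤS.:* b ℤS.:+ v₂ ℤS.:* d) ℤS.:- v₂) ℤS.:* u₁)
              ℤS.:+ (u₁ ℤS.:* v₂ ℤS.:- u₂ ℤS.:* v₁) ℤS.:* (a ℤS.:+ d ℤS.:- ℤS.con (+ 2))) refl a b c d u₁ u₂ v₁ v₂)
        (cong (λ n → ω (Lattice.φ γ v) u ℤ.+ ω u v ℤ.* n) (sym (Lattice.N≡ γ)))

    quad-𝟎 : ∀ γ → quad γ 𝟎 ≈ 1#
    quad-𝟎 γ = ≈-trans (reflexive (quad≡ γ 𝟎)) (≈-trans (*-identityˡ _) E-0)

    inverse-of : ∀ {z x} → z * x ≈ 1# → z * z ⁻¹ ≈ 1#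
    inverse-of zx≈1 = ≈-trans (*-congˡ (inverse-unique zx≈1)) zx≈1

    quad-inverse : ∀ γ u → quad γ u * quad γ u ⁻¹ ≈ 1#
    quad-inverse γ u = let _ , qw≈1 , _ = root-invert (quad-root γ u) in inverse-of qw≈1

    cleared-inversion : ∀ γ u → X⁺ γ u * X⁻ γ (⊝ u) * quad γ u ≈ 1#
    cleared-inversion γ u = ≈-trans (*-congʳ (inversion γ u)) (≈-trans (*-comm _ _) (quad-inverse γ u))

    X⁻-inverse : ∀ γ y → X⁻ γ y * I γ y ≈ 1#
    X⁻-inverse γ y = begin
      X⁻ γ y * (quad γ (⊝ y) * X⁺ γ (⊝ y))       ≡⟨ cong (λ z → X⁻ γ z * (quad γ (⊝ y) * X⁺ γ (⊝ y))) (⊝⊝ y) ⟨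
      X⁻ γ (⊝ ⊝ y) * (quad γ (⊝ y) * X⁺ γ (⊝ y)) ≈⟨ solve 3 (λ a b c → a :* (b :* c) := c :* a :* b) ≈-refl _ _ _ ⟩
      X⁺ γ (⊝ y) * X⁻ γ (⊝ ⊝ y) * quad γ (⊝ y)   ≈⟨ cleared-inversion γ (⊝ y) ⟩
      1#                                         ∎

    X⁻⁻¹≈I : ∀ γ y → X⁻ γ y ⁻¹ ≈ I γ y
    X⁻⁻¹≈I γ y = inverse-unique (X⁻-inverse γ y)

    X⁻X⁻⁻¹≈II : ∀ γ u v → (X⁻ γ u * X⁻ γ v) ⁻¹ ≈ I γ u * I γ v
    X⁻X⁻⁻¹≈II γ u v = inverse-unique (≈-trans
      (solve 4 (λ a b c d → a :* b :* (c :* d) := (a :* c) :* (b :* d)) ≈-refl _ _ _ _)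
      (≈-trans (*-cong (X⁻-inverse γ u) (X⁻-inverse γ v)) (*-identityˡ 1#)))

    r-invertible : ∀ γ u v → ¬ (InΛ γ u × InΛ γ v) → r * r ⁻¹ ≈ 1#
    r-invertible γ u v nz = [ id , (λ r⁻¹≡0 → ⊥-elim (1≉0 (begin
      1#
        ≈⟨ cleared-inversion γ (u ⊕ v) ⟨
      X⁺ γ (u ⊕ v) * X⁻ γ (⊝ (u ⊕ v)) * quad γ (u ⊕ v)
        ≈⟨ *-congʳ (*-congʳ (≈-trans (≈-sym (*-identityʳ _)) (*-congˡ (≈-sym (≈-trans (*-cong (X⁻-inverse γ u) (X⁻-inverse γ v)) (*-identityˡ 1#)))))) ⟩
      X⁺ γ (u ⊕ v) * ((X⁻ γ u * I γ u) * (X⁻ γ v * I γ v)) * X⁻ γ (⊝ (u ⊕ v)) * quad γ (u ⊕ v)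
        ≈⟨ solve 7 (λ x a i b j y q → x :* ((a :* i) :* (b :* j)) :* y :* q := (x :* (i :* j)) :* (a :* b :* y :* q)) ≈-refl _ _ _ _ _ _ _ ⟩
      (X⁺ γ (u ⊕ v) * (I γ u * I γ v)) * (X⁻ γ u * X⁻ γ v * X⁻ γ (⊝ (u ⊕ v)) * quad γ (u ⊕ v))
        ≈⟨ *-congʳ (≈-trans (*-congˡ (≈-sym (X⁻X⁻⁻¹≈II γ u v))) (≈-sym (convolution γ u v nz))) ⟩
      (r ⁻¹ * _) * (X⁻ γ u * X⁻ γ v * X⁻ γ (⊝ (u ⊕ v)) * quad γ (u ⊕ v))
        ≈⟨ *-congʳ (≈-trans (*-congʳ (reflexive r⁻¹≡0)) (zeroˡ _)) ⟩
      0# * (X⁻ γ u * X⁻ γ v * X⁻ γ (⊝ (u ⊕ v)) * quad γ (u ⊕ v))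
        ≈⟨ zeroˡ _ ⟩
      0# ∎))) ]′ (inverse-cases r)

    r²≈N : ∀ (γ : Γ N) u → ¬ InΛ γ u → r * r ≈ fromℤ (+ N)
    r²≈N γ u u∉ = [ id , (λ r≡0 → ⊥-elim (1≉0 (≈-trans (≈-sym (r-invertible γ u 𝟎 (λ (u∈ , _) → u∉ u∈)))
      (≈-trans (*-congʳ (reflexive r≡0)) (zeroˡ _))))) ]′ r-cases

    private
      clear-r : ∀ {s t} → r * r ⁻¹ ≈ 1# → r ⁻¹ * s ≈ t → s ≈ r * t
      clear-r {s} {t} rr⁻¹≈1 eq = begin
        s                ≈⟨ *-identityˡ s ⟨
        1# * s           ≈⟨ *-congʳ rr⁻¹≈1 ⟨
        r * r ⁻¹ * s     ≈⟨ *-assoc r (r ⁻¹) s ⟩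
        r * (r ⁻¹ * s)   ≈⟨ *-congˡ eq ⟩
        r * t            ∎

      nonzero⁺ : ∀ γ → X Sign.+ γ 𝟎 ≈ 0# → ⊥
      nonzero⁺ γ eq′ = let eq = ≈-trans (reflexive (X⁺≡ γ 𝟎)) eq′ in 1≉0 (≈-trans (≈-sym (cleared-inversion γ 𝟎)) (≈-trans (*-congʳ (≈-trans (*-congʳ eq) (zeroˡ _))) (zeroˡ _)))

      nonzero⁻ : ∀ γ → X Sign.- γ 𝟎 ≈ 0# → ⊥
      nonzero⁻ γ eq′ = let eq = ≈-trans (reflexive (X⁻≡ γ 𝟎)) eq′ in 1≉0 (≈-trans (≈-sym (cleared-inversion γ 𝟎)) (≈-trans (*-congʳ (≈-trans (*-congˡ eq) (zeroʳ _))) (zeroˡ _)))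

    squares-at-𝟎 : ∀ γ → X⁺ γ 𝟎 * X⁺ γ 𝟎 + X⁻ γ 𝟎 * X⁻ γ 𝟎 ≈ fromℤ (+ (N ℕ.+ 2))
    squares-at-𝟎 γ = begin
      X⁺ γ 𝟎 * X⁺ γ 𝟎 + X⁻ γ 𝟎 * X⁻ γ 𝟎
        ≡⟨ cong₂ (λ x y → x * x + y * y) (X⁺≡ γ 𝟎) (X⁻≡ γ 𝟎) ⟩
      X Sign.+ γ 𝟎 * X Sign.+ γ 𝟎 + X Sign.- γ 𝟎 * X Sign.- γ 𝟎
        ≈⟨ +-cong ([ id , ⊥-elim ∘ nonzero⁺ γ ]′ (value⁺ γ)) ([ id , ⊥-elim ∘ nonzero⁻ γ ]′ (value⁻ γ)) ⟩
      (n + w) * half + (n + - w) * half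
        ≈⟨ solve 3 (λ n w h → (n :+ w) :* h :+ (n :+ :- w) :* h := n :* (con (+ 2) :* h)) ≈-refl n w half ⟩
      n * (fromℤ (+ 2) * half)
        ≈⟨ ≈-trans (*-congˡ 2*half≈1) (*-identityʳ n) ⟩
      n ∎
      where
      n : A
      n = fromℤ (+ (N ℕ.+ 2))

    signed : Sign → Γ N → ℤ² → A
    signed Sign.+ = X⁺
    signed Sign.- = X⁻

    signed≡ : ∀ s γ u → signed s γ u ≡ X s γ u
    signed≡ Sign.+ = X⁺≡
    signed≡ Sign.- = X⁻≡

    toModel : Model R M E r
    toModel = record
      { pair = pair ; quad = quad ; μ = μ ; X = signed
      ; pair-root = pair-root ; pair-⊕ = pair-⊕ ; pair-Λ = pair-Λ ; pair-sym = pair-sym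
      ; quad-root = quad-root ; quad-𝟎 = quad-𝟎 ; r²≈N = r²≈N
      ; periodic = λ s γ {u} {v} u~v → ≈-trans (reflexive (signed≡ s γ u))
          (≈-trans (periodic s γ u v (Lattice.difference u~v)) (reflexive (sym (signed≡ s γ v))))
      ; sign-independent = sign-independent
      ; conjugation = λ s δ γ γ′ u eq → ≈-trans (reflexive (signed≡ s γ′ _))
          (≈-trans (conjugation s δ γ γ′ u eq) (reflexive (sym (signed≡ s γ u))))
      ; squares-at-𝟎 = squares-at-𝟎
      ; inversion = cleared-inversion
      ; fourier = λ γ u v v∉ → ≈-trans (≈-sym (fourier-sum≈ γ u)) (≈-trans
          (clear-r (r-invertible γ v 𝟎 (λ (v∈ , _) → v∉ v∈)) (fourier γ u))
          (*-congˡ (*-congˡ (X⁻⁻¹≈I γ u))))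
      ; convolution = λ γ u v nz → ≈-trans
          (ΣL-cong (representatives γ) (λ x _ → *-congˡ (*-congˡ (≈-sym (X⁻⁻¹≈I γ (x ⊕ v))))))
          (≈-trans (≈-sym (convolution-sum≈ γ u v)) (≈-trans (clear-r (r-invertible γ u v nz) (convolution γ u v nz))
            (*-congˡ (*-congˡ (X⁻X⁻⁻¹≈II γ u v)))))
      ; distribution = λ γ g order D p κ κ′ μκ≈1 μ′κ′≈1 → begin
          κ * κ * (X⁺ γ (p ⊕ 1 ⊛ g) * X⁺ γ (p ⊕ 2 ⊛ g))
            ≡⟨ cong₂ (λ x y → κ * κ * (x * y)) (X⁺≡ γ (p ⊕ 1 ⊛ g)) (X⁺≡ γ (p ⊕ 2 ⊛ g)) ⟩
          κ * κ * (X Sign.+ γ (p ⊕ 1 ⊛ g) * X Sign.+ γ (p ⊕ 2 ⊛ g))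
            ≈⟨ distribution-lhs≈ γ g p κ μκ≈1 ⟨
          distribution-lhs γ g p
            ≈⟨ distribution γ g order D p ⟩
          μ (DistributionData.γ′ D) ⁻¹ * X Sign.+ (DistributionData.γ′ D) (DistributionData.image D p)
            ≈⟨ *-cong (inverse-unique μ′κ′≈1) (reflexive (sym (X⁺≡ (DistributionData.γ′ D) (DistributionData.image D p)))) ⟩
          κ′ * X⁺ (DistributionData.γ′ D) (DistributionData.image D p) ∎
      }

module PointModel (em : ExcludedMiddle 0ℓ) (M : ℕ) where
  open Classical em
  open Analysis em
  open ℂ-Ring using (_≈_; _+_; _*_; -_; 0#; 1#; +-cong; +-congˡ; +-congʳ; *-cong; *-congʳ; *-congˡ; reflexive) renaming (refl to ≈-refl; sym to ≈-sym; trans to ≈-trans)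
  open import Algebra.Definitions.RawSemiring (Semiring.rawSemiring ℂ-Ring.semiring) using (_^_; product)
  open ℂI using (fromℤ)
  open ℂI.Solver using (solve; con; _:=_; _:*_)
  module Clear = ClearDivisions ℂ-commutativeRing M

  abstract
    E-isCharacter : RootsOfUnity.IsCharacter ℂ-commutativeRing M (e (2 ℕ.* suc M))
    E-isCharacter = record
      { E-+  = e-+ (2 ℕ.* suc M) refl
      ; E-0  = e-0 (2 ℕ.* suc M) refl
      ; E-N  = Sum⊎.swap (e-half M)
      ; E-2N = e-period (2 ℕ.* suc M) refl
      }

    √-cases : ∀ z → √ z * √ z ≈ z ⊎ √ z ≡ 0#
    √-cases z = Sum⊎.map₁ proj₁ (choose-cases 0# (λ w → w * w ≈ z ×
      (ℚ→ℝ 0ℚ <ℝ Re w ⊎ (Re w ≈ℝ ℚ→ℝ 0ℚ × ℚ→ℝ 0ℚ ≤ℝ Im w))))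

    r-cases : √ ℕ→ℂ (suc M) * √ ℕ→ℂ (suc M) ≈ fromℤ (+ suc M) ⊎ √ ℕ→ℂ (suc M) ≡ 0#
    r-cases = Sum⊎.map₁ (λ eq → ≈-trans eq (≈-sym (fromℕ≈ℕ→ℂ (suc M)))) (√-cases (ℕ→ℂ (suc M)))

    r²-integer : ∃[ n ] √ ℕ→ℂ (suc M) * √ ℕ→ℂ (suc M) ≈ fromℤ (+ n)
    r²-integer = [ (λ eq → suc M , eq) , (λ r≡0 → 0 , ≈-trans (*-congʳ (reflexive r≡0)) (ℂ-Ring.zeroˡ _)) ]′ r-cases

    1≉0 : ¬ 1# ≈ 0#
    1≉0 eq = 1≢0 (ℚ→ℂ-injective 1ℚ 0ℚ eq)
      where
      1≢0 : 1ℚ ≢ 0ℚ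
      1≢0 ()

    value-cases : ∀ {x w s} → x ≈ √ ((ℕ→ℂ (suc M ℕ.+ 2) + s) ÷ ℕ→ℂ 2) → s ≈ w →
                  x * x ≈ (fromℤ (+ (suc M ℕ.+ 2)) + w) * ℚ→ℂ (inv 1) ⊎ x ≈ 0#
    value-cases {x} {w} {s} x≈ s≈w = Sum⊎.map
      (λ eq → ≈-trans (*-cong x≈ x≈) (≈-trans eq (≈-trans (÷-inv (ℕ→ℂ (suc M ℕ.+ 2) + s) 1)
        (*-congʳ (+-cong (≈-sym (fromℕ≈ℕ→ℂ (suc M ℕ.+ 2))) s≈w)))))
      (λ eq → ≈-trans x≈ (reflexive eq))
      (√-cases ((ℕ→ℂ (suc M ℕ.+ 2) + s) ÷ ℕ→ℂ 2))

    foldr≈ΣL : ∀ (l : List ℤ²) (F G : ℤ² → ℂ) → (∀ x → F x ≈ G x) →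
               foldr (λ x acc → F x + acc) 0# l ≈ ListSums.ΣL ℂ-commutativeRing l G
    foldr≈ΣL []      F G F≈G = ≈-refl
    foldr≈ΣL (x ∷ l) F G F≈G = +-cong (F≈G x) (foldr≈ΣL l F G F≈G)

    square-inverse : ∀ m κ (f : Fin 2 → ℂ) → m * κ ≈ 1# →
                     (m ^ 2) ⁻¹ * product {2} f ≈ κ * κ * (f Fin.zero * f (Fin.suc Fin.zero))
    square-inverse m κ f mκ≈1 = *-cong
      (inverse-unique (≈-trans (solve 2 (λ m k → m :* (m :* con (+ 1)) :* (k :* k) := (m :* k) :* (m :* k)) ≈-refl m κ)
        (≈-trans (*-cong mκ≈1 mκ≈1) (ℂ-Ring.*-identityˡ 1#))))
      (*-congˡ (ℂ-Ring.*-identityʳ (f (Fin.suc Fin.zero))))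

  rawModel : Point (suc M) → Clear.RawModel
  rawModel (X , periodic , sign-independent , conjugation , value , inversion , fourier , convolution , distribution) = record
    { _⁻¹            = _⁻¹
    ; inverse-unique = inverse-unique
    ; inverse-cases  = inverse-cases
    ; 1≉0            = 1≉0
    ; half           = ℚ→ℂ (inv 1)
    ; 2*half≈1       = invℂ-inverse 1
    ; E              = e (2 ℕ.* suc M)
    ; e₁             = e (suc M)
    ; isCharacter    = E-isCharacter
    ; e₁-+           = e-+ (suc M) refl
    ; e₁-0           = e-0 (suc M) refl
    ; e₁-N           = e-period (suc M) refl
    ; E-double       = e-double M
    ; r              = √ ℕ→ℂ (suc M)
    ; r-cases        = r-cases
    ; μ              = μ
    ; X              = X
    ; X⁺             = X⁺ X
    ; X⁻             = X⁻ X
    ; X⁺≡            = λ _ _ → refl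
    ; X⁻≡            = λ _ _ → refl
    ; pair           = pair
    ; pair≡          = λ _ _ _ → refl
    ; quad           = quad
    ; quad≡          = λ _ _ → refl
    ; periodic       = periodic
    ; sign-independent = sign-independent
    ; conjugation    = conjugation
    ; w              = √ ℕ→ℂ (suc M ℕ.^ 2 ℕ.+ 4 ℕ.* suc M)
    ; value⁺         = λ γ → value-cases (value Sign.+ γ) ≈-refl
    ; value⁻         = λ γ → value-cases (value Sign.- γ) ≈-refl
    ; inversion      = inversion
    ; fourier-sum    = λ γ u → ΣG γ (λ x → pair γ x u * X⁺ X γ x)
    ; fourier-sum≈   = λ γ u → foldr≈ΣL (representatives γ) (λ x → pair γ x u * X⁺ X γ x) _ (λ x → ≈-refl)
    ; fourier        = fourier
    ; convolution-sum  = λ γ u v → ΣG γ (λ x → pair γ x u * (X⁺ X γ x ÷ X⁻ X γ (x ⊕ v)))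
    ; convolution-sum≈ = λ γ u v → foldr≈ΣL (representatives γ) (λ x → pair γ x u * (X⁺ X γ x ÷ X⁻ X γ (x ⊕ v))) _ (λ x → ≈-refl)
    ; convolution    = convolution
    ; distribution-lhs  = λ γ g p → (μ γ ^ 2) ⁻¹ * product {2} (λ n → X Sign.+ γ (p ⊕ suc (toℕ n) ⊛ g))
    ; distribution-lhs≈ = λ γ g p κ μκ≈1 → square-inverse (μ γ) κ (λ n → X Sign.+ γ (p ⊕ suc (toℕ n) ⊛ g)) μκ≈1
    ; distribution   = λ γ g order D p → distribution Sign.+ γ g 2 order D p
    }
    where open Equations using (X⁺; X⁻)

  pointModel : Point (suc M) → Model ℂ-commutativeRing M (e (2 ℕ.* suc M)) (√ ℕ→ℂ (suc M))
  pointModel P = Clear.toModel (rawModel P)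

  abstract
    μ-invertible : ∀ (P : Point (suc M)) (γ : Γ (suc M)) w → ¬ InΛ γ w → ∃[ κ ] μ γ * κ ≈ 1#
    μ-invertible P γ w w∉ = Orthogonality.μ-invertible (pointModel P) domain fromℤ-injective
      (λ k → ℚ→ℂ (inv k)) invℂ-inverse γ w w∉

-- Integrality and finiteness

module Cover {R : CommutativeRing 0ℓ 0ℓ} {M : ℕ} {E : ℤ → CommutativeRing.Carrier R} {r : CommutativeRing.Carrier R}
             (model : Model R M E r) where
  open Model model
  open CommutativeRing R renaming (Carrier to A; refl to ≈-refl; sym to ≈-sym; trans to ≈-trans)

  representatives-classes : List (Γ N)
  representatives-classes = Conjugacy.classes N (s≤s z≤n)

  variables : List A
  variables = 1# ∷ concatMap (λ γ → concatMap (λ u → X⁺ γ u ∷ X⁻ γ u ∷ []) (representatives γ)) representatives-classes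

  1∈variables : 1# ∈ variables
  1∈variables = here refl

  private
    X∈ : ∀ s γ u → X s γ u ∈ X⁺ γ u ∷ X⁻ γ u ∷ []
    X∈ Sign.+ γ u = here refl
    X∈ Sign.- γ u = there (here refl)

  cover : ∀ s γ u → ∃[ x ] (x ∈ variables × X s γ u ≈ x)
  cover s γ u =
    let γ′ , γ′∈ , δ , eq = Conjugacy.classes-complete N (s≤s z≤n) γ
        u′ = u ℤᴹ.▹ ℤᴹ.adj (SL₂ℤ.matrix δ)
        v , v∈ , v~u′ = Lattice.reps-complete γ′ u′
    in X s γ′ v
     , there (∈-concatMap⁺ (λ γ → concatMap (λ u → X⁺ γ u ∷ X⁻ γ u ∷ []) (representatives γ))
         (lose γ′∈ (∈-concatMap⁺ (λ u → X⁺ γ′ u ∷ X⁻ γ′ u ∷ []) (lose v∈ (X∈ s γ′ v)))))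
     , ≈-trans (≈-sym (conjugation s δ γ γ′ u eq)) (≈-sym (periodic s γ′ v~u′))

  variables-all : (P : A → Set) → P 1# → (∀ s γ u → P (X s γ u)) → ∀ {x} → x ∈ variables → P x
  variables-all P P1 PX (here refl) = P1
  variables-all P P1 PX (there x∈) =
    let γ , _ , x∈γ = find (∈-concatMap⁻ (λ γ → concatMap (λ u → X⁺ γ u ∷ X⁻ γ u ∷ []) (representatives γ)) {xs = representatives-classes} x∈)
        u , _ , x∈u = find (∈-concatMap⁻ (λ u → X⁺ γ u ∷ X⁻ γ u ∷ []) {xs = representatives γ} x∈γ)
    in pick γ u x∈u
    where
    pick : ∀ γ u {x} → x ∈ X⁺ γ u ∷ X⁻ γ u ∷ [] → P x
    pick γ u (here refl)         = PX Sign.+ γ u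
    pick γ u (there (here refl)) = PX Sign.- γ u

-- A family of models with the same constants is a model over the ring of functions on the index type.
module Family {R : CommutativeRing 0ℓ 0ℓ} {M : ℕ} {E : ℤ → CommutativeRing.Carrier R} {r : CommutativeRing.Carrier R}
  (Index : Set) (i₀ : Index) (models : Index → Model R M E r)
  (pair≡ : ∀ i γ u v → Model.pair (models i) γ u v ≡ Model.pair (models i₀) γ u v)
  (quad≡ : ∀ i γ u → Model.quad (models i) γ u ≡ Model.quad (models i₀) γ u)
  (μ≡ : ∀ i γ → Model.μ (models i) γ ≡ Model.μ (models i₀) γ) where
  open CommutativeRing R renaming (Carrier to A; refl to ≈-refl; sym to ≈-sym; trans to ≈-trans)
  open IntegerScalars R
  open RootsOfUnity R M
  open ListSums R {ℤ²}

  functions : CommutativeRing 0ℓ 0ℓ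
  functions = Pointwise.commutativeRing Index R

  module F = CommutativeRing functions
  module Fℤ = IntegerScalars functions
  module FΣ = ListSums functions {ℤ²}

  const : A → F.Carrier
  const a _ = a

  private
    open Mult semiring using () renaming (_×_ to infixl 8 _⊠_)
    open Mult F.semiring using () renaming (_×_ to infixl 8 _⊠′_)

    ⊠-pointwise : ∀ n i → (n ⊠′ F.1#) i ≡ n ⊠ 1#
    ⊠-pointwise 0             i = refl
    ⊠-pointwise 1             i = refl
    ⊠-pointwise (suc (suc n)) i = cong (_+ 1#) (⊠-pointwise (suc n) i)

  fromℤ-pointwise : ∀ k i → Fℤ.fromℤ k i ≡ fromℤ k
  fromℤ-pointwise (+ n)    i = ⊠-pointwise n i
  fromℤ-pointwise -[1+ n ] i = cong -_ (⊠-pointwise (suc n) i)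

  ΣL-pointwise : ∀ l G i → FΣ.ΣL l G i ≡ ΣL l (λ x → G x i)
  ΣL-pointwise []      G i = refl
  ΣL-pointwise (x ∷ l) G i = cong (λ s → G x i + s) (ΣL-pointwise l G i)

  lift-± : ∀ {a b} → a ≈± b → RootsOfUnity._≈±_ functions M (const a) (const b)
  lift-± = Sum⊎.map (λ p _ → p) (λ p _ → p)

  isCharacter : IsCharacter E → RootsOfUnity.IsCharacter functions M (const ∘ E)
  isCharacter c = record
    { E-+  = λ k l _ → E-+ k l
    ; E-0  = λ _ → E-0
    ; E-N  = lift-± E-N
    ; E-2N = λ _ → E-2N
    }
    where open IsCharacter c

  module M₀ = Model (models i₀)
  module Mᵢ (i : Index) = Model (models i)

  private
    I≡ : ∀ i γ y → M₀.quad γ (⊝ y) * Mᵢ.X i Sign.+ γ (⊝ y) ≡ Mᵢ.I i γ y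
    I≡ i γ y = cong (_* Mᵢ.X i Sign.+ γ (⊝ y)) (sym (quad≡ i γ (⊝ y)))

  model : Model functions M (const ∘ E) (const r)
  model = record
    { pair = λ γ u v → const (M₀.pair γ u v)
    ; quad = λ γ u → const (M₀.quad γ u)
    ; μ    = λ γ → const (M₀.μ γ)
    ; X    = λ s γ u i → Mᵢ.X i s γ u
    ; pair-root = λ γ u v → lift-± (M₀.pair-root γ u v)
    ; pair-⊕    = λ γ u u′ v _ → M₀.pair-⊕ γ u u′ v
    ; pair-Λ    = λ γ u v u∈ _ → M₀.pair-Λ γ u v u∈
    ; pair-sym  = λ γ u v _ → M₀.pair-sym γ u v
    ; quad-root = λ γ u → lift-± (M₀.quad-root γ u)
    ; quad-𝟎    = λ γ _ → M₀.quad-𝟎 γ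
    ; r²≈N      = λ γ u u∉ i → ≈-trans (M₀.r²≈N γ u u∉) (reflexive (sym (fromℤ-pointwise (+ suc M) i)))
    ; periodic  = λ s γ u~v i → Mᵢ.periodic i s γ u~v
    ; sign-independent = λ γ u u∉ i → Mᵢ.sign-independent i γ u u∉
    ; conjugation      = λ s δ γ γ′ u eq i → Mᵢ.conjugation i s δ γ γ′ u eq
    ; squares-at-𝟎     = λ γ i → ≈-trans (Mᵢ.squares-at-𝟎 i γ) (reflexive (sym (fromℤ-pointwise (+ (suc M ℕ.+ 2)) i)))
    ; inversion        = λ γ u i → ≈-trans (*-congˡ (reflexive (sym (quad≡ i γ u)))) (Mᵢ.inversion i γ u)
    ; fourier          = λ γ u w w∉ i → ≈-trans (reflexive (ΣL-pointwise (representatives γ) _ i))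
        (≈-trans (ΣL-cong (representatives γ) (λ x _ → *-congʳ (reflexive (sym (pair≡ i γ x u)))))
          (≈-trans (Mᵢ.fourier i γ u w w∉) (*-congˡ (*-cong (reflexive (μ≡ i γ)) (reflexive (sym (I≡ i γ u)))))))
    ; convolution      = λ γ u v nz i → ≈-trans (reflexive (ΣL-pointwise (representatives γ) _ i))
        (≈-trans (ΣL-cong (representatives γ) (λ x _ → *-cong (reflexive (sym (pair≡ i γ x u))) (*-congˡ (reflexive (I≡ i γ (x ⊕ v))))))
          (≈-trans (Mᵢ.convolution i γ u v nz) (*-congˡ (*-congˡ (*-cong (reflexive (sym (I≡ i γ u))) (reflexive (sym (I≡ i γ v))))))))
    ; distribution     = λ γ g order D p κ κ′ μκ≈1 μ′κ′≈1 i → Mᵢ.distribution i γ g order D p (κ i) (κ′ i)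
        (≈-trans (*-congʳ (reflexive (μ≡ i γ))) (μκ≈1 i))
        (≈-trans (*-congʳ (reflexive (μ≡ i (DistributionData.γ′ D)))) (μ′κ′≈1 i))
    }

module Integrality {R : CommutativeRing 0ℓ 0ℓ} {M : ℕ} {E : ℤ → CommutativeRing.Carrier R} {r : CommutativeRing.Carrier R}
  (isCharacter : RootsOfUnity.IsCharacter R M E)
  (r²-integer : ∃[ n ] CommutativeRing._≈_ R (CommutativeRing._*_ R r r) (IntegerScalars.fromℤ R (+ n)))
  (model : Model R M E r)
  (μ-invertible : ∀ γ w → ¬ InΛ γ w → ∃[ κ ] CommutativeRing._≈_ R (CommutativeRing._*_ R (Model.μ model γ) κ) (CommutativeRing.1# R)) where
  open Model model
  open CommutativeRing R renaming (Carrier to A; refl to ≈-refl; sym to ≈-sym; trans to ≈-trans)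
  open Spans R
  open Cover model
  open Constants R M E isCharacter r r²-integer
  open Filtration R constants variables 1∈constants constants-closed 1∈variables
  open FourthPowers isCharacter r²-integer model μ-invertible variables 1∈variables cover using (fourth-power)
  open Exp semiring using (_^_)

  private
    fourth-powers : ∀ {x} → x ∈ variables → Reducible 3 (x ^ 4)
    fourth-powers = variables-all (λ x → Reducible 3 (x ^ 4))
      (lower⇒reducible 3 (resp (isT 3)
        (≈-sym (≈-trans (*-identityˡ _) (≈-trans (*-identityˡ _) (≈-trans (*-identityˡ _) (*-identityˡ 1#))))) (T-1 3)))
      fourth-power

  generators : List A
  generators = basis fourth-powers

  1∈generators : Span generators 1#
  1∈generators = 1∈basis fourth-powers

  generators-stabilize : ∀ {e} → e ∈ generators → Stabilizes generators e
  generators-stabilize = basis-stabilizes fourth-powers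

  X-stabilizes : ∀ s γ u → Stabilizes generators (X s γ u)
  X-stabilizes s γ u = let x , x∈ , eq = cover s γ u in
    resp (stabilizers-isSubmodule generators) (≈-sym eq) (variable-stabilizes fourth-powers x∈)

  quad-stabilizes : ∀ γ u → Stabilizes generators (quad γ u)
  quad-stabilizes γ u = constant-stabilizes fourth-powers (root∈constants (quad-root γ u))

module FiniteSolutions {R : CommutativeRing 0ℓ 0ℓ} {M : ℕ} {E : ℤ → CommutativeRing.Carrier R} {r : CommutativeRing.Carrier R}
  (isCharacter : RootsOfUnity.IsCharacter R M E)
  (r²-integer : ∃[ n ] CommutativeRing._≈_ R (CommutativeRing._*_ R r r) (IntegerScalars.fromℤ R (+ n)))
  (domain : ∀ x y → CommutativeRing._≈_ R (CommutativeRing._*_ R x y) (CommutativeRing.0# R) →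
            CommutativeRing._≈_ R x (CommutativeRing.0# R) ⊎ CommutativeRing._≈_ R y (CommutativeRing.0# R))
  (fromℤ-injective : ∀ a b → CommutativeRing._≈_ R (IntegerScalars.fromℤ R a) (IntegerScalars.fromℤ R b) → a ≡ b)
  (em : ExcludedMiddle 0ℓ)
  (Index : Set) (i₀ : Index) (models : Index → Model R M E r)
  (pair≡ : ∀ i γ u v → Model.pair (models i) γ u v ≡ Model.pair (models i₀) γ u v)
  (quad≡ : ∀ i γ u → Model.quad (models i) γ u ≡ Model.quad (models i₀) γ u)
  (μ≡ : ∀ i γ → Model.μ (models i) γ ≡ Model.μ (models i₀) γ)
  (μ-invertible : ∀ γ w → ¬ InΛ γ w → ∃[ κ ] CommutativeRing._≈_ R (CommutativeRing._*_ R (Model.μ (models i₀) γ) κ) (CommutativeRing.1# R)) where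
  open CommutativeRing R renaming (Carrier to A; refl to ≈-refl; sym to ≈-sym; trans to ≈-trans)
  open Spans R
  open Roots R domain em using (finitely-many-roots; eval)
  module Fam = Family Index i₀ models pair≡ quad≡ μ≡
  module FS = Spans Fam.functions
  module FM = Model Fam.model

  r²-functions : ∃[ n ] Fam.F._≈_ (Fam.F._*_ (Fam.const r) (Fam.const r)) (FS.fromℤ (+ n))
  r²-functions = let n , eq = r²-integer in n , λ i → ≈-trans eq (reflexive (sym (Fam.fromℤ-pointwise (+ n) i)))

  μ-invertible-functions : ∀ γ w → ¬ InΛ γ w → ∃[ κ ] Fam.F._≈_ (Fam.F._*_ (FM.μ γ) κ) Fam.F.1#
  μ-invertible-functions γ w w∉ = let κ , eq = μ-invertible γ w w∉ in Fam.const κ , λ _ → eq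

  module Int = Integrality (Fam.isCharacter isCharacter) r²-functions Fam.model μ-invertible-functions
  module C = Cover Fam.model

  private
    eval≡polynomial : ∀ cs z → eval (map fromℤ cs) z ≡ polynomial cs z
    eval≡polynomial []       z = refl
    eval≡polynomial (c ∷ cs) z = cong (λ s → fromℤ c + z * s) (eval≡polynomial cs z)

    not-all-zero : ∀ {cs} → Any (_≢ + 0) cs → ¬ All (_≈ 0#) (map fromℤ cs)
    not-all-zero (here c≢0) (c≈0 ∷ _) = c≢0 (fromℤ-injective _ (+ 0) c≈0)
    not-all-zero (there p)  (_ ∷ ps)  = not-all-zero p ps

    polynomial-at : ∀ cs f i → FS.polynomial cs f i ≡ polynomial cs (f i)
    polynomial-at []       f i = refl
    polynomial-at (c ∷ cs) f i = cong₂ (λ a b → a + f i * b) (Fam.fromℤ-pointwise c i) (polynomial-at cs f i)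

  -- All the points satisfy the same integer polynomial.
  finitely-many-values : ∀ s γ u → ∃[ zs ] ∀ i → Any (FM.X s γ u i ≈_) zs
  finitely-many-values s γ u =
    let cs , nonzero , root = FS.stabilizes⇒algebraic Int.generators Int.1∈generators (Int.X-stabilizes s γ u)
        zs , complete = finitely-many-roots (map fromℤ cs) (not-all-zero nonzero)
    in zs , λ i → complete (FM.X s γ u i) (≈-trans (reflexive (trans (eval≡polynomial cs (FM.X s γ u i))
         (sym (polynomial-at cs (FM.X s γ u) i)))) (root i))

  private
    Agree : List Fam.F.Carrier → Index → Index → Set
    Agree Xs i j = ∀ {x} → x ∈ Xs → x i ≈ x j

    sample : ∀ Xs → (∀ {x} → x ∈ Xs → ∃[ zs ] ∀ i → Any (x i ≈_) zs) → (K : Index → Set) →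
             ∃[ js ] ∀ i → K i → Any (λ j → K j × Agree Xs i j) js
    sample [] _ K with em {∃ K}
    ... | yes (j , Kj) = j ∷ [] , λ i Ki → here (Kj , λ ())
    ... | no  ∄K       = [] , λ i Ki → contradiction (i , Ki) ∄K
    sample (x ∷ Xs) values K = let zs , complete = values (here refl)
                                   js , sampled  = overValues zs
                               in js , λ i Ki → sampled i Ki (complete i)
      where
      overValues : ∀ zs → ∃[ js ] ∀ i → K i → Any (x i ≈_) zs → Any (λ j → K j × Agree (x ∷ Xs) i j) js
      overValues []       = [] , λ _ _ ()
      overValues (z ∷ zs) =
        let js , f = sample Xs (values ∘ there) (λ i → K i × x i ≈ z)
            ks , g = overValues zs
        in js ++ ks , λ
          { i Ki (here xi≈z) → Any.++⁺ˡ (Any.map (λ ((Kj , xj≈z) , agree) → Kj , λ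
              { (here refl) → ≈-trans xi≈z (≈-sym xj≈z) ; (there x∈) → agree x∈ }) (f i (Ki , xi≈z)))
          ; i Ki (there p) → Any.++⁺ʳ js (g i Ki p) }

    ⊤′ : Index → Set
    ⊤′ i = i ≡ i

  finitely-many : ∃[ js ] ∀ i → Any (λ j → ∀ s γ u → FM.X s γ u i ≈ FM.X s γ u j) js
  finitely-many =
    let js , f = sample C.variables
          (C.variables-all (λ x → ∃[ zs ] ∀ i → Any (x i ≈_) zs) (1# ∷ [] , λ _ → here ≈-refl) finitely-many-values) ⊤′
    in js , λ i → Any.map (λ (_ , agree) s γ u →
         let x , x∈ , eq = C.cover s γ u in ≈-trans (eq i) (≈-trans (agree x∈) (≈-sym (eq _)))) (f i refl)

-- Valuations

open SupEquality _≈ℝ_ using (_≈⁺_; ⊤⁺≈⊤⁺; ≈⁺-sym; ≈⁺-trans) renaming ([_] to [_]≈)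
open SupOrder _≤ℝ_ using (_≤⁺_; _≤⊤⁺) renaming ([_] to [_]≤)

private
  _⊑_ : ℝ → ℝ → Set
  x ⊑ y = ∀ ε → 0ℚ ℚ.< ε → ∃[ k ] ∀ n → k ≤ n → seq x n ℚ.≤ seq y n ℚ.+ ε

abstract
  private
    p≤∣p∣ : ∀ p → p ℚ.≤ ℚ.∣ p ∣
    p≤∣p∣ p = [ (λ 0≤p → ℚ.≤-reflexive (sym (ℚ.0≤p⇒∣p∣≡p 0≤p))) , (λ p≤0 → ℚ.≤-trans p≤0 (ℚ.0≤∣p∣ p)) ]′ (ℚ.≤-total 0ℚ p)

    ∣-∣≤⇒≤+ : ∀ p q {ε} → ℚ.∣ p ℚ.- q ∣ ℚ.≤ ε → p ℚ.≤ q ℚ.+ ε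
    ∣-∣≤⇒≤+ p q {ε} h = subst (ℚ._≤ q ℚ.+ ε) (trans (ℚ.+-comm q (p ℚ.- q)) (sub-cancel p q))
      (ℚ.+-monoʳ-≤ q (ℚ.≤-trans (p≤∣p∣ (p ℚ.- q)) h))

    +-cancelʳ-≤ : ∀ p q r → p ℚ.+ r ℚ.≤ q ℚ.+ r → p ℚ.≤ q
    +-cancelʳ-≤ p q r h = subst₂-≤ (+- p r) (+- q r) (ℚ.+-monoˡ-≤ (ℚ.- r) h)
      where
      +- : ∀ p r → p ℚ.+ r ℚ.- r ≡ p
      +- = ℚS.solve 2 (λ p r → p ℚS.:+ r ℚS.:- r ℚS.:= p) refl
      subst₂-≤ : ∀ {p p′ q q′} → p ≡ p′ → q ≡ q′ → p ℚ.≤ q → p′ ℚ.≤ q′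
      subst₂-≤ refl refl h = h

    ⊑⇒≤ℝ : ∀ x y → x ⊑ y → x ≤ℝ y
    ⊑⇒≤ℝ x y x⊑y (ε , 0<ε , k , f) =
      let l , g = x⊑y (½ ℚ.* ε) (0<½* ε 0<ε)
          n = k ⊔ l
      in ℚ.<-irrefl refl (ℚ.<-≤-trans (ℚ.+-monoʳ-< (seq y n) (½<1 ε 0<ε))
           (ℚ.≤-trans (f n (ℕ.m≤m⊔n k l)) (g n (ℕ.m≤n⊔m k l))))

    ≤ℝ⇒⊑ : ∀ x y → x ≤ℝ y → x ⊑ y
    ≤ℝ⇒⊑ x y x≤y ε 0<ε =
      let δ = ½ ℚ.* (½ ℚ.* ε)
          0<δ = 0<½* (½ ℚ.* ε) (0<½* ε 0<ε)
          k , f = cauchy x δ 0<δ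
          l , g = cauchy y δ 0<δ
      in k ⊔ l , λ n kl≤n → ℚ.≮⇒≥ λ y+ε<x → x≤y (½ ℚ.* ε , 0<½* ε 0<ε , n , λ m n≤m →
        let k≤n = ℕ.m⊔n≤o⇒m≤o k l kl≤n
            l≤n = ℕ.m⊔n≤o⇒n≤o k l kl≤n
        in +-cancelʳ-≤ (seq y m ℚ.+ ½ ℚ.* ε) (seq x m) δ
             (ℚ.≤-trans (ℚ.+-monoˡ-≤ δ (ℚ.+-monoˡ-≤ (½ ℚ.* ε) (∣-∣≤⇒≤+ (seq y m) (seq y n) (ℚ.<⇒≤ (g m n (ℕ.≤-trans l≤n n≤m) l≤n)))))
             (ℚ.≤-trans (ℚ.≤-reflexive (quarters (seq y n) ε))
             (ℚ.≤-trans (ℚ.<⇒≤ y+ε<x) (∣-∣≤⇒≤+ (seq x n) (seq x m) (ℚ.<⇒≤ (f n m k≤n (ℕ.≤-trans k≤n n≤m))))))))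
      where
      quarters : ∀ q ε → q ℚ.+ ½ ℚ.* (½ ℚ.* ε) ℚ.+ ½ ℚ.* ε ℚ.+ ½ ℚ.* (½ ℚ.* ε) ≡ q ℚ.+ ε
      quarters = ℚS.solve 2 (λ q ε → q ℚS.:+ ℚS.con ½ ℚS.:* (ℚS.con ½ ℚS.:* ε) ℚS.:+ ℚS.con ½ ℚS.:* ε
        ℚS.:+ ℚS.con ½ ℚS.:* (ℚS.con ½ ℚS.:* ε) ℚS.:= q ℚS.:+ ε) refl

  ≤ℝ-reflexive : ∀ {x y} → x ≈ℝ y → x ≤ℝ y
  ≤ℝ-reflexive {x} {y} x≈y = ⊑⇒≤ℝ x y λ ε 0<ε → let k , f = close x≈y ε 0<ε in
    k , λ n k≤n → ∣-∣≤⇒≤+ (seq x n) (seq y n) (ℚ.<⇒≤ (f n n k≤n k≤n))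

  ≤ℝ-trans : ∀ x y z → x ≤ℝ y → y ≤ℝ z → x ≤ℝ z
  ≤ℝ-trans x y z x≤y y≤z = ⊑⇒≤ℝ x z λ ε 0<ε →
    let k , f = ≤ℝ⇒⊑ x y x≤y (½ ℚ.* ε) (0<½* ε 0<ε)
        l , g = ≤ℝ⇒⊑ y z y≤z (½ ℚ.* ε) (0<½* ε 0<ε)
    in k ⊔ l , λ n kl≤n → ℚ.≤-trans (f n (ℕ.m⊔n≤o⇒m≤o k l kl≤n))
         (ℚ.≤-trans (ℚ.+-monoˡ-≤ (½ ℚ.* ε) (g n (ℕ.m⊔n≤o⇒n≤o k l kl≤n)))
           (ℚ.≤-reflexive (trans (ℚ.+-assoc (seq z n) (½ ℚ.* ε) (½ ℚ.* ε)) (cong (ℚ._+_ (seq z n)) (halve ε)))))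

  ≤ℝ-antisym : ∀ x y → x ≤ℝ y → y ≤ℝ x → x ≈ℝ y
  ≤ℝ-antisym x y x≤y y≤x = diagonal⇒≈ℝ x y λ ε 0<ε →
    let k , f = ≤ℝ⇒⊑ x y x≤y ε 0<ε
        l , g = ≤ℝ⇒⊑ y x y≤x ε 0<ε
    in k ⊔ l , λ n kl≤n → bound (seq x n) (seq y n) ε
         (f n (ℕ.m⊔n≤o⇒m≤o k l kl≤n)) (g n (ℕ.m⊔n≤o⇒n≤o k l kl≤n))
    where
    shift : ∀ p q ε → p ℚ.≤ q ℚ.+ ε → p ℚ.- q ℚ.≤ ε
    shift p q ε h = +-cancelʳ-≤ (p ℚ.- q) ε q (ℚ.≤-trans (ℚ.≤-reflexive (sub-cancel p q)) (ℚ.≤-trans h (ℚ.≤-reflexive (ℚ.+-comm q ε))))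

    bound : ∀ p q ε → p ℚ.≤ q ℚ.+ ε → q ℚ.≤ p ℚ.+ ε → ℚ.∣ p ℚ.- q ∣ ℚ.≤ ε
    bound p q ε p≤ q≤ = [ (λ eq → subst (ℚ._≤ ε) (sym eq) (shift p q ε p≤))
                        , (λ eq → subst (ℚ._≤ ε) (sym (trans eq (sub-swap p q))) (shift q p ε q≤)) ]′ (ℚ.∣p∣≡p∨∣p∣≡-p (p ℚ.- q))

  +-mono-≤ℝ : ∀ x y z w → x ≤ℝ y → z ≤ℝ w → x +ℝ z ≤ℝ y +ℝ w
  +-mono-≤ℝ x y z w x≤y z≤w = ⊑⇒≤ℝ (x +ℝ z) (y +ℝ w) λ ε 0<ε →
    let k , f = ≤ℝ⇒⊑ x y x≤y (½ ℚ.* ε) (0<½* ε 0<ε)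
        l , g = ≤ℝ⇒⊑ z w z≤w (½ ℚ.* ε) (0<½* ε 0<ε)
    in k ⊔ l , λ n kl≤n → ℚ.≤-trans (ℚ.+-mono-≤ (f n (ℕ.m⊔n≤o⇒m≤o k l kl≤n)) (g n (ℕ.m⊔n≤o⇒n≤o k l kl≤n)))
         (ℚ.≤-reflexive (trans (rearrange (seq y n) (seq w n) (½ ℚ.* ε)) (cong (ℚ._+_ (seq y n ℚ.+ seq w n)) (halve ε))))
    where
    rearrange : ∀ y w δ → y ℚ.+ δ ℚ.+ (w ℚ.+ δ) ≡ y ℚ.+ w ℚ.+ (δ ℚ.+ δ)
    rearrange = ℚS.solve 3 (λ y w δ → y ℚS.:+ δ ℚS.:+ (w ℚS.:+ δ) ℚS.:= y ℚS.:+ w ℚS.:+ (δ ℚS.:+ δ)) refl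

  ≤ℝ-total : ExcludedMiddle 0ℓ → ∀ x y → x ≤ℝ y ⊎ y ≤ℝ x
  ≤ℝ-total em x y with em {y <ℝ x}
  ... | no  y≮x = inj₁ y≮x
  ... | yes (ε , 0<ε , k , f) = inj₂ λ (δ , 0<δ , l , g) →
    let n = k ⊔ l in ℚ.<-irrefl refl (ℚ.<-≤-trans (p<p+ (seq y n) ε 0<ε)
      (ℚ.≤-trans (f n (ℕ.m≤m⊔n k l)) (ℚ.≤-trans (≤+ˡ (ℚ.<⇒≤ 0<δ)) (g n (ℕ.m≤n⊔m k l)))))
    where
    p<p+ : ∀ p ε → 0ℚ ℚ.< ε → p ℚ.< p ℚ.+ ε
    p<p+ p ε 0<ε = subst (ℚ._< p ℚ.+ ε) (ℚ.+-identityʳ p) (ℚ.+-monoʳ-< p 0<ε)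

  +-cancelʳ-≤ℝ : ∀ x y z → x +ℝ z ≤ℝ y +ℝ z → x ≤ℝ y
  +-cancelʳ-≤ℝ x y z h = ≤ℝ-trans x (x +ℝ z +ℝ -ℝ z) y (≤ℝ-reflexive (ℝ-Ring.sym (shift x)))
    (≤ℝ-trans (x +ℝ z +ℝ -ℝ z) (y +ℝ z +ℝ -ℝ z) y
      (+-mono-≤ℝ (x +ℝ z) (y +ℝ z) (-ℝ z) (-ℝ z) h (≤ℝ-reflexive (ℝ-Ring.refl { -ℝ z}))) (≤ℝ-reflexive (shift y)))
    where
    shift : ∀ x → x +ℝ z +ℝ -ℝ z ≈ℝ x
    shift x = ℝ-Ring.trans (ℝ-Ring.+-assoc x z (-ℝ z)) (ℝ-Ring.trans (ℝ-Ring.+-congˡ (ℝ-Ring.-‿inverseʳ z)) (ℝ-Ring.+-identityʳ x))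

  ≤⁺-trans : ∀ {k l m} → k ≤⁺ l → l ≤⁺ m → k ≤⁺ m
  ≤⁺-trans {[ x ]} {[ y ]} {[ z ]} [ p ]≤ [ q ]≤ = [ ≤ℝ-trans x y z p q ]≤
  ≤⁺-trans p (_ ≤⊤⁺)                             = _ ≤⊤⁺

  ≤⁺-reflexive : ∀ {k l} → k ≈⁺ l → k ≤⁺ l
  ≤⁺-reflexive ⊤⁺≈⊤⁺  = ⊤⁺ ≤⊤⁺
  ≤⁺-reflexive [ p ]≈ = [ ≤ℝ-reflexive p ]≤

  ≤⁺-total : ExcludedMiddle 0ℓ → ∀ k l → k ≤⁺ l ⊎ l ≤⁺ k
  ≤⁺-total em k     ⊤⁺    = inj₁ (k ≤⊤⁺)
  ≤⁺-total em ⊤⁺    l     = inj₂ (l ≤⊤⁺)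
  ≤⁺-total em [ x ] [ y ] = Sum⊎.map [_]≤ [_]≤ (≤ℝ-total em x y)

  +⁺-shift : ∀ k l → [ ℚ→ℝ 0ℚ ] ≤⁺ k → l ≤⁺ (k +⁺ l)
  +⁺-shift ⊤⁺    l     _      = l ≤⊤⁺
  +⁺-shift [ x ] ⊤⁺    _      = ⊤⁺ ≤⊤⁺
  +⁺-shift [ x ] [ y ] [ p ]≤ = [ ≤ℝ-trans y (ℚ→ℝ 0ℚ +ℝ y) (x +ℝ y)
    (≤ℝ-reflexive (ℝ-Ring.sym (ℝ-Ring.+-identityˡ y)))
    (+-mono-≤ℝ (ℚ→ℝ 0ℚ) x y y p (≤ℝ-reflexive (ℝ-Ring.refl {y}))) ]≤

  0+⁺ : ∀ k l → k ≈⁺ [ ℚ→ℝ 0ℚ ] → (k +⁺ l) ≤⁺ l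
  0+⁺ [ x ] ⊤⁺    _      = ⊤⁺ ≤⊤⁺
  0+⁺ [ x ] [ y ] [ p ]≈ = [ ≤ℝ-reflexive (ℝ-Ring.trans (ℝ-Ring.+-congʳ p) (ℝ-Ring.+-identityˡ y)) ]≤

  +⁺-cancel : ∀ k x → [ x ] ≤⁺ (k +⁺ [ x ]) → [ ℚ→ℝ 0ℚ ] ≤⁺ k
  +⁺-cancel ⊤⁺    x _      = _ ≤⊤⁺
  +⁺-cancel [ y ] x [ p ]≤ = [ +-cancelʳ-≤ℝ (ℚ→ℝ 0ℚ) y x
    (≤ℝ-trans (ℚ→ℝ 0ℚ +ℝ x) x (y +ℝ x) (≤ℝ-reflexive (ℝ-Ring.+-identityˡ x)) p) ]≤

  +⁺-vanishing : ∀ k l → [ ℚ→ℝ 0ℚ ] ≤⁺ k → [ ℚ→ℝ 0ℚ ] ≤⁺ l → (k +⁺ l) ≈⁺ [ ℚ→ℝ 0ℚ ] → l ≈⁺ [ ℚ→ℝ 0ℚ ]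
  +⁺-vanishing [ x ] [ y ] 0≤x [ 0≤y ]≤ [ eq ]≈ with +⁺-shift [ x ] [ y ] 0≤x
  ... | [ y≤ ]≤ = [ ≤ℝ-antisym y (ℚ→ℝ 0ℚ) (≤ℝ-trans y (x +ℝ y) (ℚ→ℝ 0ℚ) y≤ (≤ℝ-reflexive eq)) 0≤y ]≈

-- v is a valuation on the elements stabilizing a finitely generated ℤ₍₂₎-module; such
-- elements are integral, as is seen on a generator of least valuation.
module BoundedBelow (em : ExcludedMiddle 0ℓ) (R : CommutativeRing 0ℓ 0ℓ) (E : List (CommutativeRing.Carrier R))
  (1∈ : Spans.Span R E (CommutativeRing.1# R))
  (E-stabilizes : ∀ {e} → e ∈ E → Spans.Stabilizes R E e)
  (v : ∀ x → Spans.Stabilizes R E x → ℝ ⁺)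
  (v-cong : ∀ {x y} p q → CommutativeRing._≈_ R x y → v x p ≈⁺ v y q)
  (v-∞ : ∀ {x} p → v x p ≡ ⊤⁺ ⇔ CommutativeRing._≈_ R x (CommutativeRing.0# R))
  (v-* : ∀ {x y z} p q s → CommutativeRing._≈_ R z (CommutativeRing._*_ R x y) → v z s ≈⁺ (v x p +⁺ v y q))
  (v-+ : ∀ {x y z} p q s → CommutativeRing._≈_ R z (CommutativeRing._+_ R x y) → v x p ≤⁺ v z s ⊎ v y q ≤⁺ v z s)
  (v-odd : ∀ k {x} p → CommutativeRing._≈_ R x (Spans.fromℤ R (odd k)) → v x p ≈⁺ [ ℚ→ℝ 0ℚ ])
  (1≉0 : ¬ CommutativeRing._≈_ R (CommutativeRing.1# R) (CommutativeRing.0# R)) where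
  open CommutativeRing R renaming (Carrier to A; refl to ≈-refl; sym to ≈-sym; trans to ≈-trans)
  open Spans R

  private
    isS : IsSubmodule (Stabilizes E)
    isS = stabilizers-isSubmodule E

    stabilizes-1 : Stabilizes E 1#
    stabilizes-1 = + 0 , λ e∈ → resp (span-isSubmodule E)
      (≈-sym (≈-trans (*-identityˡ _) (*-identityˡ _))) (∈⇒Span e∈)

    stabilizes-ℤ : ∀ n → Stabilizes E (fromℤ n)
    stabilizes-ℤ n = resp isS (*-identityʳ (fromℤ n)) (scale isS n stabilizes-1)

    v-1 : ∀ p → v 1# p ≈⁺ [ ℚ→ℝ 0ℚ ]
    v-1 p = v-odd (+ 0) p ≈-refl

    v-+-bound : ∀ {c x y z} p q s → z ≈ x + y → c ≤⁺ v x p → c ≤⁺ v y q → c ≤⁺ v z s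
    v-+-bound p q s eq c≤x c≤y = [ ≤⁺-trans c≤x , ≤⁺-trans c≤y ]′ (v-+ p q s eq)

    0≤⁺ : ∀ {k} → k ≈⁺ [ ℚ→ℝ 0ℚ ] → [ ℚ→ℝ 0ℚ ] ≤⁺ k
    0≤⁺ eq = ≤⁺-reflexive (≈⁺-sym ℝ-Ring.sym eq)

    nonneg-ℕ : ∀ n p → [ ℚ→ℝ 0ℚ ] ≤⁺ v (fromℤ (+ n)) p
    nonneg-ℕ zero    p = subst ([ ℚ→ℝ 0ℚ ] ≤⁺_) (sym (Equivalence.from (v-∞ p) ≈-refl)) (_ ≤⊤⁺)
    nonneg-ℕ (suc n) p = v-+-bound stabilizes-1 (stabilizes-ℤ (+ n)) p (fromℤ-+ (+ 1) (+ n))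
      (0≤⁺ (v-1 stabilizes-1)) (nonneg-ℕ n (stabilizes-ℤ (+ n)))

    nonneg-ℤ : ∀ n p → [ ℚ→ℝ 0ℚ ] ≤⁺ v (fromℤ n) p
    nonneg-ℤ (+ n)    p = nonneg-ℕ n p
    nonneg-ℤ -[1+ n ] p = ≤⁺-trans (nonneg-ℕ (suc n) q)
      (≤⁺-trans (+⁺-shift _ _ (0≤⁺ (v-odd -1ℤ (stabilizes-ℤ -1ℤ) ≈-refl)))
        (≤⁺-reflexive (≈⁺-sym ℝ-Ring.sym (v-* (stabilizes-ℤ -1ℤ) q p -n))))
      where
      -1ℤ : ℤ
      -1ℤ = ℤ.- + 1

      q : Stabilizes E (fromℤ (+ suc n))
      q = stabilizes-ℤ (+ suc n)

      -n : fromℤ -[1+ n ] ≈ fromℤ -1ℤ * fromℤ (+ suc n)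
      -n = ≈-trans (reflexive (cong fromℤ (sym (ℤ.-1*i≡-i (+ suc n))))) (fromℤ-* -1ℤ (+ suc n))

    AtLeast : ℝ ⁺ → A → Set
    AtLeast c x = ∃[ p ] c ≤⁺ v x p

    atLeast-isSubmodule : ∀ c → IsSubmodule (AtLeast c)
    atLeast-isSubmodule c = record
      { resp  = λ x≈y (p , h) → let q = resp isS x≈y p in q , ≤⁺-trans h (≤⁺-reflexive (v-cong p q x≈y))
      ; zero# = zero# isS , subst (c ≤⁺_) (sym (Equivalence.from (v-∞ (zero# isS)) ≈-refl)) (c ≤⊤⁺)
      ; add   = λ (p , h) (q , g) → add isS p q , v-+-bound p q (add isS p q) ≈-refl h g
      ; scale = λ n (p , h) → scale isS n p , ≤⁺-trans h (≤⁺-trans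
          (+⁺-shift _ _ (nonneg-ℤ n (stabilizes-ℤ n)))
          (≤⁺-reflexive (≈⁺-sym ℝ-Ring.sym (v-* (stabilizes-ℤ n) p (scale isS n p) ≈-refl))))
      }

    least : ∀ e F → (∀ {x} → x ∈ e ∷ F → Stabilizes E x) →
            ∃[ x ] ∃[ p ] x ∈ e ∷ F × (∀ {y} → y ∈ e ∷ F → AtLeast (v x p) y)
    least e [] stabilizes = e , stabilizes (here refl) , here refl , λ
      { (here refl) → stabilizes (here refl) , ≤⁺-reflexive (v-cong _ _ ≈-refl) }
    least e (e′ ∷ F) stabilizes = case ≤⁺-total em (v e p) (v x q) of λ
      { (inj₁ e≤x) → e , p , here refl , λ
          { (here refl) → p , ≤⁺-reflexive (v-cong _ _ ≈-refl)
          ; (there y∈)  → let s , x≤y = minimal y∈ in s , ≤⁺-trans e≤x x≤y }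
      ; (inj₂ x≤e) → x , q , there x∈ , λ
          { (here refl) → p , x≤e
          ; (there y∈)  → minimal y∈ } }
      where
      p : Stabilizes E e
      p = stabilizes (here refl)

      rec : ∃[ x ] ∃[ q ] x ∈ e′ ∷ F × (∀ {y} → y ∈ e′ ∷ F → AtLeast (v x q) y)
      rec = least e′ F (stabilizes ∘ there)

      x : A
      x = proj₁ rec

      q : Stabilizes E x
      q = proj₁ (proj₂ rec)

      x∈ : x ∈ e′ ∷ F
      x∈ = proj₁ (proj₂ (proj₂ rec))

      minimal : ∀ {y} → y ∈ e′ ∷ F → AtLeast (v x q) y
      minimal = proj₂ (proj₂ (proj₂ rec))

    minimum : ∀ F → Span F 1# → (∀ {x} → x ∈ F → Stabilizes E x) →
              ∃[ x ] ∃[ p ] x ∈ F × (∀ {y} → y ∈ F → AtLeast (v x p) y)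
    minimum []      1≈0 _          = contradiction 1≈0 1≉0
    minimum (e ∷ F) _   stabilizes = least e F stabilizes

    cancel : ∀ k l → ¬ ⊤⁺ ≤⁺ [ ℚ→ℝ 0ℚ ] → (l ≡ ⊤⁺ → ⊤⁺ ≤⁺ [ ℚ→ℝ 0ℚ ]) → l ≤⁺ (k +⁺ l) → [ ℚ→ℝ 0ℚ ] ≤⁺ k
    cancel k ⊤⁺    ⊤≰0 ⊤≤0 _ = contradiction (⊤≤0 refl) ⊤≰0
    cancel k [ x ] _   _   h = +⁺-cancel k x h

  nonneg : ∀ x p → [ ℚ→ℝ 0ℚ ] ≤⁺ v x p
  nonneg x p =
    let e , q , e∈ , minimal = minimum E 1∈ E-stabilizes
        k , x* = p
        above = λ {y} → span-least (atLeast-isSubmodule (v e q)) E minimal {y}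
        s , h = above (x* e∈)
        pe = stabilizes-* E p q
        t , g = above 1∈
    in cancel (v x p) (v e q) (λ ()) (λ eq → ≤⁺-trans (subst (_≤⁺ v 1# t) eq g) (≤⁺-reflexive (v-1 t)))
         (≤⁺-trans h (≤⁺-trans (≤⁺-reflexive (v-* (stabilizes-ℤ (odd k)) pe s ≈-refl))
           (≤⁺-trans (0+⁺ _ _ (v-odd k (stabilizes-ℤ (odd k)) ≈-refl)) (≤⁺-reflexive (v-* p q pe ≈-refl)))))

  units : ∀ x y p → Stabilizes E y → x * y ≈ 1# → v x p ≈⁺ [ ℚ→ℝ 0ℚ ]
  units x y p q xy≈1 = +⁺-vanishing (v y q) (v x p) (nonneg y q) (nonneg x p)
    (≈⁺-trans ℝ-Ring.trans (≈⁺-sym ℝ-Ring.sym (v-* q p stabilizes-1 (≈-trans (≈-sym xy≈1) (*-comm x y)))) (v-1 stabilizes-1))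

abstract
  odd-valuation : ∀ k → HasValuation₂ (ℤ→ℚ (odd k)) (+ 0)
  odd-valuation k = 0 , 0 , odd k , + 1 , 2∤odd , 2∤1 , numerator , refl
    where
    2∤odd : ¬ (+ 2 ℤ.∣ odd k)
    2∤odd 2∣ = contradiction (odd-coprime-2 k (2∣ , ℕ.∣-refl)) λ ()

    2∤1 : ¬ (+ 2 ℤ.∣ + 1)
    2∤1 2∣1 = contradiction (ℕ.∣1⇒≡1 2∣1) λ ()

    numerator : ℚ.↥ ℤ→ℚ (odd k) ℤ.* + 1 ≡ + 1 ℤ.* odd k ℤ.* ℚ.↧ ℤ→ℚ (odd k)
    numerator = of (ℤ→ℚ (odd k)) (ℚ.toℚᵘ-fromℚᵘ (ℚᵘ.mkℚᵘ (odd k) 0))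
      where
      of : ∀ q → ℚ.toℚᵘ q ℚᵘ.≃ ℚᵘ.mkℚᵘ (odd k) 0 → ℚ.↥ q ℤ.* + 1 ≡ + 1 ℤ.* odd k ℤ.* ℚ.↧ q
      of q@(ℚ.mkℚ _ _ _) (ℚᵘ.*≡* eq) = trans eq (cong (ℤ._* ℚ.↧ q) (sym (ℤ.*-identityˡ (odd k))))

  algebraicOver-ℤ⇒algebraic : ∀ {z} → Spans.IsAlgebraicOver-ℤ ℂ-commutativeRing z → IsAlgebraic z
  algebraicOver-ℤ⇒algebraic {z} (cs , nonzero , root) = map ℤ→ℚ cs
    , Any.map⁺ (Any.map (λ c≢0 eq → c≢0 (ℤ→ℚ-injective _ (+ 0) eq)) nonzero)
    , ℂ-Ring.trans (evaluate≈ cs) root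
    where
    evaluate≈ : ∀ cs → evaluate (map ℤ→ℚ cs) z ≈ℂ Spans.polynomial ℂ-commutativeRing cs z
    evaluate≈ []       = ℂ-Ring.refl
    evaluate≈ (c ∷ cs) = ℂ-Ring.+-cong (ℂ-Ring.sym (fromℤ≈ℤ→ℂ c)) (ℂ-Ring.*-congˡ (evaluate≈ cs))

module _ (em : ExcludedMiddle 0ℓ) (E : List ℂ)
  (1∈ : Spans.Span ℂ-commutativeRing E 1ℂ)
  (E-stabilizes : ∀ {e} → e ∈ E → Spans.Stabilizes ℂ-commutativeRing E e)
  (1≉0 : ¬ 1ℂ ≈ℂ ℚ→ℂ 0ℚ) where
  open Spans ℂ-commutativeRing using (fromℤ; Stabilizes; stabilizes⇒algebraic)

  module _ (val : Valuation) (extends : Extends₂ val) where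
    open Valuation val

    private
      at : ∀ z → Stabilizes E z → ℚ̄
      at z s = mkℚ̄ z (algebraicOver-ℤ⇒algebraic {z} (stabilizes⇒algebraic E 1∈ {z} s))

      ν : ∀ z → Stabilizes E z → ℝ ⁺
      ν z s = v (at z s)

    abstract
      ν-odd : ∀ k {z} s → z ≈ℂ fromℤ (odd k) → ν z s ≈⁺ [ ℚ→ℝ 0ℚ ]
      ν-odd k {z} s eq = extends (at z s) (ℤ→ℚ (odd k)) (+ 0) (ℂ-Ring.trans eq (fromℤ≈ℤ→ℂ (odd k))) (odd-valuation k)

      ν-cong : ∀ {z w} s t → z ≈ℂ w → ν z s ≈⁺ ν w t
      ν-cong {z} {w} s t = v-cong (at z s) (at w t)

      ν-∞ : ∀ {z} s → ν z s ≡ ⊤⁺ ⇔ z ≈ℂ ℚ→ℂ 0ℚ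
      ν-∞ {z} s = v-∞ (at z s)

      ν-* : ∀ {z w u} s t r → u ≈ℂ z *ℂ w → ν u r ≈⁺ (ν z s +⁺ ν w t)
      ν-* {z} {w} {u} s t r = v-* (at z s) (at w t) (at u r)

      ν-+ : ∀ {z w u} s t r → u ≈ℂ z +ℂ w → ν z s ≤⁺ ν u r ⊎ ν w t ≤⁺ ν u r
      ν-+ {z} {w} {u} s t r = v-+ (at z s) (at w t) (at u r)

    abstract
      stabilizing-unit : ∀ (x : ℚ̄) y → Stabilizes E (value x) → Stabilizes E y → value x *ℂ y ≈ℂ 1ℂ → v x ≈⁺ [ ℚ→ℝ 0ℚ ]
      stabilizing-unit x y p q xy≈1 = ≈⁺-trans ℝ-Ring.trans
        (v-cong x (at (value x) p) ℂ-Ring.refl)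
        (BoundedBelow.units em ℂ-commutativeRing E 1∈ E-stabilizes ν
          (λ {x} {y} → ν-cong {x} {y}) (λ {x} → ν-∞ {x}) (λ {x} {y} {z} → ν-* {x} {y} {z}) (λ {x} {y} {z} → ν-+ {x} {y} {z})
          (λ k {x} → ν-odd k {x}) 1≉0 (value x) y p q xy≈1)

theorem11 : (em : ExcludedMiddle 0ℓ) (N : ℕ) → 1 ≤ N → let open Classical em in
  (∀ (X : Coordinates N) → IsPoint X → (alg : ∀ s γ u → IsAlgebraic (X s γ u)) →
    ∀ s γ u → Is2AdicUnit (mkℚ̄ (X s γ u) (alg s γ u)))
  × FinitelyManyPoints N
theorem11 em (suc M) _ = units , finite em
  where
  open Classical em
  open Analysis em using (domain)
  open PointModel em M

  module Units (P : Point (suc M)) (val : Valuation) (extends : Extends₂ val) where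
    open Valuation val

    model : Model ℂ-commutativeRing M (e (2 ℕ.* suc M)) (√ ℕ→ℂ (suc M))
    model = pointModel P

    open Integrality E-isCharacter r²-integer model (μ-invertible P)
    open Spans ℂ-commutativeRing using (Stabilizes; stabilizes-*)

    unit : ∀ (x : ℚ̄) y → Stabilizes generators (value x) → Stabilizes generators y → value x *ℂ y ≈ℂ 1ℂ →
           v x ≈⁺ [ ℚ→ℝ 0ℚ ]
    unit = stabilizing-unit em generators 1∈generators generators-stabilize 1≉0 val extends

    unit⁺ : ∀ γ u alg → v (mkℚ̄ (Model.X model Sign.+ γ u) alg) ≈⁺ [ ℚ→ℝ 0ℚ ]
    unit⁺ γ u alg = unit (mkℚ̄ (Model.X model Sign.+ γ u) alg) (Model.X model Sign.- γ (⊝ u) *ℂ Model.quad model γ u)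
        (X-stabilizes Sign.+ γ u)
        (stabilizes-* generators {Model.X model Sign.- γ (⊝ u)} {Model.quad model γ u} (X-stabilizes Sign.- γ (⊝ u)) (quad-stabilizes γ u))
        (ℂ-Ring.trans (ℂ-Ring.sym (ℂ-Ring.*-assoc _ _ _)) (Model.inversion model γ u))

    unit⁻ : ∀ γ u alg → v (mkℚ̄ (Model.X model Sign.- γ u) alg) ≈⁺ [ ℚ→ℝ 0ℚ ]
    unit⁻ γ u alg = unit (mkℚ̄ (Model.X model Sign.- γ u) alg) (Model.I model γ u)
        (X-stabilizes Sign.- γ u)
        (stabilizes-* generators {Model.quad model γ (⊝ u)} {Model.X model Sign.+ γ (⊝ u)} (quad-stabilizes γ (⊝ u)) (X-stabilizes Sign.+ γ (⊝ u)))
        (ModelLemmas.I-inverse model γ u)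

  units : ∀ (X : Coordinates (suc M)) → IsPoint X → (alg : ∀ s γ u → IsAlgebraic (X s γ u)) →
          ∀ s γ u → Is2AdicUnit (mkℚ̄ (X s γ u) (alg s γ u))
  units X isPoint alg Sign.+ γ u val extends = Units.unit⁺ (X , isPoint) val extends γ u (alg Sign.+ γ u)
  units X isPoint alg Sign.- γ u val extends = Units.unit⁻ (X , isPoint) val extends γ u (alg Sign.- γ u)

  finite : Dec (Point (suc M)) → FinitelyManyPoints (suc M)
  finite (no ∄P)  = [] , λ P → contradiction P ∄P
  finite (yes P₀) =
    let Ps , complete = FiniteSolutions.finitely-many E-isCharacter r²-integer domain fromℤ-injective em
          (Point (suc M)) P₀ pointModel (λ _ _ _ _ → refl) (λ _ _ _ → refl) (λ _ _ → refl) (μ-invertible P₀)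
    in Ps , λ P → Any.map (λ agree → λ { Sign.+ γ u → agree Sign.+ γ u ; Sign.- γ u → agree Sign.- γ u }) (complete P)
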